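{- The $\mathrm{Hyper^2LTL}$ finite-state satisfiability problem under closed-world semantics (given an $X_a$-free $\mathrm{Hyper^2LTL}$ sentence $\varphi$, is there a finite transition system $\mathfrak T$ with $\mathrm{Tr}(\mathfrak T)\models_{\mathrm{cw}}\varphi$?) is polynomial-time equivalent to truth in third-order arithmetic.
   Context: Syntax. Let $\mathrm{AP}$ be a nonempty finite set of atomic propositions. A trace over $\mathrm{AP}$ is an element $t=t(0)t(1)t(2)\cdots$ of $(2^{\mathrm{AP}})^\omega$. Let $\mathcal V_1$ be a set of trace variables $\pi$ and $\mathcal V_2$ a disjoint set of second-order variables $X$ (ranging over sets of traces), with two distinguished variables $X_a,X_d\in\mathcal V_2$. $\mathrm{Hyper^2LTL}$ formulas are given by $\varphi ::= \exists X.\,\varphi \mid \forall X.\,\varphi \mid \exists \pi\in X.\,\varphi \mid \forall\pi\in X.\,\varphi \mid \psi$ and $\psi ::= p_\pi \mid \neg\psi \mid \psi\vee\psi \mid \mathbf{X}\psi \mid \psi\,\mathbf{U}\,\psi$, with $p\in\mathrm{AP}$, $\pi\in\mathcal V_1$, $X\in\mathcal V_2$. A sentence is a formula in which at most $X_a,X_d$ are free. A sentence is $X_a$-free if $X_a$ does not occur in it. Closed-world semantics ($\models_{\mathrm{cw}}$), defined for $X_a$-free formulas. A variable assignment $\Pi$ is a partial map sending trace variables to traces and second-order variables to sets of traces; $\Pi[\cdot\mapsto\cdot]$ denotes updating; $\Pi[j,\infty)$ maps each trace variable $\pi$ in the domain to the suffix of $\Pi(\pi)$ starting at position $j$. Define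 $\Pi\models_{\mathrm{cw}} p_\pi$ iff $p\in\Pi(\pi)(0)$; Boolean connectives as usual; $\Pi\models_{\mathrm{cw}}\mathbf{X}\psi$ iff $\Pi[1,\infty)\models_{\mathrm{cw}}\psi$; $\Pi\models_{\mathrm{cw}}\psi_1\mathbf{U}\psi_2$ iff there is $j\ge0$ with $\Pi[j,\infty)\models_{\mathrm{cw}}\psi_2$ and $\Pi[j',\infty)\models_{\mathrm{cw}}\psi_1$ for all $0\le j'<j$; $\Pi\models_{\mathrm{cw}}\exists\pi\in X.\varphi$ (resp. $\forall\pi\in X.\varphi$) iff for some (resp. all) $t\in\Pi(X)$, $\Pi[\pi\mapsto t]\models_{\mathrm{cw}}\varphi$; $\Pi\models_{\mathrm{cw}}\exists X.\varphi$ (resp. $\forall X.\varphi$) iff for some (resp. all) $T\subseteq\Pi(X_d)$, $\Pi[X\mapsto T]\models_{\mathrm{cw}}\varphi$. For $T\subseteq(2^{\mathrm{AP}})^\omega$ and an $X_a$-free sentence $\varphi$, $T\models_{\mathrm{cw}}\varphi$ means that the assignment with domain $\{X_d\}$ and $X_d\mapsto T$ satisfies $\varphi$. Transition systems. A finite transition system $\mathfrak T=(V,E,I,\lambda)$ consists of a finite nonempty set $V$ of vertices, a set $E\subseteq V\times V$ of edges such that every vertex has at least one outgoing edge, a set $I\subseteq V$ of initial vertices, and a labeling $\lambda\colon V\to2^{\mathrm{AP}}$. A path is an infinite sequence $\rho(0)\rho(1)\cdots$ with $\rho(0)\in I$ and $(\rho(n),\rho(n+1))\in E$ for all $n$; its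 trace is $\lambda(\rho(0))\lambda(\rho(1))\cdots$; $\mathrm{Tr}(\mathfrak T)$ is the set of traces of paths. Arithmetic. Third-order arithmetic is predicate logic over the signature $(+,\cdot,<,\in)$ with quantification over natural numbers, sets of natural numbers, and sets of sets of natural numbers, evaluated in the structure $(\mathbb N,+,\cdot,<,\in)$. Truth in third-order arithmetic is the problem: given a sentence of third-order arithmetic, does $(\mathbb N,+,\cdot,<,\in)$ satisfy it? Two decision problems are polynomial-time equivalent if each is reducible to the other by a polynomial-time computable many-one reduction. -}

module Defs where

open import Data.Bool using (Bool; true; false)
import Data.Bool.Properties as Bool
open import Data.Empty using (⊥)
open import Data.Fin using (Fin; toℕ)
open import Data.Fin.Subset using (Subset; Nonempty) renaming (_∈_ to _∈ˢ_)
open import Data.List using (List; []; _∷_; _++_; concatMap; length; map; replicate)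
open import Data.List.Properties using (≡-dec)
open import Data.Maybe using (Maybe; just; nothing)
import Data.Maybe as Maybe
open import Data.Maybe.Relation.Unary.Any using (Any)
open import Data.Nat using (ℕ; zero; suc; _+_; _*_; _^_; _<_; NonZero)
open import Data.Product using (Σ; Σ-syntax; ∃; ∃-syntax; _×_; _,_; proj₁; proj₂)
open import Data.Sum using (_⊎_)
open import Data.Vec using (Vec; []; _∷_)
import Data.Vec as Vec
open import Function using (_∘_)
open import Function.Bundles using (_⇔_)
open import Level using (Level; Lift; 0ℓ) renaming (suc to lsuc)
open import Relation.Binary.Definitions using (DecidableEquality; _Respects_)
open import Relation.Binary.PropositionalEquality using (_≡_; _≢_; _≗_; refl; sym; trans; cong)
open import Relation.Nullary using (¬_; yes; no)
open import Relation.Nullary.Decidable using (map′)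
open import Relation.Unary using (Pred; _≐_) renaming (_∈_ to _∈ᵖ_)

1ℓ : Level
1ℓ = lsuc 0ℓ

------------------------------------------------------------------------
-- Variables and updates

-- Variables are named by bit strings, so that a name is its own encoding.

Name : Set
Name = List Bool

_≟ᴺ_ : DecidableEquality Name
_≟ᴺ_ = ≡-dec Bool._≟_

module Update {A : Set} (_≟_ : DecidableEquality A) where

  _[_↦_] : ∀ {b} {B : Set b} → (A → B) → A → B → (A → B)
  (f [ x ↦ v ]) y with x ≟ y
  ... | yes _ = v
  ... | no  _ = f y

TraceVar : Set
TraceVar = Name

data SetVar : Set where
  Xa Xd : SetVar
  var    : Name → SetVar

_≟ˢ_ : DecidableEquality SetVar
Xa    ≟ˢ Xa    = yes refl
Xa    ≟ˢ Xd    = no λ ()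
Xa    ≟ˢ var _ = no λ ()
Xd    ≟ˢ Xa    = no λ ()
Xd    ≟ˢ Xd    = yes refl
Xd    ≟ˢ var _ = no λ ()
var _ ≟ˢ Xa    = no λ ()
var _ ≟ˢ Xd    = no λ ()
var x ≟ˢ var y = map′ (cong var) (λ where refl → refl) (x ≟ᴺ y)

------------------------------------------------------------------------
-- Hyper²LTL over AP = Fin n

data LTL (n : ℕ) : Set where
  _at_ : Fin n → TraceVar → LTL n
  neg  : LTL n → LTL n
  _or_ : LTL n → LTL n → LTL n
  next : LTL n → LTL n
  _U_  : LTL n → LTL n → LTL n

data Hyper²LTL (n : ℕ) : Set where
  ∃₂_∙_    : SetVar → Hyper²LTL n → Hyper²LTL n
  ∀₂_∙_    : SetVar → Hyper²LTL n → Hyper²LTL n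
  ∃₁_∈_∙_  : TraceVar → SetVar → Hyper²LTL n → Hyper²LTL n
  ∀₁_∈_∙_  : TraceVar → SetVar → Hyper²LTL n → Hyper²LTL n
  ltl      : LTL n → Hyper²LTL n

_OccursInLTL_ : ∀ {n} → TraceVar → LTL n → Set
π OccursInLTL (p at π′) = π ≡ π′
π OccursInLTL neg ψ     = π OccursInLTL ψ
π OccursInLTL (ψ or ψ′) = π OccursInLTL ψ ⊎ π OccursInLTL ψ′
π OccursInLTL next ψ    = π OccursInLTL ψ
π OccursInLTL (ψ U ψ′)  = π OccursInLTL ψ ⊎ π OccursInLTL ψ′

_FreeTraceVarOf_ : ∀ {n} → TraceVar → Hyper²LTL n → Set
π FreeTraceVarOf (∃₂ X ∙ φ)      = π FreeTraceVarOf φ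
π FreeTraceVarOf (∀₂ X ∙ φ)      = π FreeTraceVarOf φ
π FreeTraceVarOf (∃₁ π′ ∈ X ∙ φ) = π ≢ π′ × π FreeTraceVarOf φ
π FreeTraceVarOf (∀₁ π′ ∈ X ∙ φ) = π ≢ π′ × π FreeTraceVarOf φ
π FreeTraceVarOf ltl ψ           = π OccursInLTL ψ

_FreeSetVarOf_ : ∀ {n} → SetVar → Hyper²LTL n → Set
Y FreeSetVarOf (∃₂ X ∙ φ)     = Y ≢ X × Y FreeSetVarOf φ
Y FreeSetVarOf (∀₂ X ∙ φ)     = Y ≢ X × Y FreeSetVarOf φ
Y FreeSetVarOf (∃₁ π ∈ X ∙ φ) = Y ≡ X ⊎ Y FreeSetVarOf φ
Y FreeSetVarOf (∀₁ π ∈ X ∙ φ) = Y ≡ X ⊎ Y FreeSetVarOf φ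
Y FreeSetVarOf ltl ψ          = ⊥

-- Binding occurrences count as well.

_OccursIn_ : ∀ {n} → SetVar → Hyper²LTL n → Set
Y OccursIn (∃₂ X ∙ φ)     = Y ≡ X ⊎ Y OccursIn φ
Y OccursIn (∀₂ X ∙ φ)     = Y ≡ X ⊎ Y OccursIn φ
Y OccursIn (∃₁ π ∈ X ∙ φ) = Y ≡ X ⊎ Y OccursIn φ
Y OccursIn (∀₁ π ∈ X ∙ φ) = Y ≡ X ⊎ Y OccursIn φ
Y OccursIn ltl ψ          = ⊥

IsSentence : ∀ {n} → Hyper²LTL n → Set
IsSentence φ = (∀ π → ¬ π FreeTraceVarOf φ)
             × (∀ X → X FreeSetVarOf φ → X ≡ Xa ⊎ X ≡ Xd)

XaFree : ∀ {n} → Hyper²LTL n → Set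
XaFree φ = ¬ Xa OccursIn φ

XaFreeSentence : ℕ → Set
XaFreeSentence n = Σ[ φ ∈ Hyper²LTL n ] IsSentence φ × XaFree φ

------------------------------------------------------------------------
-- Closed-world semantics

Trace : ℕ → Set
Trace n = ℕ → Subset n

-- Equality of traces is pointwise, so a set of traces is a predicate
-- that respects _≗_.  Predicates and connectives get their usual
-- classical meaning only under excluded middle, which the theorem
-- therefore assumes.

record TraceSet (n : ℕ) : Set₁ where
  field
    member  : Pred (Trace n) 0ℓ
    respect : member Respects _≗_

open TraceSet

record Assignment (n : ℕ) : Set₁ where
  constructor ⟨_∣_⟩
  field
    traces : TraceVar → Maybe (Trace n)
    sets   : SetVar → Maybe (TraceSet n)

open Assignment

TraceAssignment : ℕ → Set
TraceAssignment n = TraceVar → Maybe (Trace n)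

_[_,∞⟩ : ∀ {n} → TraceAssignment n → ℕ → TraceAssignment n
(Π [ j ,∞⟩) π = Maybe.map (λ t i → t (j + i)) (Π π)

_[_↦ᵗ_] : ∀ {n} → Assignment n → TraceVar → Trace n → Assignment n
⟨ Π ∣ Ξ ⟩ [ π ↦ᵗ t ] = ⟨ Π [ π ↦ just t ] ∣ Ξ ⟩
  where open Update _≟ᴺ_

_[_↦ˢ_] : ∀ {n} → Assignment n → SetVar → TraceSet n → Assignment n
⟨ Π ∣ Ξ ⟩ [ X ↦ˢ T ] = ⟨ Π ∣ Ξ [ X ↦ just T ] ⟩
  where open Update _≟ˢ_

_⊨ᴸ_ : ∀ {n} → TraceAssignment n → LTL n → Set
Π ⊨ᴸ (p at π) = Any (λ t → p ∈ˢ t 0) (Π π)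
Π ⊨ᴸ neg ψ    = ¬ (Π ⊨ᴸ ψ)
Π ⊨ᴸ (ψ or χ) = (Π ⊨ᴸ ψ) ⊎ (Π ⊨ᴸ χ)
Π ⊨ᴸ next ψ   = (Π [ 1 ,∞⟩) ⊨ᴸ ψ
Π ⊨ᴸ (ψ U χ)  = ∃[ j ] ((Π [ j ,∞⟩) ⊨ᴸ χ)
                     × (∀ j′ → j′ < j → (Π [ j′ ,∞⟩) ⊨ᴸ ψ)

-- An undefined set variable is treated as ∅; this does not arise when
-- an Xa-free sentence is evaluated under an assignment defined on Xd.

_∈[_]_ : ∀ {n} → Trace n → Assignment n → SetVar → Set₁
t ∈[ Π ] X = Any (λ T → t ∈ᵖ member T) (sets Π X)

_⊆[_]Xd : ∀ {n} → TraceSet n → Assignment n → Set₁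
T ⊆[ Π ]Xd = ∀ t → t ∈ᵖ member T → t ∈[ Π ] Xd

_⊨ᶜʷ_ : ∀ {n} → Assignment n → Hyper²LTL n → Set₁
Π ⊨ᶜʷ (∃₂ X ∙ φ)     = ∃[ T ] T ⊆[ Π ]Xd × (Π [ X ↦ˢ T ]) ⊨ᶜʷ φ
Π ⊨ᶜʷ (∀₂ X ∙ φ)     = ∀ T → T ⊆[ Π ]Xd → (Π [ X ↦ˢ T ]) ⊨ᶜʷ φ
Π ⊨ᶜʷ (∃₁ π ∈ X ∙ φ) = ∃[ t ] t ∈[ Π ] X × (Π [ π ↦ᵗ t ]) ⊨ᶜʷ φ
Π ⊨ᶜʷ (∀₁ π ∈ X ∙ φ) = ∀ t → t ∈[ Π ] X → (Π [ π ↦ᵗ t ]) ⊨ᶜʷ φ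
Π ⊨ᶜʷ ltl ψ          = Lift 1ℓ (traces Π ⊨ᴸ ψ)

_⊨_ : ∀ {n} → TraceSet n → XaFreeSentence n → Set₁
T ⊨ (φ , _) = (⟨ (λ _ → nothing) ∣ (λ _ → nothing) ⟩ [ Xd ↦ˢ T ]) ⊨ᶜʷ φ

------------------------------------------------------------------------
-- Finite transition systems

record TransitionSystem (n : ℕ) : Set where
  field
    size       : ℕ
    ⦃ size≢0 ⦄ : NonZero size
    edges      : Fin size → Subset size      -- the successors of a vertex
    serial     : ∀ v → Nonempty (edges v)
    initial    : Subset size
    label      : Fin size → Subset n

  IsPath : Pred (ℕ → Fin size) 0ℓ
  IsPath ρ = ρ 0 ∈ˢ initial × (∀ i → ρ (suc i) ∈ˢ edges (ρ i))

Tr : ∀ {n} → TransitionSystem n → TraceSet n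
Tr 𝔗 = record
  { member  = λ t → ∃[ ρ ] IsPath ρ × (t ≗ label ∘ ρ)
  ; respect = λ where
      t≗t′ (ρ , path , t≗) → ρ , path , λ i → trans (sym (t≗t′ i)) (t≗ i)
  }
  where open TransitionSystem 𝔗

FiniteStateSatisfiable : ∀ {n} → XaFreeSentence n → Set₁
FiniteStateSatisfiable {n} φ = Σ[ 𝔗 ∈ TransitionSystem n ] Tr 𝔗 ⊨ φ

------------------------------------------------------------------------
-- Third-order arithmetic

-- The three sorts have separate variables.  Equality is primitive
-- between numbers only; between sets it is definable by extensionality.

data Term : Set where
  var      : Name → Term
  _⊕_ _⊗_  : Term → Term → Term

data Arith : Set where
  _≈_ _≺_      : Term → Term → Arith
  _∈₁_         : Term → Name → Arith     -- number in set
  _∈₂_         : Name → Name → Arith     -- set in set of sets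
  neg          : Arith → Arith
  _and_ _or_   : Arith → Arith → Arith
  ∃⁰_∙_ ∀⁰_∙_  : Name → Arith → Arith
  ∃¹_∙_ ∀¹_∙_  : Name → Arith → Arith
  ∃²_∙_ ∀²_∙_  : Name → Arith → Arith

data Sort : Set where
  number set class : Sort

_OccursInTerm_ : Name → Term → Set
x OccursInTerm var y   = x ≡ y
x OccursInTerm (s ⊕ t) = x OccursInTerm s ⊎ x OccursInTerm t
x OccursInTerm (s ⊗ t) = x OccursInTerm s ⊎ x OccursInTerm t

FreeIn : Sort × Name → Arith → Set
FreeIn (σ , x) (s ≈ t)    = σ ≡ number × (x OccursInTerm s ⊎ x OccursInTerm t)
FreeIn (σ , x) (s ≺ t)    = σ ≡ number × (x OccursInTerm s ⊎ x OccursInTerm t)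
FreeIn (σ , x) (t ∈₁ A)   = σ ≡ number × x OccursInTerm t ⊎ (σ , x) ≡ (set , A)
FreeIn v       (A ∈₂ 𝒜)   = v ≡ (set , A) ⊎ v ≡ (class , 𝒜)
FreeIn v       (neg φ)    = FreeIn v φ
FreeIn v       (φ and χ)  = FreeIn v φ ⊎ FreeIn v χ
FreeIn v       (φ or χ)   = FreeIn v φ ⊎ FreeIn v χ
FreeIn v       (∃⁰ x ∙ φ) = v ≢ (number , x) × FreeIn v φ
FreeIn v       (∀⁰ x ∙ φ) = v ≢ (number , x) × FreeIn v φ
FreeIn v       (∃¹ A ∙ φ) = v ≢ (set , A) × FreeIn v φ
FreeIn v       (∀¹ A ∙ φ) = v ≢ (set , A) × FreeIn v φ
FreeIn v       (∃² 𝒜 ∙ φ) = v ≢ (class , 𝒜) × FreeIn v φ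
FreeIn v       (∀² 𝒜 ∙ φ) = v ≢ (class , 𝒜) × FreeIn v φ

ArithSentence : Set
ArithSentence = Σ[ φ ∈ Arith ] (∀ v → ¬ FreeIn v φ)

SetOfℕ : Set₁
SetOfℕ = Pred ℕ 0ℓ

-- Equality of sets of numbers is _≐_, so a set of such sets is a
-- predicate that respects _≐_.

record SetOfSetsOfℕ : Set₁ where
  field
    member  : Pred SetOfℕ 0ℓ
    respect : member Respects _≐_

record Valuation : Set₁ where
  constructor ⟨_∣_∣_⟩
  field
    numbers : Name → ℕ
    sets    : Name → SetOfℕ
    classes : Name → SetOfSetsOfℕ

open Update _≟ᴺ_

value : (Name → ℕ) → Term → ℕ
value ν (var x) = ν x
value ν (s ⊕ t) = value ν s + value ν t
value ν (s ⊗ t) = value ν s * value ν t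

_⊨ᴬ_ : Valuation → Arith → Set₁
⟨ ν ∣ α ∣ γ ⟩ ⊨ᴬ (s ≈ t)    = Lift 1ℓ (value ν s ≡ value ν t)
⟨ ν ∣ α ∣ γ ⟩ ⊨ᴬ (s ≺ t)    = Lift 1ℓ (value ν s < value ν t)
⟨ ν ∣ α ∣ γ ⟩ ⊨ᴬ (t ∈₁ A)   = Lift 1ℓ (value ν t ∈ᵖ α A)
⟨ ν ∣ α ∣ γ ⟩ ⊨ᴬ (A ∈₂ 𝒜)   = Lift 1ℓ (α A ∈ᵖ SetOfSetsOfℕ.member (γ 𝒜))
v             ⊨ᴬ neg φ      = ¬ (v ⊨ᴬ φ)
v             ⊨ᴬ (φ and χ)  = v ⊨ᴬ φ × v ⊨ᴬ χ
v             ⊨ᴬ (φ or χ)   = v ⊨ᴬ φ ⊎ v ⊨ᴬ χ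
⟨ ν ∣ α ∣ γ ⟩ ⊨ᴬ (∃⁰ x ∙ φ) = ∃[ k ] ⟨ ν [ x ↦ k ] ∣ α ∣ γ ⟩ ⊨ᴬ φ
⟨ ν ∣ α ∣ γ ⟩ ⊨ᴬ (∀⁰ x ∙ φ) = ∀ k → ⟨ ν [ x ↦ k ] ∣ α ∣ γ ⟩ ⊨ᴬ φ
⟨ ν ∣ α ∣ γ ⟩ ⊨ᴬ (∃¹ A ∙ φ) = ∃[ S ] ⟨ ν ∣ α [ A ↦ S ] ∣ γ ⟩ ⊨ᴬ φ
⟨ ν ∣ α ∣ γ ⟩ ⊨ᴬ (∀¹ A ∙ φ) = ∀ S → ⟨ ν ∣ α [ A ↦ S ] ∣ γ ⟩ ⊨ᴬ φ
⟨ ν ∣ α ∣ γ ⟩ ⊨ᴬ (∃² 𝒜 ∙ φ) = ∃[ C ] ⟨ ν ∣ α ∣ γ [ 𝒜 ↦ C ] ⟩ ⊨ᴬ φ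
⟨ ν ∣ α ∣ γ ⟩ ⊨ᴬ (∀² 𝒜 ∙ φ) = ∀ C → ⟨ ν ∣ α ∣ γ [ 𝒜 ↦ C ] ⟩ ⊨ᴬ φ

True : ArithSentence → Set₁
True (φ , _) = ∀ v → v ⊨ᴬ φ

------------------------------------------------------------------------
-- Encodings: prefix notation with constructors tagged by a prefix code

pattern O = false
pattern I = true

-- Each bit of a name is preceded by I, and O ends the name.

⌜_⌝ᴺ : Name → List Bool
⌜ x ⌝ᴺ = concatMap (λ b → I ∷ b ∷ []) x ++ O ∷ []

⌜_⌝ˢ : SetVar → List Bool
⌜ Xa ⌝ˢ    = O ∷ O ∷ []
⌜ Xd ⌝ˢ    = O ∷ I ∷ []
⌜ var x ⌝ˢ = I ∷ ⌜ x ⌝ᴺ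

-- AP is fixed, so writing the index of a proposition in unary costs
-- only a constant factor.

⌜_⌝ᴾ : ∀ {n} → Fin n → List Bool
⌜ p ⌝ᴾ = replicate (toℕ p) I ++ O ∷ []

⌜_⌝ᴸ : ∀ {n} → LTL n → List Bool
⌜ p at π ⌝ᴸ = O ∷ O ∷ O ∷ ⌜ p ⌝ᴾ ++ ⌜ π ⌝ᴺ
⌜ neg ψ ⌝ᴸ  = O ∷ O ∷ I ∷ ⌜ ψ ⌝ᴸ
⌜ ψ or χ ⌝ᴸ = O ∷ I ∷ O ∷ ⌜ ψ ⌝ᴸ ++ ⌜ χ ⌝ᴸ
⌜ next ψ ⌝ᴸ = O ∷ I ∷ I ∷ ⌜ ψ ⌝ᴸ
⌜ ψ U χ ⌝ᴸ  = I ∷ O ∷ O ∷ ⌜ ψ ⌝ᴸ ++ ⌜ χ ⌝ᴸ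

⌜_⌝ᴴ : ∀ {n} → Hyper²LTL n → List Bool
⌜ ∃₂ X ∙ φ ⌝ᴴ     = I ∷ O ∷ O ∷ ⌜ X ⌝ˢ ++ ⌜ φ ⌝ᴴ
⌜ ∀₂ X ∙ φ ⌝ᴴ     = I ∷ O ∷ I ∷ ⌜ X ⌝ˢ ++ ⌜ φ ⌝ᴴ
⌜ ∃₁ π ∈ X ∙ φ ⌝ᴴ = I ∷ I ∷ O ∷ ⌜ π ⌝ᴺ ++ ⌜ X ⌝ˢ ++ ⌜ φ ⌝ᴴ
⌜ ∀₁ π ∈ X ∙ φ ⌝ᴴ = I ∷ I ∷ I ∷ ⌜ π ⌝ᴺ ++ ⌜ X ⌝ˢ ++ ⌜ φ ⌝ᴴ
⌜ ltl ψ ⌝ᴴ        = O ∷ ⌜ ψ ⌝ᴸ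

⌜_⌝ᵀ : Term → List Bool
⌜ var x ⌝ᵀ = O ∷ ⌜ x ⌝ᴺ
⌜ s ⊕ t ⌝ᵀ = I ∷ O ∷ ⌜ s ⌝ᵀ ++ ⌜ t ⌝ᵀ
⌜ s ⊗ t ⌝ᵀ = I ∷ I ∷ ⌜ s ⌝ᵀ ++ ⌜ t ⌝ᵀ

⌜_⌝ᴬ : Arith → List Bool
⌜ s ≈ t ⌝ᴬ    = O ∷ O ∷ O ∷ O ∷ ⌜ s ⌝ᵀ ++ ⌜ t ⌝ᵀ
⌜ s ≺ t ⌝ᴬ    = O ∷ O ∷ O ∷ I ∷ ⌜ s ⌝ᵀ ++ ⌜ t ⌝ᵀ
⌜ t ∈₁ A ⌝ᴬ   = O ∷ O ∷ I ∷ O ∷ ⌜ t ⌝ᵀ ++ ⌜ A ⌝ᴺ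
⌜ A ∈₂ 𝒜 ⌝ᴬ   = O ∷ O ∷ I ∷ I ∷ ⌜ A ⌝ᴺ ++ ⌜ 𝒜 ⌝ᴺ
⌜ neg φ ⌝ᴬ    = O ∷ I ∷ O ∷ O ∷ ⌜ φ ⌝ᴬ
⌜ φ and χ ⌝ᴬ  = O ∷ I ∷ O ∷ I ∷ ⌜ φ ⌝ᴬ ++ ⌜ χ ⌝ᴬ
⌜ φ or χ ⌝ᴬ   = O ∷ I ∷ I ∷ O ∷ ⌜ φ ⌝ᴬ ++ ⌜ χ ⌝ᴬ
⌜ ∃⁰ x ∙ φ ⌝ᴬ = I ∷ O ∷ O ∷ O ∷ ⌜ x ⌝ᴺ ++ ⌜ φ ⌝ᴬ
⌜ ∀⁰ x ∙ φ ⌝ᴬ = I ∷ O ∷ O ∷ I ∷ ⌜ x ⌝ᴺ ++ ⌜ φ ⌝ᴬ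
⌜ ∃¹ A ∙ φ ⌝ᴬ = I ∷ O ∷ I ∷ O ∷ ⌜ A ⌝ᴺ ++ ⌜ φ ⌝ᴬ
⌜ ∀¹ A ∙ φ ⌝ᴬ = I ∷ O ∷ I ∷ I ∷ ⌜ A ⌝ᴺ ++ ⌜ φ ⌝ᴬ
⌜ ∃² 𝒜 ∙ φ ⌝ᴬ = I ∷ I ∷ O ∷ O ∷ ⌜ 𝒜 ⌝ᴺ ++ ⌜ φ ⌝ᴬ
⌜ ∀² 𝒜 ∙ φ ⌝ᴬ = I ∷ I ∷ O ∷ I ∷ ⌜ 𝒜 ⌝ᴺ ++ ⌜ φ ⌝ᴬ

------------------------------------------------------------------------
-- Deterministic multi-tape Turing machines

data Cell (m : ℕ) : Set where
  blank : Cell m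
  bit   : Bool → Cell m
  mark  : Fin m → Cell m

data Move : Set where
  left stay right : Move

-- A two-way infinite tape: the cells to the left of the head (nearest
-- first), the scanned cell and the cells to the right; all cells beyond
-- the two lists are blank.

record Tape (m : ℕ) : Set where
  constructor tape
  field
    before : List (Cell m)
    scan   : Cell m
    after  : List (Cell m)

open Tape

emptyTape : ∀ {m} → Tape m
emptyTape = tape [] blank []

tapeOf : ∀ {m} → List Bool → Tape m
tapeOf []      = emptyTape
tapeOf (b ∷ w) = tape [] (bit b) (map bit w)

act : ∀ {m} → Cell m × Move → Tape m → Tape m
act (c , left)  (tape []       _ rs)       = tape [] blank (c ∷ rs)
act (c , left)  (tape (l ∷ ls) _ rs)       = tape ls l (c ∷ rs)
act (c , stay)  (tape ls       _ rs)       = tape ls c rs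
act (c , right) (tape ls       _ [])       = tape (c ∷ ls) blank []
act (c , right) (tape ls       _ (r ∷ rs)) = tape (c ∷ ls) r rs

leadingBits : ∀ {m} → List (Cell m) → List Bool
leadingBits (bit b ∷ cs) = b ∷ leadingBits cs
leadingBits _            = []

-- Tape 0 carries the input and tape 1 the output; there are `work`
-- further tapes.  The machine halts when δ is undefined.

record TuringMachine : Set where
  field
    work states marks : ℕ
    start : Fin states
    δ     : Fin states → Vec (Cell marks) (2 + work) →
            Maybe (Fin states × Vec (Cell marks × Move) (2 + work))

  Configuration : Set
  Configuration = Fin states × Vec (Tape marks) (2 + work)

  initialConfiguration : List Bool → Configuration
  initialConfiguration w = start , tapeOf w ∷ Vec.replicate (1 + work) emptyTape

  step : Configuration → Maybe Configuration
  step (q , ts) =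
    Maybe.map (λ (q′ , as) → q′ , Vec.zipWith act as ts) (δ q (Vec.map scan ts))

  -- The halting configuration, if it is reached in at most k steps.

  run : ℕ → Configuration → Maybe Configuration
  run k c with step c
  run k       c | nothing = just c
  run zero    c | just _  = nothing
  run (suc k) c | just c′ = run k c′

  -- The output starts under the head and extends to the first non-bit.

  output : Configuration → List Bool
  output (_ , _ ∷ t ∷ _) = leadingBits (scan t ∷ after t)

  OnInput_Outputs_Within_ : List Bool → List Bool → ℕ → Set
  OnInput w Outputs v Within k =
    Maybe.map output (run k (initialConfiguration w)) ≡ just v

------------------------------------------------------------------------
-- Decision problems and polynomial-time reductions

record Problem : Set₂ where
  field
    Instance : Set
    encode   : Instance → List Bool
    Yes      : Pred Instance 1ℓ

open Problem

PolynomialTime : (A B : Problem) → (Instance A → Instance B) → Set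
PolynomialTime A B f =
  Σ[ M ∈ TuringMachine ] ∃[ c ] ∃[ d ] ∀ x →
    let open TuringMachine M
        w = encode A x
    in OnInput w Outputs encode B (f x) Within (c * length w ^ d + c)

_≤ᵖ_ : Problem → Problem → Set₁
A ≤ᵖ B = Σ[ f ∈ (Instance A → Instance B) ]
  PolynomialTime A B f × (∀ x → Yes A x ⇔ Yes B (f x))

_≡ᵖ_ : Problem → Problem → Set₁
A ≡ᵖ B = A ≤ᵖ B × B ≤ᵖ A

ClosedWorldFiniteStateSatisfiability : ℕ → Problem
ClosedWorldFiniteStateSatisfiability n = record
  { Instance = XaFreeSentence n
  ; encode   = ⌜_⌝ᴴ ∘ proj₁
  ; Yes      = FiniteStateSatisfiable
  }

TruthInThirdOrderArithmetic : Problem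
TruthInThirdOrderArithmetic = record
  { Instance = ArithSentence
  ; encode   = ⌜_⌝ᴬ ∘ proj₁
  ; Yes      = True
  }

{-# OPTIONS --safe #-}
module Submission where

-- In one direction, traces become sets of numbers, sets of traces become sets of sets of numbers, and a
-- finite transition system becomes a number and three sets, so the closed-world semantics can be written
-- down as an arithmetic sentence.
--
-- In the other direction, a trace represents three sets of numbers.  The set of traces of a finite
-- transition system is closed by König's lemma; if it is nonempty and contains 0t and 1t with every t,
-- it therefore contains every trace, and then trace and set quantifiers range over all sets of numbers and
-- all sets of sets of numbers.  Two set variables are forced to contain the graphs of addition and
-- multiplication.  Quantifiers are moved to the front of the sentence, which is justified by playing its
-- quantifier prefix as a game: a true subformula gives one player a strategy, a false one the other.
--
-- Both translations are computed by programs on stacks, which are compiled to Turing machines.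

open import Defs
open import Axiom.ExcludedMiddle using (ExcludedMiddle)
open import Data.Bool using (Bool; true; false; not; T; _∧_; _∨_; if_then_else_)
open import Data.Empty using (⊥; ⊥-elim)
open import Data.Fin using (Fin; zero; suc; toℕ; fromℕ<; _↑ˡ_; _↑ʳ_; splitAt; #_)
import Data.Fin as Fin
import Data.Fin.Properties as Fin
open import Data.Fin.Subset using (Subset) renaming (_∈_ to _∈ˢ_)
open import Data.Fin.Subset.Properties using (⊆-antisym)
open import Data.List using (List; []; _∷_; _++_; _ʳ++_; concatMap; foldr; length; map; replicate; reverse)
import Data.List.Properties as List
open import Data.Maybe using (Maybe; just; nothing)
import Data.Maybe as Maybe
open import Data.Maybe.Relation.Unary.Any using (Any; just)
open import Data.Nat using (ℕ; zero; suc; _+_; _*_; _∸_; _^_; _⊔_; _≤_; _<_; _≤ᵇ_; NonZero; ≢-nonZero; ≢-nonZero⁻¹; z≤n; s≤s)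
import Data.Nat.Properties as ℕ
open import Data.Nat.DivMod using (_/_; _%_)
import Data.Nat.DivMod as ℕ
open import Data.Nat.Tactic.RingSolver using (solve-∀)
open import Data.Product using (Σ; Σ-syntax; ∃; ∃-syntax; _×_; _,_; proj₁; proj₂)
open import Data.Sum using (_⊎_; inj₁; inj₂; [_,_]′)
open import Data.Unit using (⊤; tt)
open import Data.Vec using (Vec; []; _∷_; lookup; _[_]≔_)
import Data.Vec as Vec
import Data.Vec.Properties as Vec
open import Function using (_∘_; id; case_of_)
open import Function.Bundles using (_⇔_; mk⇔; Equivalence)
open import Level using (Level; Lift; lift; lower; 0ℓ)
open import Relation.Binary.Definitions using (tri<; tri≈; tri>)
open import Relation.Binary.PropositionalEquality
  using (_≡_; _≢_; _≗_; refl; sym; trans; cong; cong₂; subst; subst₂; module ≡-Reasoning)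
open import Relation.Nullary using (¬_; Dec; yes; no; does)
open import Relation.Unary using (_≐_)

-- Stack programs

-- A formula of Hyper²LTL is a single block of quantifiers followed by a temporal formula, so no
-- Boolean connective may stand above a quantifier. Bounded quantifiers can be moved past
-- connectives only if their ranges are nonempty; this is why every set that gets bound is required
-- to have a member.
--
-- Temporal operators compare traces only position by position, and there may be just one
-- proposition. A single trace therefore interleaves three sets of numbers modulo 3 on proposition
-- `zero`: a triple `(a , b , c)` becomes one trace, the graphs of addition and multiplication
-- become sets of traces, and two axioms describe them by recursion on `b`.
--
-- The sentence cannot mention the transition system, so it has to force `Xd` to be everything by a
-- local condition on its traces; finiteness of the system is what makes closure under prepending
-- one letter suffice.
--
-- For the running time, both codes are in prefix notation and are read once from left to right. No
-- parse tree is built, and the cost is charged to the input bits.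

Stacks : ℕ → ℕ → Set
Stacks g k = Vec (List (Cell g)) k

top : ∀ {g} → List (Cell g) → Cell g
top []      = blank
top (c ∷ _) = c

tops : ∀ {g k} → Stacks g k → Vec (Cell g) k
tops = Vec.map top

rest : ∀ {g} → List (Cell g) → List (Cell g)
rest []       = []
rest (_ ∷ cs) = cs

infixr 5 _⨾_

data Prog (g k : ℕ) : Set where
  skip : Prog g k
  push : Fin k → Cell g → Prog g k
  copy : Fin k → Fin k → Prog g k
  pop  : Fin k → Prog g k
  _⨾_  : Prog g k → Prog g k → Prog g k
  cond : (Vec (Cell g) k → Bool) → Prog g k → Prog g k → Prog g k
  loop : (Vec (Cell g) k → Bool) → Prog g k → Prog g k

-- The times are the exact step counts of the compiled machine. `copy` needs distinct stacks because
-- its code first moves head `j` to a fresh cell and only then reads the top of stack `i`.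
data Run {g k : ℕ} : Prog g k → Stacks g k → ℕ → Stacks g k → Set where
  skip  : ∀ {σ} → Run skip σ 1 σ
  push  : ∀ {j c σ} → Run (push j c) σ 2 (σ [ j ]≔ (c ∷ lookup σ j))
  copy  : ∀ {i j σ} → i ≢ j → Run (copy i j) σ 2 (σ [ j ]≔ (top (lookup σ i) ∷ lookup σ j))
  pop   : ∀ {j σ} → Run (pop j) σ 1 (σ [ j ]≔ rest (lookup σ j))
  _⨾_   : ∀ {p q σ σ′ σ″ t u} → Run p σ t σ′ → Run q σ′ u σ″ → Run (p ⨾ q) σ (t + u) σ″
  condᵗ : ∀ {b p q σ σ′ t} → b (tops σ) ≡ true → Run p σ t σ′ → Run (cond b p q) σ (suc t) σ′
  condᶠ : ∀ {b p q σ σ′ t} → b (tops σ) ≡ false → Run q σ t σ′ → Run (cond b p q) σ (suc t) σ′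
  loopᵗ : ∀ {b p σ σ′ σ″ t u} → b (tops σ) ≡ true → Run p σ t σ′ → Run (loop b p) σ′ u σ″ →
          Run (loop b p) σ (suc (t + u)) σ″
  loopᶠ : ∀ {b p σ} → b (tops σ) ≡ false → Run (loop b p) σ 1 σ

-- Compilation to Turing machines

progSize : ∀ {g k} → Prog g k → ℕ
progSize skip         = 1
progSize (push _ _)   = 2
progSize (copy _ _)   = 2
progSize (pop _)      = 1
progSize (p ⨾ q)      = progSize p + progSize q
progSize (cond _ p q) = suc (progSize p + progSize q)
progSize (loop _ p)   = suc (progSize p)

entry : ∀ {g k} (p : Prog g k) → Fin (progSize p)
entry skip         = zero
entry (push _ _)   = zero
entry (copy _ _)   = zero
entry (pop _)      = zero
entry (p ⨾ q)      = entry p ↑ˡ progSize q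
entry (cond _ _ _) = zero
entry (loop _ _)   = zero

hold : ∀ {g k} → Vec (Cell g) k → Vec (Cell g × Move) k
hold = Vec.map (_, stay)

-- The top of a stack is the scanned cell, so a push first moves left.

compile : ∀ {g k} {A : Set} (p : Prog g k) → (Fin (progSize p) → A) → A →
          Fin (progSize p) → Vec (Cell g) k → A × Vec (Cell g × Move) k
compile skip         emb exit _         cs = exit , hold cs
compile (push j c)   emb exit zero      cs = emb (suc zero) , hold cs [ j ]≔ (lookup cs j , left)
compile (push j c)   emb exit (suc _)   cs = exit , hold cs [ j ]≔ (c , stay)
compile (copy i j)   emb exit zero      cs = emb (suc zero) , hold cs [ j ]≔ (lookup cs j , left)
compile (copy i j)   emb exit (suc _)   cs = exit , hold cs [ j ]≔ (lookup cs i , stay)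
compile (pop j)      emb exit _         cs = exit , hold cs [ j ]≔ (lookup cs j , right)
compile (p ⨾ q)      emb exit s         cs =
  [ (λ i → compile p (emb ∘ (_↑ˡ progSize q)) (emb (progSize p ↑ʳ entry q)) i cs)
  , (λ i → compile q (emb ∘ (progSize p ↑ʳ_)) exit i cs) ]′ (splitAt (progSize p) s)
compile (cond b p q) emb exit zero      cs =
  emb (if b cs then suc (entry p ↑ˡ progSize q) else suc (progSize p ↑ʳ entry q)) , hold cs
compile (cond b p q) emb exit (suc s)   cs =
  [ (λ i → compile p (emb ∘ suc ∘ (_↑ˡ progSize q)) exit i cs)
  , (λ i → compile q (emb ∘ suc ∘ (progSize p ↑ʳ_)) exit i cs) ]′ (splitAt (progSize p) s)
compile (loop b p)   emb exit zero      cs = (if b cs then emb (suc (entry p)) else exit) , hold cs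
compile (loop b p)   emb exit (suc s)   cs = compile p (emb ∘ suc) (emb zero) s cs

-- `zero` is the only state without transitions; it is the exit of the whole program, whose own
-- states are shifted by one.
machine : ∀ {g w} → Prog g (2 + w) → TuringMachine
machine {g} {w} p = record
  { work = w ; states = suc (progSize p) ; marks = g ; start = suc (entry p)
  ; δ = λ where
      zero    cs → nothing
      (suc s) cs → just (compile p suc zero s cs)
  }

open Tape using (scan; after)

-- Cells to the left of the head are ignored: a pop leaves its cell there, and a later push
-- overwrites it. Trailing blanks are allowed because a head that leaves the written part of the
-- tape scans, and then stores, blanks.
_Shows_ : ∀ {g} → Tape g → List (Cell g) → Set
t Shows cs = ∃[ m ] scan t ∷ after t ≡ cs ++ replicate m blank

record _Show_ {g k} (ts : Vec (Tape g) k) (σ : Stacks g k) : Set where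
  constructor showing
  field shown : ∀ i → lookup ts i Shows lookup σ i

open _Show_

scan-top : ∀ {g} (t : Tape g) {cs} → t Shows cs → scan t ≡ top cs
scan-top t {[]}    (suc m , refl) = refl
scan-top t {_ ∷ _} (m , refl)     = refl

scans-tops : ∀ {g k} (ts : Vec (Tape g) k) {σ} → ts Show σ → Vec.map scan ts ≡ tops σ
scans-tops []       {[]}    _ = refl
scans-tops (t ∷ ts) {_ ∷ _} h = cong₂ _∷_ (scan-top t (shown h zero)) (scans-tops ts (showing (shown h ∘ suc)))

act-hold : ∀ {g k} (ts : Vec (Tape g) k) → Vec.zipWith act (hold (Vec.map scan ts)) ts ≡ ts
act-hold []       = refl
act-hold (t ∷ ts) = cong (t ∷_) (act-hold ts)

act-hold-update : ∀ {g k} (ts : Vec (Tape g) k) j a →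
  Vec.zipWith act (hold (Vec.map scan ts) [ j ]≔ a) ts ≡ ts [ j ]≔ act a (lookup ts j)
act-hold-update (t ∷ ts) zero    a = cong (_ ∷_) (act-hold ts)
act-hold-update (t ∷ ts) (suc j) a = cong (t ∷_) (act-hold-update ts j a)

Show-update : ∀ {g k} (ts : Vec (Tape g) k) {σ} → ts Show σ → ∀ j {t cs} → t Shows cs →
  (ts [ j ]≔ t) Show (σ [ j ]≔ cs)
shown (Show-update (_ ∷ _)  {_ ∷ _} h zero    s) zero    = s
shown (Show-update (_ ∷ _)  {_ ∷ _} h zero    s) (suc i) = shown h (suc i)
shown (Show-update (_ ∷ _)  {_ ∷ _} h (suc j) s) zero    = shown h zero
shown (Show-update (_ ∷ ts) {_ ∷ σ} h (suc j) s) (suc i) = shown (Show-update ts {σ} (showing (shown h ∘ suc)) j s) i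

Shows-push : ∀ {g} (t : Tape g) {cs} c → t Shows cs → act (c , stay) (act (scan t , left) t) Shows (c ∷ cs)
Shows-push (tape [] _ _)      c (m , e) = m , cong (c ∷_) e
Shows-push (tape (_ ∷ _) _ _) c (m , e) = m , cong (c ∷_) e

Shows-pop : ∀ {g} (t : Tape g) {cs} → t Shows cs → act (scan t , right) t Shows rest cs
Shows-pop (tape _ _ [])       {[]}     _             = 1 , refl
Shows-pop (tape _ _ (_ ∷ _))  {[]}     (suc m , e)   = m , List.∷-injectiveʳ e
Shows-pop (tape _ _ [])       {_ ∷ []} _             = 1 , refl
Shows-pop (tape _ _ (_ ∷ _))  {_ ∷ _}  (m , e)       = m , List.∷-injectiveʳ e

module _ {g w : ℕ} (P : Prog g (2 + w)) where

  open TuringMachine (machine P)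

  data Steps : Configuration → ℕ → Configuration → Set where
    done : ∀ {c} → Steps c 0 c
    _◅_  : ∀ {c c′ c″ t} → step c ≡ just c′ → Steps c′ t c″ → Steps c (suc t) c″

  _◅◅_ : ∀ {c c′ c″ t u} → Steps c t c′ → Steps c′ u c″ → Steps c (t + u) c″
  done    ◅◅ s′ = s′
  (e ◅ s) ◅◅ s′ = e ◅ (s ◅◅ s′)

  run-steps : ∀ {c t c′} → Steps c t c′ → step c′ ≡ nothing → ∀ {k} → t ≤ k → run k c ≡ just c′
  run-steps {c} done e _ with step c
  run-steps {c} done refl {zero}  _ | nothing = refl
  run-steps {c} done refl {suc _} _ | nothing = refl
  run-steps {c} (e ◅ s) h (s≤s t≤k) with step c
  run-steps {c} (refl ◅ s) h (s≤s t≤k) | just _ = run-steps s h t≤k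

  step-δ : ∀ {q ts q′ as} → δ q (Vec.map scan ts) ≡ just (q′ , as) →
    step (q , ts) ≡ just (q′ , Vec.zipWith act as ts)
  step-δ e rewrite e = refl

  -- The code of a subprogram sits inside the code of the whole program at the states `emb`. Keeping
  -- both `emb` and `exit` arbitrary is what makes the simulation compositional.
  Embeds : (p : Prog g (2 + w)) → (Fin (progSize p) → Fin states) → Fin states → Set
  Embeds p emb exit = ∀ s cs → δ (emb s) cs ≡ just (compile p emb exit s cs)

  embeds-⨾ˡ : ∀ {p q emb exit} → Embeds (p ⨾ q) emb exit →
    Embeds p (emb ∘ (_↑ˡ progSize q)) (emb (progSize p ↑ʳ entry q))
  embeds-⨾ˡ {p} {q} H s cs = trans (H _ cs) (cong (λ x → just ([ _ , _ ]′ x)) (Fin.splitAt-↑ˡ (progSize p) s (progSize q)))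

  embeds-⨾ʳ : ∀ {p q emb exit} → Embeds (p ⨾ q) emb exit → Embeds q (emb ∘ (progSize p ↑ʳ_)) exit
  embeds-⨾ʳ {p} {q} H s cs = trans (H _ cs) (cong (λ x → just ([ _ , _ ]′ x)) (Fin.splitAt-↑ʳ (progSize p) (progSize q) s))

  embeds-condᵗ : ∀ {b p q emb exit} → Embeds (cond b p q) emb exit → Embeds p (emb ∘ suc ∘ (_↑ˡ progSize q)) exit
  embeds-condᵗ {p = p} {q} H s cs = trans (H _ cs) (cong (λ x → just ([ _ , _ ]′ x)) (Fin.splitAt-↑ˡ (progSize p) s (progSize q)))

  embeds-condᶠ : ∀ {b p q emb exit} → Embeds (cond b p q) emb exit → Embeds q (emb ∘ suc ∘ (progSize p ↑ʳ_)) exit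
  embeds-condᶠ {p = p} {q} H s cs = trans (H _ cs) (cong (λ x → just ([ _ , _ ]′ x)) (Fin.splitAt-↑ʳ (progSize p) (progSize q) s))

  write : ∀ {q q′ c m} ts j →
    δ q (Vec.map scan ts) ≡ just (q′ , hold (Vec.map scan ts) [ j ]≔ (c , m)) →
    step (q , ts) ≡ just (q′ , ts [ j ]≔ act (c , m) (lookup ts j))
  write ts j e = trans (step-δ e) (cong (λ x → just (_ , x)) (act-hold-update ts j _))

  test : ∀ {q q′} ts → δ q (Vec.map scan ts) ≡ just (q′ , hold (Vec.map scan ts)) →
    step (q , ts) ≡ just (q′ , ts)
  test ts e = trans (step-δ e) (cong (λ x → just (_ , x)) (act-hold ts))

  pushing : ∀ {q q′ q″ j c} ts {σ} → ts Show σ →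
    (∀ cs → δ q cs ≡ just (q′ , hold cs [ j ]≔ (lookup cs j , left))) →
    (let ts′ = ts [ j ]≔ act (scan (lookup ts j) , left) (lookup ts j) in
     δ q′ (Vec.map scan ts′) ≡ just (q″ , hold (Vec.map scan ts′) [ j ]≔ (c , stay))) →
    ∃[ ts″ ] Steps (q , ts) 2 (q″ , ts″) × ts″ Show (σ [ j ]≔ (c ∷ lookup σ j))
  pushing {j = j} {c} ts {σ} h e₁ e₂ = _
    , (trans (write ts j (e₁ _)) (cong (λ x → just (_ , ts [ j ]≔ act (x , left) (lookup ts j))) (Vec.lookup-map j scan ts))
       ◅ (write _ j e₂ ◅ done))
    , subst (_Show (σ [ j ]≔ (c ∷ lookup σ j)))
        (sym (trans (Vec.[]≔-idempotent ts j)
          (cong (λ x → ts [ j ]≔ act (c , stay) x) (Vec.lookup∘update j ts (act (scan (lookup ts j) , left) (lookup ts j))))))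
        (Show-update ts h j (Shows-push (lookup ts j) c (shown h j)))

  -- By induction on the run rather than on the program: a loop is unrolled as often as the run
  -- says, and nothing else has to be known about its termination.
  simulate : ∀ {p σ t σ′} → Run p σ t σ′ → ∀ {emb exit} → Embeds p emb exit → ∀ ts → ts Show σ →
    ∃[ ts′ ] Steps (emb (entry p) , ts) t (exit , ts′) × ts′ Show σ′
  simulate skip H ts h = ts , (test ts (H _ _) ◅ done) , h
  simulate (push {j} {c}) H ts h = pushing ts h (H zero) (H (suc zero) _)
  simulate (copy {i} {j} {σ} i≢j) H ts h =
    pushing ts h (H zero) (trans (H (suc zero) _) (cong (λ x → just (_ , hold (Vec.map scan ts′) [ j ]≔ (x , stay))) same))
    where
      ts′ = ts [ j ]≔ act (scan (lookup ts j) , left) (lookup ts j)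
      same : lookup (Vec.map scan ts′) i ≡ top (lookup σ i)
      same = trans (Vec.lookup-map i scan ts′)
        (trans (cong scan (Vec.lookup∘update′ i≢j ts _)) (scan-top (lookup ts i) (shown h i)))
  simulate (pop {j} {σ}) H ts h = _
    , (trans (write ts j (H zero _)) (cong (λ x → just (_ , ts [ j ]≔ act (x , right) (lookup ts j))) (Vec.lookup-map j scan ts)) ◅ done)
    , Show-update ts h j (Shows-pop (lookup ts j) (shown h j))
  simulate (_⨾_ {p} {q} r r′) H ts h with simulate r (embeds-⨾ˡ {p} {q} H) ts h
  ... | ts′ , s , h′ with simulate r′ (embeds-⨾ʳ {p} {q} H) ts′ h′
  ... | ts″ , s′ , h″ = ts″ , (s ◅◅ s′) , h″
  simulate (condᵗ {b} {p} {q} e r) {emb} H ts h with simulate r (embeds-condᵗ {b} {p} {q} H) ts h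
  ... | ts′ , s , h′ = ts′ , (trans (test ts (H zero _)) (cong (λ x → just (emb (if x then _ else _) , ts)) (trans (cong b (scans-tops ts h)) e)) ◅ s) , h′
  simulate (condᶠ {b} {p} {q} e r) {emb} H ts h with simulate r (embeds-condᶠ {b} {p} {q} H) ts h
  ... | ts′ , s , h′ = ts′ , (trans (test ts (H zero _)) (cong (λ x → just (emb (if x then _ else _) , ts)) (trans (cong b (scans-tops ts h)) e)) ◅ s) , h′
  simulate (loopᵗ {b} e r r′) {emb} {exit} H ts h with simulate r (λ s → H (suc s)) ts h
  ... | ts′ , s , h′ with simulate r′ H ts′ h′
  ... | ts″ , s′ , h″ = ts″ , (trans (test ts (H zero _)) (cong (λ x → just ((if x then _ else exit) , ts)) (trans (cong b (scans-tops ts h)) e)) ◅ (s ◅◅ s′)) , h″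
  simulate (loopᶠ {b} e) {emb} {exit} H ts h = ts
    , (trans (test ts (H zero _)) (cong (λ x → just ((if x then emb _ else exit) , ts)) (trans (cong b (scans-tops ts h)) e)) ◅ done) , h

bits : ∀ {g} → List Bool → List (Cell g)
bits = map bit

inputStacks : ∀ {g w} → List Bool → Stacks g (2 + w)
inputStacks w = bits w ∷ Vec.replicate _ []

tapeOf-Shows : ∀ {g} w → tapeOf {g} w Shows bits w
tapeOf-Shows []      = 1 , refl
tapeOf-Shows (b ∷ w) = 0 , cong (bit b ∷_) (sym (List.++-identityʳ _))

emptyTapes-Show : ∀ {g} k → Vec.replicate k (emptyTape {g}) Show Vec.replicate k []
shown (emptyTapes-Show (suc k)) zero    = 1 , refl
shown (emptyTapes-Show (suc k)) (suc i) = shown (emptyTapes-Show k) i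

leadingBits-Shows : ∀ {g} v m → leadingBits {g} (bits v ++ replicate m blank) ≡ v
leadingBits-Shows []      zero    = refl
leadingBits-Shows []      (suc m) = refl
leadingBits-Shows (b ∷ v) m       = cong (b ∷_) (leadingBits-Shows v m)

Polynomial : (ℕ → ℕ) → Set
Polynomial T = ∃[ c ] ∃[ d ] ∀ n → T n ≤ c * n ^ d + c

open Problem

polynomialTime : ∀ {A B} (f : Instance A → Instance B) {g w} (p : Prog g (2 + w)) {T} → Polynomial T →
  (∀ x → ∃[ t ] ∃[ σ ] Run p (inputStacks (encode A x)) t σ
       × lookup σ (suc zero) ≡ bits (encode B (f x)) × t ≤ T (length (encode A x))) →
  PolynomialTime A B f
polynomialTime {A} {B} f {g} {w} p (c , d , T≤) h = machine p , c , d , λ x →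
  let t , σ , r , out , t≤ = h x
      ts , s , shows = simulate p r {suc} {zero} (λ _ _ → refl) (tapeOf (encode A x) ∷ Vec.replicate _ emptyTape)
                         (showing λ { zero → tapeOf-Shows (encode A x) ; (suc i) → shown (emptyTapes-Show (1 + w)) i })
  in trans (cong (Maybe.map (output p)) (run-steps p s refl (ℕ.≤-trans t≤ (T≤ _)))) (cong just (correct ts {σ} (shown shows (suc zero)) out))
  where
    output = λ (p : Prog g (2 + w)) → TuringMachine.output (machine p)
    correct : ∀ ts {σ : Stacks g (2 + w)} {v} → lookup ts (suc zero) Shows lookup σ (suc zero) → lookup σ (suc zero) ≡ bits v →
      output p (zero , ts) ≡ v
    correct (_ ∷ t ∷ _) {v = v} (m , e) e′ = trans (cong leadingBits (trans e (cong (_++ _) e′))) (leadingBits-Shows v m)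

-- Running times

-- An evaluator for stretches without iteration. On stacks whose tops are known it computes, so that
-- a run together with its time is obtained from `refl`; a loop is accepted only when it exits at
-- once.
exec : ∀ {g k} → Prog g k → Stacks g k → Maybe (ℕ × Stacks g k)
exec skip         σ = just (1 , σ)
exec (push j c)   σ = just (2 , σ [ j ]≔ (c ∷ lookup σ j))
exec (copy i j)   σ with i Fin.≟ j
... | yes _ = nothing
... | no  _ = just (2 , σ [ j ]≔ (top (lookup σ i) ∷ lookup σ j))
exec (pop j)      σ = just (1 , σ [ j ]≔ rest (lookup σ j))
exec (p ⨾ q)      σ with exec p σ
... | nothing       = nothing
... | just (t , σ′) with exec q σ′
...   | nothing       = nothing
...   | just (u , σ″) = just (t + u , σ″)
exec (cond b p q) σ with b (tops σ)
... | true  = Maybe.map (λ (t , σ′) → suc t , σ′) (exec p σ)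
... | false = Maybe.map (λ (t , σ′) → suc t , σ′) (exec q σ)
exec (loop b p)   σ with b (tops σ)
... | true  = nothing
... | false = just (1 , σ)

exec-run : ∀ {g k} (p : Prog g k) {σ t σ′} → exec p σ ≡ just (t , σ′) → Run p σ t σ′
exec-run skip         refl = skip
exec-run (push j c)   refl = push
exec-run (copy i j)   e with i Fin.≟ j
exec-run (copy i j)   refl | no i≢j = copy i≢j
exec-run (pop j)      refl = pop
exec-run (p ⨾ q) {σ}  e with exec p σ in ep
... | just (t , σ′) with exec q σ′ in eq
exec-run (p ⨾ q) {σ}  refl | just (t , σ′) | just (u , σ″) = exec-run p ep ⨾ exec-run q eq
exec-run (cond b p q) {σ} e with b (tops σ) in eb
exec-run (cond b p q) {σ} e | true with exec p σ in ep
exec-run (cond b p q) {σ} refl | true | just _ = condᵗ eb (exec-run p ep)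
exec-run (cond b p q) {σ} e | false with exec q σ in eq
exec-run (cond b p q) {σ} refl | false | just _ = condᶠ eb (exec-run q eq)
exec-run (loop b p)   {σ} e with b (tops σ) in eb
exec-run (loop b p)   {σ} refl | false = loopᶠ eb

Within : ∀ {g k} → Prog g k → Stacks g k → Stacks g k → ℕ → Set
Within p σ σ′ T = ∃[ t ] t ≤ T × Run p σ t σ′

straight : ∀ {g k} {p : Prog g k} {σ t σ′} → exec p σ ≡ just (t , σ′) → Within p σ σ′ t
straight {p = p} e = _ , ℕ.≤-refl , exec-run p e

relax : ∀ {g k} {p : Prog g k} {σ σ′ T U} → T ≤ U → Within p σ σ′ T → Within p σ σ′ U
relax T≤U (t , t≤T , r) = t , ℕ.≤-trans t≤T T≤U , r

arrive : ∀ {g k} {p : Prog g k} {σ σ′ σ″ T} → σ′ ≡ σ″ → Within p σ σ′ T → Within p σ σ″ T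
arrive refl r = r

depart : ∀ {g k} {p : Prog g k} {σ σ′ σ″ T} → σ ≡ σ″ → Within p σ σ′ T → Within p σ″ σ′ T
depart refl r = r

infixr 5 _⨟_

_⨟_ : ∀ {g k} {p q : Prog g k} {σ σ′ σ″ T U} → Within p σ σ′ T → Within q σ′ σ″ U → Within (p ⨾ q) σ σ″ (T + U)
(t , t≤T , r) ⨟ (u , u≤U , s) = t + u , ℕ.+-mono-≤ t≤T u≤U , r ⨾ s

-- The first four parts of a translation are analysed together, since their total time bounds the
-- output that the fifth part pours; the program itself nests to the right.
reassociate : ∀ {g k} {a b c d e : Prog g k} {σ σ′ T} → Within ((a ⨾ b ⨾ c ⨾ d) ⨾ e) σ σ′ T → Within (a ⨾ b ⨾ c ⨾ d ⨾ e) σ σ′ T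
reassociate (_ , h , _⨾_ {t = _} {v} (_⨾_ {t = x} a (_⨾_ {t = y} b (_⨾_ {t = z} {u} c d))) e) =
  _ , ℕ.≤-trans (ℕ.≤-reflexive (sum x y z u v)) h , a ⨾ b ⨾ c ⨾ d ⨾ e
  where
    sum : ∀ x y z u v → x + (y + (z + (u + v))) ≡ x + (y + (z + u)) + v
    sum = solve-∀

thenᵂ : ∀ {g k b} {p q : Prog g k} {σ σ′ T} → b (tops σ) ≡ true → Within p σ σ′ T → Within (cond b p q) σ σ′ (suc T)
thenᵂ e (t , t≤T , r) = suc t , s≤s t≤T , condᵗ e r

elseᵂ : ∀ {g k b} {p q : Prog g k} {σ σ′ T} → b (tops σ) ≡ false → Within q σ σ′ T → Within (cond b p q) σ σ′ (suc T)
elseᵂ e (t , t≤T , r) = suc t , s≤s t≤T , condᶠ e r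

againᵂ : ∀ {g k b} {p : Prog g k} {σ σ′ σ″ T U} → b (tops σ) ≡ true → Within p σ σ′ T →
  Within (loop b p) σ′ σ″ U → Within (loop b p) σ σ″ (suc (T + U))
againᵂ e (t , t≤T , r) (u , u≤U , s) = _ , s≤s (ℕ.+-mono-≤ t≤T u≤U) , loopᵗ e r s

stopᵂ : ∀ {g k b} {p : Prog g k} {σ} → b (tops σ) ≡ false → Within (loop b p) σ σ 1
stopᵂ e = 1 , ℕ.≤-refl , loopᶠ e

-- Polynomials

-- Closure is easiest for bounds of the form c (1 + n)ᵈ.

Polynomial′ : (ℕ → ℕ) → Set
Polynomial′ T = ∃[ c ] ∃[ d ] ∀ n → T n ≤ c * suc n ^ d

2*-^ : ∀ n d → (n + n) ^ d ≡ 2 ^ d * n ^ d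
2*-^ n zero    = refl
2*-^ n (suc d) = trans (cong ((n + n) *_) (2*-^ n d)) (regroup n (2 ^ d) (n ^ d))
  where
    regroup : ∀ n a b → (n + n) * (a * b) ≡ 2 * a * (n * b)
    regroup = solve-∀

-- For positive `n` one has `1 + n ≤ n + n`; the summand 1 covers `n = 0`.
[1+n]^≤ : ∀ n d → suc n ^ d ≤ 2 ^ d * n ^ d + 1
[1+n]^≤ zero zero            = ℕ.m≤m+n 1 1
[1+n]^≤ zero (suc d)         rewrite ℕ.^-zeroˡ d = ℕ.m≤n+m 1 (2 ^ suc d * 0)
[1+n]^≤ n@(suc m) d          = begin
  suc n ^ d  ≤⟨ ℕ.^-monoˡ-≤ d (ℕ.+-monoˡ-≤ n (s≤s z≤n)) ⟩
  (n + n) ^ d  ≡⟨ 2*-^ n d ⟩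
  2 ^ d * n ^ d  ≤⟨ ℕ.m≤m+n _ 1 ⟩
  2 ^ d * n ^ d + 1  ∎
  where open ℕ.≤-Reasoning

polynomial : ∀ {T} → Polynomial′ T → Polynomial T
polynomial {T} (c , d , h) = c * 2 ^ d + c , d , λ n → begin
  T n  ≤⟨ h n ⟩
  c * suc n ^ d  ≤⟨ ℕ.*-monoʳ-≤ c ([1+n]^≤ n d) ⟩
  c * (2 ^ d * n ^ d + 1)  ≡⟨ expand c (2 ^ d) (n ^ d) ⟩
  c * 2 ^ d * n ^ d + c  ≤⟨ ℕ.+-mono-≤ (ℕ.*-monoˡ-≤ (n ^ d) (ℕ.m≤m+n (c * 2 ^ d) c)) (ℕ.m≤n+m c (c * 2 ^ d)) ⟩
  (c * 2 ^ d + c) * n ^ d + (c * 2 ^ d + c)  ∎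
  where
    open ℕ.≤-Reasoning
    expand : ∀ a b e → a * (b * e + 1) ≡ a * b * e + a
    expand = solve-∀

constᴾ : ∀ c → Polynomial′ (λ _ → c)
constᴾ c = c , 0 , λ n → ℕ.≤-reflexive (sym (ℕ.*-identityʳ c))

idᴾ : Polynomial′ id
idᴾ = 1 , 1 , λ n → ℕ.≤-trans (ℕ.n≤1+n n) (ℕ.≤-reflexive (unit n))
  where
    unit : ∀ n → suc n ≡ 1 * (suc n * 1)
    unit = solve-∀

infixl 6 _+ᴾ_
infixl 7 _*ᴾ_

_+ᴾ_ : ∀ {T U} → Polynomial′ T → Polynomial′ U → Polynomial′ (λ n → T n + U n)
_+ᴾ_ {T} {U} (c , d , h) (c′ , d′ , h′) = c + c′ , d + d′ , λ n → begin
  T n + U n  ≤⟨ ℕ.+-mono-≤ (h n) (h′ n) ⟩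
  c * suc n ^ d + c′ * suc n ^ d′  ≤⟨ ℕ.+-mono-≤
    (ℕ.*-monoʳ-≤ c (ℕ.^-monoʳ-≤ (suc n) (ℕ.m≤m+n d d′))) (ℕ.*-monoʳ-≤ c′ (ℕ.^-monoʳ-≤ (suc n) (ℕ.m≤n+m d′ d))) ⟩
  c * suc n ^ (d + d′) + c′ * suc n ^ (d + d′)  ≡⟨ ℕ.*-distribʳ-+ (suc n ^ (d + d′)) c c′ ⟨
  (c + c′) * suc n ^ (d + d′)  ∎
  where open ℕ.≤-Reasoning

_*ᴾ_ : ∀ {T U} → Polynomial′ T → Polynomial′ U → Polynomial′ (λ n → T n * U n)
_*ᴾ_ {T} {U} (c , d , h) (c′ , d′ , h′) = c * c′ , d + d′ , λ n → begin
  T n * U n  ≤⟨ ℕ.*-mono-≤ (h n) (h′ n) ⟩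
  (c * suc n ^ d) * (c′ * suc n ^ d′)  ≡⟨ swap c (suc n ^ d) c′ (suc n ^ d′) ⟩
  c * c′ * (suc n ^ d * suc n ^ d′)  ≡⟨ cong (c * c′ *_) (sym (ℕ.^-distribˡ-+-* (suc n) d d′)) ⟩
  c * c′ * suc n ^ (d + d′)  ∎
  where
    open ℕ.≤-Reasoning
    swap : ∀ a b a′ b′ → (a * b) * (a′ * b′) ≡ a * a′ * (b * b′)
    swap = solve-∀

-- Common loops

isOne isBit : ∀ {g} → Cell g → Bool
isOne (bit true) = true
isOne _          = false
isBit (bit _)    = true
isBit _          = false

oneOn bitOn : ∀ {g k} → Fin k → Vec (Cell g) k → Bool
oneOn i cs = isOne (lookup cs i)
bitOn i cs = isBit (lookup cs i)

-- The last bit of a word ends on top, so a stack collects its output in reverse; pouring it into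
-- the output stack restores the order.
emit : ∀ {g k} → Fin k → List Bool → Prog g k
emit j = foldr (λ b p → push j (bit b) ⨾ p) skip

move : ∀ {g k} → Fin k → Fin k → Prog g k
move i j = copy i j ⨾ pop i

pour : ∀ {g k} → Fin k → Fin k → Prog g k
pour i j = loop (bitOn i) (move i j)

discard : ∀ {g k} → Fin k → Prog g k
discard i = loop (bitOn i) (pop i)

-- A family of stack vectors in which only stack `i` varies. The loops below are analysed for any
-- such family and later used on concrete vectors, where both laws hold by computation.
record At {g k} (i : Fin k) (f : List (Cell g) → Stacks g k) : Set where
  field
    get : ∀ a → lookup (f a) i ≡ a
    put : ∀ a b → f a [ i ]≔ b ≡ f b

open At

top-get : ∀ {g k} {i : Fin k} {f : List (Cell g) → Stacks g k} → At i f → ∀ a → lookup (tops (f a)) i ≡ top a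
top-get {i = i} {f} l a = trans (Vec.lookup-map i top (f a)) (cong top (get l a))

pushᴬ : ∀ {g k} {i : Fin k} {f : List (Cell g) → Stacks g k} → At i f → ∀ c a → Within (push i c) (f a) (f (c ∷ a)) 2
pushᴬ {i = i} {f} l c a = 2 , ℕ.≤-refl ,
  subst (Run (push i c) (f a) 2) (trans (cong (λ x → f a [ i ]≔ (c ∷ x)) (get l a)) (put l a _)) push

popᴬ : ∀ {g k} {i : Fin k} {f : List (Cell g) → Stacks g k} → At i f → ∀ c a → Within (pop i) (f (c ∷ a)) (f a) 1
popᴬ {i = i} {f} l c a = 1 , ℕ.≤-refl ,
  subst (Run (pop i) (f (c ∷ a)) 1) (trans (cong (λ x → f (c ∷ a) [ i ]≔ rest x) (get l (c ∷ a))) (put l _ a)) pop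

copyᴬ : ∀ {g k} {i j : Fin k} {f : List (Cell g) → List (Cell g) → Stacks g k} → i ≢ j →
  (∀ b → At i (λ a → f a b)) → (∀ a → At j (f a)) → ∀ c a b → Within (copy i j) (f (c ∷ a) b) (f (c ∷ a) (c ∷ b)) 2
copyᴬ {i = i} {j} {f} i≢j lᵢ lⱼ c a b = 2 , ℕ.≤-refl ,
  subst (Run (copy i j) (f (c ∷ a) b) 2)
    (trans (cong₂ (λ x y → f (c ∷ a) b [ j ]≔ (top x ∷ y)) (get (lᵢ b) (c ∷ a)) (get (lⱼ (c ∷ a)) b)) (put (lⱼ (c ∷ a)) b _))
    (copy i≢j)

moveᴬ : ∀ {g k} {i j : Fin k} {f : List (Cell g) → List (Cell g) → Stacks g k} → i ≢ j →
  (∀ b → At i (λ a → f a b)) → (∀ a → At j (f a)) → ∀ c a b → Within (move i j) (f (c ∷ a) b) (f a (c ∷ b)) 3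
moveᴬ i≢j lᵢ lⱼ c a b = copyᴬ i≢j lᵢ lⱼ c a b ⨟ popᴬ (lᵢ (c ∷ b)) c a

emitᴬ : ∀ {g k} {j : Fin k} {f : List (Cell g) → Stacks g k} → At j f → ∀ s w →
  Within (emit j s) (f (bits w)) (f (bits (s ʳ++ w))) (2 * length s + 1)
emitᴬ l []      w = straight refl
emitᴬ {j = j} {f} l (b ∷ s) w =
  relax (ℕ.≤-reflexive (sum (length s))) (pushᴬ l (bit b) (bits w) ⨟ emitᴬ l s (b ∷ w))
  where
    sum : ∀ n → 2 + (2 * n + 1) ≡ 2 * suc n + 1
    sum = solve-∀

NonBit : ∀ {g} → List (Cell g) → Set
NonBit cs = isBit (top cs) ≡ false

pourᴬ : ∀ {g k} {i j : Fin k} {f : List (Cell g) → List (Cell g) → Stacks g k} → i ≢ j →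
  (∀ b → At i (λ a → f a b)) → (∀ a → At j (f a)) → ∀ s {cs} → NonBit cs → ∀ b →
  Within (pour i j) (f (bits s ++ cs) b) (f cs (bits s ʳ++ b)) (4 * length s + 1)
pourᴬ i≢j lᵢ lⱼ []      e b = stopᵂ (trans (cong isBit (top-get (lᵢ b) _)) e)
pourᴬ i≢j lᵢ lⱼ (x ∷ s) e b = relax (ℕ.≤-reflexive (sum (length s)))
  (againᵂ (cong isBit (top-get (lᵢ b) _)) (moveᴬ i≢j lᵢ lⱼ (bit x) _ b) (pourᴬ i≢j lᵢ lⱼ s e (bit x ∷ b)))
  where
    sum : ∀ n → 1 + (3 + (4 * n + 1)) ≡ 4 * suc n + 1
    sum = solve-∀

discardᴬ : ∀ {g k} {i : Fin k} {f : List (Cell g) → Stacks g k} → At i f → ∀ s {cs} → NonBit cs →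
  Within (discard i) (f (bits s ++ cs)) (f cs) (2 * length s + 1)
discardᴬ l []      e = stopᵂ (trans (cong isBit (top-get l _)) e)
discardᴬ l (x ∷ s) e = relax (ℕ.≤-reflexive (sum (length s)))
  (againᵂ (cong isBit (top-get l _)) (popᴬ l (bit x) _) (discardᴬ l s e))
  where
    sum : ∀ n → 1 + (1 + (2 * n + 1)) ≡ 2 * suc n + 1
    sum = solve-∀

bits-ʳ++ : ∀ {g} (s w : List Bool) → bits {g} (s ʳ++ w) ≡ bits s ʳ++ bits w
bits-ʳ++ s w = List.map-ʳ++ bit s

-- Total stack height, which bounds the length of the output.

height : ∀ {g k} → Stacks g k → ℕ
height []      = 0
height (a ∷ σ) = length a + height σ

height-lookup : ∀ {g k} (σ : Stacks g k) i → length (lookup σ i) ≤ height σ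
height-lookup (a ∷ σ) zero    = ℕ.m≤m+n (length a) (height σ)
height-lookup (a ∷ σ) (suc i) = ℕ.≤-trans (height-lookup σ i) (ℕ.m≤n+m _ (length a))

height-update : ∀ {g k} (σ : Stacks g k) i {a m} → length a ≤ m + length (lookup σ i) → height (σ [ i ]≔ a) ≤ m + height σ
height-update (b ∷ σ) zero {a} {m} h = begin
  length a + height σ  ≤⟨ ℕ.+-monoˡ-≤ (height σ) h ⟩
  m + length b + height σ  ≡⟨ ℕ.+-assoc m _ _ ⟩
  m + (length b + height σ)  ∎
  where open ℕ.≤-Reasoning
height-update (b ∷ σ) (suc i) {a} {m} h = begin
  length b + height (σ [ i ]≔ a)  ≤⟨ ℕ.+-monoʳ-≤ (length b) (height-update σ i h) ⟩
  length b + (m + height σ)  ≡⟨ swap (length b) m (height σ) ⟩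
  m + (length b + height σ)  ∎
  where
    open ℕ.≤-Reasoning
    swap : ∀ x y z → x + (y + z) ≡ y + (x + z)
    swap = solve-∀

+-chain : ∀ {a b c} t {u} → b ≤ t + a → c ≤ u + b → c ≤ t + u + a
+-chain {a} {b} {c} t {u} h h′ = begin
  c  ≤⟨ h′ ⟩
  u + b  ≤⟨ ℕ.+-monoʳ-≤ u h ⟩
  u + (t + a)  ≡⟨ swap u t a ⟩
  t + u + a  ∎
  where
    open ℕ.≤-Reasoning
    swap : ∀ x y z → x + (y + z) ≡ y + x + z
    swap = solve-∀

run-height : ∀ {g k} {p : Prog g k} {σ t σ′} → Run p σ t σ′ → height σ′ ≤ t + height σ
run-height skip = ℕ.n≤1+n _
run-height (push {j} {σ = σ}) = ℕ.≤-trans (height-update σ j {m = 1} ℕ.≤-refl) (ℕ.n≤1+n _)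
run-height (copy {j = j} {σ} _) = ℕ.≤-trans (height-update σ j {m = 1} ℕ.≤-refl) (ℕ.n≤1+n _)
run-height (pop {j} {σ}) = height-update σ j {m = 1} (shorter (lookup σ j))
  where
    shorter : ∀ {g} (a : List (Cell g)) → length (rest a) ≤ 1 + length a
    shorter []      = z≤n
    shorter (_ ∷ a) = ℕ.≤-trans (ℕ.n≤1+n _) (ℕ.n≤1+n _)
run-height (_⨾_ {t = t} r s) = +-chain t (run-height r) (run-height s)
run-height (condᵗ _ r) = ℕ.≤-trans (run-height r) (ℕ.n≤1+n _)
run-height (condᶠ _ r) = ℕ.≤-trans (run-height r) (ℕ.n≤1+n _)
run-height (loopᵗ {t = t} _ r s) = ℕ.≤-trans (+-chain t (run-height r) (run-height s)) (ℕ.n≤1+n _)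
run-height (loopᶠ _) = ℕ.n≤1+n _

copyName : ∀ {g k} → Fin k → Fin k → Prog g k
copyName i j = loop (oneOn i) (move i j ⨾ move i j) ⨾ move i j

copyNameᴬ : ∀ {g k} {i j : Fin k} {f : List (Cell g) → List (Cell g) → Stacks g k} → i ≢ j →
  (∀ b → At i (λ a → f a b)) → (∀ a → At j (f a)) → ∀ x rest b →
  Within (copyName i j) (f (bits (⌜ x ⌝ᴺ ++ rest)) b) (f (bits rest) (bits ⌜ x ⌝ᴺ ʳ++ b)) (7 * length ⌜ x ⌝ᴺ)
copyNameᴬ i≢j lᵢ lⱼ [] rest b = relax (ℕ.≤ᵇ⇒≤ _ _ tt)
  (stopᵂ (cong isOne (top-get (lᵢ b) _)) ⨟ moveᴬ i≢j lᵢ lⱼ (bit false) _ b)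
copyNameᴬ i≢j lᵢ lⱼ (c ∷ x) rest b with copyNameᴬ i≢j lᵢ lⱼ x rest (bit c ∷ bit true ∷ b)
-- The run for the shorter name is split into its loop and its final move, so that one more round
-- can be put in front of the loop.
... | _ , t≤ , (r ⨾ s) with
  againᵂ (cong isOne (top-get (lᵢ b) _)) (moveᴬ i≢j lᵢ lⱼ (bit true) _ b ⨟ moveᴬ i≢j lᵢ lⱼ (bit c) _ _) (_ , ℕ.≤-refl , r)
... | t , t≤′ , r′ = _ , bound t≤ t≤′ , r′ ⨾ s
  where
    bound : ∀ {u v l} → u + v ≤ 7 * l → ∀ {t} → t ≤ 1 + (3 + 3 + u) → t + v ≤ 7 * (2 + l)
    bound {u} {v} {l} h {t} h′ = begin
      t + v  ≤⟨ ℕ.+-monoˡ-≤ v h′ ⟩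
      7 + u + v  ≡⟨ ℕ.+-assoc 7 u v ⟩
      7 + (u + v)  ≤⟨ ℕ.+-mono-≤ (ℕ.m≤m+n 7 7) h ⟩
      14 + 7 * l  ≡⟨ sum l ⟩
      7 * (2 + l)  ∎
      where
        open ℕ.≤-Reasoning
        sum : ∀ l → 14 + 7 * l ≡ 7 * (2 + l)
        sum = solve-∀

-- From Hyper²LTL to arithmetic: the translation

-- Terms have no constants, so 0 and 1 are variables that the preamble pins down. These names belong
-- to the sort of numbers; trace variables become sets and set variables become classes, hence no
-- name of the source formula can capture them.
zeroᴺ oneᴺ posᴺ oldᴺ midᴺ : Name
zeroᴺ = []
oneᴺ  = O ∷ []
posᴺ  = I ∷ []
oldᴺ  = O ∷ O ∷ []
midᴺ  = O ∷ I ∷ []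

numeral : ℕ → Term
numeral zero    = var zeroᴺ
numeral (suc k) = var oneᴺ ⊕ numeral k

-- Traces are coded as { n i + p ∣ p ∈ t(i) }.

cell : ℕ → Term → Term → Term
cell n i p = (numeral n ⊗ i) ⊕ p

_≼_ : Term → Term → Arith
s ≼ t = (s ≺ t) or (s ≈ t)

-- The current position is always the value of posᴺ.  In the clause for U, old ≤ pos and every
-- mid with old ≤ mid < pos satisfies ψ; no symbol separates the codes of ψ and χ.

arithᴸ : ∀ {n} → LTL n → Arith
arithᴸ {n} (p at π) = cell n (var posᴺ) (numeral (toℕ p)) ∈₁ π
arithᴸ (neg ψ)      = neg (arithᴸ ψ)
arithᴸ (ψ or χ)     = arithᴸ ψ or arithᴸ χ
arithᴸ (next ψ)     =
  ∃⁰ oldᴺ ∙ ((var oldᴺ ≈ (var posᴺ ⊕ var oneᴺ)) and (∃⁰ posᴺ ∙ ((var posᴺ ≈ var oldᴺ) and arithᴸ ψ)))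
arithᴸ (ψ U χ)      =
  ∃⁰ oldᴺ ∙ ((var oldᴺ ≈ var posᴺ) and (∃⁰ posᴺ ∙ ((var oldᴺ ≼ var posᴺ) and
    ((∀⁰ midᴺ ∙ (neg ((var oldᴺ ≼ var midᴺ) and (var midᴺ ≺ var posᴺ)) or
       (∃⁰ posᴺ ∙ ((var posᴺ ≈ var midᴺ) and arithᴸ ψ)))) and arithᴸ χ))))

classᴺ : SetVar → Name
classᴺ Xa      = O ∷ []
classᴺ Xd      = []
classᴺ (var x) = I ∷ x

-- `savedᴺ` lies outside the range of `classᴺ`. `elemᴺ` may coincide with a trace variable, but it
-- is bound only inside an inclusion between two classes, where no trace variable is read.
savedᴺ elemᴺ : Name
savedᴺ = O ∷ O ∷ []
elemᴺ  = []

_⊑_ : Name → Name → Arith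
𝒜 ⊑ ℬ = ∀¹ elemᴺ ∙ (neg (elemᴺ ∈₂ 𝒜) or (elemᴺ ∈₂ ℬ))

-- Going through an intermediate class makes the bound correct even when X is Xd itself.

arithᴴ : ∀ {n} → Hyper²LTL n → Arith
arithᴴ (∃₂ X ∙ φ)     = ∃² savedᴺ ∙ ((savedᴺ ⊑ classᴺ Xd) and (∃² classᴺ X ∙ ((classᴺ X ⊑ savedᴺ) and arithᴴ φ)))
arithᴴ (∀₂ X ∙ φ)     = ∀² savedᴺ ∙ (neg (savedᴺ ⊑ classᴺ Xd) or (∀² classᴺ X ∙ (neg (classᴺ X ⊑ savedᴺ) or arithᴴ φ)))
arithᴴ (∃₁ π ∈ X ∙ φ) = ∃¹ π ∙ ((π ∈₂ classᴺ X) and arithᴴ φ)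
arithᴴ (∀₁ π ∈ X ∙ φ) = ∀¹ π ∙ (neg (π ∈₂ classᴺ X) or arithᴴ φ)
arithᴴ (ltl ψ)        = arithᴸ ψ

-- One-hole contexts whose hole comes last: in prefix notation the code of the filled formula is a
-- fixed word followed by the code of what fills the hole.
data Layer : Set where
  and-l         : Arith → Layer
  ex⁰ ex¹ ex²   : Name → Layer

plug : List Layer → Arith → Arith
plug []             φ = φ
plug (and-l χ ∷ ls) φ = χ and plug ls φ
plug (ex⁰ x ∷ ls)   φ = ∃⁰ x ∙ plug ls φ
plug (ex¹ x ∷ ls)   φ = ∃¹ x ∙ plug ls φ
plug (ex² x ∷ ls)   φ = ∃² x ∙ plug ls φ

layerCode : List Layer → List Bool
layerCode []             = []
layerCode (and-l χ ∷ ls) = O ∷ I ∷ O ∷ I ∷ ⌜ χ ⌝ᴬ ++ layerCode ls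
layerCode (ex⁰ x ∷ ls)   = I ∷ O ∷ O ∷ O ∷ ⌜ x ⌝ᴺ ++ layerCode ls
layerCode (ex¹ x ∷ ls)   = I ∷ O ∷ I ∷ O ∷ ⌜ x ⌝ᴺ ++ layerCode ls
layerCode (ex² x ∷ ls)   = I ∷ I ∷ O ∷ O ∷ ⌜ x ⌝ᴺ ++ layerCode ls

plug-code : ∀ ls φ → ⌜ plug ls φ ⌝ᴬ ≡ layerCode ls ++ ⌜ φ ⌝ᴬ
plug-code []             φ = refl
plug-code (and-l χ ∷ ls) φ = cong (λ s → O ∷ I ∷ O ∷ I ∷ s)
  (trans (cong (⌜ χ ⌝ᴬ ++_) (plug-code ls φ)) (sym (List.++-assoc ⌜ χ ⌝ᴬ _ _)))
plug-code (ex⁰ x ∷ ls)   φ = cong (λ s → I ∷ O ∷ O ∷ O ∷ s)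
  (trans (cong (⌜ x ⌝ᴺ ++_) (plug-code ls φ)) (sym (List.++-assoc ⌜ x ⌝ᴺ _ _)))
plug-code (ex¹ x ∷ ls)   φ = cong (λ s → I ∷ O ∷ I ∷ O ∷ s)
  (trans (cong (⌜ x ⌝ᴺ ++_) (plug-code ls φ)) (sym (List.++-assoc ⌜ x ⌝ᴺ _ _)))
plug-code (ex² x ∷ ls)   φ = cong (λ s → I ∷ I ∷ O ∷ O ∷ s)
  (trans (cong (⌜ x ⌝ᴺ ++_) (plug-code ls φ)) (sym (List.++-assoc ⌜ x ⌝ᴺ _ _)))

-- A transition system is coded by its size and the sets
-- { s u + v ∣ (u , v) an edge }, { v ∣ v initial } and { n v + p ∣ p ∈ λ(v) }.

sizeᴺ edgesᴺ initialᴺ labelᴺ pathᴺ traceᴺ iᴺ uᴺ vᴺ : Name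
sizeᴺ    = O ∷ O ∷ O ∷ []
edgesᴺ   = I ∷ []
initialᴺ = O ∷ []
labelᴺ   = O ∷ O ∷ []
pathᴺ    = O ∷ I ∷ []
traceᴺ   = I ∷ O ∷ []
iᴺ       = I ∷ O ∷ []
uᴺ       = I ∷ I ∷ []
vᴺ       = I ∷ I ∷ I ∷ []

_implies_ _iff_ : Arith → Arith → Arith
φ implies χ = neg φ or χ
φ iff χ     = (φ implies χ) and (χ implies φ)

pairᵀ : Term → Term → Term
pairᵀ i v = (i ⊗ var sizeᴺ) ⊕ v

vertex : Name → Arith
vertex u = var u ≺ var sizeᴺ

-- A path ρ is coded by any set of numbers s i + v whose choice functions are all paths with
-- the right trace; { s i + ρ(i) } is one such set.

isTrace : ℕ → Arith
isTrace n = ∃¹ pathᴺ ∙ (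
  (∀⁰ iᴺ ∙ (∃⁰ vᴺ ∙ (vertex vᴺ and (pairᵀ (var iᴺ) (var vᴺ) ∈₁ pathᴺ)))) and
  ((∀⁰ vᴺ ∙ ((vertex vᴺ and (pairᵀ (var zeroᴺ) (var vᴺ) ∈₁ pathᴺ)) implies (var vᴺ ∈₁ initialᴺ))) and
  ((∀⁰ iᴺ ∙ (∀⁰ uᴺ ∙ (∀⁰ vᴺ ∙ ((vertex uᴺ and (vertex vᴺ and ((pairᵀ (var iᴺ) (var uᴺ) ∈₁ pathᴺ) and
      (pairᵀ (var iᴺ ⊕ var oneᴺ) (var vᴺ) ∈₁ pathᴺ)))) implies (pairᵀ (var uᴺ) (var vᴺ) ∈₁ edgesᴺ))))) and
   (∀⁰ iᴺ ∙ (∀⁰ vᴺ ∙ (∀⁰ uᴺ ∙ ((vertex vᴺ and ((var uᴺ ≺ numeral n) and (pairᵀ (var iᴺ) (var vᴺ) ∈₁ pathᴺ))) implies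
      ((cell n (var iᴺ) (var uᴺ) ∈₁ traceᴺ) iff (cell n (var vᴺ) (var uᴺ) ∈₁ labelᴺ)))))))))

isSystem : Arith
isSystem = (neg (var sizeᴺ ≈ var zeroᴺ)) and
  (∀⁰ uᴺ ∙ (vertex uᴺ implies (∃⁰ vᴺ ∙ (vertex vᴺ and (pairᵀ (var uᴺ) (var vᴺ) ∈₁ edgesᴺ)))))

isOneᴬ : Arith
isOneᴬ = (neg (var oneᴺ ≈ var zeroᴺ)) and ((var oneᴺ ⊗ var oneᴺ) ≈ var oneᴺ)

preamble : ℕ → List Layer
preamble n =
  ex⁰ zeroᴺ ∷ ex⁰ oneᴺ ∷ and-l ((var zeroᴺ ⊕ var zeroᴺ) ≈ var zeroᴺ) ∷ and-l isOneᴬ ∷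
  ex⁰ sizeᴺ ∷ ex¹ edgesᴺ ∷ ex¹ initialᴺ ∷ ex¹ labelᴺ ∷ and-l isSystem ∷
  ex² (classᴺ Xd) ∷ and-l (∀¹ traceᴺ ∙ ((traceᴺ ∈₂ classᴺ Xd) iff isTrace n)) ∷
  ex⁰ posᴺ ∷ and-l (var posᴺ ≈ var zeroᴺ) ∷ []

arith : ∀ {n} → Hyper²LTL n → Arith
arith {n} φ = plug (preamble n) (arithᴴ φ)

-- From Hyper²LTL to arithmetic: the machine

module ToArith where

  -- `W` collects the output in reverse, `S` holds the name that is being cited, also reversed, and
  -- `S′` helps to copy it without losing it.
  pattern In  = zero
  pattern Out = suc zero
  pattern W   = suc (suc zero)
  pattern S   = suc (suc (suc zero))
  pattern S′  = suc (suc (suc (suc zero)))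

  P : Set
  P = Prog 0 5

  σ[_,_,_,_] : List (Cell 0) → List (Cell 0) → List (Cell 0) → List (Cell 0) → Stacks 0 5
  σ[ i , w , s , s′ ] = i ∷ [] ∷ w ∷ s ∷ s′ ∷ []

  read : P → P → P
  read p q = cond (oneOn In) (pop In ⨾ p) (pop In ⨾ q)

  nextCode untilCode : List Bool
  nextCode = I ∷ O ∷ O ∷ O ∷ ⌜ oldᴺ ⌝ᴺ ++ O ∷ I ∷ O ∷ I ∷ ⌜ var oldᴺ ≈ (var posᴺ ⊕ var oneᴺ) ⌝ᴬ ++
             I ∷ O ∷ O ∷ O ∷ ⌜ posᴺ ⌝ᴺ ++ O ∷ I ∷ O ∷ I ∷ ⌜ var posᴺ ≈ var oldᴺ ⌝ᴬ
  untilCode = I ∷ O ∷ O ∷ O ∷ ⌜ oldᴺ ⌝ᴺ ++ O ∷ I ∷ O ∷ I ∷ ⌜ var oldᴺ ≈ var posᴺ ⌝ᴬ ++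
              I ∷ O ∷ O ∷ O ∷ ⌜ posᴺ ⌝ᴺ ++ O ∷ I ∷ O ∷ I ∷ ⌜ var oldᴺ ≼ var posᴺ ⌝ᴬ ++
              O ∷ I ∷ O ∷ I ∷ I ∷ O ∷ O ∷ I ∷ ⌜ midᴺ ⌝ᴺ ++
              O ∷ I ∷ I ∷ O ∷ ⌜ neg ((var oldᴺ ≼ var midᴺ) and (var midᴺ ≺ var posᴺ)) ⌝ᴬ ++
              I ∷ O ∷ O ∷ O ∷ ⌜ posᴺ ⌝ᴺ ++ O ∷ I ∷ O ∷ I ∷ ⌜ var posᴺ ≈ var midᴺ ⌝ᴬ

  scaleCode : ℕ → List Bool
  scaleCode n = O ∷ O ∷ I ∷ O ∷ I ∷ O ∷ I ∷ I ∷ ⌜ numeral n ⌝ᵀ ++ ⌜ var posᴺ ⌝ᵀ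

  -- The unary index of a proposition becomes a numeral on the fly: each `I` writes the beginning of
  -- one more sum with left summand `var oneᴺ`, and `var zeroᴺ` closes the numeral.
  atom : ℕ → P
  atom n = emit W (scaleCode n) ⨾ loop (oneOn In) (pop In ⨾ emit W (I ∷ O ∷ ⌜ var oneᴺ ⌝ᵀ)) ⨾
    pop In ⨾ emit W ⌜ var zeroᴺ ⌝ᵀ ⨾ copyName In W

  ltlToken : ℕ → P
  ltlToken n = read
    -- Among the temporal codes only that of `U` starts with `I`, so its other two bits are known.
    (pop In ⨾ pop In ⨾ emit W untilCode)
    (read (read (emit W nextCode) (emit W (O ∷ I ∷ I ∷ O ∷ [])))
          (read (emit W (O ∷ I ∷ O ∷ O ∷ [])) (atom n)))

  -- Pouring `S` into `S′` puts the name in reading order; on the way back each bit goes both to the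
  -- output and to `S`, so the name can be cited again.
  cite : P
  cite = pour S S′ ⨾ loop (bitOn S′) (copy S′ W ⨾ move S′ S)

  readSetVar : P
  readSetVar = read
    (push S (bit I) ⨾ push S (bit I) ⨾ copyName In S)
    (read (push S (bit O)) (push S (bit I) ⨾ push S (bit O) ⨾ push S (bit O)))

  quantifier₂ : List Bool → List Bool → List Bool → P
  quantifier₂ s₁ s₂ s₃ = emit W s₁ ⨾ readSetVar ⨾ cite ⨾ emit W s₂ ⨾ cite ⨾ emit W s₃ ⨾ discard S

  quantifier₁ : List Bool → List Bool → P
  quantifier₁ s₁ s₂ = emit W s₁ ⨾ copyName In S ⨾ cite ⨾ emit W s₂ ⨾ cite ⨾ discard S ⨾
    readSetVar ⨾ cite ⨾ discard S

  ex₂₁ ex₂₂ ex₂₃ all₂₁ all₂₂ all₂₃ ex₁₁ ex₁₂ all₁₁ all₁₂ : List Bool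
  ex₂₁  = I ∷ I ∷ O ∷ O ∷ ⌜ savedᴺ ⌝ᴺ ++ O ∷ I ∷ O ∷ I ∷ ⌜ savedᴺ ⊑ classᴺ Xd ⌝ᴬ ++ I ∷ I ∷ O ∷ O ∷ []
  ex₂₂  = O ∷ I ∷ O ∷ I ∷ I ∷ O ∷ I ∷ I ∷ ⌜ elemᴺ ⌝ᴺ ++ O ∷ I ∷ I ∷ O ∷ O ∷ I ∷ O ∷ O ∷ O ∷ O ∷ I ∷ I ∷ ⌜ elemᴺ ⌝ᴺ
  ex₂₃  = ⌜ elemᴺ ∈₂ savedᴺ ⌝ᴬ
  all₂₁ = I ∷ I ∷ O ∷ I ∷ ⌜ savedᴺ ⌝ᴺ ++ O ∷ I ∷ I ∷ O ∷ ⌜ Arith.neg (savedᴺ ⊑ classᴺ Xd) ⌝ᴬ ++ I ∷ I ∷ O ∷ I ∷ []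
  all₂₂ = O ∷ I ∷ I ∷ O ∷ O ∷ I ∷ O ∷ O ∷ I ∷ O ∷ I ∷ I ∷ ⌜ elemᴺ ⌝ᴺ ++
          O ∷ I ∷ I ∷ O ∷ O ∷ I ∷ O ∷ O ∷ O ∷ O ∷ I ∷ I ∷ ⌜ elemᴺ ⌝ᴺ
  all₂₃ = ⌜ elemᴺ ∈₂ savedᴺ ⌝ᴬ
  ex₁₁  = I ∷ O ∷ I ∷ O ∷ []
  ex₁₂  = O ∷ I ∷ O ∷ I ∷ O ∷ O ∷ I ∷ I ∷ []
  all₁₁ = I ∷ O ∷ I ∷ I ∷ []
  all₁₂ = O ∷ I ∷ I ∷ O ∷ O ∷ I ∷ O ∷ O ∷ O ∷ O ∷ I ∷ I ∷ []

  quantifierToken : P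
  quantifierToken = pop In ⨾ read
    (read (quantifier₁ all₁₁ all₁₂) (quantifier₁ ex₁₁ ex₁₂))
    (read (quantifier₂ all₂₁ all₂₂ all₂₃) (quantifier₂ ex₂₁ ex₂₂ ex₂₃))

  abstract
    opening : ℕ → List Bool
    opening n = layerCode (preamble n)

    opening-code : ∀ n φ → ⌜ plug (preamble n) φ ⌝ᴬ ≡ opening n ++ ⌜ φ ⌝ᴬ
    opening-code n = plug-code (preamble n)

  -- Quantifier codes start with `I` and the matrix with `O`, which separates the two loops. Every
  -- source symbol is replaced by a block that depends on that symbol alone, so nothing has to be
  -- remembered between rounds.
  program : ℕ → P
  program n = emit W (opening n) ⨾ loop (oneOn In) quantifierToken ⨾ pop In ⨾
    loop (bitOn In) (ltlToken n) ⨾ pour W Out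

  ok : ∀ {i : Fin 5} {f : List (Cell 0) → Stacks 0 5} → (∀ a → lookup (f a) i ≡ a) → (∀ a b → f a [ i ]≔ b ≡ f b) → At i f
  ok g p = record { get = g ; put = p }

  onW : ∀ {i s s′} → At W (λ w → σ[ i , w , s , s′ ])
  onW = ok (λ _ → refl) (λ _ _ → refl)
  onIn : ∀ {w s s′} → At In (λ i → σ[ i , w , s , s′ ])
  onIn = ok (λ _ → refl) (λ _ _ → refl)
  onS : ∀ {i w s′} → At S (λ s → σ[ i , w , s , s′ ])
  onS = ok (λ _ → refl) (λ _ _ → refl)
  onS′ : ∀ {i w s} → At S′ (λ s′ → σ[ i , w , s , s′ ])
  onS′ = ok (λ _ → refl) (λ _ _ → refl)

  emitW : ∀ {i s s′} u w → Within (emit W u) σ[ i , bits w , s , s′ ] σ[ i , bits (u ʳ++ w) , s , s′ ] (2 * length u + 1)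
  emitW u w = emitᴬ onW u w

  readI : ∀ {p q σ′ T i w s s′} → Within p σ[ i , w , s , s′ ] σ′ T → Within (read p q) σ[ bit I ∷ i , w , s , s′ ] σ′ (2 + T)
  readI r = thenᵂ refl (popᴬ onIn _ _ ⨟ r)

  readO : ∀ {p q σ′ T i w s s′} → Within q σ[ i , w , s , s′ ] σ′ T → Within (read p q) σ[ bit O ∷ i , w , s , s′ ] σ′ (2 + T)
  readO r = elseᵂ refl (popᴬ onIn _ _ ⨟ r)

  copyNameW : ∀ x rest w → Within (copyName In W) σ[ bits (⌜ x ⌝ᴺ ++ rest) , bits w , [] , [] ]
    σ[ bits rest , bits (⌜ x ⌝ᴺ ʳ++ w) , [] , [] ] (7 * length ⌜ x ⌝ᴺ)
  copyNameW x rest w = arrive (cong (λ v → σ[ bits rest , v , [] , [] ]) (sym (bits-ʳ++ ⌜ x ⌝ᴺ w)))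
    (copyNameᴬ {f = λ i w → σ[ i , w , [] , [] ]} (λ ()) (λ _ → onIn) (λ _ → onW) x rest (bits w))

  copyNameS : ∀ {w} x rest s → Within (copyName In S) σ[ bits (⌜ x ⌝ᴺ ++ rest) , w , bits s , [] ]
    σ[ bits rest , w , bits (⌜ x ⌝ᴺ ʳ++ s) , [] ] (7 * length ⌜ x ⌝ᴺ)
  copyNameS {w} x rest s = arrive (cong (λ v → σ[ bits rest , w , v , [] ]) (sym (bits-ʳ++ ⌜ x ⌝ᴺ s)))
    (copyNameᴬ {f = λ i s → σ[ i , w , s , [] ]} (λ ()) (λ _ → onIn) (λ _ → onS) x rest (bits s))

  citeᵂ : ∀ {i} s w → Within cite σ[ i , bits w , bits (s ʳ++ []) , [] ] σ[ i , bits (s ʳ++ w) , bits (s ʳ++ []) , [] ]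
    (10 * length s + 2)
  citeᵂ {i} s w = relax (ℕ.≤-reflexive bound) (down ⨟ up s w [])
    where
      down : Within (pour S S′) σ[ i , bits w , bits (s ʳ++ []) , [] ] σ[ i , bits w , [] , bits s ] (4 * length (s ʳ++ []) + 1)
      down = subst₂ (λ a b → Within (pour S S′) σ[ i , bits w , a , [] ] σ[ i , bits w , [] , b ] (4 * length (s ʳ++ []) + 1))
        (List.++-identityʳ (bits (s ʳ++ []))) (trans (sym (bits-ʳ++ (s ʳ++ []) [])) (cong bits (trans (List.ʳ++-ʳ++ s) (List.++-identityʳ s))))
        (pourᴬ {f = λ s s′ → σ[ i , bits w , s , s′ ]} (λ ()) (λ _ → onS) (λ _ → onS′) (s ʳ++ []) {[]} refl [])
      step : ∀ c {u w v} → Within (copy S′ W ⨾ move S′ S) σ[ i , w , v , c ∷ u ] σ[ i , c ∷ w , c ∷ v , u ] 5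
      step c = straight refl
      up : ∀ s w v → Within (loop (bitOn S′) (copy S′ W ⨾ move S′ S)) σ[ i , bits w , bits v , bits s ]
        σ[ i , bits (s ʳ++ w) , bits (s ʳ++ v) , [] ] (6 * length s + 1)
      up []      w v = stopᵂ refl
      up (b ∷ s) w v = relax (ℕ.≤-reflexive (sum (length s))) (againᵂ refl (step (bit b)) (up s (b ∷ w) (b ∷ v)))
        where
          sum : ∀ n → 1 + (5 + (6 * n + 1)) ≡ 6 * suc n + 1
          sum = solve-∀
      bound : 4 * length (s ʳ++ []) + 1 + (6 * length s + 1) ≡ 10 * length s + 2
      bound rewrite List.length-ʳ++ s {[]} = sum (length s)
        where
          sum : ∀ n → 4 * (n + 0) + 1 + (6 * n + 1) ≡ 10 * n + 2
          sum = solve-∀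

  discardS : ∀ {i w} s → Within (discard S) σ[ i , w , bits s , [] ] σ[ i , w , [] , [] ] (2 * length s + 1)
  discardS {i} {w} s = depart (cong (λ a → σ[ i , w , a , [] ]) (List.++-identityʳ (bits s)))
    (discardᴬ onS s {[]} refl)

  readSetVarᵂ : ∀ X {rest w} → Within readSetVar σ[ bits (⌜ X ⌝ˢ ++ rest) , w , [] , [] ]
    σ[ bits rest , w , bits (⌜ classᴺ X ⌝ᴺ ʳ++ []) , [] ] (7 * length ⌜ X ⌝ˢ)
  readSetVarᵂ Xa      = relax (ℕ.≤ᵇ⇒≤ _ _ tt) (straight refl)
  readSetVarᵂ Xd      = relax (ℕ.≤ᵇ⇒≤ _ _ tt) (straight refl)
  readSetVarᵂ (var x) {rest} = relax (ℕ.≤-trans (ℕ.n≤1+n _) (ℕ.≤-reflexive (sum (length ⌜ x ⌝ᴺ))))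
    (readI (pushᴬ onS _ _ ⨟ pushᴬ onS _ _ ⨟ copyNameS x rest (I ∷ I ∷ [])))
    where
      sum : ∀ n → 1 + (2 + (2 + (2 + 7 * n))) ≡ 7 * suc n
      sum = solve-∀

  length-class : ∀ X → length ⌜ classᴺ X ⌝ᴺ ≤ 2 * length ⌜ X ⌝ˢ
  length-class Xa      = ℕ.≤ᵇ⇒≤ _ _ tt
  length-class Xd      = ℕ.≤ᵇ⇒≤ _ _ tt
  length-class (var x) = begin
    2 + length ⌜ x ⌝ᴺ  ≤⟨ ℕ.m≤m+n _ (length ⌜ x ⌝ᴺ) ⟩
    2 + length ⌜ x ⌝ᴺ + length ⌜ x ⌝ᴺ  ≡⟨ sum (length ⌜ x ⌝ᴺ) ⟩
    2 * suc (length ⌜ x ⌝ᴺ)  ∎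
    where
      open ℕ.≤-Reasoning
      sum : ∀ n → 2 + n + n ≡ 2 * suc n
      sum = solve-∀

  ʳ++₅ : ∀ (a b c d e : List Bool) w → e ʳ++ d ʳ++ c ʳ++ b ʳ++ a ʳ++ w ≡ (a ++ b ++ c ++ d ++ e) ʳ++ w
  ʳ++₅ a b c d e w = sym (trans (List.++-ʳ++ a) (trans (List.++-ʳ++ b) (trans (List.++-ʳ++ c) (List.++-ʳ++ d))))

  quantifier₂ᵂ : ∀ s₁ s₂ s₃ X {rest} w → Within (quantifier₂ s₁ s₂ s₃) σ[ bits (⌜ X ⌝ˢ ++ rest) , bits w , [] , [] ]
    σ[ bits rest , bits ((s₁ ++ ⌜ classᴺ X ⌝ᴺ ++ s₂ ++ ⌜ classᴺ X ⌝ᴺ ++ s₃) ʳ++ w) , [] , [] ]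
    (2 * (length s₁ + length s₂ + length s₃) + 8 + 51 * length ⌜ X ⌝ˢ)
  quantifier₂ᵂ s₁ s₂ s₃ X {rest} w = arrive (cong (λ v → σ[ bits rest , bits v , [] , [] ])
    (ʳ++₅ s₁ ⌜ classᴺ X ⌝ᴺ s₂ ⌜ classᴺ X ⌝ᴺ s₃ w))
    (relax bound (emitW s₁ w ⨟ readSetVarᵂ X ⨟ citeᵂ ⌜ classᴺ X ⌝ᴺ _ ⨟ emitW s₂ _ ⨟ citeᵂ ⌜ classᴺ X ⌝ᴺ _ ⨟ emitW s₃ _
                  ⨟ discardS (⌜ classᴺ X ⌝ᴺ ʳ++ [])))
    where
      open ℕ.≤-Reasoning
      sum : ∀ a b c l k → 2 * a + 1 + (7 * l + (10 * k + 2 + (2 * b + 1 + (10 * k + 2 + (2 * c + 1 + (2 * (k + 0) + 1))))))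
                          ≡ 2 * (a + b + c) + 8 + (7 * l + 22 * k)
      sum = solve-∀
      sum′ : ∀ l → 7 * l + 22 * (2 * l) ≡ 51 * l
      sum′ = solve-∀
      bound = begin
        _ ≡⟨ cong (λ k → 2 * length s₁ + 1 + (7 * length ⌜ X ⌝ˢ + (10 * length ⌜ classᴺ X ⌝ᴺ + 2 + (2 * length s₂ + 1 +
               (10 * length ⌜ classᴺ X ⌝ᴺ + 2 + (2 * length s₃ + 1 + (2 * k + 1))))))) (List.length-ʳ++ ⌜ classᴺ X ⌝ᴺ) ⟩
        _ ≡⟨ sum (length s₁) (length s₂) (length s₃) (length ⌜ X ⌝ˢ) (length ⌜ classᴺ X ⌝ᴺ) ⟩
        2 * (length s₁ + length s₂ + length s₃) + 8 + (7 * length ⌜ X ⌝ˢ + 22 * length ⌜ classᴺ X ⌝ᴺ)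
          ≤⟨ ℕ.+-monoʳ-≤ (2 * (length s₁ + length s₂ + length s₃) + 8) (ℕ.+-monoʳ-≤ (7 * length ⌜ X ⌝ˢ) (ℕ.*-monoʳ-≤ 22 (length-class X))) ⟩
        _ ≡⟨ cong (2 * (length s₁ + length s₂ + length s₃) + 8 +_) (sum′ (length ⌜ X ⌝ˢ)) ⟩
        2 * (length s₁ + length s₂ + length s₃) + 8 + 51 * length ⌜ X ⌝ˢ ∎

  quantifier₁ᵂ : ∀ s₁ s₂ π X {rest} w → Within (quantifier₁ s₁ s₂) σ[ bits (⌜ π ⌝ᴺ ++ ⌜ X ⌝ˢ ++ rest) , bits w , [] , [] ]
    σ[ bits rest , bits ((s₁ ++ ⌜ π ⌝ᴺ ++ s₂ ++ ⌜ π ⌝ᴺ ++ ⌜ classᴺ X ⌝ᴺ) ʳ++ w) , [] , [] ]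
    (2 * (length s₁ + length s₂) + 10 + 51 * (length ⌜ π ⌝ᴺ + length ⌜ X ⌝ˢ))
  quantifier₁ᵂ s₁ s₂ π X {rest} w = arrive (cong (λ v → σ[ bits rest , bits v , [] , [] ])
    (ʳ++₅ s₁ ⌜ π ⌝ᴺ s₂ ⌜ π ⌝ᴺ ⌜ classᴺ X ⌝ᴺ w))
    (relax bound (emitW s₁ w ⨟ copyNameS π _ [] ⨟ citeᵂ ⌜ π ⌝ᴺ _ ⨟ emitW s₂ _ ⨟ citeᵂ ⌜ π ⌝ᴺ _ ⨟
                  discardS (⌜ π ⌝ᴺ ʳ++ []) ⨟ readSetVarᵂ X ⨟ citeᵂ ⌜ classᴺ X ⌝ᴺ _ ⨟ discardS (⌜ classᴺ X ⌝ᴺ ʳ++ [])))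
    where
      open ℕ.≤-Reasoning
      total : ℕ → ℕ → ℕ → ℕ → ℕ → ℕ → ℕ → ℕ
      total a b p p′ l k k′ = 2 * a + 1 + (7 * p + (10 * p + 2 + (2 * b + 1 + (10 * p + 2 + (2 * p′ + 1 +
        (7 * l + (10 * k + 2 + (2 * k′ + 1))))))))
      sum : ∀ a b p l k → 2 * a + 1 + (7 * p + (10 * p + 2 + (2 * b + 1 + (10 * p + 2 + (2 * (p + 0) + 1 +
        (7 * l + (10 * k + 2 + (2 * (k + 0) + 1)))))))) ≡ 2 * (a + b) + 10 + (29 * p + (7 * l + 12 * k))
      sum = solve-∀
      sum′ : ∀ p l → 29 * p + (7 * l + 12 * (2 * l)) + (22 * p + 20 * l) ≡ 51 * (p + l)
      sum′ = solve-∀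
      p = length ⌜ π ⌝ᴺ
      l = length ⌜ X ⌝ˢ
      bound = begin
        _ ≡⟨ cong₂ (λ x y → total (length s₁) (length s₂) p x l (length ⌜ classᴺ X ⌝ᴺ) y)
               (List.length-ʳ++ ⌜ π ⌝ᴺ) (List.length-ʳ++ ⌜ classᴺ X ⌝ᴺ) ⟩
        _ ≡⟨ sum (length s₁) (length s₂) p l (length ⌜ classᴺ X ⌝ᴺ) ⟩
        2 * (length s₁ + length s₂) + 10 + (29 * p + (7 * l + 12 * length ⌜ classᴺ X ⌝ᴺ))
          ≤⟨ ℕ.+-monoʳ-≤ (2 * (length s₁ + length s₂) + 10) (ℕ.+-monoʳ-≤ (29 * p) (ℕ.+-monoʳ-≤ (7 * l) (ℕ.*-monoʳ-≤ 12 (length-class X)))) ⟩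
        2 * (length s₁ + length s₂) + 10 + (29 * p + (7 * l + 12 * (2 * l)))
          ≤⟨ ℕ.+-monoʳ-≤ (2 * (length s₁ + length s₂) + 10) (ℕ.≤-trans (ℕ.m≤m+n _ _) (ℕ.≤-reflexive (sum′ p l))) ⟩
        2 * (length s₁ + length s₂) + 10 + 51 * (p + l) ∎

  abstract
    -- A round figure above the fixed cost of every round of the two loops, except for the word in
    -- `atom` whose length depends on `n`.
    big : ℕ
    big = 1000

    ≤big : ∀ {a} → T (a ≤ᵇ 1000) → a ≤ big
    ≤big {a} = ℕ.≤ᵇ⇒≤ a 1000

  module _ (n : ℕ) where

    -- Time charged to each input bit of the matrix; `scaleCode n` is the word whose length depends
    -- on `n`.
    K : ℕ
    K = big + 2 * length (scaleCode n)

    small : ∀ {a} {_ : T (a ≤ᵇ 1000)} → a ≤ K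
    small {a} {h} = ℕ.≤-trans (≤big h) (ℕ.m≤m+n big _)

    token≤ : ∀ t j l V → suc t ≤ K → suc (t + (K * l + V)) ≤ K * (suc j + l) + V
    token≤ t j l V h = begin
      suc t + (K * l + V)  ≤⟨ ℕ.+-monoˡ-≤ (K * l + V) (ℕ.≤-trans h (ℕ.m≤m+n K (K * j))) ⟩
      K + K * j + (K * l + V)  ≡⟨ sum K j l V ⟩
      K * (suc j + l) + V  ∎
      where
        open ℕ.≤-Reasoning
        sum : ∀ k j l u → k + k * j + (k * l + u) ≡ k * (suc j + l) + u
        sum = solve-∀

    tokenTime : List Bool → ℕ
    tokenTime s = 2 + (2 + (2 + (2 * length s + 1)))

    untilTime : ℕ
    untilTime = 2 + (1 + (1 + (2 * length untilCode + 1)))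

    matrixLoop : P
    matrixLoop = loop (bitOn In) (ltlToken n)

    unary : ℕ → List Bool
    unary zero    = []
    unary (suc k) = I ∷ O ∷ ⌜ var oneᴺ ⌝ᵀ ++ unary k

    unary-numeral : ∀ k → unary k ++ ⌜ var zeroᴺ ⌝ᵀ ≡ ⌜ numeral k ⌝ᵀ
    unary-numeral zero    = refl
    unary-numeral (suc k) = cong (λ s → I ∷ O ∷ ⌜ var oneᴺ ⌝ᵀ ++ s) (unary-numeral k)

    unaryLoop : ∀ k rest w → Within (loop (oneOn In) (pop In ⨾ emit W (I ∷ O ∷ ⌜ var oneᴺ ⌝ᵀ)))
      σ[ bits (replicate k I ++ O ∷ rest) , bits w , [] , [] ] σ[ bits (O ∷ rest) , bits (unary k ʳ++ w) , [] , [] ] (15 * k + 1)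
    unaryLoop zero    rest w = stopᵂ refl
    unaryLoop (suc k) rest w = relax (ℕ.≤-reflexive (sum k)) (againᵂ refl (popᴬ onIn _ _ ⨟ emitW (I ∷ O ∷ ⌜ var oneᴺ ⌝ᵀ) w) (unaryLoop k rest _))
      where
        sum : ∀ k → 1 + (14 + (15 * k + 1)) ≡ 15 * suc k + 1
        sum = solve-∀

    atomᵂ : ∀ (p : Fin n) π rest w → Within (atom n) σ[ bits (replicate (toℕ p) I ++ O ∷ ⌜ π ⌝ᴺ ++ rest) , bits w , [] , [] ]
      σ[ bits rest , bits (⌜ arithᴸ (p at π) ⌝ᴬ ʳ++ w) , [] , [] ]
      (2 * length (scaleCode n) + 8 + (15 * toℕ p + 7 * length ⌜ π ⌝ᴺ))
    atomᵂ p π rest w = arrive (cong (λ v → σ[ bits rest , bits v , [] , [] ]) code)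
      (relax (ℕ.≤-reflexive (sum (length (scaleCode n)) (toℕ p) (length ⌜ π ⌝ᴺ)))
        (emitW (scaleCode n) w ⨟ unaryLoop (toℕ p) _ _ ⨟ popᴬ onIn _ _ ⨟ emitW ⌜ var zeroᴺ ⌝ᵀ _ ⨟ copyNameW π rest _))
      where
        sum : ∀ s p l → 2 * s + 1 + (15 * p + 1 + (1 + (5 + 7 * l))) ≡ 2 * s + 8 + (15 * p + 7 * l)
        sum = solve-∀
        open ≡-Reasoning
        Z = ⌜ var zeroᴺ ⌝ᵀ
        N = ⌜ numeral n ⌝ᵀ
        X = ⌜ var posᴺ ⌝ᵀ
        u = unary (toℕ p)
        w′ = I ∷ I ∷ O ∷ I ∷ O ∷ I ∷ O ∷ O ∷ w
        code : ⌜ π ⌝ᴺ ʳ++ Z ʳ++ u ʳ++ (scaleCode n ʳ++ w) ≡ ⌜ arithᴸ (p at π) ⌝ᴬ ʳ++ w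
        code = begin
          ⌜ π ⌝ᴺ ʳ++ Z ʳ++ u ʳ++ (N ++ X) ʳ++ w′  ≡⟨ cong (⌜ π ⌝ᴺ ʳ++_) (sym (List.++-ʳ++ u)) ⟩
          ⌜ π ⌝ᴺ ʳ++ (u ++ Z) ʳ++ (N ++ X) ʳ++ w′  ≡⟨ cong (λ s → ⌜ π ⌝ᴺ ʳ++ s ʳ++ (N ++ X) ʳ++ w′) (unary-numeral (toℕ p)) ⟩
          ⌜ π ⌝ᴺ ʳ++ ⌜ numeral (toℕ p) ⌝ᵀ ʳ++ (N ++ X) ʳ++ w′  ≡⟨ cong (⌜ π ⌝ᴺ ʳ++_) (sym (List.++-ʳ++ (N ++ X))) ⟩
          ⌜ π ⌝ᴺ ʳ++ ((N ++ X) ++ ⌜ numeral (toℕ p) ⌝ᵀ) ʳ++ w′  ≡⟨ sym (List.++-ʳ++ ((N ++ X) ++ ⌜ numeral (toℕ p) ⌝ᵀ)) ⟩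
          (((N ++ X) ++ ⌜ numeral (toℕ p) ⌝ᵀ) ++ ⌜ π ⌝ᴺ) ʳ++ w′  ∎

    atom≤ : ∀ p m → 7 + (2 * length (scaleCode n) + 8 + (15 * p + 7 * m)) ≤ K * (3 + (p + 1 + m))
    atom≤ p m = begin
      7 + (2 * s + 8 + (15 * p + 7 * m))  ≡⟨ sum s p m ⟩
      15 + 2 * s + (15 * p + 7 * m)  ≤⟨ ℕ.+-mono-≤ (ℕ.+-monoˡ-≤ (2 * s) (≤big {15} tt))
        (ℕ.+-mono-≤ (ℕ.*-monoˡ-≤ p (small {15})) (ℕ.*-monoˡ-≤ m (small {7}))) ⟩
      K + (K * p + K * m)  ≤⟨ ℕ.m≤m+n _ (3 * K) ⟩
      K + (K * p + K * m) + 3 * K  ≡⟨ sum′ K p m ⟩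
      K * (3 + (p + 1 + m))  ∎
      where
        open ℕ.≤-Reasoning
        s = length (scaleCode n)
        sum : ∀ s p m → 7 + (2 * s + 8 + (15 * p + 7 * m)) ≡ 15 + 2 * s + (15 * p + 7 * m)
        sum = solve-∀
        sum′ : ∀ k p m → k + (k * p + k * m) + 3 * k ≡ k * (3 + (p + 1 + m))
        sum′ = solve-∀

    pair≡ : ∀ (a b : List Bool) V → K * length a + (K * length b + V) ≡ K * length (a ++ b) + V
    pair≡ a b V rewrite List.length-++ a {b} = sum K (length a) (length b) V
      where
        sum : ∀ k l m v → k * l + (k * m + v) ≡ k * (l + m) + v
        sum = solve-∀

    emptyStacks : List Bool → List Bool → Stacks 0 5
    emptyStacks i w = σ[ bits i , bits w , [] , [] ]

    -- The loop is flat while the formula is a tree, hence the continuation form: a run on what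
    -- follows the code of `ψ` is extended to a run that starts before it. For a binary connective
    -- the continuation of the left operand is the run for the right one.
    matrixLoopᵂ : ∀ (ψ : LTL n) rest w {σ″ V} → Within matrixLoop (emptyStacks rest (⌜ arithᴸ ψ ⌝ᴬ ʳ++ w)) σ″ V →
      Within matrixLoop (emptyStacks (⌜ ψ ⌝ᴸ ++ rest) w) σ″ (K * length ⌜ ψ ⌝ᴸ + V)
    matrixLoopᵂ (p at π) rest w {V = V} r =
      depart (cong (λ s → emptyStacks (O ∷ O ∷ O ∷ s) w)
               (trans (cong (replicate (toℕ p) I ++_) refl)
                 (trans (sym (List.++-assoc (replicate (toℕ p) I) (O ∷ []) _))
                   (sym (List.++-assoc ⌜ p ⌝ᴾ ⌜ π ⌝ᴺ rest)))))
        (relax bound (againᵂ refl (readO (readO (readO (atomᵂ p π rest w)))) r))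
      where
        open ℕ.≤-Reasoning
        t = 2 * length (scaleCode n) + 8 + (15 * toℕ p + 7 * length ⌜ π ⌝ᴺ)
        len : length (⌜ p ⌝ᴾ ++ ⌜ π ⌝ᴺ) ≡ toℕ p + 1 + length ⌜ π ⌝ᴺ
        len = trans (List.length-++ ⌜ p ⌝ᴾ) (cong (_+ length ⌜ π ⌝ᴺ)
          (trans (List.length-++ (replicate (toℕ p) I)) (cong (_+ 1) (List.length-replicate (toℕ p)))))
        bound : 1 + (2 + (2 + (2 + t)) + V) ≤ K * (3 + length (⌜ p ⌝ᴾ ++ ⌜ π ⌝ᴺ)) + V
        bound = begin
          7 + t + V  ≤⟨ ℕ.+-monoˡ-≤ V (atom≤ (toℕ p) (length ⌜ π ⌝ᴺ)) ⟩
          _  ≡⟨ cong (λ l → K * (3 + l) + V) (sym len) ⟩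
          _  ∎
    matrixLoopᵂ (neg ψ) rest w r =
      relax (token≤ (tokenTime (O ∷ I ∷ O ∷ O ∷ [])) 2 (length ⌜ ψ ⌝ᴸ) _ small) (againᵂ refl (readO (readO (readI (emitW (O ∷ I ∷ O ∷ O ∷ []) w)))) (matrixLoopᵂ ψ rest _ r))
    matrixLoopᵂ (ψ or χ) rest w {V = V} r =
      depart (cong (λ s → emptyStacks (O ∷ I ∷ O ∷ s) w) (sym (List.++-assoc ⌜ ψ ⌝ᴸ ⌜ χ ⌝ᴸ rest)))
        (relax (ℕ.≤-trans (ℕ.≤-reflexive (cong (suc (tokenTime (O ∷ I ∷ I ∷ O ∷ [])) +_) (pair≡ ⌜ ψ ⌝ᴸ ⌜ χ ⌝ᴸ V))) (token≤ ((tokenTime (O ∷ I ∷ I ∷ O ∷ []))) 2 (length (⌜ ψ ⌝ᴸ ++ ⌜ χ ⌝ᴸ)) V small))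
          (againᵂ refl (readO (readI (readO (emitW (O ∷ I ∷ I ∷ O ∷ []) w))))
            (matrixLoopᵂ ψ _ _ (matrixLoopᵂ χ rest _
              (depart (cong (emptyStacks rest) (List.++-ʳ++ ⌜ arithᴸ ψ ⌝ᴬ)) r)))))
    matrixLoopᵂ (next ψ) rest w r =
      relax (token≤ (tokenTime nextCode) 2 (length ⌜ ψ ⌝ᴸ) _ small) (againᵂ refl (readO (readI (readI (emitW nextCode w)))) (matrixLoopᵂ ψ rest _ r))
    matrixLoopᵂ (ψ U χ) rest w {V = V} r =
      depart (cong (λ s → emptyStacks (I ∷ O ∷ O ∷ s) w) (sym (List.++-assoc ⌜ ψ ⌝ᴸ ⌜ χ ⌝ᴸ rest)))
        (relax (ℕ.≤-trans (ℕ.≤-reflexive (cong (suc untilTime +_) (pair≡ ⌜ ψ ⌝ᴸ ⌜ χ ⌝ᴸ V))) (token≤ (untilTime) 2 (length (⌜ ψ ⌝ᴸ ++ ⌜ χ ⌝ᴸ)) V small))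
          (againᵂ refl (readI (popᴬ onIn _ _ ⨟ popᴬ onIn _ _ ⨟ emitW untilCode w))
            (matrixLoopᵂ ψ _ _ (matrixLoopᵂ χ rest _
              (depart (cong (emptyStacks rest) (List.++-ʳ++ ⌜ arithᴸ ψ ⌝ᴬ)) r)))))

-- From Hyper²LTL to arithmetic: the running time

module ToArithTime (n : ℕ) where

  open ToArith

  matrix : Hyper²LTL n → LTL n
  matrix (∃₂ X ∙ φ)     = matrix φ
  matrix (∀₂ X ∙ φ)     = matrix φ
  matrix (∃₁ π ∈ X ∙ φ) = matrix φ
  matrix (∀₁ π ∈ X ∙ φ) = matrix φ
  matrix (ltl ψ)        = ψ

  quantifiers : Hyper²LTL n → List Bool
  quantifiers (∃₂ X ∙ φ)     = (ex₂₁ ++ ⌜ classᴺ X ⌝ᴺ ++ ex₂₂ ++ ⌜ classᴺ X ⌝ᴺ ++ ex₂₃) ++ quantifiers φ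
  quantifiers (∀₂ X ∙ φ)     = (all₂₁ ++ ⌜ classᴺ X ⌝ᴺ ++ all₂₂ ++ ⌜ classᴺ X ⌝ᴺ ++ all₂₃) ++ quantifiers φ
  quantifiers (∃₁ π ∈ X ∙ φ) = (ex₁₁ ++ ⌜ π ⌝ᴺ ++ ex₁₂ ++ ⌜ π ⌝ᴺ ++ ⌜ classᴺ X ⌝ᴺ) ++ quantifiers φ
  quantifiers (∀₁ π ∈ X ∙ φ) = (all₁₁ ++ ⌜ π ⌝ᴺ ++ all₁₂ ++ ⌜ π ⌝ᴺ ++ ⌜ classᴺ X ⌝ᴺ) ++ quantifiers φ
  quantifiers (ltl ψ)        = []

  ++-assoc₅ : ∀ (a b c d e w : List Bool) → (a ++ b ++ c ++ d ++ e) ++ w ≡ a ++ b ++ c ++ d ++ e ++ w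
  ++-assoc₅ a b c d e w = trans (List.++-assoc a _ w) (cong (a ++_) (trans (List.++-assoc b _ w)
    (cong (b ++_) (trans (List.++-assoc c _ w) (cong (c ++_) (List.++-assoc d e w))))))

  code₂ : ∀ (a b c d e w : List Bool) {s} → a ++ b ++ c ++ (d ++ e) ++ w ≡ s → (a ++ b ++ c ++ d ++ e) ++ w ≡ s
  code₂ a b c d e w refl = trans (++-assoc₅ a b c d e w)
    (cong (λ s → a ++ b ++ c ++ s) (sym (List.++-assoc d e w)))

  quantifiers-code : ∀ φ → quantifiers φ ++ ⌜ arithᴸ (matrix φ) ⌝ᴬ ≡ ⌜ arithᴴ φ ⌝ᴬ
  quantifiers-code (∃₂ X ∙ φ)     = trans (List.++-assoc (ex₂₁ ++ ⌜ classᴺ X ⌝ᴺ ++ ex₂₂ ++ ⌜ classᴺ X ⌝ᴺ ++ ex₂₃) _ _)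
    (trans (cong ((ex₂₁ ++ ⌜ classᴺ X ⌝ᴺ ++ ex₂₂ ++ ⌜ classᴺ X ⌝ᴺ ++ ex₂₃) ++_) (quantifiers-code φ))
      (code₂ ex₂₁ ⌜ classᴺ X ⌝ᴺ ex₂₂ ⌜ classᴺ X ⌝ᴺ ex₂₃ ⌜ arithᴴ φ ⌝ᴬ refl))
  quantifiers-code (∀₂ X ∙ φ)     = trans (List.++-assoc (all₂₁ ++ ⌜ classᴺ X ⌝ᴺ ++ all₂₂ ++ ⌜ classᴺ X ⌝ᴺ ++ all₂₃) _ _)
    (trans (cong ((all₂₁ ++ ⌜ classᴺ X ⌝ᴺ ++ all₂₂ ++ ⌜ classᴺ X ⌝ᴺ ++ all₂₃) ++_) (quantifiers-code φ))
      (code₂ all₂₁ ⌜ classᴺ X ⌝ᴺ all₂₂ ⌜ classᴺ X ⌝ᴺ all₂₃ ⌜ arithᴴ φ ⌝ᴬ refl))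
  quantifiers-code (∃₁ π ∈ X ∙ φ) = trans (List.++-assoc (ex₁₁ ++ ⌜ π ⌝ᴺ ++ ex₁₂ ++ ⌜ π ⌝ᴺ ++ ⌜ classᴺ X ⌝ᴺ) _ _)
    (trans (cong ((ex₁₁ ++ ⌜ π ⌝ᴺ ++ ex₁₂ ++ ⌜ π ⌝ᴺ ++ ⌜ classᴺ X ⌝ᴺ) ++_) (quantifiers-code φ))
      (code₂ ex₁₁ ⌜ π ⌝ᴺ ex₁₂ ⌜ π ⌝ᴺ ⌜ classᴺ X ⌝ᴺ ⌜ arithᴴ φ ⌝ᴬ refl))
  quantifiers-code (∀₁ π ∈ X ∙ φ) = trans (List.++-assoc (all₁₁ ++ ⌜ π ⌝ᴺ ++ all₁₂ ++ ⌜ π ⌝ᴺ ++ ⌜ classᴺ X ⌝ᴺ) _ _)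
    (trans (cong ((all₁₁ ++ ⌜ π ⌝ᴺ ++ all₁₂ ++ ⌜ π ⌝ᴺ ++ ⌜ classᴺ X ⌝ᴺ) ++_) (quantifiers-code φ))
      (code₂ all₁₁ ⌜ π ⌝ᴺ all₁₂ ⌜ π ⌝ᴺ ⌜ classᴺ X ⌝ᴺ ⌜ arithᴴ φ ⌝ᴬ refl))
  quantifiers-code (ltl ψ)        = refl

  length-matrix : ∀ φ → length ⌜ matrix φ ⌝ᴸ ≤ length ⌜ φ ⌝ᴴ
  length-matrix (∃₂ X ∙ φ)     = ℕ.≤-trans (length-matrix φ)
    (ℕ.≤-trans (ℕ.m≤n+m _ (3 + length ⌜ X ⌝ˢ)) (ℕ.≤-reflexive (cong (3 +_) (sym (List.length-++ ⌜ X ⌝ˢ)))))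
  length-matrix (∀₂ X ∙ φ)     = ℕ.≤-trans (length-matrix φ)
    (ℕ.≤-trans (ℕ.m≤n+m _ (3 + length ⌜ X ⌝ˢ)) (ℕ.≤-reflexive (cong (3 +_) (sym (List.length-++ ⌜ X ⌝ˢ)))))
  length-matrix (∃₁ π ∈ X ∙ φ) = ℕ.≤-trans (length-matrix φ)
    (ℕ.≤-trans (ℕ.≤-trans (ℕ.m≤n+m _ (length ⌜ X ⌝ˢ)) (ℕ.≤-reflexive (sym (List.length-++ ⌜ X ⌝ˢ))))
      (ℕ.≤-trans (ℕ.m≤n+m _ (3 + length ⌜ π ⌝ᴺ)) (ℕ.≤-reflexive (cong (3 +_) (sym (List.length-++ ⌜ π ⌝ᴺ))))))
  length-matrix (∀₁ π ∈ X ∙ φ) = ℕ.≤-trans (length-matrix φ)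
    (ℕ.≤-trans (ℕ.≤-trans (ℕ.m≤n+m _ (length ⌜ X ⌝ˢ)) (ℕ.≤-reflexive (sym (List.length-++ ⌜ X ⌝ˢ))))
      (ℕ.≤-trans (ℕ.m≤n+m _ (3 + length ⌜ π ⌝ᴺ)) (ℕ.≤-reflexive (cong (3 +_) (sym (List.length-++ ⌜ π ⌝ᴺ))))))
  length-matrix (ltl ψ)        = ℕ.n≤1+n _

  quantifier≤ : ∀ t (a b : List Bool) → t ≤ big → t + 51 * length a + big * length b ≤ big * (3 + length (a ++ b))
  quantifier≤ t a b h rewrite List.length-++ a {b} = begin
    t + 51 * length a + big * length b  ≤⟨ ℕ.+-monoˡ-≤ (big * length b)
      (ℕ.+-mono-≤ h (ℕ.*-monoˡ-≤ (length a) (≤big {51} tt))) ⟩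
    big + big * length a + big * length b  ≤⟨ ℕ.m≤n+m _ (2 * big) ⟩
    2 * big + (big + big * length a + big * length b)  ≡⟨ sum big (length a) (length b) ⟩
    big * (3 + (length a + length b))  ∎
    where
      open ℕ.≤-Reasoning
      sum : ∀ k l m → 2 * k + (k + k * l + k * m) ≡ k * (3 + (l + m))
      sum = solve-∀

  prefixLoop : P
  prefixLoop = loop (oneOn In) quantifierToken

  prefixLoopᵂ : ∀ (φ : Hyper²LTL n) w → Within prefixLoop (emptyStacks n ⌜ φ ⌝ᴴ w)
    (emptyStacks n (O ∷ ⌜ matrix φ ⌝ᴸ) (quantifiers φ ʳ++ w)) (big * length ⌜ φ ⌝ᴴ)

  two : ∀ s₁ s₂ s₃ q X (φ : Hyper²LTL n) w {_ : T (7 + (2 * (length s₁ + length s₂ + length s₃) + 8) ≤ᵇ 1000)} →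
    (∀ {σ t} → Within (quantifier₂ s₁ s₂ s₃) (emptyStacks n (⌜ X ⌝ˢ ++ ⌜ φ ⌝ᴴ) w) σ t →
      Within quantifierToken (emptyStacks n (I ∷ O ∷ q ∷ ⌜ X ⌝ˢ ++ ⌜ φ ⌝ᴴ) w) σ (6 + t)) →
    Within prefixLoop (emptyStacks n (I ∷ O ∷ q ∷ ⌜ X ⌝ˢ ++ ⌜ φ ⌝ᴴ) w)
      (emptyStacks n (O ∷ ⌜ matrix φ ⌝ᴸ) (((s₁ ++ ⌜ classᴺ X ⌝ᴺ ++ s₂ ++ ⌜ classᴺ X ⌝ᴺ ++ s₃) ++ quantifiers φ) ʳ++ w))
      (big * (3 + length (⌜ X ⌝ˢ ++ ⌜ φ ⌝ᴴ)))
  two s₁ s₂ s₃ q X φ w {h} tok =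
    arrive (cong (emptyStacks n (O ∷ ⌜ matrix φ ⌝ᴸ)) (sym (List.++-ʳ++ (s₁ ++ ⌜ classᴺ X ⌝ᴺ ++ s₂ ++ ⌜ classᴺ X ⌝ᴺ ++ s₃))))
      (relax (ℕ.≤-trans (ℕ.≤-reflexive (sum (2 * (length s₁ + length s₂ + length s₃) + 8) (51 * length ⌜ X ⌝ˢ) (big * length ⌜ φ ⌝ᴴ)))
                (quantifier≤ (7 + (2 * (length s₁ + length s₂ + length s₃) + 8)) ⌜ X ⌝ˢ ⌜ φ ⌝ᴴ (≤big h)))
        (againᵂ refl (tok (quantifier₂ᵂ s₁ s₂ s₃ X w)) (prefixLoopᵂ φ _)))
    where
      sum : ∀ a b c → 1 + (6 + (a + b) + c) ≡ 7 + a + b + c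
      sum = solve-∀

  one : ∀ s₁ s₂ q π X (φ : Hyper²LTL n) w {_ : T (7 + (2 * (length s₁ + length s₂) + 10) ≤ᵇ 1000)} →
    (∀ {σ t} → Within (quantifier₁ s₁ s₂) (emptyStacks n (⌜ π ⌝ᴺ ++ ⌜ X ⌝ˢ ++ ⌜ φ ⌝ᴴ) w) σ t →
      Within quantifierToken (emptyStacks n (I ∷ I ∷ q ∷ ⌜ π ⌝ᴺ ++ ⌜ X ⌝ˢ ++ ⌜ φ ⌝ᴴ) w) σ (6 + t)) →
    Within prefixLoop (emptyStacks n (I ∷ I ∷ q ∷ ⌜ π ⌝ᴺ ++ ⌜ X ⌝ˢ ++ ⌜ φ ⌝ᴴ) w)
      (emptyStacks n (O ∷ ⌜ matrix φ ⌝ᴸ) (((s₁ ++ ⌜ π ⌝ᴺ ++ s₂ ++ ⌜ π ⌝ᴺ ++ ⌜ classᴺ X ⌝ᴺ) ++ quantifiers φ) ʳ++ w))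
      (big * (3 + length (⌜ π ⌝ᴺ ++ ⌜ X ⌝ˢ ++ ⌜ φ ⌝ᴴ)))
  one s₁ s₂ q π X φ w {h} tok =
    arrive (cong (emptyStacks n (O ∷ ⌜ matrix φ ⌝ᴸ)) (sym (List.++-ʳ++ (s₁ ++ ⌜ π ⌝ᴺ ++ s₂ ++ ⌜ π ⌝ᴺ ++ ⌜ classᴺ X ⌝ᴺ))))
      (relax (ℕ.≤-trans (ℕ.≤-reflexive (trans
                  (sum (2 * (length s₁ + length s₂) + 10) (51 * (length ⌜ π ⌝ᴺ + length ⌜ X ⌝ˢ)) (big * length ⌜ φ ⌝ᴴ))
                  (cong (λ l → 7 + (2 * (length s₁ + length s₂) + 10) + 51 * l + big * length ⌜ φ ⌝ᴴ) (sym (List.length-++ ⌜ π ⌝ᴺ {⌜ X ⌝ˢ})))))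
                (ℕ.≤-trans (quantifier≤ (7 + (2 * (length s₁ + length s₂) + 10)) (⌜ π ⌝ᴺ ++ ⌜ X ⌝ˢ) ⌜ φ ⌝ᴴ (≤big h))
                  (ℕ.≤-reflexive (cong (λ l → big * (3 + length l)) (List.++-assoc ⌜ π ⌝ᴺ ⌜ X ⌝ˢ ⌜ φ ⌝ᴴ)))))
        (againᵂ refl (tok (quantifier₁ᵂ s₁ s₂ π X w)) (prefixLoopᵂ φ _)))
    where
      sum : ∀ a b c → 1 + (6 + (a + b) + c) ≡ 7 + a + b + c
      sum = solve-∀

  start : ∀ {i w s s′ σ T p} → Within p σ[ i , w , s , s′ ] σ T → Within (pop In ⨾ p) σ[ bit I ∷ i , w , s , s′ ] σ (1 + T)
  start r = popᴬ onIn _ _ ⨟ r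

  prefixLoopᵂ (∃₂ X ∙ φ)     w = two ex₂₁ ex₂₂ ex₂₃ O X φ w λ r → relax (ℕ.n≤1+n _) (start (readO (readO r)))
  prefixLoopᵂ (∀₂ X ∙ φ)     w = two all₂₁ all₂₂ all₂₃ I X φ w λ r → relax (ℕ.n≤1+n _) (start (readO (readI r)))
  prefixLoopᵂ (∃₁ π ∈ X ∙ φ) w = one ex₁₁ ex₁₂ O π X φ w λ r → relax (ℕ.n≤1+n _) (start (readI (readO r)))
  prefixLoopᵂ (∀₁ π ∈ X ∙ φ) w = one all₁₁ all₁₂ I π X φ w λ r → relax (ℕ.n≤1+n _) (start (readI (readI r)))
  prefixLoopᵂ (ltl ψ)        w = relax (ℕ.≤-trans (≤big {1} tt) (ℕ.m≤m*n big (suc (length ⌜ ψ ⌝ᴸ)))) (stopᵂ refl)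

  timeBefore time : ℕ → ℕ
  timeBefore l = 2 * length (opening n) + 1 + (big * l + (1 + (K n * l + 1)))
  time l       = timeBefore l + (4 * (timeBefore l + l) + 1)

  time-polynomial : Polynomial time
  time-polynomial = polynomial (before +ᴾ (constᴾ 4 *ᴾ (before +ᴾ idᴾ) +ᴾ constᴾ 1))
    where
      before : Polynomial′ timeBefore
      before = constᴾ (2 * length (opening n) + 1) +ᴾ (constᴾ big *ᴾ idᴾ +ᴾ (constᴾ 1 +ᴾ (constᴾ (K n) *ᴾ idᴾ +ᴾ constᴾ 1)))

  programᵂ : ∀ (φ : Hyper²LTL n) → ∃[ t ] ∃[ σ ] Run (program n) (inputStacks ⌜ φ ⌝ᴴ) t σ
    × lookup σ Out ≡ bits ⌜ arith φ ⌝ᴬ × t ≤ time (length ⌜ φ ⌝ᴴ)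
  programᵂ φ = _ , _ , proj₂ (proj₂ all) , refl , proj₁ (proj₂ all)
    where
      N = length ⌜ φ ⌝ᴴ
      c = ⌜ arith φ ⌝ᴬ
      translate : Within (emit W (opening n) ⨾ prefixLoop ⨾ pop In ⨾ matrixLoop n) (emptyStacks n ⌜ φ ⌝ᴴ []) (emptyStacks n [] (c ʳ++ []))
        (timeBefore N)
      translate = arrive (cong (emptyStacks n []) written)
        (relax (ℕ.+-monoʳ-≤ (2 * length (opening n) + 1) (ℕ.+-monoʳ-≤ (big * N) (ℕ.+-monoʳ-≤ 1 (ℕ.+-monoˡ-≤ 1 (ℕ.*-monoʳ-≤ (K n) (length-matrix φ))))))
          (emitW (opening n) [] ⨟ prefixLoopᵂ φ _ ⨟ popᴬ onIn _ _ ⨟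
           depart (cong (λ s → emptyStacks n s (quantifiers φ ʳ++ opening n ʳ++ [])) (List.++-identityʳ ⌜ matrix φ ⌝ᴸ)) (matrixLoopᵂ n (matrix φ) [] _ (stopᵂ refl))))
        where
          written : ⌜ arithᴸ (matrix φ) ⌝ᴬ ʳ++ quantifiers φ ʳ++ opening n ʳ++ [] ≡ c ʳ++ []
          written = begin
            ⌜ arithᴸ (matrix φ) ⌝ᴬ ʳ++ quantifiers φ ʳ++ opening n ʳ++ []  ≡⟨ sym (List.++-ʳ++ (quantifiers φ)) ⟩
            (quantifiers φ ++ ⌜ arithᴸ (matrix φ) ⌝ᴬ) ʳ++ opening n ʳ++ []  ≡⟨ cong (_ʳ++ opening n ʳ++ []) (quantifiers-code φ) ⟩
            ⌜ arithᴴ φ ⌝ᴬ ʳ++ opening n ʳ++ []  ≡⟨ sym (List.++-ʳ++ (opening n)) ⟩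
            (opening n ++ ⌜ arithᴴ φ ⌝ᴬ) ʳ++ []  ≡⟨ cong (_ʳ++ []) (sym (opening-code n (arithᴴ φ))) ⟩
            c ʳ++ []  ∎
            where open ≡-Reasoning
      output : Within (pour W Out) (emptyStacks n [] (c ʳ++ [])) ([] ∷ bits c ∷ [] ∷ [] ∷ [] ∷ []) (4 * length (c ʳ++ []) + 1)
      output = depart (cong (λ a → σ[ [] , a , [] , [] ]) (List.++-identityʳ (bits (c ʳ++ []))))
        (arrive (cong (λ b → [] ∷ b ∷ [] ∷ [] ∷ [] ∷ []) (trans (sym (bits-ʳ++ (c ʳ++ []) [])) (cong bits (trans (List.ʳ++-ʳ++ c) (List.++-identityʳ c)))))
          (pourᴬ {i = W} {j = Out} {f = λ w o → [] ∷ o ∷ w ∷ [] ∷ [] ∷ []} (λ ()) (λ _ → ok (λ _ → refl) (λ _ _ → refl))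
            (λ _ → ok (λ _ → refl) (λ _ _ → refl)) (c ʳ++ []) {[]} refl []))
      -- The collected output is part of the total stack height, which grows by at most one cell per
      -- step of the translation.
      short : length (c ʳ++ []) ≤ timeBefore N + N
      short = begin
        length (c ʳ++ [])  ≡⟨ sym (List.length-map bit (c ʳ++ [])) ⟩
        length (bits {0} (c ʳ++ []))  ≤⟨ height-lookup (emptyStacks n [] (c ʳ++ [])) W ⟩
        height (emptyStacks n [] (c ʳ++ []))  ≤⟨ run-height (proj₂ (proj₂ translate)) ⟩
        proj₁ translate + height (emptyStacks n ⌜ φ ⌝ᴴ [])  ≤⟨ ℕ.+-mono-≤ (proj₁ (proj₂ translate))
          (ℕ.≤-reflexive (trans (ℕ.+-identityʳ _) (List.length-map bit ⌜ φ ⌝ᴴ))) ⟩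
        timeBefore N + N  ∎
        where open ℕ.≤-Reasoning
      all : Within (program n) (inputStacks ⌜ φ ⌝ᴴ) ([] ∷ bits c ∷ [] ∷ [] ∷ [] ∷ []) (time N)
      all = relax (ℕ.+-monoʳ-≤ (timeBefore N) (ℕ.+-monoˡ-≤ 1 (ℕ.*-monoʳ-≤ 4 short))) (reassociate (translate ⨟ output))

-- Classical logic

module Classical (em : ExcludedMiddle 1ℓ) where

  em₀ : ExcludedMiddle 0ℓ
  em₀ {A} with em {Lift 1ℓ A}
  ... | yes (lift a) = yes a
  ... | no ¬a        = no λ a → ¬a (lift a)

  stable : {A : Set₁} → ¬ ¬ A → A
  stable {A} ¬¬a with em {A}
  ... | yes a = a
  ... | no ¬a = ⊥-elim (¬¬a ¬a)

  impliesᴵ : {A B : Set₁} → (A → B) → ¬ A ⊎ B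
  impliesᴵ {A} f with em {A}
  ... | yes a = inj₂ (f a)
  ... | no ¬a = inj₁ ¬a

  subset : ∀ {k} → (Fin k → Set) → Subset k
  subset Q = Vec.tabulate (λ p → does (em₀ {Q p}))

  ∈subset : ∀ {k} (Q : Fin k → Set) p → p ∈ˢ subset Q ⇔ Q p
  ∈subset Q p = mk⇔ (λ m → to (trans (sym (Vec.lookup∘tabulate _ p)) (Vec.[]=⇒lookup m)))
                    (λ q → Vec.lookup⇒[]= p _ (trans (Vec.lookup∘tabulate _ p) (from q)))
    where
      to : does (em₀ {Q p}) ≡ true → Q p
      to e with em₀ {Q p}
      ... | yes q = q
      from : Q p → does (em₀ {Q p}) ≡ true
      from q with em₀ {Q p}
      ... | yes _ = refl
      ... | no ¬q = ⊥-elim (¬q q)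

impliesᴱ : ∀ {ℓ} {A B : Set ℓ} → ¬ A ⊎ B → A → B
impliesᴱ (inj₁ ¬a) a = ⊥-elim (¬a a)
impliesᴱ (inj₂ b)  _ = b

divMod-unique : ∀ s {i j u v} → u < s → v < s → i * s + u ≡ j * s + v → i ≡ j × u ≡ v
divMod-unique (suc s) {i} {j} {u} {v} u<s v<s e = quotient , remainder
  where
    open ≡-Reasoning
    mod : ∀ i {u} → u < suc s → (i * suc s + u) % suc s ≡ u
    mod i {u} h = trans (cong (_% suc s) (ℕ.+-comm (i * suc s) u)) (trans (ℕ.[m+kn]%n≡m%n u i (suc s)) (ℕ.m<n⇒m%n≡m h))
    remainder : u ≡ v
    remainder = trans (sym (mod i u<s)) (trans (cong (_% suc s) e) (mod j v<s))
    quotient : i ≡ j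
    quotient = ℕ.*-cancelʳ-≡ i j (suc s) (ℕ.+-cancelʳ-≡ u _ _ (trans e (cong (j * suc s +_) (sym remainder))))

module _ {A : Set} (_≟_ : (x y : A) → Dec (x ≡ y)) where
  open Update _≟_

  update-same : ∀ {b} {B : Set b} (f : A → B) x v → (f [ x ↦ v ]) x ≡ v
  update-same f x v with x ≟ x
  ... | yes _  = refl
  ... | no x≢x = ⊥-elim (x≢x refl)

  update-other : ∀ {b} {B : Set b} (f : A → B) {x y} v → y ≢ x → (f [ x ↦ v ]) y ≡ f y
  update-other f {x} {y} v y≢x with x ≟ y
  ... | yes x≡y = ⊥-elim (y≢x (sym x≡y))
  ... | no _    = refl

-- Evaluating LTL at a position

infix 4 _at-pos_⊩_

-- The same semantics with the position kept as a number instead of being absorbed into shifted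
-- traces; this is the number that `posᴺ` denotes in the translation.
_at-pos_⊩_ : ∀ {n} → TraceAssignment n → ℕ → LTL n → Set
Π at-pos i ⊩ (p at π) = Any (λ t → p ∈ˢ t i) (Π π)
Π at-pos i ⊩ neg ψ    = ¬ (Π at-pos i ⊩ ψ)
Π at-pos i ⊩ (ψ or χ) = (Π at-pos i ⊩ ψ) ⊎ (Π at-pos i ⊩ χ)
Π at-pos i ⊩ next ψ   = Π at-pos (i + 1) ⊩ ψ
Π at-pos i ⊩ (ψ U χ)  = ∃[ j ] (Π at-pos (i + j) ⊩ χ) × (∀ j′ → j′ < j → Π at-pos (i + j′) ⊩ ψ)

-- Successive shifts compose only up to associativity of addition, so suffixes are compared
-- pointwise rather than as functions.
data Suffix {n} (i : ℕ) : Maybe (Trace n) → Maybe (Trace n) → Set where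
  nothing : Suffix i nothing nothing
  just    : ∀ {t t′} → (∀ k → t′ k ≡ t (i + k)) → Suffix i (just t′) (just t)

suffix-shift : ∀ {n i} {a b : Maybe (Trace n)} j → Suffix i a b → Suffix (i + j) (Maybe.map (λ t k → t (j + k)) a) b
suffix-shift j nothing  = nothing
suffix-shift {i = i} j (just {t} e) = just λ k → trans (e (j + k)) (cong t (sym (ℕ.+-assoc i j k)))

suffix-any : ∀ {n i} {a b : Maybe (Trace n)} {p} → Suffix i a b → Any (λ t → p ∈ˢ t 0) a ⇔ Any (λ t → p ∈ˢ t i) b
suffix-any nothing = mk⇔ (λ ()) (λ ())
suffix-any {i = i} {p = p} (just {t} e) = mk⇔
  (λ where (just m) → just (subst (p ∈ˢ_) (trans (e 0) (cong t (ℕ.+-identityʳ i))) m))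
  (λ where (just m) → just (subst (p ∈ˢ_) (sym (trans (e 0) (cong t (ℕ.+-identityʳ i)))) m))

open Equivalence

at-position : ∀ {n i} {Π′ Π : TraceAssignment n} → (∀ π → Suffix i (Π′ π) (Π π)) → ∀ ψ → Π′ ⊨ᴸ ψ ⇔ Π at-pos i ⊩ ψ
at-position s (p at π) = suffix-any (s π)
at-position s (neg ψ)  = mk⇔ (λ h → h ∘ from (at-position s ψ)) (λ h → h ∘ to (at-position s ψ))
at-position s (ψ or χ) = mk⇔
  (λ { (inj₁ h) → inj₁ (to (at-position s ψ) h) ; (inj₂ h) → inj₂ (to (at-position s χ) h) })
  (λ { (inj₁ h) → inj₁ (from (at-position s ψ) h) ; (inj₂ h) → inj₂ (from (at-position s χ) h) })
at-position s (next ψ) = at-position (λ π → suffix-shift 1 (s π)) ψ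
at-position s (ψ U χ)  = mk⇔
  (λ (j , h , g) → j , to (at-position (λ π → suffix-shift j (s π)) χ) h ,
     λ j′ lt → to (at-position (λ π → suffix-shift j′ (s π)) ψ) (g j′ lt))
  (λ (j , h , g) → j , from (at-position (λ π → suffix-shift j (s π)) χ) h ,
     λ j′ lt → from (at-position (λ π → suffix-shift j′ (s π)) ψ) (g j′ lt))

at-start : ∀ {n} (Π : TraceAssignment n) ψ → Π ⊨ᴸ ψ ⇔ Π at-pos 0 ⊩ ψ
at-start Π = at-position (λ π → whole (Π π))
  where
    whole : ∀ a → Suffix 0 a a
    whole nothing  = nothing
    whole (just _) = just λ _ → refl

-- From Hyper²LTL to arithmetic: correctness

open Assignment
open TraceSet

free-occurs : ∀ {m X} (φ : Hyper²LTL m) → X FreeSetVarOf φ → X OccursIn φ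
free-occurs (∃₂ X ∙ φ)     (_ , h)  = inj₂ (free-occurs φ h)
free-occurs (∀₂ X ∙ φ)     (_ , h)  = inj₂ (free-occurs φ h)
free-occurs (∃₁ π ∈ X ∙ φ) (inj₁ e) = inj₁ e
free-occurs (∃₁ π ∈ X ∙ φ) (inj₂ h) = inj₂ (free-occurs φ h)
free-occurs (∀₁ π ∈ X ∙ φ) (inj₁ e) = inj₁ e
free-occurs (∀₁ π ∈ X ∙ φ) (inj₂ h) = inj₂ (free-occurs φ h)

numeral-value : ∀ ν k → ν zeroᴺ ≡ 0 → ν oneᴺ ≡ 1 → value ν (numeral k) ≡ k
numeral-value ν zero    z o = z
numeral-value ν (suc k) z o = cong₂ _+_ o (numeral-value ν k z o)

record Codes {n} (t : Trace n) (Z : SetOfℕ) : Set where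
  constructor codes
  field at-cell : ∀ i (p : Fin n) → p ∈ˢ t i ⇔ Z (n * i + toℕ p)

open Codes

record AtPosition (ν : Name → ℕ) (i : ℕ) : Set where
  field
    is-zero : ν zeroᴺ ≡ 0
    is-one  : ν oneᴺ ≡ 1
    is-pos  : ν posᴺ ≡ i

open AtPosition

module Forward (em : ExcludedMiddle 1ℓ) where
  open Classical em
  open Update _≟ᴺ_

  ≼-to : ∀ {a b} → Lift 1ℓ (a < b) ⊎ Lift 1ℓ (a ≡ b) → a ≤ b
  ≼-to (inj₁ (lift h)) = ℕ.<⇒≤ h
  ≼-to (inj₂ (lift h)) = ℕ.≤-reflexive h

  ≼-from : ∀ {a b} → a ≤ b → Lift 1ℓ (a < b) ⊎ Lift 1ℓ (a ≡ b)
  ≼-from h with ℕ.m≤n⇒m<n∨m≡n h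
  ... | inj₁ lt = inj₁ (lift lt)
  ... | inj₂ eq = inj₂ (lift eq)

  arithᴸ-correct : ∀ {n} (ψ : LTL n) {Π ν α γ i} → AtPosition ν i →
    (∀ π → π OccursInLTL ψ → ∃[ t ] Π π ≡ just t × Codes t (α π)) →
    Π at-pos i ⊩ ψ ⇔ ⟨ ν ∣ α ∣ γ ⟩ ⊨ᴬ arithᴸ ψ
  arithᴸ-correct {n} (p at π) {Π} {ν} {α} {γ} {i} b h with h π refl
  ... | t , e , c rewrite e = mk⇔
    (λ where (just m) → lift (subst (α π) (sym position) (to (at-cell c i p) m)))
    (λ (lift m) → just (from (at-cell c i p) (subst (α π) position m)))
    where
      position : value ν (cell n (var posᴺ) (numeral (toℕ p))) ≡ n * i + toℕ p
      position = cong₂ _+_ (cong₂ _*_ (numeral-value ν n (is-zero b) (is-one b)) (is-pos b))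
        (numeral-value ν (toℕ p) (is-zero b) (is-one b))
  arithᴸ-correct (neg ψ) b h = mk⇔ (λ g → g ∘ from (arithᴸ-correct ψ b h)) (λ g → g ∘ to (arithᴸ-correct ψ b h))
  arithᴸ-correct (ψ or χ) b h = mk⇔
    (λ { (inj₁ g) → inj₁ (to (arithᴸ-correct ψ b (λ π → h π ∘ inj₁)) g)
       ; (inj₂ g) → inj₂ (to (arithᴸ-correct χ b (λ π → h π ∘ inj₂)) g) })
    (λ { (inj₁ g) → inj₁ (from (arithᴸ-correct ψ b (λ π → h π ∘ inj₁)) g)
       ; (inj₂ g) → inj₂ (from (arithᴸ-correct χ b (λ π → h π ∘ inj₂)) g) })
  arithᴸ-correct (next ψ) {ν = ν} {i = i} b h = mk⇔
    (λ g → i + 1 , lift (cong₂ _+_ (sym (is-pos b)) (sym (is-one b))) , i + 1 , lift refl ,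
       to (arithᴸ-correct ψ (record { is-zero = is-zero b ; is-one = is-one b ; is-pos = refl }) h) g)
    (λ (k , lift e , k′ , lift e′ , g) →
       from (arithᴸ-correct ψ (record { is-zero = is-zero b ; is-one = is-one b
                                      ; is-pos = trans e′ (trans e (cong₂ _+_ (is-pos b) (is-one b))) }) h) g)
  arithᴸ-correct (ψ U χ) {Π} {ν} {α} {γ} {i} b h = mk⇔
    (λ (j , gχ , gψ) → i , lift (sym (is-pos b)) , i + j , ≼-from (ℕ.m≤m+n i j) ,
       (λ m → impliesᴵ λ (i≤m , lift m<) → m , lift refl ,
          to (arithᴸ-correct ψ (record { is-zero = is-zero b ; is-one = is-one b
                                       ; is-pos = sym (ℕ.m+[n∸m]≡n (≼-to i≤m)) }) (λ π → h π ∘ inj₁))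
             (gψ (m ∸ i) (ℕ.+-cancelˡ-< i _ _ (subst (_< i + j) (sym (ℕ.m+[n∸m]≡n (≼-to i≤m))) m<)))) ,
       to (arithᴸ-correct χ (record { is-zero = is-zero b ; is-one = is-one b ; is-pos = refl }) (λ π → h π ∘ inj₂)) gχ)
    back
    where
      back : ⟨ ν ∣ α ∣ γ ⟩ ⊨ᴬ arithᴸ (ψ U χ) → Π at-pos i ⊩ (ψ U χ)
      back (k , lift k≡ , l , k≼l , gψ , gχ) with trans k≡ (is-pos b) | ≼-to k≼l
      ... | refl | k≤l = l ∸ k ,
        from (arithᴸ-correct χ (record { is-zero = is-zero b ; is-one = is-one b ; is-pos = sym (ℕ.m+[n∸m]≡n k≤l) }) (λ π → h π ∘ inj₂)) gχ ,
        λ j j< → case impliesᴱ (gψ (k + j)) (≼-from (ℕ.m≤m+n k j) ,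
                        lift (subst (k + j <_) (ℕ.m+[n∸m]≡n k≤l) (ℕ.+-monoʳ-< k j<))) of λ where
          (m , lift e , g) → from (arithᴸ-correct ψ (record { is-zero = is-zero b ; is-one = is-one b ; is-pos = e }) (λ π → h π ∘ inj₁)) g

-- From Hyper²LTL to arithmetic: traces, sets of traces and quantifiers

module ForwardHyper (em : ExcludedMiddle 1ℓ) (n : ℕ) (n≢0 : NonZero n) where
  open Classical em
  open Forward em
  open Update _≟ᴺ_
  open SetOfSetsOfℕ renaming (member to memberᶜ; respect to respectᶜ)

  private instance
    _ = n≢0

  scale≡ : ∀ i (p : Fin n) → n * i + toℕ p ≡ i * n + toℕ p
  scale≡ i p = cong (_+ toℕ p) (ℕ.*-comm n i)

  numbersOf : Trace n → SetOfℕ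
  numbersOf t m = ∃[ i ] ∃[ p ] m ≡ n * i + toℕ p × p ∈ˢ t i

  numbersOf-codes : ∀ t → Codes t (numbersOf t)
  numbersOf-codes t = codes λ i p → mk⇔ (λ m → i , p , refl , m) back
    where
      back : ∀ {i p} → numbersOf t (n * i + toℕ p) → p ∈ˢ t i
      back {i} {p} (j , q , e , m) with divMod-unique n {i} {j} (Fin.toℕ<n p) (Fin.toℕ<n q) (trans (sym (scale≡ i p)) (trans e (scale≡ j q)))
      ... | refl , e′ with Fin.toℕ-injective e′
      ... | refl = m

  traceOf : SetOfℕ → Trace n
  traceOf Z i = subset (λ p → Z (n * i + toℕ p))

  traceOf-codes : ∀ Z → Codes (traceOf Z) Z
  traceOf-codes Z = codes λ i p → ∈subset _ p

  codes-≗ : ∀ {t t′ : Trace n} {Z Z′} → Codes t Z → Codes t′ Z′ → Z ≐ Z′ → t ≗ t′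
  codes-≗ c c′ (f , g) i = ⊆-antisym (λ {p} m → from (at-cell c′ i p) (f (to (at-cell c i p) m))) (λ {p} m → from (at-cell c i p) (g (to (at-cell c′ i p) m)))

  -- Since `n` is nonzero, every number is `n * i + p` for some `p < n`. A set of numbers thus
  -- carries no information beyond the trace that it codes.
  codes-≐ : ∀ {t t′ : Trace n} {Z Z′} → Codes t Z → Codes t′ Z′ → t ≗ t′ → Z ≐ Z′
  codes-≐ {t} {t′} {Z} {Z′} c c′ e = (λ {m} → half c c′ e {m}) , (λ {m} → half c′ c (λ i → sym (e i)) {m})
    where
      half : ∀ {t t′ : Trace n} {Z Z′} → Codes t Z → Codes t′ Z′ → t ≗ t′ → ∀ {m} → Z m → Z′ m
      half {t} {t′} {Z} {Z′} c c′ e {m} z =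
        subst Z′ (sym split) (to (at-cell c′ (m / n) p) (subst (p ∈ˢ_) (e (m / n)) (from (at-cell c (m / n) p) (subst Z split z))))
        where
          p = fromℕ< (ℕ.m%n<n m n)
          split : m ≡ n * (m / n) + toℕ p
          split = trans (ℕ.m≡m%n+[m/n]*n m n) (trans (ℕ.+-comm (m % n) _)
            (cong₂ _+_ (ℕ.*-comm (m / n) n) (sym (Fin.toℕ-fromℕ< (ℕ.m%n<n m n)))))

  Represents : TraceSet n → SetOfSetsOfℕ → Set₁
  Represents D C = ∀ t Z → Codes t Z → member D t ⇔ memberᶜ C Z

  toClass : TraceSet n → SetOfSetsOfℕ
  toClass D = record
    { member  = λ Z → ∃[ t ] Codes t Z × member D t
    ; respect = λ { {_} {Z} e (t , c , m) → traceOf Z , traceOf-codes Z , respect D (codes-≗ c (traceOf-codes Z) e) m }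
    }

  toClass-represents : ∀ D → Represents D (toClass D)
  toClass-represents D t Z c = mk⇔ (λ m → t , c , m) (λ (t′ , c′ , m) → respect D (codes-≗ c′ c (id , id)) m)

  toTraces : SetOfSetsOfℕ → TraceSet n
  toTraces C = record
    { member  = λ t → memberᶜ C (numbersOf t)
    ; respect = λ e m → respectᶜ C (codes-≐ (numbersOf-codes _) (numbersOf-codes _) e) m
    }

  toTraces-represents : ∀ C → Represents (toTraces C) C
  toTraces-represents C t Z c = mk⇔ (respectᶜ C (codes-≐ (numbersOf-codes t) c (λ _ → refl))) (respectᶜ C (codes-≐ c (numbersOf-codes t) (λ _ → refl)))

  -- `Xd` is always included: the bound of a second-order quantifier reads it even where it is not
  -- free in the formula.
  record Related (φ : Hyper²LTL n) (Π : Assignment n) (α : Name → SetOfℕ) (γ : Name → SetOfSetsOfℕ) : Set₁ where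
    field
      on-traces : ∀ π → π FreeTraceVarOf φ → ∃[ t ] traces Π π ≡ just t × Codes t (α π)
      on-sets   : ∀ X → X ≡ Xd ⊎ X FreeSetVarOf φ → ∃[ D ] sets Π X ≡ just D × Represents D (γ (classᴺ X))

  open Related

  classᴺ-injective : ∀ {X Y} → classᴺ X ≡ classᴺ Y → X ≡ Y
  classᴺ-injective {Xa}    {Xa}    _    = refl
  classᴺ-injective {Xd}    {Xd}    _    = refl
  classᴺ-injective {var x} {var .x} refl = refl

  savedᴺ-fresh : ∀ X → classᴺ X ≢ savedᴺ
  savedᴺ-fresh Xa ()
  savedᴺ-fresh Xd ()
  savedᴺ-fresh (var _) ()

  bindSet : ∀ {φ χ X Π α γ D} W C → (∀ π → π FreeTraceVarOf χ → π FreeTraceVarOf φ) →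
    (∀ Y → Y ≢ X → Y FreeSetVarOf χ → Y FreeSetVarOf φ) → Represents D C → Related φ Π α γ →
    Related χ (Π [ X ↦ˢ D ]) α ((γ [ savedᴺ ↦ W ]) [ classᴺ X ↦ C ])
  on-traces (bindSet W C f g r R) π h = on-traces R π (f π h)
  on-sets (bindSet {X = X} {Π} {α} {γ} {D} W C f g r R) Y h with Y ≟ˢ X
  ... | yes refl = D , update-same _≟ˢ_ (sets Π) X (just D) , λ t Z c → subst (λ C → member D t ⇔ memberᶜ C Z) (sym (update-same _≟ᴺ_ _ (classᴺ X) C)) (r t Z c)
  ... | no Y≢X with on-sets R Y (case h of λ { (inj₁ e) → inj₁ e ; (inj₂ h) → inj₂ (g Y Y≢X h) })
  ...   | D′ , e , r′ = D′ , trans (update-other _≟ˢ_ (sets Π) (just D) Y≢X) e , λ t Z c →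
    subst (λ C → member D′ t ⇔ memberᶜ C Z)
      (sym (trans (update-other _≟ᴺ_ _ C (Y≢X ∘ classᴺ-injective)) (update-other _≟ᴺ_ γ W (savedᴺ-fresh Y)))) (r′ t Z c)

  bindTrace : ∀ {φ χ π Π α γ t} Z → (∀ ρ → ρ ≢ π → ρ FreeTraceVarOf χ → ρ FreeTraceVarOf φ) →
    (∀ Y → Y FreeSetVarOf χ → Y FreeSetVarOf φ) → Codes t Z → Related φ Π α γ →
    Related χ (Π [ π ↦ᵗ t ]) (α [ π ↦ Z ]) γ
  on-traces (bindTrace {π = π} {Π} {α} {γ} {t} Z f g c R) ρ h with ρ ≟ᴺ π
  ... | yes refl = t , update-same _≟ᴺ_ (traces Π) π (just t) , subst (Codes t) (sym (update-same _≟ᴺ_ α π Z)) c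
  ... | no ρ≢π with on-traces R ρ (f ρ ρ≢π h)
  ...   | t′ , e , c′ = t′ , trans (update-other _≟ᴺ_ (traces Π) (just t) ρ≢π) e , subst (Codes t′) (sym (update-other _≟ᴺ_ α Z ρ≢π)) c′
  on-sets (bindTrace Z f g c R) Y (inj₁ e) = on-sets R Y (inj₁ e)
  on-sets (bindTrace Z f g c R) Y (inj₂ h) = on-sets R Y (inj₂ (g Y h))

  _⊆ᶜ_ : SetOfSetsOfℕ → SetOfSetsOfℕ → Set₁
  C ⊆ᶜ C′ = ∀ Z → memberᶜ C Z → memberᶜ C′ Z

  ⊑-correct : ∀ {ν α γ} 𝒜 ℬ → ⟨ ν ∣ α ∣ γ ⟩ ⊨ᴬ (𝒜 ⊑ ℬ) ⇔ (γ 𝒜 ⊆ᶜ γ ℬ)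
  ⊑-correct 𝒜 ℬ = mk⇔ (λ h Z m → lower (impliesᴱ (h Z) (lift m))) (λ h Z → impliesᴵ λ (lift m) → lift (h Z m))

  -- Under the updates made by a second-order quantifier, the two guards say C ⊆ W ⊆ X_d.

  guards : ∀ {ν α} γ W C X →
    (⟨ ν ∣ α ∣ γ [ savedᴺ ↦ W ] ⟩ ⊨ᴬ (savedᴺ ⊑ classᴺ Xd) ⇔ (W ⊆ᶜ γ (classᴺ Xd))) ×
    (⟨ ν ∣ α ∣ (γ [ savedᴺ ↦ W ]) [ classᴺ X ↦ C ] ⟩ ⊨ᴬ (classᴺ X ⊑ savedᴺ) ⇔ (C ⊆ᶜ W))
  guards {ν} {α} γ W C X = ⊑-correct {ν} {α} {γ [ savedᴺ ↦ W ]} savedᴺ (classᴺ Xd) ,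
    subst₂ (λ A B → ⟨ ν ∣ α ∣ γ′ ⟩ ⊨ᴬ (classᴺ X ⊑ savedᴺ) ⇔ (A ⊆ᶜ B)) (update-same _≟ᴺ_ _ (classᴺ X) C)
      (update-other _≟ᴺ_ _ C (savedᴺ-fresh X ∘ sym)) (⊑-correct {ν} {α} {γ′} (classᴺ X) savedᴺ)
    where γ′ = (γ [ savedᴺ ↦ W ]) [ classᴺ X ↦ C ]

  module _ {φ : Hyper²LTL n} {Π α γ} (R : Related φ Π α γ) where

    bounded-to : ∀ {D C} → Represents D C → D ⊆[ Π ]Xd → C ⊆ᶜ γ (classᴺ Xd)
    bounded-to r h Z m with on-sets R Xd (inj₁ refl)
    ... | D′ , e , r′ with sets Π Xd | e | h (traceOf Z) (from (r _ Z (traceOf-codes Z)) m)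
    ...   | _ | refl | just m′ = to (r′ _ Z (traceOf-codes Z)) m′

    bounded-from : ∀ {D C} → Represents D C → C ⊆ᶜ γ (classᴺ Xd) → D ⊆[ Π ]Xd
    bounded-from r h t m with on-sets R Xd (inj₁ refl)
    ... | D′ , e , r′ with sets Π Xd | e
    ...   | _ | refl = just (from (r′ t _ (numbersOf-codes t)) (h _ (to (r t _ (numbersOf-codes t)) m)))

    element : ∀ {X t Z} → X FreeSetVarOf φ → Codes t Z → t ∈[ Π ] X ⇔ memberᶜ (γ (classᴺ X)) Z
    element {X} {t} {Z} f c with on-sets R X (inj₂ f)
    ... | D , e , r with sets Π X | e
    ...   | _ | refl = mk⇔ (λ where (just m) → to (r t Z c) m) (λ m → just (from (r t Z c) m))

  ∈₂-correct : ∀ {ν} α γ π Z X →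
    ⟨ ν ∣ α [ π ↦ Z ] ∣ γ ⟩ ⊨ᴬ (π ∈₂ classᴺ X) ⇔ Lift 1ℓ (memberᶜ (γ (classᴺ X)) Z)
  ∈₂-correct α γ π Z X = subst (λ Y → Lift 1ℓ (memberᶜ (γ (classᴺ X)) Y) ⇔ Lift 1ℓ (memberᶜ (γ (classᴺ X)) Z))
    (sym (update-same _≟ᴺ_ α π Z)) (mk⇔ id id)

  arithᴴ-correct : ∀ φ {Π ν α γ} → AtPosition ν 0 → Related φ Π α γ →
    Π ⊨ᶜʷ φ ⇔ ⟨ ν ∣ α ∣ γ ⟩ ⊨ᴬ arithᴴ φ
  arithᴴ-correct (∃₂ X ∙ φ) {Π} {ν} {α} {γ} b R = mk⇔
    -- The witness itself is taken as the intermediate class.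
    (λ (D , D⊆ , h) → let C = toClass D ; r = toClass-represents D ; g = guards {ν} {α} γ C C X in
       C , from (proj₁ g) (bounded-to R {D} {C} r D⊆) , C , from (proj₂ g) (λ _ → id) ,
       to (arithᴴ-correct φ b (bindSet C C (λ _ → id) (λ _ → _,_) r R)) h)
    (λ (W , W⊆ , C , C⊆ , h) → let r = toTraces-represents C ; g = guards {ν} {α} γ W C X in
       toTraces C , bounded-from R {toTraces C} {C} r (λ Z m → to (proj₁ g) W⊆ Z (to (proj₂ g) C⊆ Z m)) ,
       from (arithᴴ-correct φ b (bindSet W C (λ _ → id) (λ _ → _,_) r R)) h)
  arithᴴ-correct (∀₂ X ∙ φ) {Π} {ν} {α} {γ} b R = mk⇔
    (λ f W → impliesᴵ λ W⊆ C → impliesᴵ λ C⊆ → let r = toTraces-represents C ; g = guards {ν} {α} γ W C X in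
       to (arithᴴ-correct φ b (bindSet W C (λ _ → id) (λ _ → _,_) r R))
         (f (toTraces C) (bounded-from R {toTraces C} {C} r (λ Z m → to (proj₁ g) W⊆ Z (to (proj₂ g) C⊆ Z m)))))
    (λ f D D⊆ → let C = toClass D ; r = toClass-represents D ; g = guards {ν} {α} γ C C X in
       from (arithᴴ-correct φ b (bindSet C C (λ _ → id) (λ _ → _,_) r R))
         (impliesᴱ (impliesᴱ (f C) (from (proj₁ g) (bounded-to R {D} {C} r D⊆)) C) (from (proj₂ g) (λ _ → id))))
  arithᴴ-correct (∃₁ π ∈ X ∙ φ) {Π} {ν} {α} {γ} b R = mk⇔
    (λ (t , m , h) → numbersOf t , from (∈₂-correct {ν} α γ π _ X) (lift (to (element R (inj₁ refl) (numbersOf-codes t)) m)) ,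
       to (arithᴴ-correct φ b (bindTrace (numbersOf t) (λ _ → _,_) (λ _ → inj₂) (numbersOf-codes t) R)) h)
    (λ (Z , m , h) → traceOf Z , from (element R (inj₁ refl) (traceOf-codes Z)) (lower (to (∈₂-correct {ν} α γ π Z X) m)) ,
       from (arithᴴ-correct φ b (bindTrace Z (λ _ → _,_) (λ _ → inj₂) (traceOf-codes Z) R)) h)
  arithᴴ-correct (∀₁ π ∈ X ∙ φ) {Π} {ν} {α} {γ} b R = mk⇔
    (λ f Z → impliesᴵ λ m → to (arithᴴ-correct φ b (bindTrace Z (λ _ → _,_) (λ _ → inj₂) (traceOf-codes Z) R))
       (f (traceOf Z) (from (element R (inj₁ refl) (traceOf-codes Z)) (lower (to (∈₂-correct {ν} α γ π Z X) m)))))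
    (λ f t m → from (arithᴴ-correct φ b (bindTrace (numbersOf t) (λ _ → _,_) (λ _ → inj₂) (numbersOf-codes t) R))
       (impliesᴱ (f (numbersOf t)) (from (∈₂-correct {ν} α γ π _ X) (lift (to (element R (inj₁ refl) (numbersOf-codes t)) m)))))
  arithᴴ-correct (ltl ψ) {Π} b R = mk⇔
    (λ (lift h) → to (arithᴸ-correct ψ b (on-traces R)) (to (at-start (traces Π) ψ) h))
    (λ h → lift (from (at-start (traces Π) ψ) (from (arithᴸ-correct ψ b (on-traces R)) h)))

-- From Hyper²LTL to arithmetic: transition systems as numbers and sets

module ForwardSystem (em : ExcludedMiddle 1ℓ) (n : ℕ) (n≢0 : NonZero n) where
  open Classical em
  open Forward em
  open ForwardHyper em n n≢0
  open Update _≟ᴺ_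
  open SetOfSetsOfℕ renaming (member to memberᶜ; respect to respectᶜ)
  open TransitionSystem

  record CodesSystem (𝔗 : TransitionSystem n) (E Z L : SetOfℕ) : Set where
    field
      edge  : ∀ u v → v ∈ˢ edges 𝔗 u ⇔ E (toℕ u * size 𝔗 + toℕ v)
      init  : ∀ v → v ∈ˢ initial 𝔗 ⇔ Z (toℕ v)
      lab   : ∀ v p → p ∈ˢ label 𝔗 v ⇔ L (n * toℕ v + toℕ p)

  open CodesSystem

  numbers* : (Name → ℕ) → ℕ → Name → ℕ
  numbers* ν s = ((ν [ zeroᴺ ↦ 0 ]) [ oneᴺ ↦ 1 ]) [ sizeᴺ ↦ s ]

  sets* : (Name → SetOfℕ) → SetOfℕ → SetOfℕ → SetOfℕ → Name → SetOfℕ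
  sets* α E Z L = ((α [ edgesᴺ ↦ E ]) [ initialᴺ ↦ Z ]) [ labelᴺ ↦ L ]

  isTrace-correct : ∀ {ν α γ} 𝔗 {E B L} → CodesSystem 𝔗 E B L → ∀ Z →
    ⟨ numbers* ν (size 𝔗) ∣ sets* α E B L [ traceᴺ ↦ Z ] ∣ γ ⟩ ⊨ᴬ isTrace n ⇔ (∃[ t ] Codes t Z × member (Tr 𝔗) t)
  isTrace-correct {ν} {α} {γ} 𝔗 {E} {B} {L} C Z = mk⇔ there back
    where
      s = size 𝔗
      scaled : ∀ {ν} → ν zeroᴺ ≡ 0 → ν oneᴺ ≡ 1 → value ν (numeral n) ≡ n
      scaled {ν} = numeral-value ν n
      there : ⟨ numbers* ν s ∣ sets* α E B L [ traceᴺ ↦ Z ] ∣ γ ⟩ ⊨ᴬ isTrace n → ∃[ t ] Codes t Z × member (Tr 𝔗) t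
      there (R , exists , starts , follows , labels) = label 𝔗 ∘ ρ , codes coded , ρ , (initially , connected) , λ _ → refl
        where
          v : ℕ → ℕ
          v i = proj₁ (exists i)
          v< : ∀ i → v i < s
          v< i = lower (proj₁ (proj₂ (exists i)))
          v∈ : ∀ i → R (i * s + v i)
          v∈ i = lower (proj₂ (proj₂ (exists i)))
          ρ : ℕ → Fin s
          ρ i = fromℕ< (v< i)
          ρ≡ : ∀ i → v i ≡ toℕ (ρ i)
          ρ≡ i = sym (Fin.toℕ-fromℕ< (v< i))
          initially : ρ 0 ∈ˢ initial 𝔗
          initially = from (init C (ρ 0)) (subst B (ρ≡ 0) (lower (impliesᴱ (starts (v 0)) (lift (v< 0) , lift (v∈ 0)))))
          connected : ∀ i → ρ (suc i) ∈ˢ edges 𝔗 (ρ i)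
          connected i = from (edge C (ρ i) (ρ (suc i))) (subst₂ (λ a b → E (a * s + b)) (ρ≡ i) (ρ≡ (suc i))
            (lower (impliesᴱ (follows i (v i) (v (suc i))) (lift (v< i) , lift (v< (suc i)) , lift (v∈ i) ,
              lift (subst (λ j → R (j * s + v (suc i))) (ℕ.+-comm 1 i) (v∈ (suc i)))))))
          coded : ∀ i (p : Fin n) → p ∈ˢ label 𝔗 (ρ i) ⇔ Z (n * i + toℕ p)
          coded i p with labels i (v i) (toℕ p)
          ... | h = mk⇔
            (λ m → subst (λ k → Z (k * i + toℕ p)) N≡ (lower (impliesᴱ (proj₂ both)
               (lift (subst₂ (λ k a → L (k * a + toℕ p)) (sym N≡) (sym (ρ≡ i)) (to (lab C (ρ i) p) m))))))
            (λ z → from (lab C (ρ i) p) (subst₂ (λ k a → L (k * a + toℕ p)) N≡ (ρ≡ i)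
               (lower (impliesᴱ (proj₁ both) (lift (subst (λ k → Z (k * i + toℕ p)) (sym N≡) z))))))
            where
              N≡ = scaled {((numbers* ν s [ iᴺ ↦ i ]) [ vᴺ ↦ v i ]) [ uᴺ ↦ toℕ p ]} refl refl
              both = impliesᴱ h (lift (v< i) , lift (subst (toℕ p <_) (sym N≡) (Fin.toℕ<n p)) , lift (v∈ i))
      back : ∃[ t ] Codes t Z × member (Tr 𝔗) t → ⟨ numbers* ν s ∣ sets* α E B L [ traceᴺ ↦ Z ] ∣ γ ⟩ ⊨ᴬ isTrace n
      back (t , c , ρ , (initially , connected) , t≗) = R , exists , starts , follows , labels
        where
          -- The graph of `ρ`. By uniqueness of quotient and remainder it offers exactly one vertex
          -- at each position, so conditions on all offered vertices become conditions on `ρ`.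
          R : SetOfℕ
          R m = ∃[ i ] m ≡ i * s + toℕ (ρ i)
          only : ∀ {i u} → u < s → R (i * s + u) → u ≡ toℕ (ρ i)
          only {i} {u} u< (j , e) with divMod-unique s {i} {j} u< (Fin.toℕ<n (ρ j)) e
          ... | refl , e′ = e′
          exists : ∀ i → ∃[ v ] Lift 1ℓ (v < s) × Lift 1ℓ (R (i * s + v))
          exists i = toℕ (ρ i) , lift (Fin.toℕ<n (ρ i)) , lift (i , refl)
          starts : ∀ v → ¬ (Lift 1ℓ (v < s) × Lift 1ℓ (R (0 * s + v))) ⊎ Lift 1ℓ (B v)
          starts v = impliesᴵ λ (lift v< , lift r) → lift (subst B (sym (only {0} v< r)) (to (init C (ρ 0)) initially))
          follows : ∀ i u v → ¬ (Lift 1ℓ (u < s) × Lift 1ℓ (v < s) × Lift 1ℓ (R (i * s + u)) × Lift 1ℓ (R ((i + 1) * s + v))) ⊎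
            Lift 1ℓ (E (u * s + v))
          follows i u v = impliesᴵ λ (lift u< , lift v< , lift r , lift r′) →
            lift (subst₂ (λ a b → E (a * s + b)) (sym (only u< r)) (sym (trans (only v< r′) (cong (toℕ ∘ ρ) (ℕ.+-comm i 1))))
              (to (edge C (ρ i) (ρ (suc i))) (connected i)))
          letters : ∀ i p → t i ≡ label 𝔗 (ρ i) → Z (n * i + toℕ p) ⇔ L (n * toℕ (ρ i) + toℕ p)
          letters i p e = mk⇔ (λ z → to (lab C (ρ i) p) (subst (p ∈ˢ_) e (from (at-cell c i p) z)))
            (λ l → to (at-cell c i p) (subst (p ∈ˢ_) (sym e) (from (lab C (ρ i) p) l)))
          labels : ∀ i v u → _
          labels i v u = impliesᴵ λ (lift v< , lift u<N , lift r) →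
            let N≡ = scaled {((numbers* ν s [ iᴺ ↦ i ]) [ vᴺ ↦ v ]) [ uᴺ ↦ u ]} refl refl
                p  = fromℕ< (subst (u <_) N≡ u<N)
                u≡ = Fin.toℕ-fromℕ< (subst (u <_) N≡ u<N)
                e  = letters i p (t≗ i)
            in impliesᴵ (λ (lift z) → lift (subst₂ (λ k a → L (k * a + u)) (sym N≡) (sym (only v< r))
                  (subst (λ u → L (n * toℕ (ρ i) + u)) u≡ (to e (subst₂ (λ k u → Z (k * i + u)) N≡ (sym u≡) z))))) ,
               impliesᴵ (λ (lift l) → lift (subst (λ k → Z (k * i + u)) (sym N≡) (subst (λ u → Z (n * i + u)) u≡
                  (from e (subst (λ u → L (n * toℕ (ρ i) + u)) (sym u≡) (subst₂ (λ k a → L (k * a + u)) N≡ (only v< r) l))))))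

  module _ (Φ : XaFreeSentence n) where
    private
      φ = proj₁ Φ
      sentence = proj₁ (proj₂ Φ)
      Xa-free = proj₂ (proj₂ Φ)

    related : ∀ {D C α γ} → Represents D C →
      Related φ (⟨ (λ _ → nothing) ∣ (λ _ → nothing) ⟩ [ Xd ↦ˢ D ]) α (γ [ classᴺ Xd ↦ C ])
    Related.on-traces (related r) π h = ⊥-elim (proj₁ sentence π h)
    Related.on-sets (related r) X (inj₁ refl) = _ , refl , r
    Related.on-sets (related r) X (inj₂ h) with proj₂ sentence X h
    ... | inj₁ refl = ⊥-elim (Xa-free (free-occurs φ h))
    ... | inj₂ refl = _ , refl , r

    body-correct : ∀ {ν α γ} 𝔗 {E B L C} → CodesSystem 𝔗 E B L →
      (∀ Z → memberᶜ C Z ⇔ (∃[ t ] Codes t Z × member (Tr 𝔗) t)) →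
      Tr 𝔗 ⊨ Φ ⇔ ⟨ numbers* ν (size 𝔗) [ posᴺ ↦ 0 ] ∣ sets* α E B L ∣ γ [ classᴺ Xd ↦ C ] ⟩ ⊨ᴬ arithᴴ φ
    body-correct {ν} {α} {γ} 𝔗 {E} {B} {L} {C} S h =
      arithᴴ-correct φ (record { is-zero = refl ; is-one = refl ; is-pos = refl })
        (related {Tr 𝔗} {C} {sets* α E B L} {γ} λ t Z c → mk⇔ (λ m → from (h Z) (t , c , m)) (λ m → from (toClass-represents (Tr 𝔗) t Z c) (to (h Z) m)))

    satisfiable⇒true : FiniteStateSatisfiable Φ → ∀ v → v ⊨ᴬ arith φ
    satisfiable⇒true (𝔗 , h) ⟨ ν ∣ α ∣ γ ⟩ =
      0 , 1 , lift refl , ((λ ()) , lift refl) , s , E , B , L ,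
      (s≢0 , λ u → impliesᴵ λ (lift u<) → successor u u<) ,
      toClass (Tr 𝔗) , (λ Z → impliesᴵ (λ (lift m) → from (isTrace-correct {ν} {α} {γ [ classᴺ Xd ↦ toClass (Tr 𝔗) ]} 𝔗 C Z) m) , impliesᴵ (λ m → lift (to (isTrace-correct {ν} {α} {γ [ classᴺ Xd ↦ toClass (Tr 𝔗) ]} 𝔗 C Z) m))) ,
      0 , lift refl , to (body-correct 𝔗 C (λ Z → mk⇔ id id)) h
      where
        s = size 𝔗
        E B L : SetOfℕ
        E m = ∃[ u ] ∃[ v ] m ≡ toℕ u * s + toℕ v × v ∈ˢ edges 𝔗 u
        B m = ∃[ v ] m ≡ toℕ v × v ∈ˢ initial 𝔗
        L m = ∃[ v ] ∃[ p ] m ≡ n * toℕ v + toℕ p × p ∈ˢ label 𝔗 v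
        C : CodesSystem 𝔗 E B L
        edge C u v = mk⇔ (λ m → u , v , refl , m) λ (u′ , v′ , e , m) →
          case divMod-unique s {toℕ u} {toℕ u′} (Fin.toℕ<n v) (Fin.toℕ<n v′) e of λ (e₁ , e₂) →
          subst₂ (λ u v → v ∈ˢ edges 𝔗 u) (Fin.toℕ-injective (sym e₁)) (Fin.toℕ-injective (sym e₂)) m
        init C v = mk⇔ (λ m → v , refl , m) λ (v′ , e , m) → subst (_∈ˢ initial 𝔗) (Fin.toℕ-injective (sym e)) m
        lab C v p = mk⇔ (λ m → v , p , refl , m) λ (v′ , p′ , e , m) →
          case divMod-unique n {toℕ v} {toℕ v′} (Fin.toℕ<n p) (Fin.toℕ<n p′) (trans (sym (scale≡ (toℕ v) p)) (trans e (scale≡ (toℕ v′) p′))) of λ (e₁ , e₂) →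
          subst₂ (λ v p → p ∈ˢ label 𝔗 v) (Fin.toℕ-injective (sym e₁)) (Fin.toℕ-injective (sym e₂)) m
        s≢0 : ¬ Lift 1ℓ (s ≡ 0)
        s≢0 (lift e) = ≢-nonZero⁻¹ s {{size≢0 𝔗}} e
        successor : ∀ u → u < s → ∃[ v ] Lift 1ℓ (v < s) × Lift 1ℓ (E (u * s + v))
        successor u u< with serial 𝔗 (fromℕ< u<)
        ... | v , m = toℕ v , lift (Fin.toℕ<n v) , lift (fromℕ< u< , v , cong (λ a → a * s + toℕ v) (sym (Fin.toℕ-fromℕ< u<)) , m)

    true⇒satisfiable : ∀ v → v ⊨ᴬ arith φ → FiniteStateSatisfiable Φ
    true⇒satisfiable ⟨ ν ∣ α ∣ γ ⟩ (z , o , lift z≡ , (o≢ , lift o≡) , s , E , B , L , (s≢ , succ) , C , traces≡ , p , lift p≡ , h)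
      -- Cancellation turns `z + z ≡ z` into `z ≡ 0`, and `o * o ≡ o` with `o` nonzero into `o ≡ 1`.
      with ℕ.+-cancelˡ-≡ z z 0 (trans z≡ (sym (ℕ.+-identityʳ z)))
    ... | refl with ℕ.*-cancelʳ-≡ o 1 o {{≢-nonZero (o≢ ∘ lift)}} (trans o≡ (sym (ℕ.*-identityˡ o))) | p≡
    ...   | refl | refl = 𝔗 , from (body-correct 𝔗 C′ λ Z → mk⇔
              (λ m → to (isTrace-correct {ν} {α} {γ [ classᴺ Xd ↦ C ]} 𝔗 C′ Z) (impliesᴱ (proj₁ (traces≡ Z)) (lift m)))
              (λ m → lower (impliesᴱ (proj₂ (traces≡ Z)) (from (isTrace-correct {ν} {α} {γ [ classᴺ Xd ↦ C ]} 𝔗 C′ Z) m)))) h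
      where
        𝔗 : TransitionSystem n
        𝔗 = record
          { size    = s
          ; size≢0  = ≢-nonZero (s≢ ∘ lift)
          ; edges   = λ u → subset (λ v → E (toℕ u * s + toℕ v))
          ; serial  = λ u → case impliesᴱ (succ (toℕ u)) (lift (Fin.toℕ<n u)) of λ (v , lift v< , lift e) →
              fromℕ< v< , from (∈subset _ _) (subst (λ v → E (toℕ u * s + v)) (sym (Fin.toℕ-fromℕ< v<)) e)
          ; initial = subset (λ v → B (toℕ v))
          ; label   = λ v → subset (λ p → L (n * toℕ v + toℕ p))
          }
        C′ : CodesSystem 𝔗 E B L
        edge C′ u v = ∈subset _ v
        init C′ v   = ∈subset _ v
        lab C′ v p  = ∈subset _ p

-- From Hyper²LTL to arithmetic: the translation is a sentence

sort≡ᵇ : Sort → Sort → Bool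
sort≡ᵇ number number = true
sort≡ᵇ set    set    = true
sort≡ᵇ class  class  = true
sort≡ᵇ _      _      = false

Scope : Set
Scope = List (Sort × Name)

inScope : Sort × Name → Scope → Bool
inScope v       []            = false
inScope (τ , x) ((τ′ , y) ∷ Γ) = (sort≡ᵇ τ τ′ ∧ does (x ≟ᴺ y)) ∨ inScope (τ , x) Γ

ScopedTerm : Scope → Term → Set
ScopedTerm Γ (var x) = T (inScope (number , x) Γ)
ScopedTerm Γ (s ⊕ t) = ScopedTerm Γ s × ScopedTerm Γ t
ScopedTerm Γ (s ⊗ t) = ScopedTerm Γ s × ScopedTerm Γ t

-- A form of closedness that evaluates: on the fixed parts of the translation it reduces to unit
-- types, and only the numerals and the translated formula need an argument.
Scoped : Scope → Arith → Set
Scoped Γ (s ≈ t)    = ScopedTerm Γ s × ScopedTerm Γ t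
Scoped Γ (s ≺ t)    = ScopedTerm Γ s × ScopedTerm Γ t
Scoped Γ (t ∈₁ A)   = ScopedTerm Γ t × T (inScope (set , A) Γ)
Scoped Γ (A ∈₂ 𝒜)   = T (inScope (set , A) Γ) × T (inScope (class , 𝒜) Γ)
Scoped Γ (neg φ)    = Scoped Γ φ
Scoped Γ (φ and χ)  = Scoped Γ φ × Scoped Γ χ
Scoped Γ (φ or χ)   = Scoped Γ φ × Scoped Γ χ
Scoped Γ (∃⁰ x ∙ φ) = Scoped ((number , x) ∷ Γ) φ
Scoped Γ (∀⁰ x ∙ φ) = Scoped ((number , x) ∷ Γ) φ
Scoped Γ (∃¹ A ∙ φ) = Scoped ((set , A) ∷ Γ) φ
Scoped Γ (∀¹ A ∙ φ) = Scoped ((set , A) ∷ Γ) φ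
Scoped Γ (∃² 𝒜 ∙ φ) = Scoped ((class , 𝒜) ∷ Γ) φ
Scoped Γ (∀² 𝒜 ∙ φ) = Scoped ((class , 𝒜) ∷ Γ) φ

scoped-term : ∀ {Γ x} t → ScopedTerm Γ t → x OccursInTerm t → T (inScope (number , x) Γ)
scoped-term (var x) h refl = h
scoped-term (s ⊕ t) (h , _) (inj₁ f) = scoped-term s h f
scoped-term (s ⊕ t) (_ , h) (inj₂ f) = scoped-term t h f
scoped-term (s ⊗ t) (h , _) (inj₁ f) = scoped-term s h f
scoped-term (s ⊗ t) (_ , h) (inj₂ f) = scoped-term t h f

sort≡ᵇ-sound : ∀ τ τ′ → T (sort≡ᵇ τ τ′) → τ ≡ τ′
sort≡ᵇ-sound number number _ = refl
sort≡ᵇ-sound set    set    _ = refl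
sort≡ᵇ-sound class  class  _ = refl

inScope-tail : ∀ Γ v w → v ≢ w → T (inScope v (w ∷ Γ)) → T (inScope v Γ)
inScope-tail Γ (τ , x) (τ′ , y) v≢w h with sort≡ᵇ τ τ′ in e | x ≟ᴺ y
... | true  | yes refl = ⊥-elim (v≢w (cong (_, x) (sort≡ᵇ-sound τ τ′ (subst T (sym e) tt))))
... | true  | no _     = h
... | false | _        = h

scoped-free : ∀ Γ v φ → Scoped Γ φ → FreeIn v φ → T (inScope v Γ)
scoped-free Γ v (s ≈ t) (h , h′) (refl , inj₁ f) = scoped-term s h f
scoped-free Γ v (s ≈ t) (h , h′) (refl , inj₂ f) = scoped-term t h′ f
scoped-free Γ v (s ≺ t) (h , h′) (refl , inj₁ f) = scoped-term s h f
scoped-free Γ v (s ≺ t) (h , h′) (refl , inj₂ f) = scoped-term t h′ f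
scoped-free Γ v (t ∈₁ A) (h , h′) (inj₁ (refl , f)) = scoped-term t h f
scoped-free Γ v (t ∈₁ A) (h , h′) (inj₂ refl) = h′
scoped-free Γ v (A ∈₂ 𝒜) (h , h′) (inj₁ refl) = h
scoped-free Γ v (A ∈₂ 𝒜) (h , h′) (inj₂ refl) = h′
scoped-free Γ v (neg φ) h f = scoped-free Γ v φ h f
scoped-free Γ v (φ and χ) (h , _) (inj₁ f) = scoped-free Γ v φ h f
scoped-free Γ v (φ and χ) (_ , h) (inj₂ f) = scoped-free Γ v χ h f
scoped-free Γ v (φ or χ) (h , _) (inj₁ f) = scoped-free Γ v φ h f
scoped-free Γ v (φ or χ) (_ , h) (inj₂ f) = scoped-free Γ v χ h f
scoped-free Γ v (∃⁰ x ∙ φ) h (n , f) = inScope-tail Γ v _ n (scoped-free _ v φ h f)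
scoped-free Γ v (∀⁰ x ∙ φ) h (n , f) = inScope-tail Γ v _ n (scoped-free _ v φ h f)
scoped-free Γ v (∃¹ x ∙ φ) h (n , f) = inScope-tail Γ v _ n (scoped-free _ v φ h f)
scoped-free Γ v (∀¹ x ∙ φ) h (n , f) = inScope-tail Γ v _ n (scoped-free _ v φ h f)
scoped-free Γ v (∃² x ∙ φ) h (n , f) = inScope-tail Γ v _ n (scoped-free _ v φ h f)
scoped-free Γ v (∀² x ∙ φ) h (n , f) = inScope-tail Γ v _ n (scoped-free _ v φ h f)

∨-right : ∀ a {b} → T b → T (a ∨ b)
∨-right false h = h
∨-right true  _ = tt

inScope-head : ∀ x b → T (does (x ≟ᴺ x) ∨ b)
inScope-head x b with x ≟ᴺ x
... | yes _  = tt
... | no x≢x = ⊥-elim (x≢x refl)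

scoped-numeral : ∀ {Γ} k → T (inScope (number , zeroᴺ) Γ) → T (inScope (number , oneᴺ) Γ) → ScopedTerm Γ (numeral k)
scoped-numeral zero    z o = z
scoped-numeral (suc k) z o = o , scoped-numeral k z o

arithᴸ-scoped : ∀ {n} Γ (ψ : LTL n) →
  T (inScope (number , zeroᴺ) Γ) → T (inScope (number , oneᴺ) Γ) → T (inScope (number , posᴺ) Γ) →
  (∀ π → π OccursInLTL ψ → T (inScope (set , π) Γ)) → Scoped Γ (arithᴸ ψ)
arithᴸ-scoped {n} Γ (p at π) z o x h = ((scoped-numeral n z o , x) , scoped-numeral (toℕ p) z o) , h π refl
arithᴸ-scoped Γ (neg ψ)  z o x h = arithᴸ-scoped Γ ψ z o x h
arithᴸ-scoped Γ (ψ or χ) z o x h = arithᴸ-scoped Γ ψ z o x (λ π → h π ∘ inj₁) , arithᴸ-scoped Γ χ z o x (λ π → h π ∘ inj₂)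
arithᴸ-scoped Γ (next ψ) z o x h = (tt , x , o) , (tt , tt) , arithᴸ-scoped _ ψ z o tt h
arithᴸ-scoped Γ (ψ U χ)  z o x h = (tt , x) , ((tt , tt) , tt , tt) ,
  ((((tt , tt) , tt , tt) , tt , tt) , (tt , tt) , arithᴸ-scoped _ ψ z o tt (λ π → h π ∘ inj₁)) ,
  arithᴸ-scoped _ χ z o tt (λ π → h π ∘ inj₂)

arithᴴ-scoped : ∀ {n} Γ (φ : Hyper²LTL n) →
  T (inScope (number , zeroᴺ) Γ) → T (inScope (number , oneᴺ) Γ) → T (inScope (number , posᴺ) Γ) →
  T (inScope (class , classᴺ Xd) Γ) →
  (∀ π → π FreeTraceVarOf φ → T (inScope (set , π) Γ)) →
  (∀ X → X FreeSetVarOf φ → T (inScope (class , classᴺ X) Γ)) → Scoped Γ (arithᴴ φ)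

arithᴴ-scoped₂ : ∀ {n} Γ X (φ : Hyper²LTL n) →
  T (inScope (number , zeroᴺ) Γ) → T (inScope (number , oneᴺ) Γ) → T (inScope (number , posᴺ) Γ) →
  T (inScope (class , classᴺ Xd) Γ) →
  (∀ π → π FreeTraceVarOf φ → T (inScope (set , π) Γ)) →
  (∀ Y → Y ≢ X × Y FreeSetVarOf φ → T (inScope (class , classᴺ Y) Γ)) →
  (T (inScope (class , classᴺ X) ((set , elemᴺ) ∷ (class , classᴺ X) ∷ (class , savedᴺ) ∷ Γ)) ×
   T (inScope (class , savedᴺ) ((set , elemᴺ) ∷ (class , classᴺ X) ∷ (class , savedᴺ) ∷ Γ))) ×
  Scoped ((class , classᴺ X) ∷ (class , savedᴺ) ∷ Γ) (arithᴴ φ)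
arithᴴ-scoped₂ Γ X φ z o x d h g =
  (inScope-head (classᴺ X) _ , ∨-right (does (savedᴺ ≟ᴺ classᴺ X)) tt) ,
  arithᴴ-scoped Γ′ φ z o x (∨-right (does (classᴺ Xd ≟ᴺ classᴺ X)) d) h bound
  where
    Γ′ = (class , classᴺ X) ∷ (class , savedᴺ) ∷ Γ
    bound : ∀ Y → Y FreeSetVarOf φ → T (inScope (class , classᴺ Y) Γ′)
    bound Y f with Y ≟ˢ X
    ... | yes refl = inScope-head (classᴺ Y) _
    ... | no Y≢X   = ∨-right (does (classᴺ Y ≟ᴺ classᴺ X)) (∨-right (does (classᴺ Y ≟ᴺ savedᴺ)) (g Y (Y≢X , f)))

arithᴴ-scoped₁ : ∀ {n} Γ π X (φ : Hyper²LTL n) →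
  T (inScope (number , zeroᴺ) Γ) → T (inScope (number , oneᴺ) Γ) → T (inScope (number , posᴺ) Γ) →
  T (inScope (class , classᴺ Xd) Γ) →
  (∀ ρ → ρ ≢ π × ρ FreeTraceVarOf φ → T (inScope (set , ρ) Γ)) →
  (∀ Y → Y ≡ X ⊎ Y FreeSetVarOf φ → T (inScope (class , classᴺ Y) Γ)) →
  Scoped ((set , π) ∷ Γ) (π ∈₂ classᴺ X) × Scoped ((set , π) ∷ Γ) (arithᴴ φ)
arithᴴ-scoped₁ Γ π X φ z o x d h g =
  (inScope-head π _ , g X (inj₁ refl)) , arithᴴ-scoped ((set , π) ∷ Γ) φ z o x d bound (λ Y → g Y ∘ inj₂)
  where
    bound : ∀ ρ → ρ FreeTraceVarOf φ → T (inScope (set , ρ) ((set , π) ∷ Γ))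
    bound ρ f with ρ ≟ᴺ π
    ... | yes _  = tt
    ... | no ρ≢π = h ρ (ρ≢π , f)

arithᴴ-scoped Γ (∃₂ X ∙ φ) z o x d h g with arithᴴ-scoped₂ Γ X φ z o x d h g
... | (a , b) , s = ((tt , tt) , tt , d) , ((tt , a) , tt , b) , s
arithᴴ-scoped Γ (∀₂ X ∙ φ) z o x d h g with arithᴴ-scoped₂ Γ X φ z o x d h g
... | (a , b) , s = ((tt , tt) , tt , d) , ((tt , a) , tt , b) , s
arithᴴ-scoped Γ (∃₁ π ∈ X ∙ φ) z o x d h g = arithᴴ-scoped₁ Γ π X φ z o x d h g
arithᴴ-scoped Γ (∀₁ π ∈ X ∙ φ) z o x d h g = arithᴴ-scoped₁ Γ π X φ z o x d h g
arithᴴ-scoped Γ (ltl ψ) z o x d h g = arithᴸ-scoped Γ ψ z o x h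

arithSentence : ∀ {n} → XaFreeSentence n → ArithSentence
arithSentence {n} (φ , (closed , onlyX) , noXa) = arith φ , λ v → scoped-free [] v (arith φ) scoped
  where
    trace-numeral : ∀ {Γ} → T (inScope (number , zeroᴺ) Γ) → T (inScope (number , oneᴺ) Γ) → ScopedTerm Γ (numeral n)
    trace-numeral = scoped-numeral n
    Δ : Scope
    Δ = (class , classᴺ Xd) ∷ (set , labelᴺ) ∷ (set , initialᴺ) ∷ (set , edgesᴺ) ∷
        (number , sizeᴺ) ∷ (number , oneᴺ) ∷ (number , zeroᴺ) ∷ []
    onlyXd : ∀ X → X FreeSetVarOf φ → T (inScope (class , classᴺ X) ((number , posᴺ) ∷ Δ))
    onlyXd X f with onlyX X f
    ... | inj₁ refl = ⊥-elim (noXa (free-occurs φ f))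
    ... | inj₂ refl = tt
    isTrace-scoped : Scoped ((set , traceᴺ) ∷ Δ) (isTrace n)
    isTrace-scoped = _ , _ , _ , (_ , (_ , trace-numeral tt tt) , _) ,
      ((((trace-numeral tt tt , _) , _) , _) , ((trace-numeral tt tt , _) , _) , _) ,
      ((((trace-numeral tt tt , _) , _) , _) , ((trace-numeral tt tt , _) , _) , _)
    scoped : Scoped [] (arith φ)
    scoped = _ , _ , _ , ((_ , isTrace-scoped) , (isTrace-scoped , _)) , _ ,
      arithᴴ-scoped _ φ tt tt tt tt (λ π f → ⊥-elim (closed π f)) onlyXd

-- From Hyper²LTL to arithmetic: the reduction

forward : ExcludedMiddle 1ℓ → ∀ n → NonZero n → ClosedWorldFiniteStateSatisfiability n ≤ᵖ TruthInThirdOrderArithmetic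
forward em n n≢0 = arithSentence ,
  polynomialTime {ClosedWorldFiniteStateSatisfiability n} {TruthInThirdOrderArithmetic} arithSentence (ToArith.program n) time-polynomial
    (λ x → programᵂ (proj₁ x)) ,
  λ Φ → mk⇔ (satisfiable⇒true Φ) (λ h → true⇒satisfiable Φ ⟨ (λ _ → 0) ∣ (λ _ _ → ⊥) ∣ (λ _ → record { member = λ _ → ⊥ ; respect = λ _ () }) ⟩ (h _))
  where
    open ToArithTime n
    open ForwardSystem em n n≢0

-- From arithmetic to Hyper²LTL: the translation

-- Variables are numbered; k names both a trace variable and a set variable.

nm : ℕ → Name
nm k = replicate k I

data Source : Set where
  every : Source
  ix    : ℕ → Source

sourceVar : Source → SetVar
sourceVar every  = Xd
sourceVar (ix i) = var (nm i)

Prefix : Set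
Prefix = List (Bool × Source)

quantify₂ : ∀ {n} → Bool → SetVar → Hyper²LTL n → Hyper²LTL n
quantify₂ true  X φ = ∃₂ X ∙ φ
quantify₂ false X φ = ∀₂ X ∙ φ

quantify₁ : ∀ {n} → Bool → TraceVar → SetVar → Hyper²LTL n → Hyper²LTL n
quantify₁ true  π X φ = ∃₁ π ∈ X ∙ φ
quantify₁ false π X φ = ∀₁ π ∈ X ∙ φ

-- Each entry of a prefix binds a nonempty set and a trace; the first trace quantifier
-- only expresses that the set is nonempty.

prefixed : ∀ {n} → ℕ → Prefix → Hyper²LTL n → Hyper²LTL n
prefixed k []            φ = φ
prefixed k ((b , s) ∷ Q) φ =
  quantify₂ b (var (nm k)) (quantify₁ b (nm k) (var (nm k)) (quantify₁ b (nm k) (sourceVar s) (prefixed (suc k) Q φ)))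

after-prefix : ℕ → Prefix → ℕ
after-prefix k []      = k
after-prefix k (_ ∷ Q) = after-prefix (suc k) Q

Env : Set
Env = List (Sort × Name × ℕ)

find : Env → Sort → Name → ℕ
-- A default that a sentence never reaches. Level 0 is always bound already, so the bound on found
-- levels holds for all names without a condition on scope.
find []                τ x = 0
find ((τ′ , y , k) ∷ ρ) τ x = if sort≡ᵇ τ τ′ ∧ does (x ≟ᴺ y) then k else find ρ τ x

conj : ∀ {n} → LTL n → LTL n → LTL n
conj ψ χ = neg (neg ψ or neg χ)

iffᴸ : ∀ {n} → LTL n → LTL n → LTL n
iffᴸ ψ χ = conj ψ χ or neg (ψ or χ)

delay : ∀ {n} → ℕ → LTL n → LTL n
delay zero    ψ = ψ
delay (suc c) ψ = next (delay c ψ)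

module Gadgets (m : ℕ) where

  bitAt : ℕ → LTL (suc m)
  bitAt k = zero at nm k

  opaque
    -- Truth is expressed by a tautology about trace 0, which is bound in front of everything else.
    eventually : LTL (suc m) → LTL (suc m)
    eventually ψ = (bitAt 0 or neg (bitAt 0)) U ψ

  always : LTL (suc m) → LTL (suc m)
  always ψ = neg (eventually (neg ψ))

  -- Trace 0 marks the multiples of 3.

  somewhere : LTL (suc m) → LTL (suc m)
  somewhere ψ = eventually (conj (bitAt 0) ψ)

  -- A trace represents three sets of numbers, the c-th of which is { a ∣ bit 3a + c is on };
  -- numbers are represented by singletons.

  component : ℕ → ℕ → LTL (suc m)
  component c k = delay c (bitAt k)

  -- For two singletons this is equality of numbers, for a set and a singleton it is membership.
  meet : ℕ → ℕ → ℕ → ℕ → LTL (suc m)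
  meet c j d k = somewhere (conj (component c j) (component d k))

  -- The value of a variable or of an inner node of a term is always the third component of its
  -- trace; `link` delivers it to a slot, that is, to a component of another trace.
  link : ℕ → ℕ × ℕ → LTL (suc m)
  link r (j , c) = meet 2 r c j

  -- Three positions further means one number further, so for singletons the number in trace `j` is
  -- one more than that in trace `k`.
  successor : ℕ → ℕ → ℕ → ℕ → LTL (suc m)
  successor c j d k = somewhere (conj (component (c + 3) j) (component d k))

  singleton : ℕ → ℕ → LTL (suc m)
  singleton c k = conj (somewhere (component c k))
    (neg (somewhere (conj (component c k) (next (somewhere (component c k))))))

  sameSet : ℕ → ℕ → LTL (suc m)
  sameSet j k = conj (neg (somewhere (conj (component 2 j) (neg (component 2 k)))))
                     (neg (somewhere (conj (neg (component 2 j)) (component 2 k))))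

  nextᵀ : ℕ → Term → ℕ
  nextᵀ k (var x) = k
  nextᵀ k (s ⊕ t) = nextᵀ (nextᵀ (suc k) s) t
  nextᵀ k (s ⊗ t) = nextᵀ (nextᵀ (suc k) s) t

  prefixᵀ : Bool → Term → Prefix
  prefixᵀ b (var x) = []
  prefixᵀ b (s ⊕ t) = (b , ix 1) ∷ prefixᵀ b s ++ prefixᵀ b t
  prefixᵀ b (s ⊗ t) = (b , ix 2) ∷ prefixᵀ b s ++ prefixᵀ b t

  -- `slot` is the place where the value of the term is awaited. An inner node at level `k` sends
  -- its third component there and offers its first two components as slots to its operands.
  links : Env → ℕ → ℕ × ℕ → Term → List (LTL (suc m))
  links ρ k slot (var x) = link (find ρ number x) slot ∷ []
  links ρ k slot (s ⊕ t) = link k slot ∷ links ρ (suc k) (k , 0) s ++ links ρ (nextᵀ (suc k) s) (k , 1) t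
  links ρ k slot (s ⊗ t) = link k slot ∷ links ρ (suc k) (k , 0) s ++ links ρ (nextᵀ (suc k) s) (k , 1) t

  -- The empty conjunction is the bit of trace 0 at the start, which is on because 0 is a multiple
  -- of 3.
  conjs : List (LTL (suc m)) → LTL (suc m)
  conjs = foldr conj (bitAt 0)

  nextᶠ : ℕ → Arith → ℕ
  nextᶠ k (s ≈ t)    = nextᵀ (nextᵀ (suc k) s) t
  nextᶠ k (s ≺ t)    = nextᵀ (nextᵀ (suc k) s) t
  nextᶠ k (t ∈₁ A)   = nextᵀ (suc k) t
  nextᶠ k (A ∈₂ 𝒜)   = suc k
  nextᶠ k (neg φ)    = nextᶠ k φ
  nextᶠ k (φ and χ)  = nextᶠ (nextᶠ k φ) χ
  nextᶠ k (φ or χ)   = nextᶠ (nextᶠ k φ) χ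
  nextᶠ k (∃⁰ x ∙ φ) = nextᶠ (suc k) φ
  nextᶠ k (∀⁰ x ∙ φ) = nextᶠ (suc k) φ
  nextᶠ k (∃¹ A ∙ φ) = nextᶠ (suc k) φ
  nextᶠ k (∀¹ A ∙ φ) = nextᶠ (suc k) φ
  nextᶠ k (∃² 𝒜 ∙ φ) = nextᶠ (suc k) φ
  nextᶠ k (∀² 𝒜 ∙ φ) = nextᶠ (suc k) φ

  -- Prenex form: `b` is the parity of the negations above, so an existential quantifier keeps the
  -- sign `b` and a universal one gets `not b`. The auxiliary triples of an atom are existential and
  -- follow the same rule. Connectives simply concatenate prefixes, because levels are never reused.
  prefixᶠ : Env → ℕ → Bool → Arith → Prefix
  prefixᶠ ρ k b (s ≈ t)    = (b , ix 1) ∷ prefixᵀ b s ++ prefixᵀ b t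
  prefixᶠ ρ k b (s ≺ t)    = (b , ix 1) ∷ prefixᵀ b s ++ prefixᵀ b t
  prefixᶠ ρ k b (t ∈₁ A)   = (b , ix 1) ∷ prefixᵀ b t
  prefixᶠ ρ k b (A ∈₂ 𝒜)   = (b , ix (find ρ class 𝒜)) ∷ []
  prefixᶠ ρ k b (neg φ)    = prefixᶠ ρ k (not b) φ
  prefixᶠ ρ k b (φ and χ)  = prefixᶠ ρ k b φ ++ prefixᶠ ρ (nextᶠ k φ) b χ
  prefixᶠ ρ k b (φ or χ)   = prefixᶠ ρ k b φ ++ prefixᶠ ρ (nextᶠ k φ) b χ
  -- A number is drawn as the third component of a triple in the graph of addition. This guarantees
  -- a singleton, and every number `a` is available as `a + 0`.
  prefixᶠ ρ k b (∃⁰ x ∙ φ) = (b , ix 1) ∷ prefixᶠ ((number , x , k) ∷ ρ) (suc k) b φ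
  prefixᶠ ρ k b (∀⁰ x ∙ φ) = (not b , ix 1) ∷ prefixᶠ ((number , x , k) ∷ ρ) (suc k) b φ
  prefixᶠ ρ k b (∃¹ A ∙ φ) = (b , every) ∷ prefixᶠ ((set , A , k) ∷ ρ) (suc k) b φ
  prefixᶠ ρ k b (∀¹ A ∙ φ) = (not b , every) ∷ prefixᶠ ((set , A , k) ∷ ρ) (suc k) b φ
  -- Here the set bound by the entry is what matters; the trace is drawn from that same set.
  prefixᶠ ρ k b (∃² 𝒜 ∙ φ) = (b , ix k) ∷ prefixᶠ ((class , 𝒜 , k) ∷ ρ) (suc k) b φ
  prefixᶠ ρ k b (∀² 𝒜 ∙ φ) = (not b , ix k) ∷ prefixᶠ ((class , 𝒜 , k) ∷ ρ) (suc k) b φ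

  matrixᶠ : Env → ℕ → Arith → LTL (suc m)
  matrixᶠ ρ k (s ≈ t)    = conj (component 1 k) (conjs (links ρ (suc k) (k , 0) s ++ links ρ (nextᵀ (suc k) s) (k , 2) t))
  matrixᶠ ρ k (s ≺ t)    = conj (neg (component 1 k)) (conjs (links ρ (suc k) (k , 0) s ++ links ρ (nextᵀ (suc k) s) (k , 2) t))
  matrixᶠ ρ k (t ∈₁ A)   = conjs (links ρ (suc k) (k , 2) t ++ link (find ρ set A) (k , 2) ∷ [])
  matrixᶠ ρ k (A ∈₂ 𝒜)   = conj (sameSet (find ρ set A) k) (bitAt k)
  matrixᶠ ρ k (neg φ)    = neg (matrixᶠ ρ k φ)
  matrixᶠ ρ k (φ and χ)  = conj (matrixᶠ ρ k φ) (matrixᶠ ρ (nextᶠ k φ) χ)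
  matrixᶠ ρ k (φ or χ)   = matrixᶠ ρ k φ or matrixᶠ ρ (nextᶠ k φ) χ
  matrixᶠ ρ k (∃⁰ x ∙ φ) = matrixᶠ ((number , x , k) ∷ ρ) (suc k) φ
  matrixᶠ ρ k (∀⁰ x ∙ φ) = matrixᶠ ((number , x , k) ∷ ρ) (suc k) φ
  matrixᶠ ρ k (∃¹ A ∙ φ) = matrixᶠ ((set , A , k) ∷ ρ) (suc k) φ
  matrixᶠ ρ k (∀¹ A ∙ φ) = matrixᶠ ((set , A , k) ∷ ρ) (suc k) φ
  matrixᶠ ρ k (∃² 𝒜 ∙ φ) = matrixᶠ ((class , 𝒜 , k) ∷ ρ) (suc k) φ
  matrixᶠ ρ k (∀² 𝒜 ∙ φ) = matrixᶠ ((class , 𝒜 , k) ∷ ρ) (suc k) φ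

  -- Set 1 contains the triples (a , b , a + b) and set 2 the triples (a , b , a * b): there is one for
  -- all a and b (totality), and recursion on b shows that its third component is right.

  group : Source → Source → Source → Prefix
  group s₁ s₂ s₃ = (false , s₁) ∷ (true , s₂) ∷ (true , s₃) ∷ []

  -- The numerals are the levels fixed by `wholePrefix`: 0 to 2 for the constants, then three
  -- consecutive levels per group, 3 to 5 for totality, 6 to 8 for addition, 9 to 11 for
  -- multiplication and 12 to 14 for prepending. In the recursion for multiplication, trace 11 is
  -- the sum that leads from `a * b` to `a * (1 + b)`.
  marking totality additive multiplicative prepending axioms : LTL (suc m)
  marking = conj (bitAt 0) (conj (neg (component 1 0)) (conj (neg (component 2 0)) (always (iffᴸ (bitAt 0) (component 3 0)))))
  totality = neg (conj (singleton 0 3) (singleton 1 3)) or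
    (conj (conj (meet 0 3 0 4) (meet 1 3 1 4)) (conj (meet 0 3 0 5) (meet 1 3 1 5)))
  additive = conj (conj (singleton 0 6) (conj (singleton 1 6) (singleton 2 6)))
    (conj (component 1 6) (meet 0 6 2 6) or
     conj (meet 0 6 0 7) (conj (successor 1 6 1 7) (successor 2 6 2 7)))
  multiplicative = conj (conj (singleton 0 9) (conj (singleton 1 9) (singleton 2 9)))
    (conj (component 1 9) (component 2 9) or
     conj (meet 0 9 0 10) (conj (successor 1 9 1 10) (conj (meet 0 11 2 10) (conj (meet 1 11 0 9) (meet 2 11 2 9)))))
  prepending = conj (conj (neg (bitAt 13)) (bitAt 14))
    (conj (always (iffᴸ (next (bitAt 13)) (bitAt 12))) (always (iffᴸ (next (bitAt 14)) (bitAt 12))))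
  axioms = conj marking (conj totality (conj additive (conj multiplicative prepending)))

  -- Level 0 supplies the marking trace. Levels 1 and 2 draw their trace from the set that they
  -- bind, and these sets become the graphs of addition and multiplication.
  constants : Prefix
  constants = (true , every) ∷ (true , ix 1) ∷ (true , ix 2) ∷ []

  axiomPrefix : Prefix
  axiomPrefix = group every (ix 1) (ix 2) ++ group (ix 1) (ix 1) every ++ group (ix 2) (ix 2) (ix 1) ++ group every every every

  firstFree : ℕ
  firstFree = 15

  wholePrefix : Arith → Prefix
  wholePrefix φ = constants ++ axiomPrefix ++ prefixᶠ [] firstFree true φ

  wholeMatrix : Arith → LTL (suc m)
  wholeMatrix φ = conj axioms (matrixᶠ [] firstFree φ)

  hyper : Arith → Hyper²LTL (suc m)
  hyper φ = prefixed 0 (wholePrefix φ) (ltl (wholeMatrix φ))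

-- From arithmetic to Hyper²LTL: prefixes as games

nm-injective : ∀ {j k} → nm j ≡ nm k → j ≡ k
nm-injective {j} {k} e = trans (sym (List.length-replicate j)) (trans (cong length e) (List.length-replicate k))

module Game (m : ℕ) where

  Asg : Set₁
  Asg = Assignment (suc m)

  bind : ℕ → Asg → TraceSet (suc m) → Trace (suc m) → Trace (suc m) → Asg
  bind k Π D u t = ((Π [ var (nm k) ↦ˢ D ]) [ nm k ↦ᵗ u ]) [ nm k ↦ᵗ t ]

  record Legal (k : ℕ) (s : Source) (Π : Asg) (D : TraceSet (suc m)) (u t : Trace (suc m)) : Set₁ where
    constructor legal
    field
      bounded   : D ⊆[ Π ]Xd
      witness   : u ∈[ Π [ var (nm k) ↦ˢ D ] ] var (nm k)
      in-source : t ∈[ (Π [ var (nm k) ↦ˢ D ]) [ nm k ↦ᵗ u ] ] sourceVar s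

  -- The weakest precondition of `P` under the quantifier prefix, that is, a winning strategy of the
  -- existential player. Since `P` is arbitrary, it may be another game, and prefixes can be cut
  -- anywhere.
  Game : ℕ → Prefix → (Asg → Set₁) → Asg → Set₁
  Game k []                P Π = P Π
  Game k ((true  , s) ∷ Q) P Π = ∃[ D ] ∃[ u ] ∃[ t ] Legal k s Π D u t × Game (suc k) Q P (bind k Π D u t)
  Game k ((false , s) ∷ Q) P Π = ∀ D u t → Legal k s Π D u t → Game (suc k) Q P (bind k Π D u t)

  prefixed-game : ∀ k Q φ {Π} → Π ⊨ᶜʷ prefixed k Q φ ⇔ Game k Q (_⊨ᶜʷ φ) Π
  prefixed-game k []                φ = mk⇔ id id
  prefixed-game k ((true  , s) ∷ Q) φ = mk⇔
    (λ (D , D⊆ , u , u∈ , t , t∈ , h) → D , u , t , legal D⊆ u∈ t∈ , to (prefixed-game (suc k) Q φ) h)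
    (λ (D , u , t , legal D⊆ u∈ t∈ , h) → D , D⊆ , u , u∈ , t , t∈ , from (prefixed-game (suc k) Q φ) h)
  prefixed-game k ((false , s) ∷ Q) φ = mk⇔
    (λ h D u t (legal D⊆ u∈ t∈) → to (prefixed-game (suc k) Q φ) (h D D⊆ u u∈ t t∈))
    (λ h D D⊆ u u∈ t t∈ → from (prefixed-game (suc k) Q φ) (h D u t (legal D⊆ u∈ t∈)))

  game-mono : ∀ k Q {P P′ : Asg → Set₁} {Π} → (∀ {Π} → P Π → P′ Π) → Game k Q P Π → Game k Q P′ Π
  game-mono k []                f h = f h
  game-mono k ((true  , s) ∷ Q) f (D , u , t , l , h) = D , u , t , l , game-mono (suc k) Q f h
  game-mono k ((false , s) ∷ Q) f h = λ D u t l → game-mono (suc k) Q f (h D u t l)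

  game-++ : ∀ k Q Q′ {P Π} → Game k (Q ++ Q′) P Π ⇔ Game k Q (Game (after-prefix k Q) Q′ P) Π
  game-++ k []                Q′ = mk⇔ id id
  game-++ k ((true  , s) ∷ Q) Q′ = mk⇔
    (λ (D , u , t , l , h) → D , u , t , l , to (game-++ (suc k) Q Q′) h)
    (λ (D , u , t , l , h) → D , u , t , l , from (game-++ (suc k) Q Q′) h)
  game-++ k ((false , s) ∷ Q) Q′ = mk⇔
    (λ h D u t l → to (game-++ (suc k) Q Q′) (h D u t l))
    (λ h D u t l → from (game-++ (suc k) Q Q′) (h D u t l))

  dual : Prefix → Prefix
  dual = map λ (b , s) → not b , s

  -- Two strategies for opposite goals are played against each other, and the resulting assignment
  -- is contradictory.
  game-dual : ∀ k Q {P Π} → Game k (dual Q) (¬_ ∘ P) Π → ¬ Game k Q P Π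
  game-dual k []                h g = h g
  game-dual k ((true  , s) ∷ Q) h (D , u , t , l , g) = game-dual (suc k) Q (h D u t l) g
  game-dual k ((false , s) ∷ Q) (D , u , t , l , h) g = game-dual (suc k) Q h (g D u t l)

  data ValidSource (k : ℕ) : Source → Set where
    every : ValidSource k every
    ix    : ∀ {i} → i ≤ k → ValidSource k (ix i)

  Valid : ℕ → Prefix → Set
  Valid k []            = ⊤
  Valid k ((b , s) ∷ Q) = ValidSource k s × Valid (suc k) Q

  infix 4 _~[_]_

  -- Agreement on all that was bound before level `k`. Every move at level `k` or later preserves
  -- it, so it records what survives the rest of a play.
  record _~[_]_ (Π : Asg) (k : ℕ) (Π′ : Asg) : Set₁ where
    field
      same-trace : ∀ {j} → j < k → traces Π (nm j) ≡ traces Π′ (nm j)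
      same-set   : ∀ {j} → j < k → sets Π (var (nm j)) ≡ sets Π′ (var (nm j))
      same-Xd    : sets Π Xd ≡ sets Π′ Xd

  open _~[_]_ public

  ~-refl : ∀ {Π k} → Π ~[ k ] Π
  ~-refl = record { same-trace = λ _ → refl ; same-set = λ _ → refl ; same-Xd = refl }

  ~-trans : ∀ {Π Π′ Π″ k k′} → k ≤ k′ → Π ~[ k ] Π′ → Π′ ~[ k′ ] Π″ → Π ~[ k ] Π″
  ~-trans k≤k′ e e′ = record
    { same-trace = λ j< → trans (same-trace e j<) (same-trace e′ (ℕ.≤-trans j< k≤k′))
    ; same-set   = λ j< → trans (same-set e j<) (same-set e′ (ℕ.≤-trans j< k≤k′))
    ; same-Xd    = trans (same-Xd e) (same-Xd e′)
    }

  ~-bind : ∀ {Π k D u t} → Π ~[ k ] bind k Π D u t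
  ~-bind {Π} {k} {D} {u} {t} = record
    { same-trace = λ j<k → sym (trans (update-other _≟ᴺ_ _ (just t) (ℕ.<⇒≢ j<k ∘ nm-injective))
                                      (update-other _≟ᴺ_ (traces Π) (just u) (ℕ.<⇒≢ j<k ∘ nm-injective)))
    ; same-set   = λ j<k → sym (update-other _≟ˢ_ (sets Π) (just D) (ℕ.<⇒≢ j<k ∘ nm-injective ∘ var-injective))
    ; same-Xd    = refl
    }
    where
      var-injective : ∀ {x y} → SetVar.var x ≡ var y → x ≡ y
      var-injective refl = refl

  bind-trace : ∀ {Π k D u t} → traces (bind k Π D u t) (nm k) ≡ just t
  bind-trace {Π} {k} {D} {u} {t} = update-same _≟ᴺ_ _ (nm k) (just t)

  bind-set : ∀ {Π k D u t} → sets (bind k Π D u t) (var (nm k)) ≡ just D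
  bind-set {Π} {k} {D} {u} {t} = update-same _≟ˢ_ _ (var (nm k)) (just D)

  k≤after : ∀ k Q → k ≤ after-prefix k Q
  k≤after k []      = ℕ.≤-refl
  k≤after k (_ ∷ Q) = ℕ.≤-trans (ℕ.n≤1+n k) (k≤after (suc k) Q)

  -- For each polarity b: the player who moves at the quantifiers of sign "true" can make M true
  -- if b and V holds, respectively make M false if b is false and V fails, without touching variables below k.

  Holds : ∀ {ℓ} → Bool → Set ℓ → Set ℓ
  Holds true  A = A
  Holds false A = ¬ A

  -- The outcome is conditional on the truth value of `V`, so a strategy is available whichever way
  -- `V` turns out. This allows the prefixes of two subformulas to be played one after the other
  -- without knowing which of them will decide the result.
  record Strategy (b : Bool) (k : ℕ) (Q : Prefix) (M : Asg → Set) (V : Set₁) (Π : Asg) : Set₂ where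
    constructor strategy
    field play : ∀ (P : Asg → Set₁) → (∀ Π′ → Π ~[ k ] Π′ → (Holds b V → Holds b (M Π′)) → P Π′) → Game k Q P Π

  open Strategy public

  StableFrom : ℕ → (Asg → Set) → Set₁
  StableFrom k M = ∀ {Π Π′} → Π ~[ k ] Π′ → M Π ⇔ M Π′

module Strategies (em : ExcludedMiddle 1ℓ) (m : ℕ) where
  open Classical em
  open Game m

  holds-map : ∀ {ℓ ℓ′ b} {A : Set ℓ} {A′ : Set ℓ′} → A ⇔ A′ → Holds b A → Holds b A′
  holds-map {b = true}  e h = to e h
  holds-map {b = false} e h = h ∘ from e

  strategy-cong : ∀ {b k Q M M′ V V′ Π} → (∀ Π′ → M Π′ ⇔ M′ Π′) → V ⇔ V′ → Strategy b k Q M V Π → Strategy b k Q M′ V′ Π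
  strategy-cong {b} f g s = strategy λ P h → play s P λ Π′ e w → h Π′ e λ v →
    holds-map {b = b} (f Π′) (w (holds-map {b = b} (mk⇔ (from g) (to g)) v))

  strategy-static : ∀ {b k M V Π} → (∀ {Π′} → Π ~[ k ] Π′ → M Π′ ⇔ V) → Strategy b k [] M V Π
  strategy-static {b} f = strategy λ P h → h _ ~-refl (holds-map {b = b} (mk⇔ (from (f ~-refl)) (to (f ~-refl))))

  strategy-neg : ∀ b {k Q M V Π} → Strategy (not b) k Q M V Π → Strategy b k Q (¬_ ∘ M) (¬ V) Π
  strategy-neg true  s = strategy λ P h → play s P h
  strategy-neg false s = strategy λ P h → play s P λ Π′ e w → h Π′ e λ ¬¬v ¬m → ¬m (w (stable ¬¬v))

  -- The second prefix starts at the level where the first one ended, and `M` reads only what lies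
  -- below that level; the outcome of the first play therefore survives the second.
  strategy-or : ∀ b {k k′ Q Q′ M M′ V V′ Π} → after-prefix k Q ≡ k′ → StableFrom k′ M →
    Strategy b k Q M V Π → (∀ {Π′} → Π ~[ k ] Π′ → Strategy b k′ Q′ M′ V′ Π′) →
    Strategy b k (Q ++ Q′) (λ Π → M Π ⊎ M′ Π) (V ⊎ V′) Π
  strategy-or b {k} {_} {Q} {Q′} refl st s s′ = strategy λ P h → from (game-++ k Q Q′)
    (play s _ λ Π′ e w → play (s′ e) P λ Π″ e′ w′ → h Π″ (~-trans (k≤after k Q) e e′) (combine b (holds-map {b = b} (st e′) ∘ w) w′))
    where
      combine : ∀ b {A B : Set₁} {C D : Set} → (Holds b A → Holds b C) → (Holds b B → Holds b D) → Holds b (A ⊎ B) → Holds b (C ⊎ D)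
      combine true  f g (inj₁ a) = inj₁ (f a)
      combine true  f g (inj₂ b) = inj₂ (g b)
      combine false f g h (inj₁ c) = f (h ∘ inj₁) c
      combine false f g h (inj₂ d) = g (h ∘ inj₂) d

  ×⇔ : {A B : Set} → (¬ (¬ A ⊎ ¬ B)) ⇔ (A × B)
  ×⇔ {A} {B} = mk⇔ f (λ (a , b) → λ { (inj₁ ¬a) → ¬a a ; (inj₂ ¬b) → ¬b b })
    where
      f : ¬ (¬ A ⊎ ¬ B) → A × B
      f h with em₀ {A} | em₀ {B}
      ... | yes a | yes b = a , b
      ... | no ¬a | _     = ⊥-elim (h (inj₁ ¬a))
      ... | _     | no ¬b = ⊥-elim (h (inj₂ ¬b))

  ×⇔₁ : {A B : Set₁} → (¬ (¬ A ⊎ ¬ B)) ⇔ (A × B)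
  ×⇔₁ {A} {B} = mk⇔ (λ h → stable (h ∘ inj₁) , stable (h ∘ inj₂)) (λ (a , b) → λ { (inj₁ ¬a) → ¬a a ; (inj₂ ¬b) → ¬b b })

  strategy-not-not : ∀ b {k Q M V Π} → Strategy b k Q M V Π → Strategy (not (not b)) k Q M V Π
  strategy-not-not true  s = s
  strategy-not-not false s = s

  -- De Morgan: a disjunction of negations at the opposite polarity.
  strategy-and : ∀ b {k k′ Q Q′ M M′ V V′ Π} → after-prefix k Q ≡ k′ → StableFrom k′ M →
    Strategy b k Q M V Π → (∀ {Π′} → Π ~[ k ] Π′ → Strategy b k′ Q′ M′ V′ Π′) →
    Strategy b k (Q ++ Q′) (λ Π → M Π × M′ Π) (V × V′) Π
  strategy-and b {M = M} {M′} e st s s′ = strategy-cong (λ Π → ×⇔) ×⇔₁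
    (strategy-neg b (strategy-or (not b) e (λ r → mk⇔ (λ h → h ∘ from (st r)) (λ h → h ∘ to (st r)))
      (strategy-neg (not b) (strategy-not-not b s)) (λ r → strategy-neg (not b) (strategy-not-not b (s′ r)))))

  -- Moves need to match elements of `A` only through the representation `R`. At polarity `true` the
  -- strategy plays a witness of `V`, or `a₀` as some legal move when `V` fails; at polarity `false`
  -- the opponent moves, and `answer` reads off which element that move stands for.
  strategy-ex : ∀ {ℓ} {A : Set ℓ} (R : A → Asg → Set₁) b {k s Q M V Π} {V′ : A → Set₁} → A →
    (V → Σ A V′) → (∀ {a} → V′ a → V) →
    (∀ a → ∃[ D ] ∃[ u ] ∃[ t ] Legal k s Π D u t × R a (bind k Π D u t)) →
    (∀ {D u t} → Legal k s Π D u t → ∃[ a ] R a (bind k Π D u t)) →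
    (∀ {a Π′} → Π ~[ k ] Π′ → R a Π′ → Strategy b (suc k) Q M (V′ a) Π′) →
    Strategy b k ((b , s) ∷ Q) M V Π
  strategy-ex {A = A} R true {k} {s} {Q} {M} {V} {Π} {V′} a₀ f g choose answer strat = strategy result
    where
      module _ (P : Asg → Set₁) (h : ∀ Π′ → Π ~[ k ] Π′ → (V → M Π′) → P Π′) where
        move-to : (a : A) → (V → V′ a) → Game k ((true , s) ∷ Q) P Π
        move-to a v with choose a
        ... | D , u , t , l , r = D , u , t , l ,
          play (strat ~-bind r) P λ Π′ e w → h Π′ (~-trans (ℕ.n≤1+n k) ~-bind e) (w ∘ v)
        result : Game k ((true , s) ∷ Q) P Π
        result with em {V}
        ... | yes v = move-to (proj₁ (f v)) (λ _ → proj₂ (f v))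
        ... | no ¬v = move-to a₀ (⊥-elim ∘ ¬v)
  strategy-ex {A = A} R false {k} {s} {Q} {M} {V} {Π} a₀ f g choose answer strat = strategy result
    where
      result : ∀ (P : Asg → Set₁) → (∀ Π′ → Π ~[ k ] Π′ → (¬ V → ¬ M Π′) → P Π′) → Game k ((false , s) ∷ Q) P Π
      result P h D u t l with answer l
      ... | a , r = play (strat ~-bind r) P λ Π′ e w → h Π′ (~-trans (ℕ.n≤1+n k) ~-bind e) (λ ¬v → w (¬v ∘ g))

  -- A universal quantifier is a negated existential one over the negated matrix, which explains the
  -- sign `not b`.
  strategy-all : ∀ {ℓ} {A : Set ℓ} (R : A → Asg → Set₁) b {k s Q M V Π} {V′ : A → Set₁} → A →
    (∀ {a} → ¬ V′ a → ¬ V) → (¬ V → Σ A (¬_ ∘ V′)) →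
    (∀ a → ∃[ D ] ∃[ u ] ∃[ t ] Legal k s Π D u t × R a (bind k Π D u t)) →
    (∀ {D u t} → Legal k s Π D u t → ∃[ a ] R a (bind k Π D u t)) →
    (∀ {a Π′} → Π ~[ k ] Π′ → R a Π′ → Strategy b (suc k) Q M (V′ a) Π′) →
    Strategy b k ((not b , s) ∷ Q) M V Π
  strategy-all R b a₀ g g′ choose answer strat =
    strategy-cong (λ Π → mk⇔ (λ ¬¬m → stable₀ ¬¬m) (λ x ¬x → ¬x x)) (mk⇔ stable (λ x ¬x → ¬x x))
      (strategy-neg b (strategy-ex R (not b) a₀ g′ g choose answer
        (λ e r → strategy-neg (not b) (strategy-not-not b (strat e r)))))
    where
      stable₀ : {A : Set} → ¬ ¬ A → A
      stable₀ {A} ¬¬a with em₀ {A}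
      ... | yes a = a
      ... | no ¬a = ⊥-elim (¬¬a ¬a)

  -- All sources are nonempty when every bound set is, so a play always exists.

  record Inhabited (k : ℕ) (Π : Asg) : Set₁ where
    field
      all-set  : ∃[ D ] ∃[ t ] sets Π Xd ≡ just D × member D t
      each-set : ∀ {j} → j < k → ∃[ D ] ∃[ t ] sets Π (var (nm j)) ≡ just D × member D t

  open Inhabited

  ∈-just : ∀ {Π : Asg} {X D t} → sets Π X ≡ just D → member D t → t ∈[ Π ] X
  ∈-just {Π} {X} e h with sets Π X
  ∈-just refl h | just _ = just h

  just-∈ : ∀ {Π : Asg} {X D t} → sets Π X ≡ just D → t ∈[ Π ] X → member D t
  just-∈ {Π} {X} e h with sets Π X
  just-∈ refl (just h) | just _ = h

  legal-every : ∀ {k Π D u t} → sets Π Xd ≡ just D → member D u → member D t → Legal k every Π D u t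
  legal-every {k} {Π} {D} e u∈ t∈ = legal (λ t h → ∈-just {Π} e h)
    (∈-just {Π [ var (nm k) ↦ˢ D ]} {var (nm k)} (update-same _≟ˢ_ (sets Π) (var (nm k)) (just D)) u∈) (∈-just {Π} e t∈)

  legal-ix : ∀ {k i Π D D′ t} → i < k → sets Π Xd ≡ just D → sets Π (var (nm i)) ≡ just D′ → member D′ t →
    ∀ {u} → member D u → Legal k (ix i) Π D u t
  legal-ix {k} {i} {Π} {D} i<k e e′ t∈ {u} u∈ = legal (λ t h → ∈-just {Π} e h)
    (∈-just {Π [ var (nm k) ↦ˢ D ]} {var (nm k)} (update-same _≟ˢ_ (sets Π) (var (nm k)) (just D)) u∈)
    (∈-just {(Π [ var (nm k) ↦ˢ D ]) [ nm k ↦ᵗ u ]} {var (nm i)} (trans (sym (same-set (~-bind {Π} {k} {D} {u} {u}) i<k)) e′) t∈)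

  legal-self : ∀ {k Π D D′ t} → sets Π Xd ≡ just D → (∀ t → member D′ t → member D t) → member D′ t → Legal k (ix k) Π D′ t t
  legal-self {k} {Π} {D} {D′} {t} e sub t∈ = legal (λ t h → ∈-just {Π} e (sub t h))
    (∈-just {Π [ var (nm k) ↦ˢ D′ ]} {var (nm k)} (update-same _≟ˢ_ (sets Π) (var (nm k)) (just D′)) t∈)
    (∈-just {(Π [ var (nm k) ↦ˢ D′ ]) [ nm k ↦ᵗ t ]} {var (nm k)} (update-same _≟ˢ_ (sets Π) (var (nm k)) (just D′)) t∈)

  inhabited-bind : ∀ {k s Π D u t} → Inhabited k Π → Legal k s Π D u t → Inhabited (suc k) (bind k Π D u t)
  all-set (inhabited-bind h l) = all-set h
  each-set (inhabited-bind {k} {s} {Π} {D} {u} {t} h l) {j} j≤k with ℕ.m≤n⇒m<n∨m≡n (ℕ.≤-pred j≤k)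
  ... | inj₂ refl = D , u , bind-set {Π} {k} {D} {u} {t} ,
    just-∈ {Π [ var (nm k) ↦ˢ D ]} {var (nm k)} (update-same _≟ˢ_ (sets Π) (var (nm k)) (just D)) (Legal.witness l)
  ... | inj₁ j<k with each-set h j<k
  ...   | D′ , t′ , e , m = D′ , t′ , trans (sym (same-set (~-bind {Π} {k} {D} {u} {t}) j<k)) e , m

  some-legal : ∀ {k s Π} → Inhabited k Π → ValidSource k s → ∃[ D ] ∃[ u ] ∃[ t ] Legal k s Π D u t
  some-legal {k} {every} {Π} h every with all-set h
  ... | D , t , e , m = D , t , t , legal-every e m m
  some-legal {k} {ix i} {Π} h (ix i≤k) with ℕ.m≤n⇒m<n∨m≡n i≤k | all-set h
  ... | inj₂ refl | D , t , e , m = D , t , t , legal-self e (λ _ → id) m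
  ... | inj₁ i<k | D , t , e , m with each-set h i<k
  ...   | D′ , t′ , e′ , m′ = D , t , t′ , legal-ix i<k e e′ m′ m

  -- Gets behind a prefix whose particular moves are of no interest: the strategy is followed and
  -- the opponent moves arbitrarily, but legally.
  some-play : ∀ k Q {P Π} → Inhabited k Π → Valid k Q → Game k Q P Π →
    ∃[ Π′ ] Π ~[ k ] Π′ × Inhabited (after-prefix k Q) Π′ × P Π′
  some-play k []                h v g = _ , ~-refl , h , g
  some-play k ((true  , s) ∷ Q) h (_ , v) (D , u , t , l , g) with some-play (suc k) Q (inhabited-bind h l) v g
  ... | Π′ , e , h′ , p = Π′ , ~-trans (ℕ.n≤1+n k) ~-bind e , h′ , p
  some-play k ((false , s) ∷ Q) h (vs , v) g with some-legal h vs
  ... | D , u , t , l with some-play (suc k) Q (inhabited-bind h l) v (g D u t l)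
  ...   | Π′ , e , h′ , p = Π′ , ~-trans (ℕ.n≤1+n k) ~-bind e , h′ , p

-- From arithmetic to Hyper²LTL: meaning of the gadgets

record Component (w : ℕ → Set) (c a : ℕ) : Set where
  constructor comp
  field only : ∀ x → w (3 * x + c) ⇔ x ≡ a

open Component

component-unique : ∀ {w c a b} → Component w c a → Component w c b → a ≡ b
component-unique {a = a} u v = to (only v a) (from (only u a) refl)

component-cong : ∀ {w w′ c a} → (∀ i → w i ⇔ w′ i) → Component w c a → Component w′ c a
component-cong e u = comp λ x → mk⇔ (to (only u x) ∘ from (e _)) (to (e _) ∘ from (only u x))

Triple : (ℕ → Set) → ℕ → ℕ → ℕ → Set
Triple w a b c = Component w 0 a × Component w 1 b × Component w 2 c

triple-cong : ∀ {w w′ a b c} → (∀ i → w i ⇔ w′ i) → Triple w a b c → Triple w′ a b c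
triple-cong e (u , v , x) = component-cong e u , component-cong e v , component-cong e x

bits∈ : ∀ {m} → Trace (suc m) → ℕ → Set
bits∈ t i = zero ∈ˢ t i

module Meaning (em : ExcludedMiddle 1ℓ) (m : ℕ) where
  open Classical em
  open Game m
  open Strategies em m
  open Gadgets m

  bitOf : Asg → ℕ → ℕ → Set
  bitOf Π k i = traces Π at-pos i ⊩ bitAt k

  bitOf-trace : ∀ {Π k t} → traces Π (nm k) ≡ just t → ∀ i → bits∈ t i ⇔ bitOf Π k i
  bitOf-trace {Π} {k} e i with traces Π (nm k)
  bitOf-trace refl i | just _ = mk⇔ just (λ where (just h) → h)

  bitOf-same : ∀ {Π Π′ k} → traces Π (nm k) ≡ traces Π′ (nm k) → ∀ i → bitOf Π k i ⇔ bitOf Π′ k i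
  bitOf-same {Π} {Π′} e i = mk⇔ (subst (Any _) e) (subst (Any _) (sym e))

  module _ {Π : TraceAssignment (suc m)} where

    conj-⇔ : ∀ {i} ψ χ → Π at-pos i ⊩ conj ψ χ ⇔ (Π at-pos i ⊩ ψ × Π at-pos i ⊩ χ)
    conj-⇔ ψ χ = ×⇔

    delay-⇔ : ∀ i c ψ → Π at-pos i ⊩ delay c ψ ⇔ Π at-pos (i + c) ⊩ ψ
    delay-⇔ i zero    ψ = mk⇔ (subst (Π at-pos_⊩ ψ) (sym (ℕ.+-identityʳ i))) (subst (Π at-pos_⊩ ψ) (ℕ.+-identityʳ i))
    delay-⇔ i (suc c) ψ = mk⇔ (subst (Π at-pos_⊩ ψ) (ℕ.+-assoc i 1 c) ∘ to (delay-⇔ (i + 1) c ψ))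
      (from (delay-⇔ (i + 1) c ψ) ∘ subst (Π at-pos_⊩ ψ) (sym (ℕ.+-assoc i 1 c)))

    opaque
      unfolding eventually

      eventually-⇔ : ∀ i ψ → Π at-pos i ⊩ eventually ψ ⇔ (∃[ j ] Π at-pos (i + j) ⊩ ψ)
      eventually-⇔ i ψ = mk⇔ (λ (j , h , _) → j , h) (λ (j , h) → j , h , λ _ _ → tautology)
        where
          tautology : {A : Set} → A ⊎ ¬ A
          tautology {A} with em₀ {A}
          ... | yes a = inj₁ a
          ... | no ¬a = inj₂ ¬a

    always-⇔ : ∀ ψ → Π at-pos 0 ⊩ always ψ ⇔ (∀ i → Π at-pos i ⊩ ψ)
    always-⇔ ψ = mk⇔ (λ h i → stable₀ (λ ¬p → h (from (eventually-⇔ 0 (neg ψ)) (i , ¬p))))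
                     (λ h p → let (i , ¬p) = to (eventually-⇔ 0 (neg ψ)) p in ¬p (h i))
      where
        stable₀ : {A : Set} → ¬ ¬ A → A
        stable₀ {A} ¬¬a with em₀ {A}
        ... | yes a = a
        ... | no ¬a = ⊥-elim (¬¬a ¬a)

    iff-⇔ : ∀ {i} ψ χ → Π at-pos i ⊩ iffᴸ ψ χ ⇔ (Π at-pos i ⊩ ψ ⇔ Π at-pos i ⊩ χ)
    iff-⇔ {i} ψ χ = mk⇔
      (λ { (inj₁ h) → let (a , b) = to (conj-⇔ ψ χ) h in mk⇔ (λ _ → b) (λ _ → a)
         ; (inj₂ h) → mk⇔ (⊥-elim ∘ h ∘ inj₁) (⊥-elim ∘ h ∘ inj₂) })
      (λ e → decide e)
      where
        decide : (Π at-pos i ⊩ ψ ⇔ Π at-pos i ⊩ χ) → Π at-pos i ⊩ iffᴸ ψ χ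
        decide e with em₀ {Π at-pos i ⊩ ψ}
        ... | yes a = inj₁ (from (conj-⇔ ψ χ) (a , to e a))
        ... | no ¬a = inj₂ λ { (inj₁ a) → ¬a a ; (inj₂ b) → ¬a (from e b) }

  Marked : Asg → Set
  Marked Π = ∀ i → bitOf Π 0 i ⇔ (∃[ a ] i ≡ 3 * a)

  module _ {Π : Asg} (mk : Marked Π) where

    somewhere-from : ∀ i ψ → traces Π at-pos i ⊩ somewhere ψ ⇔ (∃[ a ] i ≤ 3 * a × traces Π at-pos (3 * a) ⊩ ψ)
    somewhere-from i ψ = mk⇔ there back
      where
        there : traces Π at-pos i ⊩ somewhere ψ → ∃[ a ] i ≤ 3 * a × traces Π at-pos (3 * a) ⊩ ψ
        there h with to (eventually-⇔ i (conj (bitAt 0) ψ)) h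
        ... | j , g with to (conj-⇔ {traces Π} (bitAt 0) ψ) g
        ...   | b , p with to (mk (i + j)) b
        ...     | a , e = a , subst (i ≤_) e (ℕ.m≤m+n i j) , subst (traces Π at-pos_⊩ ψ) e p
        back : ∃[ a ] i ≤ 3 * a × traces Π at-pos (3 * a) ⊩ ψ → traces Π at-pos i ⊩ somewhere ψ
        back (a , i≤ , p) = from (eventually-⇔ i (conj (bitAt 0) ψ)) (3 * a ∸ i ,
          subst (traces Π at-pos_⊩ conj (bitAt 0) ψ) (sym (ℕ.m+[n∸m]≡n i≤)) (from (conj-⇔ {traces Π} (bitAt 0) ψ) (from (mk (3 * a)) (a , refl) , p)))

    somewhere-⇔ : ∀ ψ → traces Π at-pos 0 ⊩ somewhere ψ ⇔ (∃[ a ] traces Π at-pos (3 * a) ⊩ ψ)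
    somewhere-⇔ ψ = mk⇔ (λ h → let (a , _ , p) = to (somewhere-from 0 ψ) h in a , p) (λ (a , p) → from (somewhere-from 0 ψ) (a , z≤n , p))

    meet-⇔ : ∀ c j d k → traces Π at-pos 0 ⊩ meet c j d k ⇔ (∃[ a ] bitOf Π j (3 * a + c) × bitOf Π k (3 * a + d))
    meet-⇔ c j d k = mk⇔
      (λ h → let (a , p) = to (somewhere-⇔ (conj (component c j) (component d k))) h ; (x , y) = to (conj-⇔ {traces Π} (component c j) (component d k)) p in
             a , to (delay-⇔ {traces Π} (3 * a) c (bitAt j)) x , to (delay-⇔ {traces Π} (3 * a) d (bitAt k)) y)
      (λ (a , x , y) → from (somewhere-⇔ (conj (component c j) (component d k))) (a , from (conj-⇔ {traces Π} (component c j) (component d k))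
             (from (delay-⇔ {traces Π} (3 * a) c (bitAt j)) x , from (delay-⇔ {traces Π} (3 * a) d (bitAt k)) y)))

    meet-components : ∀ {c j d k a b} → Component (bitOf Π j) c a → Component (bitOf Π k) d b →
      traces Π at-pos 0 ⊩ meet c j d k ⇔ a ≡ b
    meet-components {c} {j} {d} {k} {a} u v = mk⇔
      (λ h → let (x , p , q) = to (meet-⇔ c j d k) h in trans (sym (to (only u x) p)) (to (only v x) q))
      (λ e → from (meet-⇔ c j d k) (a , from (only u a) refl , from (only v a) e))

    successor-components : ∀ {c j d k a b} → Component (bitOf Π j) c a → Component (bitOf Π k) d b →
      traces Π at-pos 0 ⊩ successor c j d k ⇔ a ≡ suc b
    successor-components {c} {j} {d} {k} {a} {b} u v = mk⇔
      (λ h → let (x , p , q) = to (meet-⇔ (c + 3) j d k) h in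
             trans (sym (to (only u (suc x)) (subst (bitOf Π j) (shift x c) p))) (cong suc (to (only v x) q)))
      (λ e → from (meet-⇔ (c + 3) j d k) (b , subst (bitOf Π j) (sym (shift b c)) (from (only u (suc b)) (sym e)) , from (only v b) refl))
      where
        shift : ∀ x c → 3 * x + (c + 3) ≡ 3 * suc x + c
        shift = solve-∀

    component-zero : ∀ {c k a} → Component (bitOf Π k) c a → traces Π at-pos 0 ⊩ component c k ⇔ a ≡ 0
    component-zero {c} {k} u = mk⇔ (λ h → sym (to (only u 0) (to (delay-⇔ {traces Π} 0 c (bitAt k)) h)))
                                   (λ e → from (delay-⇔ {traces Π} 0 c (bitAt k)) (from (only u 0) (sym e)))

    singleton-⇔ : ∀ c k → traces Π at-pos 0 ⊩ singleton c k ⇔ (∃[ a ] Component (bitOf Π k) c a)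
    singleton-⇔ c k = mk⇔ there back
      where
        C L : LTL (suc m)
        C = component c k
        L = conj C (next (somewhere C))
        at′ : ∀ x → traces Π at-pos (3 * x) ⊩ C ⇔ bitOf Π k (3 * x + c)
        at′ x = delay-⇔ {traces Π} (3 * x) c (bitAt k)
        cancel : ∀ {x y} → 3 * x + 1 ≤ 3 * y → x < y
        cancel {x} {y} h = ℕ.*-cancelˡ-< 3 x y (subst (_≤ 3 * y) (ℕ.+-comm (3 * x) 1) h)
        extend : ∀ {x y} → x < y → 3 * x + 1 ≤ 3 * y
        extend {x} {y} h = subst (_≤ 3 * y) (ℕ.+-comm 1 (3 * x)) (ℕ.*-monoʳ-< 3 h)
        there : traces Π at-pos 0 ⊩ singleton c k → ∃[ a ] Component (bitOf Π k) c a
        there h with to (conj-⇔ {traces Π} (somewhere C) (neg (somewhere L))) h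
        ... | p , q with to (somewhere-⇔ C) p
        ...   | a , pa = a , comp λ x → mk⇔ (unique x) (λ { refl → to (at′ a) pa })
          where
            clash : ∀ {x y} → x < y → bitOf Π k (3 * x + c) → bitOf Π k (3 * y + c) → ⊥
            clash {x} {y} x<y bx by = q (from (somewhere-⇔ L) (x , from (conj-⇔ {traces Π} C (next (somewhere C)))
              (from (at′ x) bx , from (somewhere-from (3 * x + 1) C) (y , extend x<y , from (at′ y) by))))
            unique : ∀ x → bitOf Π k (3 * x + c) → x ≡ a
            unique x bx with ℕ.<-cmp x a
            ... | tri< x<a _ _ = ⊥-elim (clash x<a bx (to (at′ a) pa))
            ... | tri≈ _ e _   = e
            ... | tri> _ _ a<x = ⊥-elim (clash a<x (to (at′ a) pa) bx)
        back : ∃[ a ] Component (bitOf Π k) c a → traces Π at-pos 0 ⊩ singleton c k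
        back (a , u) = from (conj-⇔ {traces Π} (somewhere C) (neg (somewhere L)))
          ( from (somewhere-⇔ C) (a , from (at′ a) (from (only u a) refl))
          , λ h → let (x , p) = to (somewhere-⇔ L) h
                      (p₁ , p₂) = to (conj-⇔ {traces Π} C (next (somewhere C))) p
                      (y , lt , p₃) = to (somewhere-from (3 * x + 1) C) p₂
                  in ℕ.<⇒≢ (cancel lt) (trans (to (only u x) (to (at′ x) p₁)) (sym (to (only u y) (to (at′ y) p₃)))) )

    sameSet-⇔ : ∀ j k → traces Π at-pos 0 ⊩ sameSet j k ⇔ (∀ a → bitOf Π j (3 * a + 2) ⇔ bitOf Π k (3 * a + 2))
    sameSet-⇔ j k = mk⇔ there back
      where
        J K onlyJ onlyK : LTL (suc m)
        J = component 2 j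
        K = component 2 k
        onlyJ = conj J (neg K)
        onlyK = conj (neg J) K
        onJ : ∀ a → traces Π at-pos (3 * a) ⊩ J ⇔ bitOf Π j (3 * a + 2)
        onJ a = delay-⇔ {traces Π} (3 * a) 2 (bitAt j)
        onK : ∀ a → traces Π at-pos (3 * a) ⊩ K ⇔ bitOf Π k (3 * a + 2)
        onK a = delay-⇔ {traces Π} (3 * a) 2 (bitAt k)
        decide : {A : Set} → ¬ ¬ A → A
        decide {A} ¬¬a with em₀ {A}
        ... | yes a = a
        ... | no ¬a = ⊥-elim (¬¬a ¬a)
        there : traces Π at-pos 0 ⊩ sameSet j k → ∀ a → bitOf Π j (3 * a + 2) ⇔ bitOf Π k (3 * a + 2)
        there h a with to (conj-⇔ {traces Π} (neg (somewhere onlyJ)) (neg (somewhere onlyK))) h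
        ... | p , q = mk⇔
          (λ x → decide (λ ¬y → p (from (somewhere-⇔ onlyJ) (a , from (conj-⇔ {traces Π} J (neg K)) (from (onJ a) x , ¬y ∘ to (onK a))))))
          (λ y → decide (λ ¬x → q (from (somewhere-⇔ onlyK) (a , from (conj-⇔ {traces Π} (neg J) K) (¬x ∘ to (onJ a) , from (onK a) y)))))
        back : (∀ a → bitOf Π j (3 * a + 2) ⇔ bitOf Π k (3 * a + 2)) → traces Π at-pos 0 ⊩ sameSet j k
        back h = from (conj-⇔ {traces Π} (neg (somewhere onlyJ)) (neg (somewhere onlyK)))
          ( (λ s → let (a , p) = to (somewhere-⇔ onlyJ) s ; (x , ¬y) = to (conj-⇔ {traces Π} J (neg K)) p in ¬y (from (onK a) (to (h a) (to (onJ a) x))))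
          , (λ s → let (a , p) = to (somewhere-⇔ onlyK) s ; (¬x , y) = to (conj-⇔ {traces Π} (neg J) K) p in ¬x (from (onJ a) (from (h a) (to (onK a) y)))) )

-- From arithmetic to Hyper²LTL: variable bounds

module Bounds (m : ℕ) where
  open Game m
  open Gadgets m

  Below : ℕ → LTL (suc m) → Set
  Below k (p at π) = ∃[ j ] j < k × π ≡ nm j
  Below k (neg ψ)  = Below k ψ
  Below k (ψ or χ) = Below k ψ × Below k χ
  Below k (next ψ) = Below k ψ
  Below k (ψ U χ)  = Below k ψ × Below k χ

  name-below : ℕ → Name → Bool
  name-below zero    _       = false
  name-below (suc k) []      = true
  name-below (suc k) (O ∷ _) = false
  name-below (suc k) (I ∷ x) = name-below k x

  name-below-sound : ∀ k x → T (name-below k x) → ∃[ j ] j < k × x ≡ nm j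
  name-below-sound (suc k) []      _ = 0 , s≤s z≤n , refl
  name-below-sound (suc k) (I ∷ x) h with name-below-sound k x h
  ... | j , j<k , e = suc j , s≤s j<k , cong (I ∷_) e

  -- A decision procedure, so that the bounds for the fixed axioms hold by evaluation.
  below : ℕ → LTL (suc m) → Bool
  below k (p at π) = name-below k π
  below k (neg ψ)  = below k ψ
  below k (ψ or χ) = below k ψ ∧ below k χ
  below k (next ψ) = below k ψ
  below k (ψ U χ)  = below k ψ ∧ below k χ

  ∧-split : ∀ a {b} → T (a ∧ b) → T a × T b
  ∧-split true h = tt , h

  below-sound : ∀ k ψ → T (below k ψ) → Below k ψ
  below-sound k (p at π) h = name-below-sound k π h
  below-sound k (neg ψ)  h = below-sound k ψ h
  below-sound k (ψ or χ) h with ∧-split (below k ψ) h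
  ... | a , b = below-sound k ψ a , below-sound k χ b
  below-sound k (next ψ) h = below-sound k ψ h
  below-sound k (ψ U χ)  h with ∧-split (below k ψ) h
  ... | a , b = below-sound k ψ a , below-sound k χ b

  below-weaken : ∀ {k k′} ψ → k ≤ k′ → Below k ψ → Below k′ ψ
  below-weaken (p at π) h (j , j<k , e)   = j , ℕ.≤-trans j<k h , e
  below-weaken (neg ψ)  h b       = below-weaken ψ h b
  below-weaken (ψ or χ) h (b , c) = below-weaken ψ h b , below-weaken χ h c
  below-weaken (next ψ) h b       = below-weaken ψ h b
  below-weaken (ψ U χ)  h (b , c) = below-weaken ψ h b , below-weaken χ h c

  below-stable : ∀ {k Π Π′} ψ → Below k ψ → Π ~[ k ] Π′ → ∀ i → traces Π at-pos i ⊩ ψ ⇔ traces Π′ at-pos i ⊩ ψ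
  below-stable (p at π) (j , j<k , refl) e i = mk⇔ (subst (Any _) (same-trace e j<k)) (subst (Any _) (sym (same-trace e j<k)))
  below-stable (neg ψ)  b e i = mk⇔ (λ h → h ∘ from (below-stable ψ b e i)) (λ h → h ∘ to (below-stable ψ b e i))
  below-stable (ψ or χ) (b , c) e i = mk⇔
    (λ { (inj₁ h) → inj₁ (to (below-stable ψ b e i) h) ; (inj₂ h) → inj₂ (to (below-stable χ c e i) h) })
    (λ { (inj₁ h) → inj₁ (from (below-stable ψ b e i) h) ; (inj₂ h) → inj₂ (from (below-stable χ c e i) h) })
  below-stable (next ψ) b e i = below-stable ψ b e (i + 1)
  below-stable (ψ U χ)  (b , c) e i = mk⇔
    (λ (j , h , g) → j , to (below-stable χ c e (i + j)) h , λ j′ l → to (below-stable ψ b e (i + j′)) (g j′ l))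
    (λ (j , h , g) → j , from (below-stable χ c e (i + j)) h , λ j′ l → from (below-stable ψ b e (i + j′)) (g j′ l))

  bit-below : ∀ {j k} → j < k → Below k (bitAt j)
  bit-below {j} h = j , h , refl

  delay-below : ∀ {k} c ψ → Below k ψ → Below k (delay c ψ)
  delay-below zero    ψ h = h
  delay-below (suc c) ψ h = delay-below c ψ h

  opaque
    unfolding eventually

    eventually-below : ∀ {k} ψ → 0 < k → Below k ψ → Below k (eventually ψ)
    eventually-below ψ z h = (bit-below z , bit-below z) , h

    axioms-below : Below firstFree axioms
    axioms-below = below-sound firstFree axioms tt

    totality-below : Below 6 totality
    totality-below = below-sound 6 totality tt

    additive-below : Below 9 additive
    additive-below = below-sound 9 additive tt

    multiplicative-below : Below 12 multiplicative
    multiplicative-below = below-sound 12 multiplicative tt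

    prepending-below : Below 15 prepending
    prepending-below = below-sound 15 prepending tt

  meet-below : ∀ {k} c {i} d {j} → 0 < k → i < k → j < k → Below k (meet c i d j)
  meet-below c {i} d {j} z h h′ = eventually-below (conj (bitAt 0) (conj (component c i) (component d j))) z
    (bit-below z , delay-below c _ (bit-below h) , delay-below d _ (bit-below h′))

  EachBelow : ℕ → List (LTL (suc m)) → Set
  EachBelow k []      = ⊤
  EachBelow k (ψ ∷ L) = Below k ψ × EachBelow k L

  eachBelow-++ : ∀ {k} L {L′} → EachBelow k L → EachBelow k L′ → EachBelow k (L ++ L′)
  eachBelow-++ []      _       h = h
  eachBelow-++ (ψ ∷ L) (a , b) h = a , eachBelow-++ L b h

  eachBelow-weaken : ∀ {k k′} L → k ≤ k′ → EachBelow k L → EachBelow k′ L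
  eachBelow-weaken []      h _       = tt
  eachBelow-weaken (ψ ∷ L) h (a , b) = below-weaken ψ h a , eachBelow-weaken L h b

  conjs-below : ∀ {k} L → 0 < k → EachBelow k L → Below k (conjs L)
  conjs-below []      z _       = bit-below z
  conjs-below (ψ ∷ L) z (a , b) = a , conjs-below L z b

  record EnvBelow (k : ℕ) (ρ : Env) : Set where
    constructor found-below
    field found : ∀ τ x → find ρ τ x < k

  open EnvBelow public

  envBelow-weaken : ∀ {k k′ ρ} → k ≤ k′ → EnvBelow k ρ → EnvBelow k′ ρ
  envBelow-weaken h e = found-below λ τ x → ℕ.≤-trans (found e τ x) h

  envBelow-cons : ∀ {k ρ} τ x → EnvBelow k ρ → EnvBelow (suc k) ((τ , x , k) ∷ ρ)
  found (envBelow-cons τ x e) τ′ y with sort≡ᵇ τ′ τ ∧ does (y ≟ᴺ x)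
  ... | true  = ℕ.≤-refl
  ... | false = ℕ.≤-trans (found e τ′ y) (ℕ.n≤1+n _)

  k≤nextᵀ : ∀ k t → k ≤ nextᵀ k t
  k≤nextᵀ k (var x) = ℕ.≤-refl
  k≤nextᵀ k (s ⊕ t) = ℕ.≤-trans (ℕ.n≤1+n k) (ℕ.≤-trans (k≤nextᵀ (suc k) s) (k≤nextᵀ _ t))
  k≤nextᵀ k (s ⊗ t) = ℕ.≤-trans (ℕ.n≤1+n k) (ℕ.≤-trans (k≤nextᵀ (suc k) s) (k≤nextᵀ _ t))

  k≤nextᶠ : ∀ k φ → k ≤ nextᶠ k φ
  k≤nextᶠ k (s ≈ t)    = ℕ.≤-trans (ℕ.n≤1+n k) (ℕ.≤-trans (k≤nextᵀ (suc k) s) (k≤nextᵀ _ t))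
  k≤nextᶠ k (s ≺ t)    = ℕ.≤-trans (ℕ.n≤1+n k) (ℕ.≤-trans (k≤nextᵀ (suc k) s) (k≤nextᵀ _ t))
  k≤nextᶠ k (t ∈₁ A)   = ℕ.≤-trans (ℕ.n≤1+n k) (k≤nextᵀ (suc k) t)
  k≤nextᶠ k (A ∈₂ 𝒜)   = ℕ.n≤1+n k
  k≤nextᶠ k (neg φ)    = k≤nextᶠ k φ
  k≤nextᶠ k (φ and χ)  = ℕ.≤-trans (k≤nextᶠ k φ) (k≤nextᶠ _ χ)
  k≤nextᶠ k (φ or χ)   = ℕ.≤-trans (k≤nextᶠ k φ) (k≤nextᶠ _ χ)
  k≤nextᶠ k (∃⁰ x ∙ φ) = ℕ.≤-trans (ℕ.n≤1+n k) (k≤nextᶠ (suc k) φ)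
  k≤nextᶠ k (∀⁰ x ∙ φ) = ℕ.≤-trans (ℕ.n≤1+n k) (k≤nextᶠ (suc k) φ)
  k≤nextᶠ k (∃¹ x ∙ φ) = ℕ.≤-trans (ℕ.n≤1+n k) (k≤nextᶠ (suc k) φ)
  k≤nextᶠ k (∀¹ x ∙ φ) = ℕ.≤-trans (ℕ.n≤1+n k) (k≤nextᶠ (suc k) φ)
  k≤nextᶠ k (∃² x ∙ φ) = ℕ.≤-trans (ℕ.n≤1+n k) (k≤nextᶠ (suc k) φ)
  k≤nextᶠ k (∀² x ∙ φ) = ℕ.≤-trans (ℕ.n≤1+n k) (k≤nextᶠ (suc k) φ)

  after-++ : ∀ k Q Q′ → after-prefix k (Q ++ Q′) ≡ after-prefix (after-prefix k Q) Q′
  after-++ k []      Q′ = refl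
  after-++ k (_ ∷ Q) Q′ = after-++ (suc k) Q Q′

  after-prefixᵀ : ∀ b k t → after-prefix k (prefixᵀ b t) ≡ nextᵀ k t
  after-prefixᵀ₂ : ∀ b k s t → after-prefix k (prefixᵀ b s ++ prefixᵀ b t) ≡ nextᵀ (nextᵀ k s) t
  after-prefixᵀ b k (var x) = refl
  after-prefixᵀ b k (s ⊕ t) = after-prefixᵀ₂ b (suc k) s t
  after-prefixᵀ b k (s ⊗ t) = after-prefixᵀ₂ b (suc k) s t
  after-prefixᵀ₂ b k s t = trans (after-++ k (prefixᵀ b s) _)
    (trans (cong (λ i → after-prefix i (prefixᵀ b t)) (after-prefixᵀ b k s)) (after-prefixᵀ b _ t))

  after-prefixᶠ : ∀ ρ k b φ → after-prefix k (prefixᶠ ρ k b φ) ≡ nextᶠ k φ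
  after-prefixᶠ₂ : ∀ ρ k b φ χ → after-prefix k (prefixᶠ ρ k b φ ++ prefixᶠ ρ (nextᶠ k φ) b χ) ≡ nextᶠ (nextᶠ k φ) χ
  after-prefixᶠ ρ k b (s ≈ t)    = after-prefixᵀ₂ b (suc k) s t
  after-prefixᶠ ρ k b (s ≺ t)    = after-prefixᵀ₂ b (suc k) s t
  after-prefixᶠ ρ k b (t ∈₁ A)   = after-prefixᵀ b (suc k) t
  after-prefixᶠ ρ k b (A ∈₂ 𝒜)   = refl
  after-prefixᶠ ρ k b (neg φ)    = after-prefixᶠ ρ k (not b) φ
  after-prefixᶠ ρ k b (φ and χ)  = after-prefixᶠ₂ ρ k b φ χ
  after-prefixᶠ ρ k b (φ or χ)   = after-prefixᶠ₂ ρ k b φ χ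
  after-prefixᶠ ρ k b (∃⁰ x ∙ φ) = after-prefixᶠ _ (suc k) b φ
  after-prefixᶠ ρ k b (∀⁰ x ∙ φ) = after-prefixᶠ _ (suc k) b φ
  after-prefixᶠ ρ k b (∃¹ x ∙ φ) = after-prefixᶠ _ (suc k) b φ
  after-prefixᶠ ρ k b (∀¹ x ∙ φ) = after-prefixᶠ _ (suc k) b φ
  after-prefixᶠ ρ k b (∃² x ∙ φ) = after-prefixᶠ _ (suc k) b φ
  after-prefixᶠ ρ k b (∀² x ∙ φ) = after-prefixᶠ _ (suc k) b φ
  after-prefixᶠ₂ ρ k b φ χ = trans (after-++ k (prefixᶠ ρ k b φ) _)
    (trans (cong (λ i → after-prefix i (prefixᶠ ρ (nextᶠ k φ) b χ)) (after-prefixᶠ ρ k b φ)) (after-prefixᶠ ρ _ b χ))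

  links-below : ∀ {ρ} k {j} c t → EnvBelow k ρ → j < k → EachBelow (nextᵀ k t) (links ρ k (j , c) t)
  links-below₂ : ∀ {ρ} k {j} c₁ c₂ s t → EnvBelow k ρ → j < suc k →
    EachBelow (nextᵀ (nextᵀ (suc k) s) t) (links ρ (suc k) (j , c₁) s ++ links ρ (nextᵀ (suc k) s) (j , c₂) t)
  links-below {ρ} k {j} c (var x) e j<k = meet-below 2 {find ρ number x} c {j} (ℕ.≤-<-trans z≤n j<k) (found e number x) j<k , tt
  links-below k {j} c (s ⊕ t) e j<k =
    below-weaken (link k (j , c)) (ℕ.≤-trans (k≤nextᵀ (suc k) s) (k≤nextᵀ _ t)) (meet-below 2 {k} c {j} (s≤s z≤n) ℕ.≤-refl (ℕ.m≤n⇒m≤1+n j<k)) ,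
    links-below₂ k 0 1 s t e ℕ.≤-refl
  links-below k {j} c (s ⊗ t) e j<k =
    below-weaken (link k (j , c)) (ℕ.≤-trans (k≤nextᵀ (suc k) s) (k≤nextᵀ _ t)) (meet-below 2 {k} c {j} (s≤s z≤n) ℕ.≤-refl (ℕ.m≤n⇒m≤1+n j<k)) ,
    links-below₂ k 0 1 s t e ℕ.≤-refl
  links-below₂ {ρ} k {j} c₁ c₂ s t e j≤k = eachBelow-++ (links ρ (suc k) (j , c₁) s)
    (eachBelow-weaken (links ρ (suc k) (j , c₁) s) (k≤nextᵀ _ t) (links-below (suc k) c₁ s (envBelow-weaken (ℕ.n≤1+n k) e) j≤k))
    (links-below _ c₂ t (envBelow-weaken (ℕ.≤-trans (ℕ.n≤1+n k) (k≤nextᵀ _ s)) e) (ℕ.≤-trans j≤k (k≤nextᵀ _ s)))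

  matrixᶠ-below : ∀ {ρ} k φ → EnvBelow k ρ → Below (nextᶠ k φ) (matrixᶠ ρ k φ)
  matrixᶠ-below {ρ} k (s ≈ t) e = below-weaken (component 1 k) (ℕ.≤-trans (k≤nextᵀ (suc k) s) (k≤nextᵀ _ t)) (bit-below ℕ.≤-refl) ,
    conjs-below (links ρ (suc k) (k , 0) s ++ links ρ (nextᵀ (suc k) s) (k , 2) t) (ℕ.≤-trans (s≤s z≤n) (ℕ.≤-trans (k≤nextᵀ (suc k) s) (k≤nextᵀ _ t))) (links-below₂ k 0 2 s t e ℕ.≤-refl)
  matrixᶠ-below {ρ} k (s ≺ t) e = below-weaken (component 1 k) (ℕ.≤-trans (k≤nextᵀ (suc k) s) (k≤nextᵀ _ t)) (bit-below ℕ.≤-refl) ,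
    conjs-below (links ρ (suc k) (k , 0) s ++ links ρ (nextᵀ (suc k) s) (k , 2) t) (ℕ.≤-trans (s≤s z≤n) (ℕ.≤-trans (k≤nextᵀ (suc k) s) (k≤nextᵀ _ t))) (links-below₂ k 0 2 s t e ℕ.≤-refl)
  matrixᶠ-below {ρ} k (t ∈₁ A) e = conjs-below (links ρ (suc k) (k , 2) t ++ link (find ρ set A) (k , 2) ∷ []) (ℕ.≤-trans (s≤s z≤n) (k≤nextᵀ (suc k) t))
    (eachBelow-++ (links ρ (suc k) (k , 2) t) (links-below (suc k) 2 t (envBelow-weaken (ℕ.n≤1+n k) e) ℕ.≤-refl)
      (below-weaken (link (find ρ set A) (k , 2)) (k≤nextᵀ (suc k) t) (meet-below 2 {find ρ set A} 2 {k} (s≤s z≤n) (ℕ.m≤n⇒m≤1+n (found e set A)) ℕ.≤-refl) , tt))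
  matrixᶠ-below {ρ} k (A ∈₂ 𝒜) e =
    (eventually-below (conj (bitAt 0) (conj (component 2 (find ρ set A)) (neg (component 2 k)))) z (bit-below z , a , b) ,
     eventually-below (conj (bitAt 0) (conj (neg (component 2 (find ρ set A))) (component 2 k))) z (bit-below z , a , b)) , b
    where
      z = s≤s z≤n
      a = bit-below {find ρ set A} (ℕ.m≤n⇒m≤1+n (found e set A))
      b = bit-below {k} ℕ.≤-refl
  matrixᶠ-below k (neg φ) e = matrixᶠ-below k φ e
  matrixᶠ-below {ρ} k (φ and χ) e = below-weaken (matrixᶠ ρ k φ) (k≤nextᶠ _ χ) (matrixᶠ-below k φ e) , matrixᶠ-below _ χ (envBelow-weaken (k≤nextᶠ k φ) e)
  matrixᶠ-below {ρ} k (φ or χ) e = below-weaken (matrixᶠ ρ k φ) (k≤nextᶠ _ χ) (matrixᶠ-below k φ e) , matrixᶠ-below _ χ (envBelow-weaken (k≤nextᶠ k φ) e)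
  matrixᶠ-below {ρ} k (∃⁰ x ∙ φ) e = matrixᶠ-below (suc k) φ (envBelow-cons number x e)
  matrixᶠ-below {ρ} k (∀⁰ x ∙ φ) e = matrixᶠ-below (suc k) φ (envBelow-cons number x e)
  matrixᶠ-below {ρ} k (∃¹ x ∙ φ) e = matrixᶠ-below (suc k) φ (envBelow-cons set x e)
  matrixᶠ-below {ρ} k (∀¹ x ∙ φ) e = matrixᶠ-below (suc k) φ (envBelow-cons set x e)
  matrixᶠ-below {ρ} k (∃² x ∙ φ) e = matrixᶠ-below (suc k) φ (envBelow-cons class x e)
  matrixᶠ-below {ρ} k (∀² x ∙ φ) e = matrixᶠ-below (suc k) φ (envBelow-cons class x e)

  valid-++ : ∀ k Q {Q′} → Valid k Q → Valid (after-prefix k Q) Q′ → Valid k (Q ++ Q′)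
  valid-++ k []      _       h = h
  valid-++ k (_ ∷ Q) (v , w) h = v , valid-++ (suc k) Q w h

  valid-prefixᵀ : ∀ b k t → 2 ≤ k → Valid k (prefixᵀ b t)
  valid-prefixᵀ₂ : ∀ b k s t → 2 ≤ k → Valid k (prefixᵀ b s ++ prefixᵀ b t)
  valid-prefixᵀ b k (var x) h = tt
  valid-prefixᵀ b k (s ⊕ t) h = ix (ℕ.≤-trans (s≤s z≤n) h) , valid-prefixᵀ₂ b (suc k) s t (ℕ.m≤n⇒m≤1+n h)
  valid-prefixᵀ b k (s ⊗ t) h = ix h , valid-prefixᵀ₂ b (suc k) s t (ℕ.m≤n⇒m≤1+n h)
  valid-prefixᵀ₂ b k s t h = valid-++ k (prefixᵀ b s) (valid-prefixᵀ b k s h)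
    (valid-prefixᵀ b _ t (ℕ.≤-trans h (k≤after k (prefixᵀ b s))))

  valid-prefixᶠ : ∀ {ρ} k b φ → 2 ≤ k → EnvBelow k ρ → Valid k (prefixᶠ ρ k b φ)
  valid-prefixᶠ₂ : ∀ {ρ} k b φ χ → 2 ≤ k → EnvBelow k ρ → Valid k (prefixᶠ ρ k b φ ++ prefixᶠ ρ (nextᶠ k φ) b χ)
  valid-prefixᶠ k b (s ≈ t) h e = ix (ℕ.≤-trans (s≤s z≤n) h) , valid-prefixᵀ₂ b (suc k) s t (ℕ.m≤n⇒m≤1+n h)
  valid-prefixᶠ k b (s ≺ t) h e = ix (ℕ.≤-trans (s≤s z≤n) h) , valid-prefixᵀ₂ b (suc k) s t (ℕ.m≤n⇒m≤1+n h)
  valid-prefixᶠ k b (t ∈₁ A) h e = ix (ℕ.≤-trans (s≤s z≤n) h) , valid-prefixᵀ b (suc k) t (ℕ.m≤n⇒m≤1+n h)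
  valid-prefixᶠ k b (A ∈₂ 𝒜) h e = ix (ℕ.<⇒≤ (found e class 𝒜)) , tt
  valid-prefixᶠ k b (neg φ) h e = valid-prefixᶠ k (not b) φ h e
  valid-prefixᶠ k b (φ and χ) h e = valid-prefixᶠ₂ k b φ χ h e
  valid-prefixᶠ k b (φ or χ) h e = valid-prefixᶠ₂ k b φ χ h e
  valid-prefixᶠ {ρ} k b (∃⁰ x ∙ φ) h e = ix (ℕ.≤-trans (s≤s z≤n) h) , valid-prefixᶠ (suc k) b φ (ℕ.m≤n⇒m≤1+n h) (envBelow-cons number x e)
  valid-prefixᶠ {ρ} k b (∀⁰ x ∙ φ) h e = ix (ℕ.≤-trans (s≤s z≤n) h) , valid-prefixᶠ (suc k) b φ (ℕ.m≤n⇒m≤1+n h) (envBelow-cons number x e)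
  valid-prefixᶠ {ρ} k b (∃¹ x ∙ φ) h e = every , valid-prefixᶠ (suc k) b φ (ℕ.m≤n⇒m≤1+n h) (envBelow-cons set x e)
  valid-prefixᶠ {ρ} k b (∀¹ x ∙ φ) h e = every , valid-prefixᶠ (suc k) b φ (ℕ.m≤n⇒m≤1+n h) (envBelow-cons set x e)
  valid-prefixᶠ {ρ} k b (∃² x ∙ φ) h e = ix ℕ.≤-refl , valid-prefixᶠ (suc k) b φ (ℕ.m≤n⇒m≤1+n h) (envBelow-cons class x e)
  valid-prefixᶠ {ρ} k b (∀² x ∙ φ) h e = ix ℕ.≤-refl , valid-prefixᶠ (suc k) b φ (ℕ.m≤n⇒m≤1+n h) (envBelow-cons class x e)
  valid-prefixᶠ₂ {ρ} k b φ χ h e = valid-++ k (prefixᶠ ρ k b φ) (valid-prefixᶠ k b φ h e)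
    (subst (λ i → Valid i (prefixᶠ ρ (nextᶠ k φ) b χ)) (sym (after-prefixᶠ ρ k b φ))
      (valid-prefixᶠ _ b χ (ℕ.≤-trans h (k≤nextᶠ k φ)) (envBelow-weaken (k≤nextᶠ k φ) e)))

  prefixed-traces : ∀ k Q {ψ : LTL (suc m)} {π} → Below (after-prefix k Q) ψ → π FreeTraceVarOf prefixed k Q (ltl ψ) → ∃[ j ] j < k × π ≡ nm j
  prefixed-traces k [] {ψ} h f = occurs ψ h f
    where
      occurs : ∀ {k π} (ψ : LTL (suc m)) → Below k ψ → π OccursInLTL ψ → ∃[ j ] j < k × π ≡ nm j
      occurs (p at π) b       refl     = b
      occurs (neg ψ)  b       f        = occurs ψ b f
      occurs (ψ or χ) (b , c) (inj₁ f) = occurs ψ b f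
      occurs (ψ or χ) (b , c) (inj₂ f) = occurs χ c f
      occurs (next ψ) b       f        = occurs ψ b f
      occurs (ψ U χ)  (b , c) (inj₁ f) = occurs ψ b f
      occurs (ψ U χ)  (b , c) (inj₂ f) = occurs χ c f
  prefixed-traces k ((b , s) ∷ Q) {ψ} {π} h f with unbound b f
    where
      unbound : ∀ b → π FreeTraceVarOf prefixed k ((b , s) ∷ Q) (ltl ψ) → π ≢ nm k × π FreeTraceVarOf prefixed (suc k) Q (ltl ψ)
      unbound true  (n , _ , f) = n , f
      unbound false (n , _ , f) = n , f
  ... | π≢ , f′ with prefixed-traces (suc k) Q h f′
  ...   | j , j≤k , e with ℕ.m≤n⇒m<n∨m≡n (ℕ.≤-pred j≤k)
  ...     | inj₁ j<k  = j , j<k , e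
  ...     | inj₂ refl = ⊥-elim (π≢ e)

  source-below : ∀ {k s Y} → ValidSource k s → Y ≡ sourceVar s → Y ≡ Xd ⊎ (∃[ j ] j < suc k × Y ≡ var (nm j))
  source-below every    refl = inj₁ refl
  source-below (ix i≤k) refl = inj₂ (_ , s≤s i≤k , refl)

  prefixed-sets : ∀ k Q {ψ : LTL (suc m)} {Y} → Valid k Q → Y FreeSetVarOf prefixed k Q (ltl ψ) → Y ≡ Xd ⊎ (∃[ j ] j < k × Y ≡ var (nm j))
  prefixed-sets k ((b , s) ∷ Q) {ψ} {Y} (vs , v) f = bound (unbound b f)
    where
      unbound : ∀ b → Y FreeSetVarOf prefixed k ((b , s) ∷ Q) (ltl ψ) →
        Y ≢ var (nm k) × (Y ≡ var (nm k) ⊎ Y ≡ sourceVar s ⊎ Y FreeSetVarOf prefixed (suc k) Q (ltl ψ))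
      unbound true  f = f
      unbound false f = f
      lower-bound : Y ≢ var (nm k) → Y ≡ Xd ⊎ (∃[ j ] j < suc k × Y ≡ var (nm j)) → Y ≡ Xd ⊎ (∃[ j ] j < k × Y ≡ var (nm j))
      lower-bound n (inj₁ e) = inj₁ e
      lower-bound n (inj₂ (j , j≤k , e)) with ℕ.m≤n⇒m<n∨m≡n (ℕ.≤-pred j≤k)
      ... | inj₁ j<k  = inj₂ (j , j<k , e)
      ... | inj₂ refl = ⊥-elim (n e)
      bound : Y ≢ var (nm k) × (Y ≡ var (nm k) ⊎ Y ≡ sourceVar s ⊎ Y FreeSetVarOf prefixed (suc k) Q (ltl ψ)) → _
      bound (n , inj₁ e)        = ⊥-elim (n e)
      bound (n , inj₂ (inj₁ e)) = lower-bound n (source-below vs e)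
      bound (n , inj₂ (inj₂ f)) = lower-bound n (prefixed-sets (suc k) Q v f)

  prefixed-Xa : ∀ k Q {ψ : LTL (suc m)} → ¬ Xa OccursIn prefixed k Q (ltl ψ)
  prefixed-Xa k [] ()
  prefixed-Xa k ((true  , every) ∷ Q) (inj₂ (inj₂ (inj₂ f))) = prefixed-Xa (suc k) Q f
  prefixed-Xa k ((true  , ix _)  ∷ Q) (inj₂ (inj₂ (inj₂ f))) = prefixed-Xa (suc k) Q f
  prefixed-Xa k ((false , every) ∷ Q) (inj₂ (inj₂ (inj₂ f))) = prefixed-Xa (suc k) Q f
  prefixed-Xa k ((false , ix _)  ∷ Q) (inj₂ (inj₂ (inj₂ f))) = prefixed-Xa (suc k) Q f

  noEntries : EnvBelow firstFree []
  found noEntries τ x = s≤s z≤n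

  wholeBelow : ∀ φ → Below (after-prefix 0 (wholePrefix φ)) (wholeMatrix φ)
  wholeBelow φ = subst (λ k → Below k (wholeMatrix φ)) (sym (after-prefixᶠ [] firstFree true φ))
    (below-weaken axioms (k≤nextᶠ firstFree φ) axioms-below , matrixᶠ-below firstFree φ noEntries)

  wholeValid : ∀ φ → Valid 0 (wholePrefix φ)
  wholeValid φ = every , ix (ℕ.≤ᵇ⇒≤ _ _ tt) , ix (ℕ.≤ᵇ⇒≤ _ _ tt) ,
    every , ix (ℕ.≤ᵇ⇒≤ _ _ tt) , ix (ℕ.≤ᵇ⇒≤ _ _ tt) , ix (ℕ.≤ᵇ⇒≤ _ _ tt) , ix (ℕ.≤ᵇ⇒≤ _ _ tt) , every ,
    ix (ℕ.≤ᵇ⇒≤ _ _ tt) , ix (ℕ.≤ᵇ⇒≤ _ _ tt) , ix (ℕ.≤ᵇ⇒≤ _ _ tt) , every , every , every ,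
    valid-prefixᶠ firstFree true φ (ℕ.≤ᵇ⇒≤ _ _ tt) noEntries

  prefixed-sentence : ∀ Q ψ → Valid 0 Q → Below (after-prefix 0 Q) ψ →
    IsSentence (prefixed 0 Q (ltl ψ)) × XaFree (prefixed 0 Q (ltl ψ))
  prefixed-sentence Q ψ v b = (no-traces , only-Xd) , prefixed-Xa 0 Q
    where
      no-traces : ∀ π → ¬ π FreeTraceVarOf prefixed 0 Q (ltl ψ)
      no-traces π f with prefixed-traces 0 Q b f
      ... | _ , () , _
      only-Xd : ∀ X → X FreeSetVarOf prefixed 0 Q (ltl ψ) → X ≡ Xa ⊎ X ≡ Xd
      only-Xd X f with prefixed-sets 0 Q v f
      ... | inj₁ e = inj₂ e

  hyperSentence : ArithSentence → XaFreeSentence (suc m)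
  hyperSentence (φ , _) = hyper φ , prefixed-sentence (wholePrefix φ) (wholeMatrix φ) (wholeValid φ) (wholeBelow φ)

-- From arithmetic to Hyper²LTL: strategies for formulas

module FormulaStrategy (em : ExcludedMiddle 1ℓ) (m : ℕ) where
  open Classical em
  open Game m
  open Strategies em m
  open Gadgets m
  open Meaning em m
  open Bounds m
  open Update _≟ᴺ_
  open SetOfSetsOfℕ renaming (member to memberᶜ; respect to respectᶜ)

  record Operation (Π : Asg) (i : ℕ) (f : ℕ → ℕ → ℕ) : Set₁ where
    field
      graph    : TraceSet (suc m)
      is-graph : sets Π (var (nm i)) ≡ just graph
      sound    : ∀ t → member graph t → ∃[ a ] ∃[ b ] Triple (bits∈ t) a b (f a b)
      total    : ∀ a b → ∃[ t ] member graph t × Triple (bits∈ t) a b (f a b)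

  -- The meeting point of both directions of correctness: such an assignment is built by hand over
  -- the complete system, and is derived from the axioms over an arbitrary one. The strategies for
  -- formulas assume nothing else about the system.
  record Good (Π : Asg) : Set₁ where
    field
      world     : TraceSet (suc m)
      is-world  : sets Π Xd ≡ just world
      universal : ∀ (β : ℕ → Set) → ∃[ t ] member world t × (∀ i → bits∈ t i ⇔ β i)
      marked    : Marked Π
      plus      : Operation Π 1 _+_
      times     : Operation Π 2 _*_

  open Operation
  open Good

  operation-~ : ∀ {Π Π′ k i f} → i < k → Π ~[ k ] Π′ → Operation Π i f → Operation Π′ i f
  operation-~ i<k e op = record
    { graph = graph op ; is-graph = trans (sym (same-set e i<k)) (is-graph op) ; sound = sound op ; total = total op }

  marked-~ : ∀ {Π Π′ k} → 0 < k → Π ~[ k ] Π′ → Marked Π → Marked Π′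
  marked-~ {Π} {Π′} h e mk i = mk⇔ (to (mk i) ∘ from (bitOf-same {Π} {Π′} (same-trace e h) i)) (to (bitOf-same {Π} {Π′} (same-trace e h) i) ∘ from (mk i))

  good-~ : ∀ {Π Π′ k} → 3 ≤ k → Π ~[ k ] Π′ → Good Π → Good Π′
  good-~ {Π} {Π′} h e g = record
    { world = world g ; is-world = trans (sym (same-Xd e)) (is-world g) ; universal = universal g
    ; marked = marked-~ {Π} {Π′} (ℕ.≤-trans (s≤s z≤n) h) e (marked g)
    ; plus = operation-~ (ℕ.≤-trans (s≤s (s≤s z≤n)) h) e (plus g)
    ; times = operation-~ h e (times g) }

  Each : Asg → List (LTL (suc m)) → Set
  Each Π []      = ⊤
  Each Π (ψ ∷ L) = traces Π at-pos 0 ⊩ ψ × Each Π L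

  each-++ : ∀ Π L {L′} → Each Π (L ++ L′) ⇔ (Each Π L × Each Π L′)
  each-++ Π []      = mk⇔ (tt ,_) proj₂
  each-++ Π (ψ ∷ L) = mk⇔ (λ (p , h) → (p , proj₁ (to (each-++ Π L) h)) , proj₂ (to (each-++ Π L) h))
                          (λ ((p , h) , h′) → p , from (each-++ Π L) (h , h′))

  each-stable : ∀ {k} L → EachBelow k L → StableFrom k (λ Π → Each Π L)
  each-stable []      _       e = mk⇔ id id
  each-stable (ψ ∷ L) (a , b) e = mk⇔
    (λ (p , h) → to (below-stable ψ a e 0) p , to (each-stable L b e) h)
    (λ (p , h) → from (below-stable ψ a e 0) p , from (each-stable L b e) h)

  conjs-⇔ : ∀ {Π} → Marked Π → ∀ L → traces Π at-pos 0 ⊩ conjs L ⇔ Each Π L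
  conjs-⇔ {Π} mk []      = mk⇔ (λ _ → tt) (λ _ → from (mk 0) (0 , refl))
  conjs-⇔ {Π} mk (ψ ∷ L) = mk⇔
    (λ h → let (p , q) = to (conj-⇔ {traces Π} ψ (conjs L)) h in p , to (conjs-⇔ {Π} mk L) q)
    (λ (p , q) → from (conj-⇔ {traces Π} ψ (conjs L)) (p , from (conjs-⇔ {Π} mk L) q))

  -- The moves at an entry of the prefix correspond to the elements of A.

  record Moves {ℓ} {A : Set ℓ} (R : A → Asg → Set₁) (k : ℕ) (s : Source) (Π : Asg) : Set (ℓ Level.⊔ 1ℓ) where
    field
      choose : ∀ a → ∃[ D ] ∃[ u ] ∃[ t ] Legal k s Π D u t × R a (bind k Π D u t)
      answer : ∀ {D u t} → Legal k s Π D u t → ∃[ a ] R a (bind k Π D u t)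

  open Moves

  module _ {Π : Asg} {k : ℕ} {D : TraceSet (suc m)} {u t : Trace (suc m)} where

    bits-bind : ∀ i → bits∈ t i ⇔ bitOf (bind k Π D u t) k i
    bits-bind = bitOf-trace {bind k Π D u t} {k} (bind-trace {Π} {k} {D} {u} {t})

    set-before : ∀ {i} → i < k → sets ((Π [ var (nm k) ↦ˢ D ]) [ nm k ↦ᵗ u ]) (var (nm i)) ≡ sets Π (var (nm i))
    set-before i<k = sym (same-set (~-bind {Π} {k} {D} {u} {u}) i<k)

  IsTriple : ℕ → (ℕ → ℕ → ℕ) → ℕ × ℕ → Asg → Set₁
  IsTriple k f (a , b) Π = Lift 1ℓ (Triple (bitOf Π k) a b (f a b))

  operation-moves : ∀ {Π i f k} → Good Π → Operation Π i f → i < k → Moves (IsTriple k f) k (ix i) Π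
  choose (operation-moves {Π} {k = k} g op i<k) (a , b) with total op a b
  ... | t , t∈ , h = world g , proj₁ w , t , legal-ix i<k (is-world g) (is-graph op) t∈ (proj₁ (proj₂ w)) ,
        lift (triple-cong (bits-bind {Π} {k} {world g} {proj₁ w} {t}) h)
    -- Some member of the world, to show that the set bound by this entry is nonempty.
    where w = universal g (λ _ → ⊥)
  answer (operation-moves {Π} {i} {k = k} g op i<k) {D} {u} {t} l
    with sound op t (just-∈ {(Π [ var (nm k) ↦ˢ D ]) [ nm k ↦ᵗ u ]} {var (nm i)} (trans (set-before {Π} {k} {D} {u} {t} i<k) (is-graph op)) (Legal.in-source l))
  ... | a , b , h = (a , b) , lift (triple-cong (bits-bind {Π} {k} {D} {u} {t}) h)

  ReadsSet : ℕ → SetOfℕ → Asg → Set₁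
  ReadsSet k Z Π = Lift 1ℓ (∀ a → bitOf Π k (3 * a + 2) ⇔ Z a)

  third : ℕ → ℕ × ℕ
  third i = i / 3 , i % 3

  third-reads : ∀ a → third (3 * a + 2) ≡ (a , 2)
  third-reads a = cong₂ _,_ (proj₁ both) (proj₂ both)
    where
      i = 3 * a + 2
      both = divMod-unique 3 {i / 3} {a} (ℕ.m%n<n i 3) (s≤s (s≤s (s≤s z≤n)))
        (trans (trans (ℕ.+-comm (i / 3 * 3) (i % 3)) (sym (ℕ.m≡m%n+[m/n]*n i 3))) (cong (_+ 2) (ℕ.*-comm 3 a)))

  set-moves : ∀ {Π k} → Good Π → Moves (ReadsSet k) k every Π
  choose (set-moves {Π} {k} g) Z with universal g (λ i → Z (proj₁ (third i)))
  ... | t , t∈ , h = world g , t , t , legal-every (is-world g) t∈ t∈ , lift λ a → mk⇔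
    (λ b → subst (Z ∘ proj₁) (third-reads a) (to (h _) (from (bits-bind {Π} {k} {world g} {t} {t} _) b)))
    (λ z → to (bits-bind {Π} {k} {world g} {t} {t} _) (from (h _) (subst (Z ∘ proj₁) (sym (third-reads a)) z)))
  answer (set-moves {Π} {k} g) {D} {u} {t} l = (λ a → bits∈ t (3 * a + 2)) ,
    lift λ a → mk⇔ (from (bits-bind {Π} {k} {D} {u} {t} _)) (to (bits-bind {Π} {k} {D} {u} {t} _))

  -- A class is represented by the set components 2 of those members whose bit 0 is on;
  -- the other members only make the set nonempty.

  Shows : TraceSet (suc m) → SetOfℕ → Trace (suc m) → Set
  Shows D Z t = member D t × bits∈ t 0 × (∀ a → bits∈ t (3 * a + 2) ⇔ Z a)

  record RepresentsClass (D : TraceSet (suc m)) (C : SetOfSetsOfℕ) : Set₁ where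
    field
      inhabited : ∃[ t ] member D t
      members   : ∀ Z → memberᶜ C Z ⇔ (∃[ t ] Shows D Z t)

  open RepresentsClass

  ReadsClass : ℕ → SetOfSetsOfℕ → Asg → Set₁
  ReadsClass k C Π = ∃[ D ] sets Π (var (nm k)) ≡ just D × RepresentsClass D C

  -- A given `C` is played as the set of all traces of the world whose bit 0 is off or whose third
  -- component lies in `C`. Conversely, every set that the opponent can bind shows some class, so
  -- each legal move has a meaning.
  class-moves : ∀ {Π k} → Good Π → Moves (ReadsClass k) k (ix k) Π
  choose (class-moves {Π} {k} g) C = D , u , u , legal-self (is-world g) (λ _ → proj₁) (u∈ , inj₁ (to (u≡ 0))) ,
    D , bind-set {Π} {k} {D} {u} {u} , record { inhabited = u , u∈ , inj₁ (to (u≡ 0)) ; members = λ Z → mk⇔ (there Z) (back Z) }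
    where
      D : TraceSet (suc m)
      D = record
        { member  = λ t → member (world g) t × (¬ bits∈ t 0 ⊎ memberᶜ C (λ a → bits∈ t (3 * a + 2)))
        ; respect = λ {t} {t′} e (t∈ , h) → respect (world g) e t∈ , (case h of λ where
            (inj₁ ¬b) → inj₁ (¬b ∘ subst (zero ∈ˢ_) (sym (e 0)))
            (inj₂ c)  → inj₂ (respectᶜ C ((λ {a} → subst (zero ∈ˢ_) (e _)) , (λ {a} → subst (zero ∈ˢ_) (sym (e _)))) c))
        }
      empty = universal g (λ _ → ⊥)
      u = proj₁ empty
      u∈ = proj₁ (proj₂ empty)
      u≡ = proj₂ (proj₂ empty)
      there : ∀ Z → memberᶜ C Z → ∃[ t ] Shows D Z t
      there Z z with universal g (λ i → i ≡ 0 ⊎ (proj₂ (third i) ≡ 2 × Z (proj₁ (third i))))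
      ... | t , t∈ , h = t , (t∈ , inj₂ (respectᶜ C ((λ {a} → from (reads a)) , (λ {a} → to (reads a))) z)) , from (h 0) (inj₁ refl) , reads
        where
          reads : ∀ a → bits∈ t (3 * a + 2) ⇔ Z a
          reads a = mk⇔ (λ b → forth (to (h (3 * a + 2)) b)) (λ z → from (h _) (inj₂ (cong proj₂ (third-reads a) , subst (Z ∘ proj₁) (sym (third-reads a)) z)))
            where
              forth : 3 * a + 2 ≡ 0 ⊎ (proj₂ (third (3 * a + 2)) ≡ 2 × Z (proj₁ (third (3 * a + 2)))) → Z a
              forth (inj₁ e)       = ⊥-elim (ℕ.<⇒≢ (ℕ.≤-trans (s≤s z≤n) (ℕ.m≤n+m 2 (3 * a))) (sym e))
              forth (inj₂ (_ , z)) = subst (Z ∘ proj₁) (third-reads a) z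
      back : ∀ Z → (∃[ t ] Shows D Z t) → memberᶜ C Z
      back Z (t , (t∈ , inj₁ ¬b) , b , r) = ⊥-elim (¬b b)
      back Z (t , (t∈ , inj₂ c) , b , r) = respectᶜ C ((λ {a} → to (r a)) , (λ {a} → from (r a))) c
  answer (class-moves {Π} {k} g) {D} {u} {t} l = C , D , bind-set {Π} {k} {D} {u} {t} ,
    record { inhabited = u , just-∈ {Π [ var (nm k) ↦ˢ D ]} {var (nm k)} (update-same _≟ˢ_ (sets Π) (var (nm k)) (just D)) (Legal.witness l)
           ; members = λ Z → mk⇔ id id }
    where
      C : SetOfSetsOfℕ
      C = record
        { member  = λ Z → ∃[ t ] Shows D Z t
        ; respect = λ (f , f′) (t , t∈ , b , r) → t , t∈ , b , λ a → mk⇔ (f ∘ to (r a)) (from (r a) ∘ f′)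
        }

  Denotation : Sort → Set₁
  Denotation number = Lift 1ℓ ℕ
  Denotation set    = SetOfℕ
  Denotation class  = SetOfSetsOfℕ

  ⟦_⟧ : Valuation → ∀ τ → Name → Denotation τ
  ⟦ v ⟧ number x = lift (Valuation.numbers v x)
  ⟦ v ⟧ set    x = Valuation.sets v x
  ⟦ v ⟧ class  x = Valuation.classes v x

  assign : Valuation → ∀ τ → Name → Denotation τ → Valuation
  assign ⟨ ν ∣ α ∣ γ ⟩ number x (lift a) = ⟨ ν [ x ↦ a ] ∣ α ∣ γ ⟩
  assign ⟨ ν ∣ α ∣ γ ⟩ set    x Z        = ⟨ ν ∣ α [ x ↦ Z ] ∣ γ ⟩
  assign ⟨ ν ∣ α ∣ γ ⟩ class  x C        = ⟨ ν ∣ α ∣ γ [ x ↦ C ] ⟩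

  assign-same : ∀ v τ x d → ⟦ assign v τ x d ⟧ τ x ≡ d
  assign-same ⟨ ν ∣ α ∣ γ ⟩ number x (lift a) = cong lift (update-same _≟ᴺ_ ν x a)
  assign-same ⟨ ν ∣ α ∣ γ ⟩ set    x Z        = update-same _≟ᴺ_ α x Z
  assign-same ⟨ ν ∣ α ∣ γ ⟩ class  x C        = update-same _≟ᴺ_ γ x C

  assign-other : ∀ v τ x d τ′ y → (τ′ , y) ≢ (τ , x) → ⟦ assign v τ x d ⟧ τ′ y ≡ ⟦ v ⟧ τ′ y
  assign-other v number x d       number y n = cong lift (update-other _≟ᴺ_ (Valuation.numbers v) (lower d) (n ∘ cong (number ,_)))
  assign-other v set    x d       set    y n = update-other _≟ᴺ_ (Valuation.sets v) d (n ∘ cong (set ,_))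
  assign-other v class  x d       class  y n = update-other _≟ᴺ_ (Valuation.classes v) d (n ∘ cong (class ,_))
  assign-other v number x d       set    y n = refl
  assign-other v number x d       class  y n = refl
  assign-other v set    x d       number y n = refl
  assign-other v set    x d       class  y n = refl
  assign-other v class  x d       number y n = refl
  assign-other v class  x d       set    y n = refl

  Reads : ∀ τ → ℕ → Denotation τ → Asg → Set₁
  Reads number k (lift a) Π = Lift 1ℓ (Component (bitOf Π k) 2 a)
  Reads set    k Z        Π = ReadsSet k Z Π
  Reads class  k C        Π = ReadsClass k C Π

  reads-~ : ∀ τ {j k d Π Π′} → j < k → Π ~[ k ] Π′ → Reads τ j d Π → Reads τ j d Π′
  reads-~ number {Π = Π} {Π′} j<k e (lift h) = lift (component-cong (bitOf-same {Π} {Π′} (same-trace e j<k)) h)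
  reads-~ set    {Π = Π} {Π′} j<k e (lift h) = lift λ a →
    mk⇔ (to (h a) ∘ from (bitOf-same {Π} {Π′} (same-trace e j<k) _)) (to (bitOf-same {Π} {Π′} (same-trace e j<k) _) ∘ from (h a))
  reads-~ class  j<k e (D , eq , r) = D , trans (sym (same-set e j<k)) eq , r

  -- Only the names in `F`, the free ones, have to be interpreted; for a sentence the condition is
  -- empty.
  Interprets : Env → (Sort × Name → Set) → Valuation → Asg → Set₁
  Interprets ρ F v Π = ∀ τ x → F (τ , x) → Reads τ (find ρ τ x) (⟦ v ⟧ τ x) Π

  interprets-~ : ∀ {ρ F v k Π Π′} → EnvBelow k ρ → Π ~[ k ] Π′ → Interprets ρ F v Π → Interprets ρ F v Π′
  interprets-~ {v = v} e r h τ x f = reads-~ τ {d = ⟦ v ⟧ τ x} (found e τ x) r (h τ x f)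

  sort≡ᵇ-refl : ∀ τ → sort≡ᵇ τ τ ≡ true
  sort≡ᵇ-refl number = refl
  sort≡ᵇ-refl set    = refl
  sort≡ᵇ-refl class  = refl

  interprets-bind : ∀ {ρ F F′ v k Π Π′} τ x d → EnvBelow k ρ → Π ~[ k ] Π′ → (∀ w → w ≢ (τ , x) → F′ w → F w) →
    Reads τ k d Π′ → Interprets ρ F v Π → Interprets ((τ , x , k) ∷ ρ) F′ (assign v τ x d) Π′
  interprets-bind {ρ} {v = v} {k} {Π} {Π′} τ x d e r sub new h τ′ y f with sort≡ᵇ τ′ τ in eq | y ≟ᴺ x
  ... | true | yes refl with sort≡ᵇ-sound τ′ τ (subst T (sym eq) tt)
  ...   | refl = subst (λ d → Reads τ k d Π′) (sym (assign-same v τ x d)) new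
  interprets-bind {ρ} {v = v} {k} {Π} {Π′} τ x d e r sub new h τ′ y f | true | no y≢x =
    subst (λ d → Reads τ′ (find ρ τ′ y) d Π′) (sym (assign-other v τ x d τ′ y (y≢x ∘ cong proj₂)))
      (reads-~ τ′ {d = ⟦ v ⟧ τ′ y} (found e τ′ y) r (h τ′ y (sub (τ′ , y) (y≢x ∘ cong proj₂) f)))
  interprets-bind {ρ} {v = v} {k} {Π} {Π′} τ x d e r sub new h τ′ y f | false | _ =
    subst (λ d → Reads τ′ (find ρ τ′ y) d Π′) (sym (assign-other v τ x d τ′ y other))
      (reads-~ τ′ {d = ⟦ v ⟧ τ′ y} (found e τ′ y) r (h τ′ y (sub (τ′ , y) other f)))
    where
      other : (τ′ , y) ≢ (τ , x)
      other refl with trans (sym eq) (sort≡ᵇ-refl τ)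
      ... | ()

-- From arithmetic to Hyper²LTL: induction on terms and formulas

module FormulaStrategies (em : ExcludedMiddle 1ℓ) (m : ℕ) where
  open Classical em
  open Game m
  open Strategies em m
  open Gadgets m
  open Meaning em m
  open Bounds m
  open FormulaStrategy em m
  open Update _≟ᴺ_
  open SetOfSetsOfℕ renaming (member to memberᶜ; respect to respectᶜ)
  open Operation
  open Good
  open Moves

  link-⇔ : ∀ {Π r j c a e} → Marked Π → Component (bitOf Π r) 2 a → Component (bitOf Π j) c e →
    traces Π at-pos 0 ⊩ link r (j , c) ⇔ a ≡ e
  link-⇔ {Π} {r} {j} {c} mk u v = meet-components {Π} mk {2} {r} {c} {j} u v

  move-component : ∀ {Π Π′ k j c a} → j < k → Π ~[ k ] Π′ → Component (bitOf Π j) c a → Component (bitOf Π′ j) c a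
  move-component {Π} {Π′} j<k e = component-cong (bitOf-same {Π} {Π′} (same-trace e j<k))

  Values : Env → (Name → ℕ) → (Name → Set) → Asg → Set
  Values ρ ν F Π = ∀ x → F x → Component (bitOf Π (find ρ number x)) 2 (ν x)

  values-~ : ∀ {ρ ν F k Π Π′} → EnvBelow k ρ → Π ~[ k ] Π′ → Values ρ ν F Π → Values ρ ν F Π′
  values-~ {Π = Π} {Π′} e r h x f = move-component {Π} {Π′} (found e number x) r (h x f)

  term-strategy : ∀ t b {ρ ν k j c e Π} → 3 ≤ k → Good Π → EnvBelow k ρ → j < k → Component (bitOf Π j) c e →
    Values ρ ν (_OccursInTerm t) Π →
    Strategy b k (prefixᵀ b t) (λ Π → Each Π (links ρ k (j , c) t)) (Lift 1ℓ (value ν t ≡ e)) Π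

  terms-strategy : ∀ s t b {ρ ν k j c₁ c₂ e₁ e₂ Π} → 3 ≤ k → Good Π → EnvBelow k ρ → j < k →
    Component (bitOf Π j) c₁ e₁ → Component (bitOf Π j) c₂ e₂ →
    Values ρ ν (λ x → x OccursInTerm s ⊎ x OccursInTerm t) Π →
    Strategy b k (prefixᵀ b s ++ prefixᵀ b t) (λ Π → Each Π (links ρ k (j , c₁) s ++ links ρ (nextᵀ k s) (j , c₂) t))
      (Lift 1ℓ (value ν s ≡ e₁) × Lift 1ℓ (value ν t ≡ e₂)) Π

  -- That a compound term has value `e` is unfolded into an existential statement: there is a triple
  -- `(a , d , f a d)` with `f a d ≡ e` whose first two components are the values of the operands.
  -- The entry of the node quantifies over exactly these triples.
  node-strategy : ∀ i f (op : ∀ {Π} → Good Π → Operation Π i f) → i < 3 → ∀ s t b {ρ ν k j c e Π} → 3 ≤ k → Good Π →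
    EnvBelow k ρ → j < k → Component (bitOf Π j) c e →
    (∀ {a d Π′} → 3 ≤ suc k → Good Π′ → EnvBelow (suc k) ρ → Component (bitOf Π′ k) 0 a → Component (bitOf Π′ k) 1 d →
      Π ~[ k ] Π′ →
      Strategy b (suc k) (prefixᵀ b s ++ prefixᵀ b t) (λ Π → Each Π (links ρ (suc k) (k , 0) s ++ links ρ (nextᵀ (suc k) s) (k , 1) t))
        (Lift 1ℓ (value ν s ≡ a) × Lift 1ℓ (value ν t ≡ d)) Π′) →
    Strategy b k ((b , ix i) ∷ prefixᵀ b s ++ prefixᵀ b t)
      (λ Π → Each Π (link k (j , c) ∷ links ρ (suc k) (k , 0) s ++ links ρ (nextᵀ (suc k) s) (k , 1) t))
      (Lift 1ℓ (f (value ν s) (value ν t) ≡ e)) Π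
  node-strategy i f op i<3 s t b {ρ} {ν} {k} {j} {c} {e} {Π} 3≤k g eb j<k u sub =
    strategy-ex (IsTriple k f) b
      {V′ = λ (a , d) → Lift 1ℓ (f a d ≡ e) × Lift 1ℓ (value ν s ≡ a) × Lift 1ℓ (value ν t ≡ d)}
      (0 , 0)
      (λ h → (value ν s , value ν t) , h , lift refl , lift refl)
      (λ (lift h , lift p , lift q) → lift (trans (cong₂ f p q) h))
      (choose moves) (answer moves)
      (λ {_} {Π′} r (lift (u₀ , u₁ , u₂)) → strategy-and b {Q = []} refl
        (λ e → below-stable (link k (j , c)) (meet-below 2 {k} c {j} (s≤s z≤n) ℕ.≤-refl (ℕ.m≤n⇒m≤1+n j<k)) e 0)
        (strategy-static λ {Π″} r′ → mk⇔
          (lift ∘ to (linked r u₂ r′)) (from (linked r u₂ r′) ∘ lower))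
        (λ {Π″} r′ → sub (ℕ.m≤n⇒m≤1+n 3≤k) (good-~ (ℕ.m≤n⇒m≤1+n 3≤k) r′ (good-~ 3≤k r g)) (envBelow-weaken (ℕ.n≤1+n k) eb)
          (move-component {Π′} {Π″} ℕ.≤-refl r′ u₀) (move-component {Π′} {Π″} ℕ.≤-refl r′ u₁) (~-trans (ℕ.n≤1+n k) r r′)))
    where
      moves = operation-moves {k = k} g (op g) (ℕ.≤-trans i<3 3≤k)
      linked : ∀ {Π′ Π″ a} → Π ~[ k ] Π′ → Component (bitOf Π′ k) 2 a → Π′ ~[ suc k ] Π″ →
        traces Π″ at-pos 0 ⊩ link k (j , c) ⇔ a ≡ e
      linked {Π′} {Π″} r u₂ r′ = link-⇔ {Π″} (marked (good-~ 3≤k (~-trans (ℕ.n≤1+n k) r r′) g))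
        (move-component {Π′} {Π″} ℕ.≤-refl r′ u₂) (move-component {Π} {Π″} j<k (~-trans (ℕ.n≤1+n k) r r′) u)

  term-strategy (var x) b {ρ} {ν} {k} {j} {c} {e} {Π} 3≤k g eb j<k u h = strategy-static λ {Π′} r →
    let l = link-⇔ {Π′} (marked (good-~ 3≤k r g)) (values-~ {F = _OccursInTerm var x} {Π = Π} {Π′} eb r h x refl) (move-component {Π} {Π′} j<k r u)
    in mk⇔ (λ (p , _) → lift (to l p)) (λ (lift p) → from l p , tt)
  term-strategy (s ⊕ t) b {Π = Π} 3≤k g eb j<k u h = node-strategy 1 _+_ plus (s≤s (s≤s z≤n)) s t b 3≤k g eb j<k u
    λ {Π′ = Π′} 3≤ g′ eb′ u₀ u₁ r → terms-strategy s t b 3≤ g′ eb′ ℕ.≤-refl u₀ u₁ (values-~ {F = _OccursInTerm (s ⊕ t)} {Π = Π} {Π′} eb r h)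
  term-strategy (s ⊗ t) b {Π = Π} 3≤k g eb j<k u h = node-strategy 2 _*_ times (s≤s (s≤s (s≤s z≤n))) s t b 3≤k g eb j<k u
    λ {Π′ = Π′} 3≤ g′ eb′ u₀ u₁ r → terms-strategy s t b 3≤ g′ eb′ ℕ.≤-refl u₀ u₁ (values-~ {F = _OccursInTerm (s ⊗ t)} {Π = Π} {Π′} eb r h)

  terms-strategy s t b {ρ} {ν} {k} {j} {c₁} {c₂} {Π = Π} 3≤k g eb j<k u v h =
    strategy-cong (λ Π → mk⇔ (from (each-++ Π L)) (to (each-++ Π L))) (mk⇔ id id)
      (strategy-and b (after-prefixᵀ b k s) (each-stable L (links-below k c₁ s eb j<k))
        (term-strategy s b 3≤k g eb j<k u (λ x → h x ∘ inj₁))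
        (λ {Π′} r → strategy-weaken′ {Π′} r))
    where
      L = links ρ k (j , c₁) s
      k′ = nextᵀ k s
      strategy-weaken′ : ∀ {Π′} → Π ~[ k ] Π′ → Strategy b k′ (prefixᵀ b t) (λ Π → Each Π (links ρ k′ (j , c₂) t)) (Lift 1ℓ (value ν t ≡ _)) Π′
      strategy-weaken′ {Π′} r = term-strategy t b (ℕ.≤-trans 3≤k (k≤nextᵀ k s)) (good-~ 3≤k r g) (envBelow-weaken (k≤nextᵀ k s) eb)
        (ℕ.≤-trans j<k (k≤nextᵀ k s)) (move-component {Π} {Π′} j<k r v) (λ x f → values-~ {F = _OccursInTerm t} {Π = Π} {Π′} eb r (λ x → h x ∘ inj₂) x f)

  Truth : LTL (suc m) → Asg → Set
  Truth ψ Π = traces Π at-pos 0 ⊩ ψ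

  FormulaStrategy′ : Bool → Env → ℕ → Arith → Valuation → Asg → Set₂
  FormulaStrategy′ b ρ k φ v Π = Strategy b k (prefixᶠ ρ k b φ) (Truth (matrixᶠ ρ k φ)) (v ⊨ᴬ φ) Π

  -- The atoms s ≈ t and s ≺ t say that t = s + d for d = 0, respectively d ≠ 0.

  comparison-strategy : ∀ s t b (ψ : ℕ → LTL (suc m)) (N : ℕ → Set) {ρ ν k Π} {V : Set₁} → 3 ≤ k → Good Π → EnvBelow k ρ →
    Values ρ ν (λ x → x OccursInTerm s ⊎ x OccursInTerm t) Π → Below (suc k) (ψ k) →
    (∀ {Π d} → Component (bitOf Π k) 1 d → Truth (ψ k) Π ⇔ N d) →
    (V → ∃[ d ] N d × value ν t ≡ value ν s + d) → (∀ {d} → N d → value ν t ≡ value ν s + d → V) →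
    Strategy b k ((b , ix 1) ∷ prefixᵀ b s ++ prefixᵀ b t)
      (Truth (conj (ψ k) (conjs (links ρ (suc k) (k , 0) s ++ links ρ (nextᵀ (suc k) s) (k , 2) t)))) V Π
  comparison-strategy s t b ψ N {ρ} {ν} {k} {Π} 3≤k g eb h bψ meaning f f′ =
    strategy-ex (IsTriple k _+_) b
      {V′ = λ (a , d) → Lift 1ℓ (N d) × Lift 1ℓ (value ν s ≡ a) × Lift 1ℓ (value ν t ≡ a + d)}
      (0 , 0)
      (λ v → let (d , n , e) = f v in (value ν s , d) , lift n , lift refl , lift e)
      (λ { (lift n , lift refl , lift e) → f′ n e })
      (choose moves) (answer moves)
      (λ {_} {Π′} r (lift (u₀ , u₁ , u₂)) → strategy-strengthen (good-~ 3≤k r g)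
        (strategy-and b {Q = []} refl (λ e → below-stable (ψ k) bψ e 0)
          (strategy-static λ {Π″} r′ → mk⇔
            (lift ∘ to (meaning {Π″} (move-component {Π′} {Π″} ℕ.≤-refl r′ u₁)))
            (from (meaning {Π″} (move-component {Π′} {Π″} ℕ.≤-refl r′ u₁)) ∘ lower))
          (λ {Π″} r′ → terms-strategy s t b (ℕ.m≤n⇒m≤1+n 3≤k) (good-~ (ℕ.m≤n⇒m≤1+n 3≤k) r′ (good-~ 3≤k r g)) (envBelow-weaken (ℕ.n≤1+n k) eb) ℕ.≤-refl
            (move-component {Π′} {Π″} ℕ.≤-refl r′ u₀) (move-component {Π′} {Π″} ℕ.≤-refl r′ u₂)
            (λ x o → values-~ {F = λ x → x OccursInTerm s ⊎ x OccursInTerm t} {Π = Π} {Π″} eb (~-trans (ℕ.n≤1+n k) r r′) h x o))))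
    where
      moves = operation-moves {k = k} g (plus g) (ℕ.≤-trans (s≤s (s≤s z≤n)) 3≤k)
      L = links ρ (suc k) (k , 0) s ++ links ρ (nextᵀ (suc k) s) (k , 2) t
      strategy-strengthen : ∀ {Π Q V} → Good Π → Strategy b (suc k) Q (λ Π → Truth (ψ k) Π × Each Π L) V Π → Strategy b (suc k) Q (Truth (conj (ψ k) (conjs L))) V Π
      strategy-strengthen {Π} g st = strategy λ P w → play st P λ Π′ r x → w Π′ r λ v →
        let mk = marked (good-~ (ℕ.m≤n⇒m≤1+n 3≤k) r g)
        in holds-map {b = b} (mk⇔ (λ (p , q) → from (conj-⇔ {traces Π′} (ψ k) (conjs L)) (p , from (conjs-⇔ {Π′} mk L) q))
                                  (λ p → let (p₁ , p₂) = to (conj-⇔ {traces Π′} (ψ k) (conjs L)) p in p₁ , to (conjs-⇔ {Π′} mk L) p₂)) (x v)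

  module _ {Π : Asg} {b : Bool} {k : ℕ} (3≤k : 3 ≤ k) (g : Good Π) where

    each-strategy : ∀ {Π′ Q V} L → Π ~[ k ] Π′ → Strategy b (suc k) Q (λ Π → Each Π L) V Π′ → Strategy b (suc k) Q (Truth (conjs L)) V Π′
    each-strategy L r st = strategy λ P w → play st P λ Π″ r′ x → w Π″ r′ λ v →
      let e = conjs-⇔ {Π″} (marked (good-~ 3≤k (~-trans (ℕ.n≤1+n k) r r′) g)) L in holds-map {b = b} (mk⇔ (from e) (to e)) (x v)

    -- The triple drawn here provides a component that holds the value of `t`; the canonical choice
    -- adds 0 to that value.
    set-member-strategy : ∀ t A {ρ v} → EnvBelow k ρ → Interprets ρ (λ w → FreeIn w (t ∈₁ A)) v Π →
      FormulaStrategy′ b ρ k (t ∈₁ A) v Π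
    set-member-strategy t A {ρ} {v} eb h =
      strategy-ex (IsTriple k _+_) b
        {V′ = λ (a , d) → Lift 1ℓ (Z (a + d)) × Lift 1ℓ (value ν t ≡ a + d)}
        (0 , 0)
        (λ (lift z) → (value ν t , 0) , lift (subst Z (sym (ℕ.+-identityʳ _)) z) , lift (sym (ℕ.+-identityʳ _)))
        (λ { (lift z , lift e) → lift (subst Z (sym e) z) })
        (choose moves) (answer moves)
        (λ {_} {Π′} r (lift (_ , _ , u)) → each-strategy (L ++ link j (k , 2) ∷ []) r
          (strategy-cong (λ Π → mk⇔ (λ (p , q) → from (each-++ Π L {link j (k , 2) ∷ []}) (q , p , tt)) (λ w → let (q , p , _) = to (each-++ Π L {link j (k , 2) ∷ []}) w in p , q)) (mk⇔ id id)
            (strategy-and b {Q = []} refl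
              (λ e → below-stable (link j (k , 2)) (meet-below 2 {j} 2 {k} (s≤s z≤n) (ℕ.m≤n⇒m≤1+n (found eb set A)) ℕ.≤-refl) e 0)
              (strategy-static λ {Π″} r′ → linked {Π″} (~-trans (ℕ.n≤1+n k) r r′) (move-component {Π′} {Π″} ℕ.≤-refl r′ u))
              (λ {Π″} r′ → term-strategy t b (ℕ.m≤n⇒m≤1+n 3≤k) (good-~ 3≤k (~-trans (ℕ.n≤1+n k) r r′) g) (envBelow-weaken (ℕ.n≤1+n k) eb) ℕ.≤-refl
                (move-component {Π′} {Π″} ℕ.≤-refl r′ u)
                (values-~ {F = _OccursInTerm t} {Π = Π} {Π″} eb (~-trans (ℕ.n≤1+n k) r r′) (λ x f → lower (h number x (inj₁ (refl , f)))))))))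
      where
        ν = Valuation.numbers v
        Z = Valuation.sets v A
        j = find ρ set A
        L = links ρ (suc k) (k , 2) t
        moves = operation-moves {k = k} g (plus g) (ℕ.≤-trans (s≤s (s≤s z≤n)) 3≤k)
        linked : ∀ {Π′ a} → Π ~[ k ] Π′ → Component (bitOf Π′ k) 2 a → Truth (link j (k , 2)) Π′ ⇔ Lift 1ℓ (Z a)
        linked {Π′} {a} r u = mk⇔
          (λ p → let (x , p₁ , p₂) = to (meet-⇔ {Π′} (marked (good-~ 3≤k r g)) 2 j 2 k) p
                 in lift (subst Z (to (Component.only u x) p₂) (to (read x) p₁)))
          (λ (lift z) → from (meet-⇔ {Π′} (marked (good-~ 3≤k r g)) 2 j 2 k) (a , from (read a) z , from (Component.only u a) refl))
          where
            read : ∀ x → bitOf Π′ j (3 * x + 2) ⇔ Z x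
            read = lower (reads-~ set {d = Z} (found eb set A) r (h set A (inj₂ refl)))

    -- Membership is unfolded into the existence of a trace in the representing set that shows the
    -- set `A`. If there is none, the representation still supplies a member, so a legal move
    -- remains.
    class-member-strategy : ∀ A 𝒜 {ρ v} → EnvBelow k ρ → Interprets ρ (λ w → FreeIn w (A ∈₂ 𝒜)) v Π →
      FormulaStrategy′ b ρ k (A ∈₂ 𝒜) v Π
    class-member-strategy A 𝒜 {ρ} {v} eb h with h class 𝒜 (inj₂ refl)
    ... | D , is-D , represents =
      strategy-ex R b {V′ = λ (t , _) → Lift 1ℓ (bits∈ t 0 × (∀ a → bits∈ t (3 * a + 2) ⇔ Z a))}
        inhabited
        (λ (lift z) → let (t , t∈ , x) = to (members Z) z in (t , t∈) , lift x)
        (λ {(t , t∈)} (lift x) → lift (from (members Z) (t , t∈ , x)))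
        (λ (t , t∈) → world g , proj₁ w , t , legal-ix i<k (is-world g) is-D t∈ (proj₁ (proj₂ w)) , lift (bits-bind {Π} {k} {world g} {proj₁ w} {t}))
        (λ {D′} {u} {t} l → (t , just-∈ {(Π [ var (nm k) ↦ˢ D′ ]) [ nm k ↦ᵗ u ]} {var (nm i)} (trans (set-before {Π} {k} {D′} {u} {t} i<k) is-D) (Legal.in-source l)) ,
          lift (bits-bind {Π} {k} {D′} {u} {t}))
        (λ {a} {Π′} r (lift e) → strategy-static λ {Π″} r′ → matched {Π″} a (~-trans (ℕ.n≤1+n k) r r′)
          (λ x → mk⇔ (to (bitOf-same {Π′} {Π″} (same-trace r′ ℕ.≤-refl) x) ∘ to (e x)) (from (e x) ∘ from (bitOf-same {Π′} {Π″} (same-trace r′ ℕ.≤-refl) x))))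
      where
        open RepresentsClass represents
        Z = Valuation.sets v A
        i = find ρ class 𝒜
        j = find ρ set A
        i<k = found eb class 𝒜
        w = universal g (λ _ → ⊥)
        R : ∃ (member D) → Asg → Set₁
        R (t , _) Π = Lift 1ℓ (∀ x → bits∈ t x ⇔ bitOf Π k x)
        matched : ∀ {Π′} ((t , _) : ∃ (member D)) → Π ~[ k ] Π′ → (∀ x → bits∈ t x ⇔ bitOf Π′ k x) →
          Truth (conj (sameSet j k) (bitAt k)) Π′ ⇔ Lift 1ℓ (bits∈ t 0 × (∀ a → bits∈ t (3 * a + 2) ⇔ Z a))
        matched {Π′} (t , _) r e = mk⇔
          (λ p → let (p₁ , p₂) = to (conj-⇔ {traces Π′} (sameSet j k) (bitAt k)) p ; same = to (sameSet-⇔ {Π′} mk j k) p₁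
                 in lift (from (e 0) p₂ , λ a → mk⇔ (λ x → to (read a) (from (same a) (to (e _) x))) (λ z → from (e _) (to (same a) (from (read a) z)))))
          (λ (lift (p , q)) → from (conj-⇔ {traces Π′} (sameSet j k) (bitAt k))
            (from (sameSet-⇔ {Π′} mk j k) (λ a → mk⇔ (λ x → to (e _) (from (q a) (to (read a) x))) (λ x → from (read a) (to (q a) (from (e _) x)))) , to (e 0) p))
          where
            mk = marked (good-~ 3≤k r g)
            read : ∀ x → bitOf Π′ j (3 * x + 2) ⇔ Z x
            read = lower (reads-~ set {d = Z} (found eb set A) r (h set A (inj₁ refl)))

    module _ {ℓ} {A : Set ℓ} {R : A → Asg → Set₁} {s : Source} (moves : Moves R k s Π) {ρ : Env} {v : Valuation} (τ : Sort) (x : Name) (φ : Arith)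
             (eb : EnvBelow k ρ) (d : A → Denotation τ) (reads : ∀ {a Π′} → R a Π′ → Reads τ k (d a) Π′)
             (ih : ∀ {Π′} v′ → Good Π′ → Interprets ((τ , x , k) ∷ ρ) (λ w → FreeIn w φ) v′ Π′ →
                   FormulaStrategy′ b ((τ , x , k) ∷ ρ) (suc k) φ v′ Π′) where

      exists-strategy : ∀ {V} → A → Interprets ρ (λ w → w ≢ (τ , x) × FreeIn w φ) v Π →
        (V → Σ A (λ a → assign v τ x (d a) ⊨ᴬ φ)) → (∀ {a} → assign v τ x (d a) ⊨ᴬ φ → V) →
        Strategy b k ((b , s) ∷ prefixᶠ ((τ , x , k) ∷ ρ) (suc k) b φ) (Truth (matrixᶠ ((τ , x , k) ∷ ρ) (suc k) φ)) V Π
      exists-strategy a₀ h f f′ = strategy-ex R b {V′ = λ a → assign v τ x (d a) ⊨ᴬ φ} a₀ f f′ (choose moves) (answer moves)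
        λ {a} r ra → ih (assign v τ x (d a)) (good-~ 3≤k r g)
          (interprets-bind {v = v} τ x (d a) eb r (λ _ → _,_) (reads ra) h)

      forall-strategy : ∀ {V} → A → Interprets ρ (λ w → w ≢ (τ , x) × FreeIn w φ) v Π →
        (∀ {a} → ¬ (assign v τ x (d a) ⊨ᴬ φ) → ¬ V) → (¬ V → Σ A (λ a → ¬ (assign v τ x (d a) ⊨ᴬ φ))) →
        Strategy b k ((not b , s) ∷ prefixᶠ ((τ , x , k) ∷ ρ) (suc k) b φ) (Truth (matrixᶠ ((τ , x , k) ∷ ρ) (suc k) φ)) V Π
      forall-strategy a₀ h f f′ = strategy-all R b {V′ = λ a → assign v τ x (d a) ⊨ᴬ φ} a₀ f f′ (choose moves) (answer moves)
        λ {a} r ra → ih (assign v τ x (d a)) (good-~ 3≤k r g)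
          (interprets-bind {v = v} τ x (d a) eb r (λ _ → _,_) (reads ra) h)

  refute : ∀ {A : Set₁} {V : A → Set₁} → ¬ (∀ a → V a) → Σ A (λ a → ¬ V a)
  refute {A} {V} h = stable λ none → h λ a → stable λ ¬v → none (a , ¬v)

  -- The polarity is part of the induction because negation switches it. Quantifiers reduce to the
  -- moves available at their kind of source: triples, traces, or nonempty sets of traces.
  formula-strategy : ∀ φ b {ρ k v Π} → 3 ≤ k → Good Π → EnvBelow k ρ → Interprets ρ (λ w → FreeIn w φ) v Π →
    FormulaStrategy′ b ρ k φ v Π
  formula-strategy (s ≈ t) b {ρ} {k} {v} {Π} 3≤k g eb h = comparison-strategy s t b (component 1) (_≡ 0) 3≤k g eb
    (λ x f → lower (h number x (refl , f))) (bit-below ℕ.≤-refl) (λ {Π} u → component-zero′ {Π} u)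
    (λ (lift e) → 0 , refl , trans (sym e) (sym (ℕ.+-identityʳ _)))
    (λ { refl e → lift (sym (trans e (ℕ.+-identityʳ _))) })
    where
      component-zero′ : ∀ {Π d} → Component (bitOf Π k) 1 d → Truth (component 1 k) Π ⇔ d ≡ 0
      component-zero′ {Π} u = mk⇔ (λ p → sym (to (Component.only u 0) (to (delay-⇔ {traces Π} 0 1 (bitAt k)) p)))
                                  (λ e → from (delay-⇔ {traces Π} 0 1 (bitAt k)) (from (Component.only u 0) (sym e)))
  formula-strategy (s ≺ t) b {ρ} {k} {v} {Π} 3≤k g eb h = comparison-strategy s t b (λ k → neg (component 1 k)) (_≢ 0) 3≤k g eb
    (λ x f → lower (h number x (refl , f))) (bit-below ℕ.≤-refl) (λ {Π} u → component-nonzero {Π} u)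
    (λ (lift lt) → value ν t ∸ value ν s , ℕ.m>n⇒m∸n≢0 lt , sym (ℕ.m+[n∸m]≡n (ℕ.<⇒≤ lt)))
    (λ {d} d≢0 e → lift (subst (value ν s <_) (sym e) (ℕ.m<m+n (value ν s) (ℕ.n≢0⇒n>0 d≢0))))
    where
      ν = Valuation.numbers v
      component-nonzero : ∀ {Π d} → Component (bitOf Π k) 1 d → Truth (neg (component 1 k)) Π ⇔ d ≢ 0
      component-nonzero {Π} u = mk⇔
        (λ p e → p (from (delay-⇔ {traces Π} 0 1 (bitAt k)) (from (Component.only u 0) (sym e))))
        (λ n p → n (sym (to (Component.only u 0) (to (delay-⇔ {traces Π} 0 1 (bitAt k)) p))))
  formula-strategy (t ∈₁ A) b 3≤k g eb h = set-member-strategy 3≤k g t A eb h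
  formula-strategy (A ∈₂ 𝒜) b 3≤k g eb h = class-member-strategy 3≤k g A 𝒜 eb h
  formula-strategy (neg φ) b 3≤k g eb h = strategy-neg b (formula-strategy φ (not b) 3≤k g eb h)
  formula-strategy (φ and χ) b {ρ} {k} {v} {Π} 3≤k g eb h =
    strategy-cong (λ Π → mk⇔ (from (conj-⇔ {traces Π} (matrixᶠ ρ k φ) (matrixᶠ ρ (nextᶠ k φ) χ))) (to (conj-⇔ {traces Π} (matrixᶠ ρ k φ) (matrixᶠ ρ (nextᶠ k φ) χ)))) (mk⇔ id id)
      (strategy-and b (after-prefixᶠ ρ k b φ) (λ e → below-stable (matrixᶠ ρ k φ) (matrixᶠ-below k φ eb) e 0)
        (formula-strategy φ b 3≤k g eb (λ τ x f → h τ x (inj₁ f)))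
        (λ {Π′} r → formula-strategy χ b (ℕ.≤-trans 3≤k (k≤nextᶠ k φ)) (good-~ 3≤k r g) (envBelow-weaken (k≤nextᶠ k φ) eb)
          (λ τ x f → interprets-~ {F = λ w → FreeIn w (φ and χ)} {v = v} eb r h τ x (inj₂ f))))
  formula-strategy (φ or χ) b {ρ} {k} {v} {Π} 3≤k g eb h =
    strategy-or b (after-prefixᶠ ρ k b φ) (λ e → below-stable (matrixᶠ ρ k φ) (matrixᶠ-below k φ eb) e 0)
      (formula-strategy φ b 3≤k g eb (λ τ x f → h τ x (inj₁ f)))
      (λ {Π′} r → formula-strategy χ b (ℕ.≤-trans 3≤k (k≤nextᶠ k φ)) (good-~ 3≤k r g) (envBelow-weaken (k≤nextᶠ k φ) eb)
        (λ τ x f → interprets-~ {F = λ w → FreeIn w (φ or χ)} {v = v} eb r h τ x (inj₂ f)))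
  formula-strategy (∃⁰ x ∙ φ) b {ρ} {k} {v} 3≤k g eb h =
    exists-strategy 3≤k g (operation-moves g (plus g) (ℕ.≤-trans (s≤s (s≤s z≤n)) 3≤k)) {v = v} number x φ eb
      (λ (a , d) → lift (a + d)) (λ (lift (_ , _ , u)) → lift u)
      (λ v′ g′ h′ → formula-strategy φ b (ℕ.m≤n⇒m≤1+n 3≤k) g′ (envBelow-cons number x eb) h′)
      (0 , 0) h (λ (a , w) → (a , 0) , subst (λ a → assign v number x (lift a) ⊨ᴬ φ) (sym (ℕ.+-identityʳ a)) w) (_ ,_)
  formula-strategy (∀⁰ x ∙ φ) b {ρ} {k} {v} 3≤k g eb h =
    forall-strategy 3≤k g (operation-moves g (plus g) (ℕ.≤-trans (s≤s (s≤s z≤n)) 3≤k)) {v = v} number x φ eb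
      (λ (a , d) → lift (a + d)) (λ (lift (_ , _ , u)) → lift u)
      (λ v′ g′ h′ → formula-strategy φ b (ℕ.m≤n⇒m≤1+n 3≤k) g′ (envBelow-cons number x eb) h′)
      (0 , 0) h (λ ¬w w → ¬w (w _))
      (λ ¬w → let (lift a , ¬w′) = refute {Lift 1ℓ ℕ} (λ w → ¬w (λ a → w (lift a)))
              in (a , 0) , subst (λ a → ¬ (assign v number x (lift a) ⊨ᴬ φ)) (sym (ℕ.+-identityʳ a)) ¬w′)
  formula-strategy (∃¹ A ∙ φ) b {ρ} {k} {v} 3≤k g eb h =
    exists-strategy 3≤k g (set-moves g) {v = v} set A φ eb id id
      (λ v′ g′ h′ → formula-strategy φ b (ℕ.m≤n⇒m≤1+n 3≤k) g′ (envBelow-cons set A eb) h′)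
      (λ _ → ⊥) h id (_ ,_)
  formula-strategy (∀¹ A ∙ φ) b {ρ} {k} {v} 3≤k g eb h =
    forall-strategy 3≤k g (set-moves g) {v = v} set A φ eb id id
      (λ v′ g′ h′ → formula-strategy φ b (ℕ.m≤n⇒m≤1+n 3≤k) g′ (envBelow-cons set A eb) h′)
      (λ _ → ⊥) h (λ ¬w w → ¬w (w _)) refute
  formula-strategy (∃² 𝒜 ∙ φ) b {ρ} {k} {v} 3≤k g eb h =
    exists-strategy 3≤k g (class-moves g) {v = v} class 𝒜 φ eb id id
      (λ v′ g′ h′ → formula-strategy φ b (ℕ.m≤n⇒m≤1+n 3≤k) g′ (envBelow-cons class 𝒜 eb) h′)
      (record { member = λ _ → ⊥ ; respect = λ _ () }) h id (_ ,_)
  formula-strategy (∀² 𝒜 ∙ φ) b {ρ} {k} {v} 3≤k g eb h =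
    forall-strategy 3≤k g (class-moves g) {v = v} class 𝒜 φ eb id id
      (λ v′ g′ h′ → formula-strategy φ b (ℕ.m≤n⇒m≤1+n 3≤k) g′ (envBelow-cons class 𝒜 eb) h′)
      (record { member = λ _ → ⊥ ; respect = λ _ () }) h (λ ¬w w → ¬w (w _)) refute

-- From arithmetic to Hyper²LTL: transition systems

module Systems (em : ExcludedMiddle 1ℓ) (m : ℕ) where
  open Classical em
  open TransitionSystem

  stable₀ : {A : Set} → ¬ ¬ A → A
  stable₀ {A} ¬¬a with em₀ {A}
  ... | yes a = a
  ... | no ¬a = ⊥-elim (¬¬a ¬a)

  common-bound : ∀ {s} (f : Fin s → ℕ) → ∃[ M ] ∀ w → f w ≤ M
  common-bound {zero}  f = 0 , λ ()
  common-bound {suc s} f with common-bound (f ∘ suc)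
  ... | M , h = f zero ⊔ M , λ { zero → ℕ.m≤m⊔n _ M ; (suc w) → ℕ.≤-trans (h w) (ℕ.m≤n⊔m (f zero) M) }

  -- If every `w` failed at some index, then all would fail at the maximum of these indices, because
  -- `Q` is downward closed in its index; but some `w` succeeds there.
  pigeonhole : ∀ {s} (Q : Fin s → ℕ → Set) → (∀ {w i j} → i ≤ j → Q w j → Q w i) → (∀ i → ∃[ w ] Q w i) → ∃[ w ] ∀ i → Q w i
  pigeonhole {s} Q anti h = stable₀ λ none →
    let fails : ∀ w → ∃[ i ] ¬ Q w i
        fails w = stable₀ λ all → none (w , λ i → stable₀ λ ¬q → all (i , ¬q))
        (M , bound) = common-bound (proj₁ ∘ fails)
        (w , q) = h M
    in proj₂ (fails w) (anti (bound w) q)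

  Prepends : TraceSet (suc m) → Set
  Prepends D = ∀ x → member D x → ∃[ y ] ∃[ z ] member D y × member D z × ¬ bits∈ y 0 × bits∈ z 0 ×
    (∀ i → bits∈ y (i + 1) ⇔ bits∈ x i) × (∀ i → bits∈ z (i + 1) ⇔ bits∈ x i)

  -- Words are built from the back: a trace that starts with the bits of `β ∘ suc` gets the bit
  -- `β 0` put in front.
  prepends-dense : ∀ {D} → ∃ (member D) → Prepends D → ∀ l (β : ℕ → Set) → ∃[ t ] member D t × (∀ i → i < l → bits∈ t i ⇔ β i)
  prepends-dense (t , t∈) h zero β = t , t∈ , λ _ ()
  prepends-dense {D} ne h (suc l) β with prepends-dense {D} ne h l (β ∘ suc)
  ... | x , x∈ , e with h x x∈ | em₀ {β 0}
  ...   | y , z , y∈ , z∈ , ¬y0 , z0 , ye , ze | yes b = z , z∈ , λ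
    { zero    _        → mk⇔ (λ _ → b) (λ _ → z0)
    ; (suc i) (s≤s i<) → mk⇔ (to (e i i<) ∘ to (ze i) ∘ subst (bits∈ z) (ℕ.+-comm 1 i)) (subst (bits∈ z) (ℕ.+-comm i 1) ∘ from (ze i) ∘ from (e i i<)) }
  ...   | y , z , y∈ , z∈ , ¬y0 , z0 , ye , ze | no ¬b = y , y∈ , λ
    { zero    _        → mk⇔ (⊥-elim ∘ ¬y0) (⊥-elim ∘ ¬b)
    ; (suc i) (s≤s i<) → mk⇔ (to (e i i<) ∘ to (ye i) ∘ subst (bits∈ y) (ℕ.+-comm 1 i)) (subst (bits∈ y) (ℕ.+-comm i 1) ∘ from (ye i) ∘ from (e i i<)) }

  -- König's lemma: the traces of a finite transition system form a closed set.

  module _ (𝔗 : TransitionSystem (suc m)) (β : ℕ → Set) where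

    Follows : ℕ → Fin (size 𝔗) → ℕ → Set
    Follows i v l = Σ[ ρ ∈ (ℕ → Fin (size 𝔗)) ] ρ 0 ≡ v × (∀ j → ρ (suc j) ∈ˢ edges 𝔗 (ρ j)) × (∀ j → j < l → zero ∈ˢ label 𝔗 (ρ j) ⇔ β (i + j))

    follows-anti : ∀ {i v l l′} → l ≤ l′ → Follows i v l′ → Follows i v l
    follows-anti h (ρ , e , p , a) = ρ , e , p , λ j j< → a j (ℕ.≤-trans j< h)

    -- Every length is reached through some successor of `v`; there are finitely many, so one of
    -- them serves all lengths.
    extend : ∀ i v → (∀ l → Follows i v l) → ∃[ w ] ∀ l → w ∈ˢ edges 𝔗 v × Follows (suc i) w l
    extend i v h = pigeonhole (λ w l → w ∈ˢ edges 𝔗 v × Follows (suc i) w l) (λ le (e , f) → e , follows-anti le f)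
      λ l → let (ρ , e , p , a) = h (suc l) in
        ρ 1 , subst (λ v → ρ 1 ∈ˢ edges 𝔗 v) e (p 0) , ρ ∘ suc , refl , (λ j → p (suc j)) ,
        λ j j< → subst (λ k → zero ∈ˢ label 𝔗 (ρ (suc j)) ⇔ β k) (ℕ.+-suc i j) (a (suc j) (s≤s j<))

    closed : (∀ l → ∃[ t ] member (Tr 𝔗) t × (∀ i → i < l → bits∈ t i ⇔ β i)) → ∃[ t ] member (Tr 𝔗) t × (∀ i → bits∈ t i ⇔ β i)
    closed dense = label 𝔗 ∘ ρ , (ρ , (proj₁ (proj₂ start 0) , λ i → proj₁ (proj₂ (onward i) 0)) , λ _ → refl) , λ i → follows i
      where
        start : ∃[ v ] ∀ l → v ∈ˢ initial 𝔗 × Follows 0 v l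
        start = pigeonhole (λ v l → v ∈ˢ initial 𝔗 × Follows 0 v l) (λ le (e , f) → e , follows-anti le f)
          λ l → let (t , (ρ , (ini , p) , e) , a) = dense l in
            ρ 0 , ini , ρ , refl , p , λ j j< → mk⇔ (to (a j j<) ∘ subst (zero ∈ˢ_) (sym (e j))) (subst (zero ∈ˢ_) (e j) ∘ from (a j j<))
        -- The vertices carry only the promise of arbitrarily long continuations; the letter at each
        -- position is then read off a continuation of length 1.
        walk : ∀ i → ∃[ v ] ∀ l → Follows i v l
        onward : ∀ i → ∃[ w ] ∀ l → w ∈ˢ edges 𝔗 (proj₁ (walk i)) × Follows (suc i) w l
        walk zero    = proj₁ start , λ l → proj₂ (proj₂ start l)
        walk (suc i) = proj₁ (onward i) , λ l → proj₂ (proj₂ (onward i) l)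
        onward i = extend i (proj₁ (walk i)) (proj₂ (walk i))
        ρ : ℕ → Fin (size 𝔗)
        ρ i = proj₁ (walk i)
        follows : ∀ i → zero ∈ˢ label 𝔗 (ρ i) ⇔ β i
        follows i with proj₂ (walk i) 1
        ... | σ , e , _ , a = subst₂ (λ v k → zero ∈ˢ label 𝔗 v ⇔ β k) e (ℕ.+-identityʳ i) (a 0 (s≤s z≤n))

  prepends-universal : ∀ 𝔗 → ∃ (member (Tr 𝔗)) → Prepends (Tr 𝔗) →
    ∀ (β : ℕ → Set) → ∃[ t ] member (Tr 𝔗) t × (∀ i → bits∈ t i ⇔ β i)
  prepends-universal 𝔗 ne h β = closed 𝔗 β λ l → prepends-dense {Tr 𝔗} ne h l β

  letter : Fin 2 → Subset (suc m)
  letter zero       = false ∷ Vec.replicate m false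
  letter (suc zero) = true ∷ Vec.replicate m false

  complete : TransitionSystem (suc m)
  complete = record
    { size    = 2
    ; edges   = λ _ → everything
    ; serial  = λ _ → zero , all∈ zero
    ; initial = everything
    ; label   = letter
    }
    where
      everything : Subset 2
      everything = true ∷ true ∷ []
      all∈ : ∀ v → v ∈ˢ everything
      all∈ zero       = Vec.here
      all∈ (suc zero) = Vec.there Vec.here

  complete-universal : ∀ (β : ℕ → Set) → ∃[ t ] member (Tr complete) t × (∀ i → bits∈ t i ⇔ β i)
  complete-universal β = letter ∘ ρ , (ρ , (all∈ (ρ 0) , λ i → all∈ (ρ (suc i))) , λ _ → refl) , reads
    where
      choice : ∀ {A : Set} → Dec A → Fin 2
      choice (yes _) = suc zero
      choice (no _)  = zero
      ρ : ℕ → Fin 2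
      ρ i = choice (em₀ {β i})
      all∈ : ∀ v → v ∈ˢ (true ∷ true ∷ [])
      all∈ zero       = Vec.here
      all∈ (suc zero) = Vec.there Vec.here
      reads : ∀ i → bits∈ (letter ∘ ρ) i ⇔ β i
      reads i with em₀ {β i}
      ... | yes b = mk⇔ (λ _ → b) (λ _ → Vec.here)
      ... | no ¬b = mk⇔ (λ ()) (⊥-elim ∘ ¬b)

-- From arithmetic to Hyper²LTL: the axioms

module Axioms (em : ExcludedMiddle 1ℓ) (m : ℕ) where
  open Classical em
  open Game m
  open Strategies em m
  open Gadgets m
  open Meaning em m
  open Bounds m
  open FormulaStrategy em m
  open FormulaStrategies em m
  open Systems em m
  open Operation
  open Good

  cj : ∀ {Π} ψ χ → Truth (conj ψ χ) Π ⇔ (Truth ψ Π × Truth χ Π)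
  cj {Π} ψ χ = conj-⇔ {traces Π} {0} ψ χ

  position : ∀ {Π} c k → Truth (component c k) Π ⇔ bitOf Π k c
  position {Π} c k = delay-⇔ {traces Π} 0 c (bitAt k)

  marking-⇔ : ∀ {Π} → Truth marking Π ⇔ Marked Π
  marking-⇔ {Π} = mk⇔ there back
    where
      tail₁ tail₂ periodic : LTL (suc m)
      periodic = always (iffᴸ (bitAt 0) (component 3 0))
      tail₂ = conj (neg (component 2 0)) periodic
      tail₁ = conj (neg (component 1 0)) tail₂
      there : Truth marking Π → Marked Π
      there h = mk
        where
          h₁ = to (cj {Π} (bitAt 0) tail₁) h
          h₂ = to (cj {Π} (neg (component 1 0)) tail₂) (proj₂ h₁)
          h₃ = to (cj {Π} (neg (component 2 0)) periodic) (proj₂ h₂)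
          period : ∀ i → bitOf Π 0 i ⇔ bitOf Π 0 (i + 3)
          period i = let e = to (iff-⇔ {traces Π} (bitAt 0) (component 3 0)) (to (always-⇔ {traces Π} (iffᴸ (bitAt 0) (component 3 0))) (proj₂ h₃) i)
                         d = delay-⇔ {traces Π} i 3 (bitAt 0) in mk⇔ (to d ∘ to e) (from e ∘ from d)
          mk : Marked Π
          mk 0 = mk⇔ (λ _ → 0 , refl) (λ _ → proj₁ h₁)
          mk 1 = mk⇔ (λ b → ⊥-elim (proj₁ h₂ (from (position {Π} 1 0) b))) λ { (suc a , e) → ⊥-elim (ℕ.<⇒≢ (ℕ.≤-trans (s≤s (s≤s z≤n)) (ℕ.*-monoʳ-≤ 3 (s≤s (z≤n {a})))) e) }
          mk 2 = mk⇔ (λ b → ⊥-elim (proj₁ h₃ (from (position {Π} 2 0) b))) λ { (suc a , e) → ⊥-elim (ℕ.<⇒≢ (ℕ.≤-trans (s≤s (s≤s (s≤s z≤n))) (ℕ.*-monoʳ-≤ 3 (s≤s (z≤n {a})))) e) }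
          mk (suc (suc (suc i))) = mk⇔
            (λ b → let (a , e) = to (mk i) (from (period i) (subst (bitOf Π 0) (ℕ.+-comm 3 i) b)) in suc a , trans (cong (3 +_) e) (sym (ℕ.*-suc 3 a)))
            (λ { (zero , ()) ; (suc a , e) → subst (bitOf Π 0) (ℕ.+-comm i 3) (to (period i) (from (mk i) (a , ℕ.+-cancelˡ-≡ 3 _ _ (trans e (ℕ.*-suc 3 a))))) })
      back : Marked Π → Truth marking Π
      back mk = from (cj {Π} (bitAt 0) tail₁) (from (mk 0) (0 , refl) ,
        from (cj {Π} (neg (component 1 0)) tail₂) ((λ h → not-multiple 1 (s≤s (s≤s z≤n)) (λ ()) (to (mk 1) (to (position {Π} 1 0) h))) ,
        from (cj {Π} (neg (component 2 0)) periodic) ((λ h → not-multiple 2 (s≤s (s≤s (s≤s z≤n))) (λ ()) (to (mk 2) (to (position {Π} 2 0) h))) ,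
        from (always-⇔ {traces Π} (iffᴸ (bitAt 0) (component 3 0))) λ i → from (iff-⇔ {traces Π} (bitAt 0) (component 3 0)) (let d = delay-⇔ {traces Π} i 3 (bitAt 0) in mk⇔
          (λ b → let (a , e) = to (mk i) b in from d (from (mk (i + 3)) (suc a , trans (ℕ.+-comm i 3) (trans (cong (3 +_) e) (sym (ℕ.*-suc 3 a))))))
          (λ b → shrink i (to (mk (i + 3)) (to d b)))))))
        where
          not-multiple : ∀ i → i < 3 → i ≢ 0 → (∃[ a ] i ≡ 3 * a) → ⊥
          not-multiple i i<3 i≢0 (zero , e)  = i≢0 e
          not-multiple i i<3 i≢0 (suc a , e) = ℕ.<⇒≢ (ℕ.≤-trans i<3 (ℕ.*-monoʳ-≤ 3 (s≤s (z≤n {a})))) e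
          shrink : ∀ i → (∃[ a ] i + 3 ≡ 3 * a) → bitOf Π 0 i
          shrink i (zero , e)  = ⊥-elim (ℕ.<⇒≢ (ℕ.≤-trans (s≤s z≤n) (ℕ.m≤n+m 3 i)) (sym e))
          shrink i (suc a , e) = from (mk i) (a , ℕ.+-cancelʳ-≡ 3 _ _ (trans e (trans (ℕ.*-suc 3 a) (ℕ.+-comm 3 (3 * a)))))

  module _ {Π : Asg} (mk : Marked Π) where

    Singles : ℕ → Set
    Singles k = ∃[ a ] ∃[ b ] ∃[ c ] Triple (bitOf Π k) a b c

    singles-⇔ : ∀ k → Truth (conj (singleton 0 k) (conj (singleton 1 k) (singleton 2 k))) Π ⇔ Singles k
    singles-⇔ k = mk⇔
      (λ h → let (p , q) = to (cj {Π} (singleton 0 k) (conj (singleton 1 k) (singleton 2 k))) h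
                 (q , r) = to (cj {Π} (singleton 1 k) (singleton 2 k)) q
                 (a , u) = to (singleton-⇔ {Π} mk 0 k) p ; (b , v) = to (singleton-⇔ {Π} mk 1 k) q ; (c , w) = to (singleton-⇔ {Π} mk 2 k) r
             in a , b , c , u , v , w)
      (λ (a , b , c , u , v , w) → from (cj {Π} (singleton 0 k) (conj (singleton 1 k) (singleton 2 k)))
        (from (singleton-⇔ {Π} mk 0 k) (a , u) , from (cj {Π} (singleton 1 k) (singleton 2 k))
          (from (singleton-⇔ {Π} mk 1 k) (b , v) , from (singleton-⇔ {Π} mk 2 k) (c , w))))

    mc : ∀ c j d k {a b} → Component (bitOf Π j) c a → Component (bitOf Π k) d b → Truth (meet c j d k) Π ⇔ a ≡ b
    mc c j d k u v = meet-components {Π} mk {c} {j} {d} {k} u v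

    sc : ∀ c j d k {a b} → Component (bitOf Π j) c a → Component (bitOf Π k) d b → Truth (successor c j d k) Π ⇔ a ≡ suc b
    sc c j d k u v = successor-components {Π} mk {c} {j} {d} {k} u v

    zc : ∀ c k {a} → Component (bitOf Π k) c a → Truth (component c k) Π ⇔ a ≡ 0
    zc c k u = component-zero {Π} mk {c} {k} u

    totality-to : Truth totality Π → ∀ {a b} → Component (bitOf Π 3) 0 a → Component (bitOf Π 3) 1 b →
      ∀ k → k ≡ 4 ⊎ k ≡ 5 → Truth (conj (meet 0 3 0 k) (meet 1 3 1 k)) Π
    totality-to (inj₁ h) u v k _ = ⊥-elim (h (from (cj {Π} (singleton 0 3) (singleton 1 3)) (from (singleton-⇔ {Π} mk 0 3) (_ , u) , from (singleton-⇔ {Π} mk 1 3) (_ , v))))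
    totality-to (inj₂ h) u v k (inj₁ refl) = proj₁ (to (cj {Π} (conj (meet 0 3 0 4) (meet 1 3 1 4)) (conj (meet 0 3 0 5) (meet 1 3 1 5))) h)
    totality-to (inj₂ h) u v k (inj₂ refl) = proj₂ (to (cj {Π} (conj (meet 0 3 0 4) (meet 1 3 1 4)) (conj (meet 0 3 0 5) (meet 1 3 1 5))) h)

    meets-to : ∀ {a b a′ b′} k → Component (bitOf Π 3) 0 a → Component (bitOf Π 3) 1 b → Component (bitOf Π k) 0 a′ → Component (bitOf Π k) 1 b′ →
      Truth (conj (meet 0 3 0 k) (meet 1 3 1 k)) Π ⇔ (a ≡ a′ × b ≡ b′)
    meets-to k u v u′ v′ = mk⇔
      (λ h → let (p , q) = to (cj {Π} (meet 0 3 0 k) (meet 1 3 1 k)) h in to (mc 0 3 0 k u u′) p , to (mc 1 3 1 k v v′) q)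
      (λ (p , q) → from (cj {Π} (meet 0 3 0 k) (meet 1 3 1 k)) (from (mc 0 3 0 k u u′) p , from (mc 1 3 1 k v v′) q))

    totality-from : ∀ {a b} → Component (bitOf Π 4) 0 a → Component (bitOf Π 4) 1 b → Component (bitOf Π 5) 0 a → Component (bitOf Π 5) 1 b →
      Component (bitOf Π 3) 0 a → Component (bitOf Π 3) 1 b → Truth totality Π
    totality-from u₄ v₄ u₅ v₅ u v = inj₂ (from (cj {Π} (conj (meet 0 3 0 4) (meet 1 3 1 4)) (conj (meet 0 3 0 5) (meet 1 3 1 5)))
      (from (meets-to 4 u v u₄ v₄) (refl , refl) , from (meets-to 5 u v u₅ v₅) (refl , refl)))

    totality-vacuous : ¬ (∃[ a ] ∃[ b ] Component (bitOf Π 3) 0 a × Component (bitOf Π 3) 1 b) → Truth totality Π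
    totality-vacuous n = inj₁ λ h → let (p , q) = to (cj {Π} (singleton 0 3) (singleton 1 3)) h
                                        (a , u) = to (singleton-⇔ {Π} mk 0 3) p ; (b , v) = to (singleton-⇔ {Π} mk 1 3) q in n (a , b , u , v)

    module _ {a b c a′ b′ c′} (t₆ : Triple (bitOf Π 6) a b c) (t₇ : Triple (bitOf Π 7) a′ b′ c′) where
      private
        first second third′ : LTL (suc m)
        first  = conj (component 1 6) (meet 0 6 2 6)
        third′ = conj (successor 1 6 1 7) (successor 2 6 2 7)
        second = conj (meet 0 6 0 7) third′

      additive-⇔ : Truth additive Π ⇔ ((b ≡ 0 × a ≡ c) ⊎ (a ≡ a′ × b ≡ suc b′ × c ≡ suc c′))
      additive-⇔ = mk⇔ there back
        where
          sg = conj (singleton 0 6) (conj (singleton 1 6) (singleton 2 6))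
          u = proj₁ t₆ ; v = proj₁ (proj₂ t₆) ; w = proj₂ (proj₂ t₆)
          u′ = proj₁ t₇ ; v′ = proj₁ (proj₂ t₇) ; w′ = proj₂ (proj₂ t₇)
          cases : Truth (first or second) Π → (b ≡ 0 × a ≡ c) ⊎ (a ≡ a′ × b ≡ suc b′ × c ≡ suc c′)
          cases (inj₁ h) = let (p , q) = to (cj {Π} (component 1 6) (meet 0 6 2 6)) h in
            inj₁ (to (zc 1 6 v) p , to (mc 0 6 2 6 u w) q)
          cases (inj₂ h) = inj₂ (to (mc 0 6 0 7 u u′) (proj₁ h₁) , to (sc 1 6 1 7 v v′) (proj₁ h₂) , to (sc 2 6 2 7 w w′) (proj₂ h₂))
            where
              h₁ = to (cj {Π} (meet 0 6 0 7) third′) h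
              h₂ = to (cj {Π} (successor 1 6 1 7) (successor 2 6 2 7)) (proj₂ h₁)
          there : Truth additive Π → (b ≡ 0 × a ≡ c) ⊎ (a ≡ a′ × b ≡ suc b′ × c ≡ suc c′)
          there h = cases (proj₂ (to (cj {Π} sg (first or second)) h))
          cases′ : (b ≡ 0 × a ≡ c) ⊎ (a ≡ a′ × b ≡ suc b′ × c ≡ suc c′) → Truth (first or second) Π
          cases′ (inj₁ (p , q)) = inj₁ (from (cj {Π} (component 1 6) (meet 0 6 2 6)) (from (zc 1 6 v) p , from (mc 0 6 2 6 u w) q))
          cases′ (inj₂ (p , q , r)) = inj₂ (from (cj {Π} (meet 0 6 0 7) third′) (from (mc 0 6 0 7 u u′) p ,
            from (cj {Π} (successor 1 6 1 7) (successor 2 6 2 7)) (from (sc 1 6 1 7 v v′) q , from (sc 2 6 2 7 w w′) r)))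
          back : (b ≡ 0 × a ≡ c) ⊎ (a ≡ a′ × b ≡ suc b′ × c ≡ suc c′) → Truth additive Π
          back h = from (cj {Π} sg (first or second)) (from (singles-⇔ 6) (a , b , c , t₆) , cases′ h)

    additive-singles : Truth additive Π → Singles 6
    additive-singles h = to (singles-⇔ 6) (proj₁ (to (cj {Π} (conj (singleton 0 6) (conj (singleton 1 6) (singleton 2 6)))
      (conj (component 1 6) (meet 0 6 2 6) or conj (meet 0 6 0 7) (conj (successor 1 6 1 7) (successor 2 6 2 7)))) h))

    module _ {a b c a′ b′ c′ x y z} (t₉ : Triple (bitOf Π 9) a b c) (t₁₀ : Triple (bitOf Π 10) a′ b′ c′) (t₁₁ : Triple (bitOf Π 11) x y z) where
      private
        first second r₁ r₂ r₃ : LTL (suc m)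
        first  = conj (component 1 9) (component 2 9)
        r₃ = conj (meet 1 11 0 9) (meet 2 11 2 9)
        r₂ = conj (meet 0 11 2 10) r₃
        r₁ = conj (successor 1 9 1 10) r₂
        second = conj (meet 0 9 0 10) r₁

      multiplicative-⇔ : Truth multiplicative Π ⇔ ((b ≡ 0 × c ≡ 0) ⊎ (a ≡ a′ × b ≡ suc b′ × x ≡ c′ × y ≡ a × z ≡ c))
      multiplicative-⇔ = mk⇔ there back
        where
          sg = conj (singleton 0 9) (conj (singleton 1 9) (singleton 2 9))
          u = proj₁ t₉ ; v = proj₁ (proj₂ t₉) ; w = proj₂ (proj₂ t₉)
          u′ = proj₁ t₁₀ ; v′ = proj₁ (proj₂ t₁₀) ; w′ = proj₂ (proj₂ t₁₀)
          u″ = proj₁ t₁₁ ; v″ = proj₁ (proj₂ t₁₁) ; w″ = proj₂ (proj₂ t₁₁)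
          cases : Truth (first or second) Π → (b ≡ 0 × c ≡ 0) ⊎ (a ≡ a′ × b ≡ suc b′ × x ≡ c′ × y ≡ a × z ≡ c)
          cases (inj₁ h) = let (p , q) = to (cj {Π} (component 1 9) (component 2 9)) h in
            inj₁ (to (zc 1 9 v) p , to (zc 2 9 w) q)
          cases (inj₂ h) = inj₂ (to (mc 0 9 0 10 u u′) (proj₁ h₁) , to (sc 1 9 1 10 v v′) (proj₁ h₂) , to (mc 0 11 2 10 u″ w′) (proj₁ h₃) ,
            to (mc 1 11 0 9 v″ u) (proj₁ h₄) , to (mc 2 11 2 9 w″ w) (proj₂ h₄))
            where
              h₁ = to (cj {Π} (meet 0 9 0 10) r₁) h
              h₂ = to (cj {Π} (successor 1 9 1 10) r₂) (proj₂ h₁)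
              h₃ = to (cj {Π} (meet 0 11 2 10) r₃) (proj₂ h₂)
              h₄ = to (cj {Π} (meet 1 11 0 9) (meet 2 11 2 9)) (proj₂ h₃)
          there : Truth multiplicative Π → (b ≡ 0 × c ≡ 0) ⊎ (a ≡ a′ × b ≡ suc b′ × x ≡ c′ × y ≡ a × z ≡ c)
          there h = cases (proj₂ (to (cj {Π} sg (first or second)) h))
          cases′ : (b ≡ 0 × c ≡ 0) ⊎ (a ≡ a′ × b ≡ suc b′ × x ≡ c′ × y ≡ a × z ≡ c) → Truth (first or second) Π
          cases′ (inj₁ (p , q)) = inj₁ (from (cj {Π} (component 1 9) (component 2 9)) (from (zc 1 9 v) p , from (zc 2 9 w) q))
          cases′ (inj₂ (p , q , r , s , t)) = inj₂ (from (cj {Π} (meet 0 9 0 10) r₁) (from (mc 0 9 0 10 u u′) p ,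
            from (cj {Π} (successor 1 9 1 10) r₂) (from (sc 1 9 1 10 v v′) q ,
            from (cj {Π} (meet 0 11 2 10) r₃) (from (mc 0 11 2 10 u″ w′) r ,
            from (cj {Π} (meet 1 11 0 9) (meet 2 11 2 9)) (from (mc 1 11 0 9 v″ u) s , from (mc 2 11 2 9 w″ w) t)))))
          back : (b ≡ 0 × c ≡ 0) ⊎ (a ≡ a′ × b ≡ suc b′ × x ≡ c′ × y ≡ a × z ≡ c) → Truth multiplicative Π
          back h = from (cj {Π} sg (first or second)) (from (singles-⇔ 9) (a , b , c , t₉) , cases′ h)

    multiplicative-singles : Truth multiplicative Π → Singles 9
    multiplicative-singles h = to (singles-⇔ 9) (proj₁ (to (cj {Π} (conj (singleton 0 9) (conj (singleton 1 9) (singleton 2 9)))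
      (conj (component 1 9) (component 2 9) or conj (meet 0 9 0 10) (conj (successor 1 9 1 10) (conj (meet 0 11 2 10) (conj (meet 1 11 0 9) (meet 2 11 2 9)))))) h))

  prepending-⇔ : ∀ {Π} → Truth prepending Π ⇔ (¬ bitOf Π 13 0 × bitOf Π 14 0 ×
    (∀ i → bitOf Π 13 (i + 1) ⇔ bitOf Π 12 i) × (∀ i → bitOf Π 14 (i + 1) ⇔ bitOf Π 12 i))
  prepending-⇔ {Π} = mk⇔
    (λ h → let (p , q) = to (cj {Π} (conj (neg (bitAt 13)) (bitAt 14)) (conj (always y) (always z))) h
               (p₁ , p₂) = to (cj {Π} (neg (bitAt 13)) (bitAt 14)) p
               (q₁ , q₂) = to (cj {Π} (always y) (always z)) q
           in p₁ , p₂ , (λ i → to (iff-⇔ {traces Π} (next (bitAt 13)) (bitAt 12)) (to (always-⇔ {traces Π} y) q₁ i))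
                      , (λ i → to (iff-⇔ {traces Π} (next (bitAt 14)) (bitAt 12)) (to (always-⇔ {traces Π} z) q₂ i)))
    (λ (p₁ , p₂ , q₁ , q₂) → from (cj {Π} (conj (neg (bitAt 13)) (bitAt 14)) (conj (always y) (always z)))
      (from (cj {Π} (neg (bitAt 13)) (bitAt 14)) (p₁ , p₂) , from (cj {Π} (always y) (always z))
        (from (always-⇔ {traces Π} y) (λ i → from (iff-⇔ {traces Π} (next (bitAt 13)) (bitAt 12)) (q₁ i)) ,
         from (always-⇔ {traces Π} z) (λ i → from (iff-⇔ {traces Π} (next (bitAt 14)) (bitAt 12)) (q₂ i)))))
    where
      y z : LTL (suc m)
      y = iffᴸ (next (bitAt 13)) (bitAt 12)
      z = iffᴸ (next (bitAt 14)) (bitAt 12)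

  whole-⇔ : ∀ {Π} φ → Truth (wholeMatrix φ) Π ⇔
    (Marked Π × Truth totality Π × Truth additive Π × Truth multiplicative Π × Truth prepending Π × Truth (matrixᶠ [] firstFree φ) Π)
  whole-⇔ {Π} φ = mk⇔ there
    (λ (a , b , c , d , e , f) → from (cj {Π} axioms (matrixᶠ [] firstFree φ))
      (from (cj {Π} marking t₁) (from (marking-⇔ {Π}) a , from (cj {Π} totality t₂) (b ,
        from (cj {Π} additive t₃) (c , from (cj {Π} multiplicative prepending) (d , e)))) , f))
    where
      t₁ t₂ t₃ : LTL (suc m)
      t₃ = conj multiplicative prepending
      t₂ = conj additive t₃
      t₁ = conj totality t₂
      there : Truth (wholeMatrix φ) Π →
        Marked Π × Truth totality Π × Truth additive Π × Truth multiplicative Π × Truth prepending Π × Truth (matrixᶠ [] firstFree φ) Π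
      there h = to (marking-⇔ {Π}) (proj₁ h₂) , proj₁ h₃ , proj₁ h₄ , proj₁ h₅ , proj₂ h₅ , proj₂ h₁
        where
          h₁ = to (cj {Π} axioms (matrixᶠ [] firstFree φ)) h
          h₂ : Truth marking Π × Truth t₁ Π
          h₂ = to (cj {Π} marking t₁) (proj₁ h₁)
          h₃ = to (cj {Π} totality t₂) (proj₂ h₂)
          h₄ = to (cj {Π} additive t₃) (proj₂ h₃)
          h₅ = to (cj {Π} multiplicative prepending) (proj₂ h₄)

-- From arithmetic to Hyper²LTL: correctness

module Backward (em : ExcludedMiddle 1ℓ) (m : ℕ) where
  open Classical em
  open Game m
  open Strategies em m
  open Gadgets m
  open Meaning em m
  open Bounds m
  open FormulaStrategy em m
  open FormulaStrategies em m
  open Systems em m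
  open Axioms em m
  open Operation
  open Good
  open Inhabited

  SourceIs : ℕ → Source → Asg → TraceSet (suc m) → Set₁
  SourceIs k every  Π D = sets Π Xd ≡ just D
  SourceIs k (ix i) Π D = Lift 1ℓ (i < k) × sets Π (var (nm i)) ≡ just D

  source-~ : ∀ {k k′ Π Π′ D} s → k ≤ k′ → Π ~[ k ] Π′ → SourceIs k s Π D → SourceIs k′ s Π′ D
  source-~ every  h e h₁ = trans (sym (same-Xd e)) h₁
  source-~ (ix i) h e (lift i<k , h₁) = lift (ℕ.≤-trans i<k h) , trans (sym (same-set e i<k)) h₁

  legal-in : ∀ {k Π D W w t} s → SourceIs k s Π D → sets Π Xd ≡ just W → member W w → member D t → Legal k s Π W w t
  legal-in {k} {Π} {D} {W} {w} {t} every e xd w∈ t∈ with trans (sym e) xd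
  ... | refl = legal-every xd w∈ t∈
  legal-in (ix i) (lift i<k , e) xd w∈ t∈ = legal-ix i<k xd e t∈ w∈

  legal-out : ∀ {k Π D D′ u t} s → SourceIs k s Π D → Legal k s Π D′ u t → member D t
  legal-out {k} {Π} {D} {D′} {u} every e l = just-∈ {(Π [ var (nm k) ↦ˢ D′ ]) [ nm k ↦ᵗ u ]} {Xd} e (Legal.in-source l)
  legal-out {k} {Π} {D} {D′} {u} {t} (ix i) (lift i<k , e) l =
    just-∈ {(Π [ var (nm k) ↦ˢ D′ ]) [ nm k ↦ᵗ u ]} {var (nm i)} (trans (set-before {Π} {k} {D′} {u} {t} i<k) e) (Legal.in-source l)

  record Named (k : ℕ) (Π Π′ : Asg) (x y z : Trace (suc m)) : Set₁ where
    field
      before : Π ~[ k ] Π′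
      first  : traces Π′ (nm k) ≡ just x
      second : traces Π′ (nm (1 + k)) ≡ just y
      third′ : traces Π′ (nm (2 + k)) ≡ just z

  open Named

  named : ∀ {k Π Π′ D₁ D₂ D₃ u₁ u₂ u₃ x y z} →
    let Π₁ = bind k Π D₁ u₁ x ; Π₂ = bind (1 + k) Π₁ D₂ u₂ y ; Π₃ = bind (2 + k) Π₂ D₃ u₃ z in
    Π₃ ~[ 3 + k ] Π′ → Named k Π Π′ x y z
  named {k} {Π} {Π′} {D₁} {D₂} {D₃} {u₁} {u₂} {u₃} {x} {y} {z} e = record
    { before = ~-trans (ℕ.n≤1+n k) ~-bind (~-trans (ℕ.n≤1+n (1 + k)) ~-bind (~-trans (ℕ.n≤1+n (2 + k)) ~-bind e))
    ; first  = trans (sym (same-trace (~-trans (ℕ.n≤1+n (1 + k)) (~-bind {bind k Π D₁ u₁ x}) (~-trans (ℕ.n≤1+n (2 + k)) ~-bind e)) ℕ.≤-refl)) (bind-trace {Π} {k} {D₁} {u₁} {x})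
    ; second = trans (sym (same-trace (~-trans (ℕ.n≤1+n (2 + k)) (~-bind {bind (1 + k) (bind k Π D₁ u₁ x) D₂ u₂ y}) e) ℕ.≤-refl)) (bind-trace {bind k Π D₁ u₁ x} {1 + k} {D₂} {u₂} {y})
    ; third′ = trans (sym (same-trace e ℕ.≤-refl)) (bind-trace {bind (1 + k) (bind k Π D₁ u₁ x) D₂ u₂ y} {2 + k} {D₃} {u₃} {z})
    }

  group-strategy : ∀ {k Π W D₁ D₂ D₃ w M} s₁ s₂ s₃ → sets Π Xd ≡ just W → member W w →
    SourceIs k s₁ Π D₁ → SourceIs k s₂ Π D₂ → SourceIs k s₃ Π D₃ →
    (∀ x → member D₁ x → ∃[ y ] ∃[ z ] member D₂ y × member D₃ z × (∀ {Π′} → Named k Π Π′ x y z → M Π′)) →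
    Strategy true k (group s₁ s₂ s₃) M (Lift 1ℓ ⊤) Π
  group-strategy {k} {W = W} {w = w} s₁ s₂ s₃ xd w∈ e₁ e₂ e₃ f = strategy λ P h D u x l →
    let (y , z , y∈ , z∈ , g) = f x (legal-out s₁ e₁ l) in
    W , w , y , legal-in s₂ (source-~ s₂ (ℕ.n≤1+n k) ~-bind e₂) xd w∈ y∈ ,
    W , w , z , legal-in s₃ (source-~ s₃ (ℕ.n≤1+n (1 + k)) ~-bind (source-~ s₃ (ℕ.n≤1+n k) ~-bind e₃)) xd w∈ z∈ ,
    h _ (~-trans (ℕ.n≤1+n k) ~-bind (~-trans (ℕ.n≤1+n (1 + k)) ~-bind ~-bind)) (λ _ → g (named ~-refl))

  -- An axiom is usable for every `x` of its first source: the opponent plays `x`, the strategy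
  -- answers with `y` and `z`, and the remaining prefix is played out in any legal way to reach an
  -- assignment where `P` holds.
  group-extract : ∀ {k Π D₁ D₂ D₃ P rest} s₁ s₂ s₃ → Inhabited k Π → Valid (3 + k) rest →
    SourceIs k s₁ Π D₁ → SourceIs k s₂ Π D₂ → SourceIs k s₃ Π D₃ →
    Game k (group s₁ s₂ s₃ ++ rest) P Π → ∀ x → member D₁ x →
    ∃[ y ] ∃[ z ] member D₂ y × member D₃ z × ∃[ Π′ ] Named k Π Π′ x y z × P Π′
  group-extract {k} {Π} {rest = rest} s₁ s₂ s₃ inh v e₁ e₂ e₃ game x x∈ with all-set inh
  ... | W , w , xd , w∈ with legal-in s₁ e₁ xd w∈ x∈
  ... | l₁ with game W w x l₁
  ... | A₂ , u₂ , y , l₂ , A₃ , u₃ , z , l₃ , h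
    with some-play (3 + k) rest (inhabited-bind (inhabited-bind (inhabited-bind inh l₁) l₂) l₃) v h
  ... | Π′ , e , _ , p = y , z , legal-out s₂ (source-~ s₂ (ℕ.n≤1+n k) ~-bind e₂) l₂ ,
    legal-out s₃ (source-~ s₃ (ℕ.n≤1+n (1 + k)) ~-bind (source-~ s₃ (ℕ.n≤1+n k) ~-bind e₃)) l₃ , Π′ , named e , p

  thirds : ∀ x c → c < 3 → third (3 * x + c) ≡ (x , c)
  thirds x c c<3 = cong₂ _,_ (proj₁ both) (proj₂ both)
    where
      i = 3 * x + c
      both = divMod-unique 3 {i / 3} {x} (ℕ.m%n<n i 3) c<3
        (trans (trans (ℕ.+-comm (i / 3 * 3) (i % 3)) (sym (ℕ.m≡m%n+[m/n]*n i 3))) (cong (_+ c) (ℕ.*-comm 3 x)))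

  Interleaved : ℕ → ℕ → ℕ → ℕ × ℕ → Set
  Interleaved a b c (x , 0) = x ≡ a
  Interleaved a b c (x , 1) = x ≡ b
  Interleaved a b c (x , _) = x ≡ c

  triple-exists : ∀ {W : TraceSet (suc m)} → (∀ (β : ℕ → Set) → ∃[ t ] member W t × (∀ i → bits∈ t i ⇔ β i)) → ∀ a b c →
    ∃[ t ] member W t × Triple (bits∈ t) a b c
  triple-exists universal a b c with universal (Interleaved a b c ∘ third)
  ... | t , t∈ , h = t , t∈ , comp (read 0 (s≤s z≤n)) , comp (read 1 (s≤s (s≤s z≤n))) , comp (read 2 (s≤s (s≤s (s≤s z≤n))))
    where
      read : ∀ d (d<3 : d < 3) x → bits∈ t (3 * x + d) ⇔ Interleaved a b c (x , d)
      read d d<3 x = mk⇔ (λ p → subst (Interleaved a b c) (thirds x d d<3) (to (h (3 * x + d)) p))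
                         (λ e → from (h (3 * x + d)) (subst (Interleaved a b c) (sym (thirds x d d<3)) e))

  Parts : Arith → Asg → Set
  Parts φ Π = Marked Π × Truth totality Π × Truth additive Π × Truth multiplicative Π × Truth prepending Π × Truth (matrixᶠ [] firstFree φ) Π

  opaque
    Won : Arith → Asg → Set₁
    Won φ Π = Lift 1ℓ (Parts φ Π)

    won-parts : ∀ {Π} φ → Won φ Π ⇔ Parts φ Π
    won-parts φ = mk⇔ lower lift

    won-matrix : ∀ {Π} φ → Won φ Π ⇔ Π ⊨ᶜʷ ltl (wholeMatrix φ)
    won-matrix {Π} φ = mk⇔ (λ (lift p) → lift (from (at-start (traces Π) (wholeMatrix φ)) (from (whole-⇔ {Π} φ) p)))
                           (λ (lift h) → lift (to (whole-⇔ {Π} φ) (to (at-start (traces Π) (wholeMatrix φ)) h)))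

  rest₁ rest₂ rest₃ rest₄ : Arith → Prefix
  rest₄ φ = prefixᶠ [] firstFree true φ
  rest₃ φ = group every every every ++ rest₄ φ
  rest₂ φ = group (ix 2) (ix 2) (ix 1) ++ rest₃ φ
  rest₁ φ = group (ix 1) (ix 1) every ++ rest₂ φ

  through : ∀ {k} {Π Π′ : Asg} {x : Trace (suc m)} → traces Π′ (nm k) ≡ just x → ∀ {a b c} → Triple (bits∈ x) a b c → Triple (bitOf Π′ k) a b c
  through {k} {Π} {Π′} e = triple-cong (bitOf-trace {Π′} {k} e)

  module _ {Π : Asg} (g : Good Π) (φ : Arith) (v : Valuation) (closedᶠ : ∀ w → ¬ FreeIn w φ) where

    -- The axioms enter as conjuncts of truth value `⊤`, so the same rule that handles conjunctions
    -- chains them with the formula; their variable bounds keep the earlier ones true during later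
    -- moves.
    good-strategy : Strategy true 3 (group every (ix 1) (ix 2) ++ rest₁ φ)
      (λ Π → Truth totality Π × Truth additive Π × Truth multiplicative Π × Truth prepending Π × Truth (matrixᶠ [] firstFree φ) Π)
      (Lift 1ℓ ⊤ × Lift 1ℓ ⊤ × Lift 1ℓ ⊤ × Lift 1ℓ ⊤ × v ⊨ᴬ φ) Π
    good-strategy =
      strategy-and true refl (λ e → below-stable totality totality-below e 0) first-group λ r₁ →
      strategy-and true refl (λ e → below-stable additive additive-below e 0) (second-group r₁) λ r₂ →
      strategy-and true refl (λ e → below-stable multiplicative multiplicative-below e 0) (third-group (~-trans 3≤6 r₁ r₂)) λ r₃ →
      strategy-and true refl (λ e → below-stable prepending prepending-below e 0) (fourth-group (~-trans 3≤9 (~-trans 3≤6 r₁ r₂) r₃)) λ r₄ →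
      strategy-formula (~-trans 3≤12 (~-trans 3≤9 (~-trans 3≤6 r₁ r₂) r₃) r₄)
      where
        3≤6 = ℕ.≤ᵇ⇒≤ 3 6 tt
        3≤9 = ℕ.≤ᵇ⇒≤ 3 9 tt
        3≤12 = ℕ.≤ᵇ⇒≤ 3 12 tt
        w = proj₁ (universal g (λ _ → ⊥))
        w∈ = proj₁ (proj₂ (universal g (λ _ → ⊥)))
        P T′ : TraceSet (suc m)
        P = graph (plus g)
        T′ = graph (times g)
        module At-index {Π′ : Asg} {k : ℕ} (3≤k : 3 ≤ k) (r : Π ~[ 3 ] Π′) where
          xd : sets Π′ Xd ≡ just (world g)
          xd = trans (sym (same-Xd r)) (is-world g)
          sum : SourceIs k (ix 1) Π′ P
          sum = lift (ℕ.≤-trans (s≤s (s≤s z≤n)) 3≤k) , trans (sym (same-set r (s≤s (s≤s z≤n)))) (is-graph (plus g))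
          product : SourceIs k (ix 2) Π′ T′
          product = lift 3≤k , trans (sym (same-set r (s≤s (s≤s (s≤s z≤n))))) (is-graph (times g))
          mk : ∀ {Π″} → Π′ ~[ k ] Π″ → Marked Π″
          mk r′ = marked (good-~ (ℕ.≤ᵇ⇒≤ 3 3 tt) (~-trans 3≤k r r′) g)
        first-group : Strategy true 3 (group every (ix 1) (ix 2)) (Truth totality) (Lift 1ℓ ⊤) Π
        first-group = group-strategy every (ix 1) (ix 2) xd w∈ xd sum product choose
          where
            open At-index {Π} {3} ℕ.≤-refl ~-refl
            choose : ∀ x → member (world g) x → ∃[ y ] ∃[ z ] member P y × member T′ z × (∀ {Π′} → Named 3 Π Π′ x y z → Truth totality Π′)
            choose x x∈ with em₀ {∃[ a ] ∃[ b ] Component (bits∈ x) 0 a × Component (bits∈ x) 1 b}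
            ... | yes (a , b , u , v) = let (y , y∈ , t) = total (plus g) a b ; (z , z∈ , t′) = total (times g) a b in
              y , z , y∈ , z∈ , λ {Π′} nd →
                totality-from {Π′} (mk (before nd))
                  (component-cong (bitOf-trace {Π′} {4} (second nd)) (proj₁ t)) (component-cong (bitOf-trace {Π′} {4} (second nd)) (proj₁ (proj₂ t)))
                  (component-cong (bitOf-trace {Π′} {5} (third′ nd)) (proj₁ t′)) (component-cong (bitOf-trace {Π′} {5} (third′ nd)) (proj₁ (proj₂ t′)))
                  (component-cong (bitOf-trace {Π′} {3} (first nd)) u) (component-cong (bitOf-trace {Π′} {3} (first nd)) v)
            ... | no none = let (y , y∈ , _) = total (plus g) 0 0 ; (z , z∈ , _) = total (times g) 0 0 in
              y , z , y∈ , z∈ , λ {Π′} nd → totality-vacuous {Π′} (mk (before nd)) λ (a , b , u , v) → none (a , b ,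
                component-cong (λ i → mk⇔ (from (bitOf-trace {Π′} {3} (first nd) i)) (to (bitOf-trace {Π′} {3} (first nd) i))) u ,
                component-cong (λ i → mk⇔ (from (bitOf-trace {Π′} {3} (first nd) i)) (to (bitOf-trace {Π′} {3} (first nd) i))) v)
        second-group : ∀ {Π′} → Π ~[ 3 ] Π′ → Strategy true 6 (group (ix 1) (ix 1) every) (Truth additive) (Lift 1ℓ ⊤) Π′
        second-group {Π₁} r = group-strategy (ix 1) (ix 1) every xd w∈ sum sum xd choose
          where
            open At-index {Π₁} {6} 3≤6 r
            choose : ∀ x → member P x → ∃[ y ] ∃[ z ] member P y × member (world g) z × (∀ {Π′} → Named 6 Π₁ Π′ x y z → Truth additive Π′)
            choose x x∈ with sound (plus g) x x∈
            -- In the base case any triple may stand at level 7, and `x` is at hand.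
            ... | a , zero , t = x , w , x∈ , w∈ , λ {Π′} nd → from (additive-⇔ {Π′} (mk (before nd)) (through {6} {Π₁} {Π′} (first nd) t) (through {7} {Π₁} {Π′} (second nd) t))
              (inj₁ (refl , sym (ℕ.+-identityʳ a)))
            ... | a , suc b , t = let (y , y∈ , t′) = total (plus g) a b in y , w , y∈ , w∈ , λ {Π′} nd →
              from (additive-⇔ {Π′} (mk (before nd)) (through {6} {Π₁} {Π′} (first nd) t) (through {7} {Π₁} {Π′} (second nd) t′)) (inj₂ (refl , refl , ℕ.+-suc a b))
        third-group : ∀ {Π′} → Π ~[ 3 ] Π′ → Strategy true 9 (group (ix 2) (ix 2) (ix 1)) (Truth multiplicative) (Lift 1ℓ ⊤) Π′
        third-group {Π₁} r = group-strategy (ix 2) (ix 2) (ix 1) xd w∈ product product sum choose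
          where
            open At-index {Π₁} {9} 3≤9 r
            choose : ∀ x → member T′ x → ∃[ y ] ∃[ z ] member T′ y × member P z × (∀ {Π′} → Named 9 Π₁ Π′ x y z → Truth multiplicative Π′)
            choose x x∈ with sound (times g) x x∈
            ... | a , zero , t = let (z , z∈ , t″) = total (plus g) 0 0 in x , z , x∈ , z∈ , λ {Π′} nd →
              from (multiplicative-⇔ {Π′} (mk (before nd)) (through {9} {Π₁} {Π′} (first nd) t) (through {10} {Π₁} {Π′} (second nd) t) (through {11} {Π₁} {Π′} (third′ nd) t″))
                (inj₁ (refl , ℕ.*-zeroʳ a))
            -- The third trace is the sum of `a * b` and `a`, the step from `a * b` to `a * suc b`.
            ... | a , suc b , t = let (y , y∈ , t′) = total (times g) a b ; (z , z∈ , t″) = total (plus g) (a * b) a in y , z , y∈ , z∈ , λ {Π′} nd →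
              from (multiplicative-⇔ {Π′} (mk (before nd)) (through {9} {Π₁} {Π′} (first nd) t) (through {10} {Π₁} {Π′} (second nd) t′) (through {11} {Π₁} {Π′} (third′ nd) t″))
                (inj₂ (refl , refl , refl , refl , trans (ℕ.+-comm (a * b) a) (sym (ℕ.*-suc a b))))
        fourth-group : ∀ {Π′} → Π ~[ 3 ] Π′ → Strategy true 12 (group every every every) (Truth prepending) (Lift 1ℓ ⊤) Π′
        fourth-group {Π₁} r = group-strategy every every every xd w∈ xd xd xd choose
          where
            open At-index {Π₁} {12} 3≤12 r
            Shifted : Set → Trace (suc m) → ℕ → Set
            Shifted A x zero    = A
            Shifted A x (suc i) = bits∈ x i
            shifted : ∀ {A} {x y : Trace (suc m)} → (∀ i → bits∈ y i ⇔ Shifted A x i) → ∀ i → bits∈ y (i + 1) ⇔ bits∈ x i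
            shifted {A} {x} h i = mk⇔ (subst (Shifted A x) (ℕ.+-comm i 1) ∘ to (h (i + 1))) (from (h (i + 1)) ∘ subst (Shifted A x) (ℕ.+-comm 1 i))
            relay : ∀ {Π′ : Asg} {j k} {x y : Trace (suc m)} → traces Π′ (nm j) ≡ just x → traces Π′ (nm k) ≡ just y → (∀ i → bits∈ y (i + 1) ⇔ bits∈ x i) →
              ∀ i → bitOf Π′ k (i + 1) ⇔ bitOf Π′ j i
            relay {Π′} {j} {k} e e′ h i = mk⇔
              (to (bitOf-trace {Π′} {j} e i) ∘ to (h i) ∘ from (bitOf-trace {Π′} {k} e′ (i + 1)))
              (to (bitOf-trace {Π′} {k} e′ (i + 1)) ∘ from (h i) ∘ from (bitOf-trace {Π′} {j} e i))
            choose : ∀ x → member (world g) x → ∃[ y ] ∃[ z ] member (world g) y × member (world g) z × (∀ {Π′} → Named 12 Π₁ Π′ x y z → Truth prepending Π′)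
            choose x x∈ = let (y , y∈ , hy) = universal g (Shifted ⊥ x) ; (z , z∈ , hz) = universal g (Shifted ⊤ x) in
              y , z , y∈ , z∈ , λ {Π′} nd → from (prepending-⇔ {Π′})
                ( (λ b → to (hy 0) (from (bitOf-trace {Π′} {13} (second nd) 0) b))
                , to (bitOf-trace {Π′} {14} (third′ nd) 0) (from (hz 0) tt)
                , relay {Π′} {12} {13} (first nd) (second nd) (shifted {⊥} {x} {y} hy)
                , relay {Π′} {12} {14} (first nd) (third′ nd) (shifted {⊤} {x} {z} hz) )
        strategy-formula : ∀ {Π′} → Π ~[ 3 ] Π′ → Strategy true 15 (rest₄ φ) (Truth (matrixᶠ [] firstFree φ)) (v ⊨ᴬ φ) Π′
        strategy-formula r = formula-strategy φ true (ℕ.≤ᵇ⇒≤ 3 15 tt) (good-~ ℕ.≤-refl r g) noEntries λ τ x f → ⊥-elim (closedᶠ (τ , x) f)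

  start : TraceSet (suc m) → Asg
  start W = ⟨ (λ _ → nothing) ∣ (λ _ → nothing) ⟩ [ Xd ↦ˢ W ]

  true⇒satisfiableᴴ : ∀ φ (c : ∀ w → ¬ FreeIn w φ) v → v ⊨ᴬ φ → FiniteStateSatisfiable (hyperSentence (φ , c))
  true⇒satisfiableᴴ φ c v h = complete , from (prefixed-game 0 (wholePrefix φ) (ltl (wholeMatrix φ)))
    (game-mono 0 (wholePrefix φ) (λ {Π} → to (won-matrix {Π} φ))
    ( W , w , ruler , legal-every {0} {start W} refl w∈ ruler∈
    -- The trace of this entry is drawn from the set just bound, so one member serves both as the
    -- proof of nonemptiness and as the trace.
    , P , p , p , legal-self {1} {Π₁} refl (λ _ → proj₁) p∈
    , Q , q , q , legal-self {2} {Π₂} refl (λ _ → proj₁) q∈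
    , play (good-strategy good φ v c) (Won φ) λ Π′ e truth → from (won-parts {Π′} φ)
        (marked-~ {Π₃} {Π′} (s≤s z≤n) e (marked good) , truth (lift tt , lift tt , lift tt , lift tt , h)) ))
    where
      W = Tr complete
      universalᵂ = complete-universal
      w = proj₁ (universalᵂ (λ _ → ⊥))
      w∈ = proj₁ (proj₂ (universalᵂ (λ _ → ⊥)))
      multiples = universalᵂ (λ i → ∃[ a ] i ≡ 3 * a)
      ruler = proj₁ multiples
      ruler∈ = proj₁ (proj₂ multiples)
      graphOf : (ℕ → ℕ → ℕ) → TraceSet (suc m)
      graphOf f = record
        { member  = λ t → member W t × ∃[ a ] ∃[ b ] Triple (bits∈ t) a b (f a b)
        ; respect = λ e (t∈ , a , b , h) → respect W e t∈ , a , b ,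
            triple-cong (λ i → mk⇔ (subst (zero ∈ˢ_) (e i)) (subst (zero ∈ˢ_) (sym (e i)))) h
        }
      totalOf : ∀ f a b → ∃[ t ] member (graphOf f) t × Triple (bits∈ t) a b (f a b)
      totalOf f a b with triple-exists {W} universalᵂ a b (f a b)
      ... | t , t∈ , h = t , (t∈ , a , b , h) , h
      P Q : TraceSet (suc m)
      P = graphOf _+_
      Q = graphOf _*_
      p = proj₁ (totalOf _+_ 0 0)
      p∈ = proj₁ (proj₂ (totalOf _+_ 0 0))
      q = proj₁ (totalOf _*_ 0 0)
      q∈ = proj₁ (proj₂ (totalOf _*_ 0 0))
      Π₁ Π₂ Π₃ : Asg
      Π₁ = bind 0 (start W) W w ruler
      Π₂ = bind 1 Π₁ P p p
      Π₃ = bind 2 Π₂ Q q q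
      good : Good Π₃
      good = record
        { world = W ; is-world = refl ; universal = universalᵂ
        ; marked = λ i → mk⇔ (to (proj₂ (proj₂ multiples) i) ∘ from (bitOf-trace {Π₃} {0} {ruler} refl i))
                             (to (bitOf-trace {Π₃} {0} {ruler} refl i) ∘ from (proj₂ (proj₂ multiples) i))
        ; plus  = record { graph = P ; is-graph = refl ; sound = λ t (_ , h) → h ; total = totalOf _+_ }
        ; times = record { graph = Q ; is-graph = refl ; sound = λ t (_ , h) → h ; total = totalOf _*_ }
        }

  dual-prefixᵀ : ∀ b t → dual (prefixᵀ b t) ≡ prefixᵀ (not b) t
  dual-prefixᵀ₂ : ∀ b s t → dual (prefixᵀ b s ++ prefixᵀ b t) ≡ prefixᵀ (not b) s ++ prefixᵀ (not b) t
  dual-prefixᵀ b (var x) = refl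
  dual-prefixᵀ b (s ⊕ t) = cong (_ ∷_) (dual-prefixᵀ₂ b s t)
  dual-prefixᵀ b (s ⊗ t) = cong (_ ∷_) (dual-prefixᵀ₂ b s t)
  dual-prefixᵀ₂ b s t = trans (List.map-++ _ (prefixᵀ b s) _) (cong₂ _++_ (dual-prefixᵀ b s) (dual-prefixᵀ b t))

  dual-prefixᶠ : ∀ ρ k b φ → dual (prefixᶠ ρ k b φ) ≡ prefixᶠ ρ k (not b) φ
  dual-prefixᶠ ρ k b (s ≈ t)    = cong (_ ∷_) (dual-prefixᵀ₂ b s t)
  dual-prefixᶠ ρ k b (s ≺ t)    = cong (_ ∷_) (dual-prefixᵀ₂ b s t)
  dual-prefixᶠ ρ k b (t ∈₁ A)   = cong (_ ∷_) (dual-prefixᵀ b t)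
  dual-prefixᶠ ρ k b (A ∈₂ 𝒜)   = refl
  dual-prefixᶠ ρ k b (neg φ)    = dual-prefixᶠ ρ k (not b) φ
  dual-prefixᶠ ρ k b (φ and χ)  = trans (List.map-++ _ (prefixᶠ ρ k b φ) _) (cong₂ _++_ (dual-prefixᶠ ρ k b φ) (dual-prefixᶠ ρ _ b χ))
  dual-prefixᶠ ρ k b (φ or χ)   = trans (List.map-++ _ (prefixᶠ ρ k b φ) _) (cong₂ _++_ (dual-prefixᶠ ρ k b φ) (dual-prefixᶠ ρ _ b χ))
  dual-prefixᶠ ρ k b (∃⁰ x ∙ φ) = cong (_ ∷_) (dual-prefixᶠ _ (suc k) b φ)
  dual-prefixᶠ ρ k b (∀⁰ x ∙ φ) = cong (_ ∷_) (dual-prefixᶠ _ (suc k) b φ)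
  dual-prefixᶠ ρ k b (∃¹ x ∙ φ) = cong (_ ∷_) (dual-prefixᶠ _ (suc k) b φ)
  dual-prefixᶠ ρ k b (∀¹ x ∙ φ) = cong (_ ∷_) (dual-prefixᶠ _ (suc k) b φ)
  dual-prefixᶠ ρ k b (∃² x ∙ φ) = cong (_ ∷_) (dual-prefixᶠ _ (suc k) b φ)
  dual-prefixᶠ ρ k b (∀² x ∙ φ) = cong (_ ∷_) (dual-prefixᶠ _ (suc k) b φ)

  -- If φ fails then the opponent wins the game that remains after the axioms.

  formula-true : ∀ φ (c : ∀ w → ¬ FreeIn w φ) v {Π} → Good Π → Game firstFree (rest₄ φ) (Won φ) Π → v ⊨ᴬ φ
  formula-true φ c v {Π} g game = stable λ ¬v → game-dual firstFree (rest₄ φ)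
    (subst (λ Q → Game firstFree Q (¬_ ∘ Won φ) Π) (sym (dual-prefixᶠ [] firstFree true φ))
      (play (formula-strategy φ false {v = v} (ℕ.≤ᵇ⇒≤ 3 15 tt) g noEntries (λ τ x f → ⊥-elim (c (τ , x) f))) (¬_ ∘ Won φ)
        λ Π′ e w mx → w ¬v (proj₂ (proj₂ (proj₂ (proj₂ (proj₂ (to (won-parts {Π′} φ) mx))))))))
    game

  module _ (𝔗 : TransitionSystem (suc m)) (φ : Arith) where
    private
      W = Tr 𝔗

    Fact : ℕ → Asg → TraceSet (suc m) → TraceSet (suc m) → TraceSet (suc m) → Set₁
    Fact k Π D₁ D₂ D₃ = ∀ x → member D₁ x → ∃[ y ] ∃[ z ] member D₂ y × member D₃ z × ∃[ Π′ ] Named k Π Π′ x y z × Won φ Π′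

    record Facts (Π₃ : Asg) (P Q : TraceSet (suc m)) : Set₁ where
      field
        {Π₆ Π₉ Π₁₂ Π₁₅} : Asg
        fact₁ : Fact 3 Π₃ W P Q
        fact₂ : Fact 6 Π₆ P P W
        fact₃ : Fact 9 Π₉ Q Q P
        fact₄ : Fact 12 Π₁₂ W W W
        final : Π₃ ~[ 3 ] Π₁₅
        remaining : Game firstFree (rest₄ φ) (Won φ) Π₁₅

    -- Each axiom is extracted at the assignment reached just before its group. The game is then
    -- played through that group to reach the next one; the sources are still the same because they
    -- were bound earlier.
    axioms-facts : ∀ {Π P Q} → Inhabited 3 Π → sets Π Xd ≡ just W → sets Π (var (nm 1)) ≡ just P → sets Π (var (nm 2)) ≡ just Q →
      Game 3 (group every (ix 1) (ix 2) ++ rest₁ φ) (Won φ) Π → Facts Π P Q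
    axioms-facts {Π₃} {P} {Q} inh₃ xd pe qe game₃ = record
      { fact₁ = fact₁ ; fact₂ = fact₂ ; fact₃ = fact₃ ; fact₄ = fact₄ ; final = r₁₅ ; remaining = game₁₅ }
      where
        valid₄ : Valid 15 (rest₄ φ)
        valid₄ = valid-prefixᶠ firstFree true φ (ℕ.≤ᵇ⇒≤ 2 15 tt) noEntries
        valid₃ : Valid 12 (rest₃ φ)
        valid₃ = every , every , every , valid₄
        valid₂ : Valid 9 (rest₂ φ)
        valid₂ = ix (ℕ.≤ᵇ⇒≤ 2 9 tt) , ix (ℕ.≤ᵇ⇒≤ 2 10 tt) , ix (ℕ.≤ᵇ⇒≤ 1 11 tt) , valid₃
        valid₁ : Valid 6 (rest₁ φ)
        valid₁ = ix (ℕ.≤ᵇ⇒≤ 1 6 tt) , ix (ℕ.≤ᵇ⇒≤ 1 7 tt) , every , valid₂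

        Played : ℕ → Prefix → Prefix → Asg → Set₁
        Played k Q rest Π = ∃[ Π′ ] Π ~[ k ] Π′ × Inhabited (after-prefix k Q) Π′ × Game (after-prefix k Q) rest (Won φ) Π′
        play-through : ∀ {k Π} Q rest → Inhabited k Π → Valid k Q → Game k (Q ++ rest) (Won φ) Π → Played k Q rest Π
        play-through {k} {Π} Q rest inh v game = some-play k Q {Game (after-prefix k Q) rest (Won φ)} inh v (to (game-++ k Q rest {Won φ} {Π}) game)

        step₁ : Played 3 (group every (ix 1) (ix 2)) (rest₁ φ) Π₃
        step₁ = play-through (group every (ix 1) (ix 2)) (rest₁ φ) inh₃ (every , ix (ℕ.≤ᵇ⇒≤ 1 4 tt) , ix (ℕ.≤ᵇ⇒≤ 2 5 tt) , tt) game₃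
        Π₆ : Asg
        Π₆ = proj₁ step₁
        r₆ : Π₃ ~[ 3 ] Π₆
        r₆ = proj₁ (proj₂ step₁)
        inh₆ : Inhabited 6 Π₆
        inh₆ = proj₁ (proj₂ (proj₂ step₁))
        game₆ : Game 6 (rest₁ φ) (Won φ) Π₆
        game₆ = proj₂ (proj₂ (proj₂ step₁))
        step₂ : Played 6 (group (ix 1) (ix 1) every) (rest₂ φ) Π₆
        step₂ = play-through (group (ix 1) (ix 1) every) (rest₂ φ) inh₆ (ix (ℕ.≤ᵇ⇒≤ 1 6 tt) , ix (ℕ.≤ᵇ⇒≤ 1 7 tt) , every , tt) game₆
        Π₉ : Asg
        Π₉ = proj₁ step₂
        r₉ : Π₃ ~[ 3 ] Π₉
        r₉ = ~-trans (ℕ.≤ᵇ⇒≤ 3 6 tt) r₆ (proj₁ (proj₂ step₂))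
        inh₉ : Inhabited 9 Π₉
        inh₉ = proj₁ (proj₂ (proj₂ step₂))
        game₉ : Game 9 (rest₂ φ) (Won φ) Π₉
        game₉ = proj₂ (proj₂ (proj₂ step₂))
        step₃ : Played 9 (group (ix 2) (ix 2) (ix 1)) (rest₃ φ) Π₉
        step₃ = play-through (group (ix 2) (ix 2) (ix 1)) (rest₃ φ) inh₉ (ix (ℕ.≤ᵇ⇒≤ 2 9 tt) , ix (ℕ.≤ᵇ⇒≤ 2 10 tt) , ix (ℕ.≤ᵇ⇒≤ 1 11 tt) , tt) game₉
        Π₁₂ : Asg
        Π₁₂ = proj₁ step₃
        r₁₂ : Π₃ ~[ 3 ] Π₁₂
        r₁₂ = ~-trans (ℕ.≤ᵇ⇒≤ 3 9 tt) r₉ (proj₁ (proj₂ step₃))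
        inh₁₂ : Inhabited 12 Π₁₂
        inh₁₂ = proj₁ (proj₂ (proj₂ step₃))
        game₁₂ : Game 12 (rest₃ φ) (Won φ) Π₁₂
        game₁₂ = proj₂ (proj₂ (proj₂ step₃))
        step₄ : Played 12 (group every every every) (rest₄ φ) Π₁₂
        step₄ = play-through (group every every every) (rest₄ φ) inh₁₂ (every , every , every , tt) game₁₂
        Π₁₅ : Asg
        Π₁₅ = proj₁ step₄
        r₁₅ : Π₃ ~[ 3 ] Π₁₅
        r₁₅ = ~-trans (ℕ.≤ᵇ⇒≤ 3 12 tt) r₁₂ (proj₁ (proj₂ step₄))
        game₁₅ : Game 15 (rest₄ φ) (Won φ) Π₁₅
        game₁₅ = proj₂ (proj₂ (proj₂ step₄))

        sum : ∀ {Π k} → 3 ≤ k → Π₃ ~[ 3 ] Π → SourceIs k (ix 1) Π P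
        sum h r = source-~ (ix 1) h r (lift (s≤s (s≤s z≤n)) , pe)
        product : ∀ {Π k} → 3 ≤ k → Π₃ ~[ 3 ] Π → SourceIs k (ix 2) Π Q
        product h r = source-~ (ix 2) h r (lift (s≤s (s≤s (s≤s z≤n))) , qe)
        whole : ∀ {Π k} → 3 ≤ k → Π₃ ~[ 3 ] Π → SourceIs k every Π W
        whole h r = source-~ every h r xd

        fact : ∀ {k Π D₁ D₂ D₃} s₁ s₂ s₃ rest → Inhabited k Π → Valid (3 + k) rest →
          SourceIs k s₁ Π D₁ → SourceIs k s₂ Π D₂ → SourceIs k s₃ Π D₃ →
          Game k (group s₁ s₂ s₃ ++ rest) (Won φ) Π → Fact k Π D₁ D₂ D₃
        fact {k} {Π} {D₁} {D₂} {D₃} s₁ s₂ s₃ rest inh v e₁ e₂ e₃ game =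
          group-extract {k} {Π} {D₁} {D₂} {D₃} {Won φ} {rest} s₁ s₂ s₃ inh v e₁ e₂ e₃ game

        fact₁ : Fact 3 Π₃ W P Q
        fact₁ = fact every (ix 1) (ix 2) (rest₁ φ) inh₃ valid₁ xd (sum ℕ.≤-refl ~-refl) (product ℕ.≤-refl ~-refl) game₃
        fact₂ : Fact 6 Π₆ P P W
        fact₂ = fact (ix 1) (ix 1) every (rest₂ φ) inh₆ valid₂ (sum (ℕ.≤ᵇ⇒≤ 3 6 tt) r₆) (sum (ℕ.≤ᵇ⇒≤ 3 6 tt) r₆) (whole (ℕ.≤ᵇ⇒≤ 3 6 tt) r₆) game₆
        fact₃ : Fact 9 Π₉ Q Q P
        fact₃ = fact (ix 2) (ix 2) (ix 1) (rest₃ φ) inh₉ valid₃ (product (ℕ.≤ᵇ⇒≤ 3 9 tt) r₉) (product (ℕ.≤ᵇ⇒≤ 3 9 tt) r₉) (sum (ℕ.≤ᵇ⇒≤ 3 9 tt) r₉) game₉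
        fact₄ : Fact 12 Π₁₂ W W W
        fact₄ = fact every every every (rest₄ φ) inh₁₂ valid₄ (whole (ℕ.≤ᵇ⇒≤ 3 12 tt) r₁₂) (whole (ℕ.≤ᵇ⇒≤ 3 12 tt) r₁₂) (whole (ℕ.≤ᵇ⇒≤ 3 12 tt) r₁₂) game₁₂

    -- The graphs are right by induction on the second argument.

    facts-good : ∀ {Π P Q} → ∃ (member W) → sets Π Xd ≡ just W → sets Π (var (nm 1)) ≡ just P → sets Π (var (nm 2)) ≡ just Q →
      Facts Π P Q → Good Π
    facts-good {Π₃} {P} {Q} nonempty xd pe qe facts = good
      where
        open Facts facts
        untrace : ∀ {Π k} {x : Trace (suc m)} → traces Π (nm k) ≡ just x → ∀ i → bitOf Π k i ⇔ bits∈ x i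
        untrace {Π} {k} e i = mk⇔ (from (bitOf-trace {Π} {k} e i)) (to (bitOf-trace {Π} {k} e i))

        marking-of : ∀ {Π} → Won φ Π → Marked Π
        marking-of {Π} mx = proj₁ (to (won-parts {Π} φ) mx)
        totality-of : ∀ {Π} → Won φ Π → Truth totality Π
        totality-of {Π} mx = proj₁ (proj₂ (to (won-parts {Π} φ) mx))
        addition-of : ∀ {Π} → Won φ Π → Truth additive Π
        addition-of {Π} mx = proj₁ (proj₂ (proj₂ (to (won-parts {Π} φ) mx)))
        multiplication-of : ∀ {Π} → Won φ Π → Truth multiplicative Π
        multiplication-of {Π} mx = proj₁ (proj₂ (proj₂ (proj₂ (to (won-parts {Π} φ) mx))))

        prepends : Prepends W
        prepends x x∈ with fact₄ x x∈
        ... | y , z , y∈ , z∈ , Π′ , nd , mx with to (prepending-⇔ {Π′}) (proj₁ (proj₂ (proj₂ (proj₂ (proj₂ (to (won-parts {Π′} φ) mx))))))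
        ... | h₁ , h₂ , h₃ , h₄ = y , z , y∈ , z∈ , h₁ ∘ to (bitOf-trace {Π′} {13} (second nd) 0) , from (bitOf-trace {Π′} {14} (third′ nd) 0) h₂ ,
          (λ i → mk⇔ (to (untrace {Π′} {12} (first nd) i) ∘ to (h₃ i) ∘ to (bitOf-trace {Π′} {13} (second nd) (i + 1)))
                     (to (untrace {Π′} {13} (second nd) (i + 1)) ∘ from (h₃ i) ∘ to (bitOf-trace {Π′} {12} (first nd) i))) ,
          (λ i → mk⇔ (to (untrace {Π′} {12} (first nd) i) ∘ to (h₄ i) ∘ to (bitOf-trace {Π′} {14} (third′ nd) (i + 1)))
                     (to (untrace {Π′} {14} (third′ nd) (i + 1)) ∘ from (h₄ i) ∘ to (bitOf-trace {Π′} {12} (first nd) i)))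

        universalᵂ : ∀ (β : ℕ → Set) → ∃[ t ] member W t × (∀ i → bits∈ t i ⇔ β i)
        universalᵂ = prepends-universal 𝔗 nonempty prepends

        marked₃ : Marked Π₃
        marked₃ with fact₁ (proj₁ nonempty) (proj₂ nonempty)
        ... | y , z , y∈ , z∈ , Π′ , nd , mx = λ i →
          let same = bitOf-same {Π₃} {Π′} (same-trace (before nd) (s≤s z≤n)) i ; mk = proj₁ (to (won-parts {Π′} φ) mx) i in
          mk⇔ (to mk ∘ to same) (from same ∘ from mk)

        read-singles : ∀ {Π k} {x : Trace (suc m)} → traces Π (nm k) ≡ just x → ∃[ a ] ∃[ b ] ∃[ c ] Triple (bitOf Π k) a b c →
          ∃[ a ] ∃[ b ] ∃[ c ] Triple (bits∈ x) a b c
        read-singles {Π} {k} e (a , b , c , t) = a , b , c , triple-cong (untrace {Π} {k} e) t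

        triples-P : ∀ x → member P x → ∃[ a ] ∃[ b ] ∃[ c ] Triple (bits∈ x) a b c
        triples-P x x∈ with fact₂ x x∈
        ... | y , z , y∈ , z∈ , Π′ , nd , mx = read-singles {Π′} {6} (first nd) (additive-singles {Π′} (marking-of {Π′} mx) (addition-of {Π′} mx))

        triples-Q : ∀ x → member Q x → ∃[ a ] ∃[ b ] ∃[ c ] Triple (bits∈ x) a b c
        triples-Q x x∈ with fact₃ x x∈
        ... | y , z , y∈ , z∈ , Π′ , nd , mx = read-singles {Π′} {9} (first nd) (multiplicative-singles {Π′} (marking-of {Π′} mx) (multiplication-of {Π′} mx))

        adds : ∀ b x {a c} → member P x → Triple (bits∈ x) a b c → c ≡ a + b
        adds-step : ∀ b y {a c a′ b′ c′} → member P y → Triple (bits∈ y) a′ b′ c′ →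
          (b ≡ 0 × a ≡ c) ⊎ (a ≡ a′ × b ≡ suc b′ × c ≡ suc c′) → c ≡ a + b
        adds-step b       y {a} y∈ t (inj₁ (refl , refl))        = sym (ℕ.+-identityʳ a)
        adds-step (suc b) y {a} y∈ t (inj₂ (refl , refl , refl)) = trans (cong suc (adds b y y∈ t)) (sym (ℕ.+-suc a b))
        adds b x x∈ t with fact₂ x x∈
        ... | y , z , y∈ , z∈ , Π′ , nd , mx = let (a′ , b′ , c′ , t′) = triples-P y y∈ in adds-step b y y∈ t′
          (to (additive-⇔ {Π′} (marking-of {Π′} mx) (through {6} {Π′} {Π′} (first nd) t) (through {7} {Π′} {Π′} (second nd) t′)) (addition-of {Π′} mx))

        multiplies : ∀ b x {a c} → member Q x → Triple (bits∈ x) a b c → c ≡ a * b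
        multiplies-step : ∀ b y z {a c a′ b′ c′ a″ b″ c″} → member Q y → member P z → Triple (bits∈ y) a′ b′ c′ → Triple (bits∈ z) a″ b″ c″ →
          (b ≡ 0 × c ≡ 0) ⊎ (a ≡ a′ × b ≡ suc b′ × a″ ≡ c′ × b″ ≡ a × c″ ≡ c) → c ≡ a * b
        multiplies-step b       y z {a} y∈ z∈ t t″ (inj₁ (refl , refl)) = sym (ℕ.*-zeroʳ a)
        multiplies-step (suc b) y z {a} {b″ = b″} y∈ z∈ t t″ (inj₂ (refl , refl , refl , refl , refl)) =
          trans (adds b″ z z∈ t″) (trans (cong (_+ a) (multiplies b y y∈ t)) (trans (ℕ.+-comm (a * b) a) (sym (ℕ.*-suc a b))))
        multiplies b x x∈ t with fact₃ x x∈
        ... | y , z , y∈ , z∈ , Π′ , nd , mx = let (a′ , b′ , c′ , t′) = triples-Q y y∈ ; (a″ , b″ , c″ , t″) = triples-P z z∈ in multiplies-step b y z y∈ z∈ t′ t″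
          (to (multiplicative-⇔ {Π′} (marking-of {Π′} mx) (through {9} {Π′} {Π′} (first nd) t) (through {10} {Π′} {Π′} (second nd) t′) (through {11} {Π′} {Π′} (third′ nd) t″))
            (multiplication-of {Π′} mx))

        -- Totality needs only a member with the right first two components: its third component is
        -- forced by correctness of the graph.
        operation : ∀ f i D → sets Π₃ (var (nm i)) ≡ just D → (∀ x → member D x → ∃[ a ] ∃[ b ] ∃[ c ] Triple (bits∈ x) a b c) →
          (∀ b x {a c} → member D x → Triple (bits∈ x) a b c → c ≡ f a b) →
          (∀ a b → ∃[ x ] member D x × Component (bits∈ x) 0 a × Component (bits∈ x) 1 b) → Operation Π₃ i f
        operation f i D e triples correct pairs = record
          { graph = D ; is-graph = e
          ; sound = λ x x∈ → let (a , b , c , t) = triples x x∈ in a , b , subst (Triple (bits∈ x) a b) (correct b x x∈ t) t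
          ; total = λ a b → let (x , x∈ , u , v) = pairs a b ; (a′ , b′ , c , t) = triples x x∈ in x , x∈ ,
              (u , v , subst (Component (bits∈ x) 2)
                (trans (correct b′ x x∈ t) (cong₂ f (component-unique (proj₁ t) u) (component-unique (proj₁ (proj₂ t)) v))) (proj₂ (proj₂ t)))
          }

        pairs : ∀ a b → (∃[ x ] member P x × Component (bits∈ x) 0 a × Component (bits∈ x) 1 b) ×
                        (∃[ x ] member Q x × Component (bits∈ x) 0 a × Component (bits∈ x) 1 b)
        pairs-from : ∀ {a b} → (∃[ x ] member W x × Triple (bits∈ x) a b 0) →
          (∃[ x ] member P x × Component (bits∈ x) 0 a × Component (bits∈ x) 1 b) × (∃[ x ] member Q x × Component (bits∈ x) 0 a × Component (bits∈ x) 1 b)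
        pairs a b = pairs-from (triple-exists {W} universalᵂ a b 0)
        pairs-from {a} {b} (x , x∈ , u , v , _) with fact₁ x x∈
        ... | y , z , y∈ , z∈ , Π′ , nd , mx =
          let (_ , _ , _ , u₁ , v₁ , _) = triples-P y y∈ ; (_ , _ , _ , u₂ , v₂ , _) = triples-Q z z∈ in
          (y , y∈ , found-at 4 (second nd) (inj₁ refl) u₁ v₁) , (z , z∈ , found-at 5 (third′ nd) (inj₂ refl) u₂ v₂)
          where
            u₀ = component-cong (bitOf-trace {Π′} {3} (first nd)) u
            v₀ = component-cong (bitOf-trace {Π′} {3} (first nd)) v
            agree : ∀ {y a′ b′} → a ≡ a′ × b ≡ b′ → Component (bits∈ y) 0 a′ → Component (bits∈ y) 1 b′ →
              Component (bits∈ y) 0 a × Component (bits∈ y) 1 b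
            agree (refl , refl) u v = u , v
            found-at : ∀ k {y a′ b′} → traces Π′ (nm k) ≡ just y → k ≡ 4 ⊎ k ≡ 5 → Component (bits∈ y) 0 a′ → Component (bits∈ y) 1 b′ →
              Component (bits∈ y) 0 a × Component (bits∈ y) 1 b
            found-at k {y} e which u′ v′ = agree {y} (to (meets-to {Π′} (marking-of {Π′} mx) k u₀ v₀ (component-cong (bitOf-trace {Π′} {k} e) u′) (component-cong (bitOf-trace {Π′} {k} e) v′))
                (totality-to {Π′} (marking-of {Π′} mx) (totality-of {Π′} mx) u₀ v₀ k which)) u′ v′

        good : Good Π₃
        good = record
          { world = W ; is-world = xd ; universal = universalᵂ ; marked = marked₃
          ; plus  = operation _+_ 1 P pe triples-P adds (λ a b → proj₁ (pairs a b))
          ; times = operation _*_ 2 Q qe triples-Q multiplies (λ a b → proj₂ (pairs a b))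
          }

  satisfiableᴴ⇒true : ∀ φ (c : ∀ w → ¬ FreeIn w φ) → FiniteStateSatisfiable (hyperSentence (φ , c)) → ∀ v → v ⊨ᴬ φ
  satisfiableᴴ⇒true φ c (𝔗 , h) v = conclude (game-mono 0 (wholePrefix φ) (λ {Π} → from (won-matrix {Π} φ))
    (to (prefixed-game 0 (wholePrefix φ) (ltl (wholeMatrix φ))) h))
    where
      conclude : Game 0 (constants ++ group every (ix 1) (ix 2) ++ rest₁ φ) (Won φ) (start (Tr 𝔗)) → v ⊨ᴬ φ
      conclude (D₀ , u₀ , t₀ , l₀ , D₁ , u₁ , t₁ , l₁ , D₂ , u₂ , t₂ , l₂ , game) = formula-true φ c v
        (good-~ {Π₃} ℕ.≤-refl (Facts.final facts) (facts-good 𝔗 φ {Π₃} (t₀ , t₀∈) refl refl refl facts)) (Facts.remaining facts)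
        where
          Π₁ Π₂ Π₃ : Asg
          Π₁ = bind 0 (start (Tr 𝔗)) D₀ u₀ t₀
          Π₂ = bind 1 Π₁ D₁ u₁ t₁
          Π₃ = bind 2 Π₂ D₂ u₂ t₂
          -- The first constant is drawn from `Xd`, so the system has at least one trace, from which
          -- prepending starts.
          t₀∈ : member (Tr 𝔗) t₀
          t₀∈ = legal-out {0} {start (Tr 𝔗)} every refl l₀
          inh : Inhabited 0 (start (Tr 𝔗))
          inh = record { all-set = Tr 𝔗 , t₀ , refl , t₀∈ ; each-set = λ () }
          facts : Facts 𝔗 φ Π₃ D₁ D₂
          facts = axioms-facts 𝔗 φ (inhabited-bind (inhabited-bind (inhabited-bind inh l₀) l₁) l₂) refl refl refl game

-- From arithmetic to Hyper²LTL: the machine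

module ToHyper where

  -- `Q` and `M` collect prefix and matrix, both reversed; they grow together but are output one
  -- after the other. `E` holds the binders in scope and the pending connectives, `C` the current
  -- level in unary, `L` the slots that await a term, `N` a name to look up, `R` the level found for
  -- it, and `P` the polarity.
  pattern In  = zero
  pattern Out = suc zero
  pattern Q   = suc (suc zero)
  pattern M   = suc (suc (suc zero))
  pattern E   = suc (suc (suc (suc zero)))
  pattern C   = suc (suc (suc (suc (suc zero))))
  pattern L   = suc (suc (suc (suc (suc (suc zero)))))
  pattern N   = suc (suc (suc (suc (suc (suc (suc zero))))))
  pattern R   = suc (suc (suc (suc (suc (suc (suc (suc zero)))))))
  pattern S   = suc (suc (suc (suc (suc (suc (suc (suc (suc zero))))))))
  pattern S′  = suc (suc (suc (suc (suc (suc (suc (suc (suc (suc zero)))))))))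
  pattern P   = suc (suc (suc (suc (suc (suc (suc (suc (suc (suc (suc zero))))))))))

  Cells : Set
  Cells = List (Cell 11)

  Program : Set
  Program = Prog 11 12

  sortMark : Sort → Cell 11
  sortMark number = mark (# 0)
  sortMark set    = mark (# 1)
  sortMark class  = mark (# 2)

  andMark orMark negMark sepMark pendingMark : Cell 11
  andMark     = mark (# 3)
  orMark      = mark (# 4)
  negMark     = mark (# 5)
  sepMark     = mark (# 6)
  pendingMark = mark (# 10)

  data Side : Set where
    side₀ side₁ side₂ : Side

  sideℕ : Side → ℕ
  sideℕ side₀ = 0
  sideℕ side₁ = 1
  sideℕ side₂ = 2

  sideMark : Side → Cell 11
  sideMark side₀ = mark (# 7)
  sideMark side₁ = mark (# 8)
  sideMark side₂ = mark (# 9)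

  same : Cell 11 → Cell 11 → Bool
  same blank    blank    = true
  same (bit O)  (bit O)  = true
  same (bit I)  (bit I)  = true
  same (mark a) (mark b) = does (a Fin.≟ b)
  same _        _        = false

  isBlank isBody isSide : Cell 11 → Bool
  isBlank blank    = true
  isBlank _        = false
  isBody c         = isBit c ∨ same c sepMark
  isSide c         = same c (sideMark side₀) ∨ (same c (sideMark side₁) ∨ same c (sideMark side₂))

  on : Fin 12 → (Cell 11 → Bool) → Vec (Cell 11) 12 → Bool
  on i f cs = f (lookup cs i)

  read : Program → Program → Program
  read p q = cond (oneOn In) (pop In ⨾ p) (pop In ⨾ q)

  -- Tape S is free for temporary use between procedures.

  emitIndex copyIndex : Fin 12 → Fin 12 → Program
  emitIndex i j = loop (oneOn i) (push j (bit I) ⨾ push j (bit I) ⨾ move i S) ⨾ pour S i ⨾ push j (bit O)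
  copyIndex i j = loop (oneOn i) (copy i j ⨾ move i S) ⨾ pour S i

  -- The codes of existential and universal quantifiers differ only in their third bit, which is `O`
  -- for existential ones; `P` holds this bit, the negation of the polarity.
  quantifiers : Program
  quantifiers = emit Q (I ∷ O ∷ []) ⨾ copy P Q ⨾ push Q (bit I) ⨾ emitIndex C Q ⨾
    emit Q (I ∷ I ∷ []) ⨾ copy P Q ⨾ emitIndex C Q ⨾ push Q (bit I) ⨾ emitIndex C Q ⨾
    emit Q (I ∷ I ∷ []) ⨾ copy P Q ⨾ emitIndex C Q

  flip : Program
  flip = cond (oneOn P) (pop P ⨾ push P (bit O)) (pop P ⨾ push P (bit I))

  -- Conjunction is `neg (neg ψ or neg χ)`, so its code is `conjCode`, the code of `ψ`, `thenCode`,
  -- the code of `χ`. As the code of a negation sign, `thenCode` also translates `neg`.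
  conjCode thenCode bitCode linkCode : List Bool
  conjCode = O ∷ O ∷ I ∷ O ∷ I ∷ O ∷ O ∷ O ∷ I ∷ []
  thenCode = O ∷ O ∷ I ∷ []
  bitCode  = O ∷ O ∷ O ∷ O ∷ []
  linkCode = I ∷ O ∷ O ∷ O ∷ I ∷ O ∷ (bitCode ++ O ∷ []) ++ (O ∷ O ∷ I ∷ bitCode ++ O ∷ []) ++
    conjCode ++ (bitCode ++ O ∷ []) ++ thenCode ++ conjCode

  slot : Program
  slot = cond (on L (same (sideMark side₀))) (pop L)
      (cond (on L (same (sideMark side₁))) (pop L ⨾ emit M (O ∷ I ∷ I ∷ []))
        (pop L ⨾ emit M (O ∷ I ∷ I ∷ O ∷ I ∷ I ∷ []))) ⨾
    emit M bitCode ⨾ loop (oneOn L) (push M (bit I) ⨾ push M (bit I) ⨾ pop L) ⨾ push M (bit O)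

  linkTo : Fin 12 → Program
  linkTo i = emit M (conjCode ++ linkCode ++ O ∷ I ∷ I ∷ O ∷ I ∷ I ∷ bitCode) ⨾ emitIndex i M ⨾ emit M thenCode ⨾ slot ⨾ emit M thenCode

  skipBody : Program
  skipBody = loop (on E isBody) (move E S)

  agree : Vec (Cell 11) 12 → Bool
  agree cs = isBit (lookup cs E) ∧ same (lookup cs E) (lookup cs N)

  -- Frames and `N` both hold names reversed, since both were copied bit by bit from the input; so
  -- they can be compared from the top. Scanned frames move to `S`, and the matched part of `N` is
  -- restored from `S′`.
  inspect : Sort → Program
  inspect τ = cond (on E (same (sortMark τ)))
    (move E S ⨾ loop agree (move E S ⨾ move N S′) ⨾
     cond (λ cs → same (lookup cs E) sepMark ∧ isBlank (lookup cs N))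
       (move E S ⨾ push R sepMark ⨾ loop (oneOn E) (copy E R ⨾ move E S))
       skipBody ⨾
     pour S′ N)
    (move E S ⨾ skipBody)

  -- The separator makes `R` nonblank even for level 0, which signals success and stops the search.
  -- A name that is not found gets level 0, in agreement with `find`.
  lookupName : Sort → Program
  lookupName τ = loop (λ cs → not (isBlank (lookup cs E)) ∧ isBlank (lookup cs R)) (inspect τ) ⨾
    cond (on R isBlank) (push R sepMark) skip ⨾
    loop (λ cs → not (isBlank (lookup cs S))) (move S E) ⨾ discard N

  forget : Program
  forget = discard R ⨾ pop R

  findName : Sort → Program
  findName τ = copyName In N ⨾ lookupName τ

  pushSlot : Cell 11 → Program
  pushSlot c = copyIndex C L ⨾ push L c

  -- The new trace fills the slot on top of `L` and opens two slots for the operands, the left one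
  -- on top because the left operand is read next.
  node : ℕ → Program
  node i = quantifiers ⨾ emit Q (I ∷ ⌜ nm i ⌝ᴺ) ⨾ linkTo C ⨾ pushSlot (sideMark side₁) ⨾ pushSlot (sideMark side₀) ⨾ push C (bit I)

  termToken : Program
  termToken = read (read (node 2) (node 1)) (findName number ⨾ linkTo R ⨾ forget)

  terms : Program
  terms = loop (on L isSide) termToken

  -- After an atom, the binders and negations whose scope ends there are dropped and the polarity is
  -- restored. The innermost pending `and` or `or` then passes to its second operand; its frame is
  -- removed at once, so that the end of the second operand also ends the scopes around it.
  backtrack : Program
  backtrack =
    loop (on E (λ c → same c negMark ∨ (same c (sortMark number) ∨ (same c (sortMark set) ∨ same c (sortMark class)))))
      (cond (on E (same negMark)) (pop E ⨾ flip) (pop E ⨾ loop (on E isBody) (pop E))) ⨾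
    cond (on E (same andMark)) (pop E ⨾ emit M thenCode) (cond (on E (same orMark)) (pop E) skip)

  finish : Program
  finish = emit M (bitCode ++ O ∷ []) ⨾ backtrack

  comparison : List Bool → Program
  comparison s = quantifiers ⨾ emit Q (I ∷ ⌜ nm 1 ⌝ᴺ) ⨾ emit M (conjCode ++ s) ⨾ emitIndex C M ⨾ emit M thenCode ⨾
    pushSlot (sideMark side₂) ⨾ pushSlot (sideMark side₀) ⨾ push C (bit I) ⨾ terms ⨾ finish

  -- The slot at level `k` is needed twice, for the term and for the set. The second copy is marked
  -- `pendingMark`, which is not a side, so that the loop over terms stops there.
  setMember : Program
  setMember = quantifiers ⨾ emit Q (I ∷ ⌜ nm 1 ⌝ᴺ) ⨾ pushSlot pendingMark ⨾ pushSlot (sideMark side₂) ⨾ push C (bit I) ⨾ terms ⨾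
    pop L ⨾ push L (sideMark side₂) ⨾ findName set ⨾ linkTo R ⨾ forget ⨾ finish

  sameCode₁ sameCode₂ sameCode₃ sameCode₄ sameCode₅ : List Bool
  sameCode₁ = conjCode ++ conjCode ++ thenCode ++ linkCode ++ O ∷ I ∷ I ∷ O ∷ I ∷ I ∷ bitCode
  sameCode₂ = thenCode ++ thenCode ++ O ∷ I ∷ I ∷ O ∷ I ∷ I ∷ bitCode
  sameCode₃ = thenCode ++ thenCode ++ linkCode ++ thenCode ++ O ∷ I ∷ I ∷ O ∷ I ∷ I ∷ bitCode
  sameCode₄ = thenCode ++ O ∷ I ∷ I ∷ O ∷ I ∷ I ∷ bitCode
  sameCode₅ = thenCode ++ bitCode

  classMember : Program
  classMember = findName set ⨾ emit M sameCode₁ ⨾ emitIndex R M ⨾ emit M sameCode₂ ⨾ emitIndex C M ⨾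
    emit M sameCode₃ ⨾ emitIndex R M ⨾ emit M sameCode₄ ⨾ emitIndex C M ⨾ emit M sameCode₅ ⨾ emitIndex C M ⨾ forget ⨾
    findName class ⨾ quantifiers ⨾ push Q (bit I) ⨾ emitIndex R Q ⨾ forget ⨾ push C (bit I) ⨾ backtrack

  source : Sort → Program
  source number = emit Q (I ∷ ⌜ nm 1 ⌝ᴺ)
  source set    = emit Q (O ∷ I ∷ [])
  source class  = push Q (bit I) ⨾ emitIndex C Q

  introduce : Sort → Program
  introduce τ = source τ ⨾ copyIndex C E ⨾ push E sepMark ⨾ copyName In E ⨾ push E (sortMark τ) ⨾ push C (bit I)

  -- A universal entry has the opposite sign while the polarity of its body is unchanged, so `P` is
  -- flipped only around the entry.
  quantifier : Sort → Program
  quantifier τ = read (flip ⨾ quantifiers ⨾ flip ⨾ introduce τ) (quantifiers ⨾ introduce τ)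

  token : Program
  token = read
    (read (read skip (quantifier class)) (read (quantifier set) (quantifier number)))
    (read
      (read (read skip (emit M (O ∷ I ∷ O ∷ []) ⨾ push E orMark)) (read (emit M conjCode ⨾ push E andMark) (emit M thenCode ⨾ push E negMark ⨾ flip)))
      (read (read classMember setMember) (read (comparison (thenCode ++ O ∷ I ∷ I ∷ bitCode)) (comparison (O ∷ I ∷ I ∷ bitCode)))))

  mainLoop : Program
  mainLoop = loop (bitOn In) token

  stacks : Cells → Cells → Cells → Cells → Cells → Cells → Cells → Cells → Cells → Cells → Cells → Stacks 11 12
  stacks i q m e c l n r s s′ p = i ∷ [] ∷ q ∷ m ∷ e ∷ c ∷ l ∷ n ∷ r ∷ s ∷ s′ ∷ p ∷ []

  ones : ℕ → Cells
  ones k = bits (nm k)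

  lens : ∀ {i : Fin 12} {f : Cells → Stacks 11 12} → (∀ a → lookup (f a) i ≡ a) → (∀ a b → f a [ i ]≔ b ≡ f b) → At i f
  lens g p = record { get = g ; put = p }

  module Timing (Z : ℕ) (1≤Z : 1 ≤ Z) where

    -- Times are counted in multiples of `Z`, which will bound the levels, names and frame stacks
    -- that occur. Costs of consecutive procedures are then numerals that add up and are compared by
    -- evaluation.
    record Takes (c : ℕ) (p : Program) (σ σ′ : Stacks 11 12) : Set where
      constructor takes
      field within : Within p σ σ′ (c * Z)

    open Takes public

    const : ∀ {p σ σ′ t} → Within p σ σ′ t → Takes t p σ σ′
    const {t = t} r = takes (relax (ℕ.≤-trans (ℕ.≤-reflexive (sym (ℕ.*-identityʳ t))) (ℕ.*-monoʳ-≤ t 1≤Z)) r)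

    linear : ∀ {p σ σ′} a b {l} → l ≤ Z → Within p σ σ′ (a * l + b) → Takes (a + b) p σ σ′
    linear a b {l} l≤ r = takes (relax bound r)
      where
        open ℕ.≤-Reasoning
        bound : a * l + b ≤ (a + b) * Z
        bound = begin
          a * l + b  ≤⟨ ℕ.+-mono-≤ (ℕ.*-monoʳ-≤ a l≤) (ℕ.≤-trans (ℕ.≤-reflexive (sym (ℕ.*-identityʳ b))) (ℕ.*-monoʳ-≤ b 1≤Z)) ⟩
          a * Z + b * Z  ≡⟨ ℕ.*-distribʳ-+ Z a b ⟨
          (a + b) * Z  ∎

    infixr 5 _⊳_

    _⊳_ : ∀ {a b p q σ σ′ σ″} → Takes a p σ σ′ → Takes b q σ′ σ″ → Takes (a + b) (p ⨾ q) σ σ″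
    _⊳_ {a} {b} (takes r) (takes s) = takes (relax (ℕ.≤-reflexive (sym (ℕ.*-distribʳ-+ Z a b))) (r ⨟ s))

    slacken : ∀ {a b p σ σ′} {_ : T (a ≤ᵇ b)} → Takes a p σ σ′ → Takes b p σ σ′
    slacken {a} {b} {_} {_} {_} {h} (takes r) = takes (relax (ℕ.*-monoˡ-≤ Z (ℕ.≤ᵇ⇒≤ a b h)) r)

    thenᵀ : ∀ {a b p q σ σ′} → b (tops σ) ≡ true → Takes a p σ σ′ → Takes (suc a) (cond b p q) σ σ′
    thenᵀ {a} e (takes r) = takes (relax (ℕ.+-monoˡ-≤ (a * Z) 1≤Z) (thenᵂ e r))

    elseᵀ : ∀ {a b p q σ σ′} → b (tops σ) ≡ false → Takes a q σ σ′ → Takes (suc a) (cond b p q) σ σ′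
    elseᵀ {a} e (takes r) = takes (relax (ℕ.+-monoˡ-≤ (a * Z) 1≤Z) (elseᵂ e r))

    arriveᵀ : ∀ {c p σ σ′ σ″} → σ′ ≡ σ″ → Takes c p σ σ′ → Takes c p σ σ″
    arriveᵀ refl r = r

    departᵀ : ∀ {c p σ σ′ σ″} → σ ≡ σ″ → Takes c p σ σ′ → Takes c p σ″ σ′
    departᵀ refl r = r

    not-one : ∀ (cs : Cells) → NonBit cs → isOne (top cs) ≡ false
    not-one []             _ = refl
    not-one (blank ∷ _)    _ = refl
    not-one (mark _ ∷ _)   _ = refl

    module _ {i j : Fin 12} (i≢j : i ≢ j) (i≢S : i ≢ S) (S≢i : S ≢ i) {f : Cells → Cells → Cells → Stacks 11 12}
             (onᵢ : ∀ b s → At i (λ a → f a b s)) (onⱼ : ∀ a s → At j (λ b → f a b s)) (onₛ : ∀ a b → At S (λ s → f a b s)) where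

      refill : ∀ u {cs} b → NonBit cs → Within (pour S i) (f cs b (bits (u ʳ++ []))) (f (bits u ++ cs) b []) (4 * length u + 1)
      refill u {cs} b nb = relax (ℕ.≤-reflexive (cong (λ l → 4 * l + 1) (trans (List.length-ʳ++ u) (ℕ.+-identityʳ _))))
        (depart (cong (f cs b) (List.++-identityʳ (bits (u ʳ++ []))))
          (arrive (cong (λ a → f a b []) (trans (List.ʳ++-defn (bits (u ʳ++ []))) (cong (_++ cs) same-bits)))
            (pourᴬ {i = S} {j = i} {f = λ s a → f a b s} S≢i (λ a → onₛ a b) (λ s → onᵢ b s) (u ʳ++ []) {[]} refl cs)))
        where
          same-bits : reverse (bits (u ʳ++ [])) ≡ bits u
          same-bits = trans (cong reverse (bits-ʳ++ u [])) (trans (cong reverse (trans (List.ʳ++-defn (bits u)) (List.++-identityʳ _))) (List.reverse-involutive (bits u)))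

      emitIndexᵂ : ∀ k {cs} b → NonBit cs → k ≤ Z → Takes 16 (emitIndex i j) (f (ones k ++ cs) (bits b) []) (f (ones k ++ cs) (bits (⌜ nm k ⌝ᴺ ʳ++ b)) [])
      emitIndexᵂ k {cs} b nb k≤ = slacken {9 + (5 + 2)} (linear 8 1 k≤ (writing k b []) ⊳
        linear 4 1 (subst (_≤ Z) (sym (List.length-replicate k)) k≤) (refill (nm k) (bits (written k b)) nb) ⊳
        arriveᵀ (cong (λ b → f (ones k ++ cs) (bits b) []) (sym (end k b))) (const (pushᴬ (onⱼ (ones k ++ cs) []) (bit O) _)))
        where
          written : ℕ → List Bool → List Bool
          written zero    b = b
          written (suc k) b = written k (I ∷ I ∷ b)
          end : ∀ k b → ⌜ nm k ⌝ᴺ ʳ++ b ≡ O ∷ written k b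
          end zero    b = refl
          end (suc k) b = end k (I ∷ I ∷ b)
          writing : ∀ k b s → Within (loop (oneOn i) (push j (bit I) ⨾ push j (bit I) ⨾ move i S)) (f (ones k ++ cs) (bits b) (bits s))
            (f cs (bits (written k b)) (bits (nm k ʳ++ s))) (8 * k + 1)
          writing zero    b s = stopᵂ (trans (cong isOne (top-get (onᵢ (bits b) (bits s)) cs)) (not-one cs nb))
          writing (suc k) b s = relax (ℕ.≤-reflexive (sum k)) (againᵂ (cong isOne (top-get (onᵢ (bits b) (bits s)) _))
            (pushᴬ (onⱼ _ (bits s)) (bit I) (bits b) ⨟ pushᴬ (onⱼ _ (bits s)) (bit I) _ ⨟
             moveᴬ {f = λ a s → f a (bits (I ∷ I ∷ b)) s} i≢S (λ s → onᵢ _ s) (λ a → onₛ a _) (bit I) _ (bits s)) (writing k (I ∷ I ∷ b) (I ∷ s)))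
            where
              sum : ∀ k → 1 + (2 + (2 + 3) + (8 * k + 1)) ≡ 8 * suc k + 1
              sum = solve-∀

      copyIndexᵂ : ∀ k {cs} b → NonBit cs → k ≤ Z → Takes 12 (copyIndex i j) (f (ones k ++ cs) b []) (f (ones k ++ cs) (ones k ++ b) [])
      copyIndexᵂ k {cs} b nb k≤ = slacken {7 + 5} (linear 6 1 k≤ (copying k [] b nb) ⊳
        linear 4 1 (subst (_≤ Z) (sym (List.length-replicate k)) k≤) (refill (nm k) (ones k ++ b) nb))
        where
          copying : ∀ k s b → NonBit cs → Within (loop (oneOn i) (copy i j ⨾ move i S)) (f (ones k ++ cs) b (bits s))
            (f cs (ones k ++ b) (bits (nm k ʳ++ s))) (6 * k + 1)
          copying zero    s b nb = stopᵂ (trans (cong isOne (top-get (onᵢ b (bits s)) cs)) (not-one cs nb))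
          copying (suc k) s b nb = arrive (cong (λ b → f cs b _) (slide k b)) (relax (ℕ.≤-reflexive (sum k))
            (againᵂ (cong isOne (top-get (onᵢ b (bits s)) _))
              (copyᴬ {f = λ a b → f a b (bits s)} i≢j (λ b → onᵢ b _) (λ a → onⱼ a _) (bit I) _ b ⨟
               moveᴬ {f = λ a s → f a (bit I ∷ b) s} i≢S (λ s → onᵢ _ s) (λ a → onₛ a _) (bit I) _ (bits s)) (copying k (I ∷ s) (bit I ∷ b) nb)))
            where
              sum : ∀ k → 1 + (2 + 3 + (6 * k + 1)) ≡ 6 * suc k + 1
              sum = solve-∀
              slide : ∀ k b → ones k ++ bit I ∷ b ≡ ones (suc k) ++ b
              slide zero    b = refl
              slide (suc k) b = cong (bit I ∷_) (slide k b)

-- From arithmetic to Hyper²LTL: the running time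

data Frame : Set where
  bindᶠ           : Sort → Name → ℕ → Frame
  andᶠ orᶠ negᶠ   : Frame

env : List Frame → Env
env []                 = []
env (bindᶠ τ x k ∷ fs) = (τ , x , k) ∷ env fs
env (_ ∷ fs)           = env fs

code-injective : ∀ {x y} → ⌜ x ⌝ᴺ ≡ ⌜ y ⌝ᴺ → x ≡ y
code-injective {[]}    {[]}    _ = refl
code-injective {a ∷ x} {b ∷ y} e =
  cong₂ _∷_ (List.∷-injectiveˡ (List.∷-injectiveʳ e)) (code-injective {x} {y} (List.∷-injectiveʳ (List.∷-injectiveʳ e)))

reversed-injective : ∀ {x y} → ⌜ x ⌝ᴺ ʳ++ [] ≡ ⌜ y ⌝ᴺ ʳ++ [] → x ≡ y
reversed-injective {x} {y} e = code-injective (begin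
  ⌜ x ⌝ᴺ  ≡⟨ sym (twice ⌜ x ⌝ᴺ) ⟩
  (⌜ x ⌝ᴺ ʳ++ []) ʳ++ []  ≡⟨ cong (_ʳ++ []) e ⟩
  (⌜ y ⌝ᴺ ʳ++ []) ʳ++ []  ≡⟨ twice ⌜ y ⌝ᴺ ⟩
  ⌜ y ⌝ᴺ  ∎)
  where
    open ≡-Reasoning
    twice : ∀ (s : List Bool) → (s ʳ++ []) ʳ++ [] ≡ s
    twice s = trans (List.ʳ++-ʳ++ s) (List.++-identityʳ s)

-- From arithmetic to Hyper²LTL: searching the frame stack

module Lookup where

  open ToHyper

  frameCode : Frame → Cells
  frameCode (bindᶠ τ x k) = sortMark τ ∷ bits (⌜ x ⌝ᴺ ʳ++ []) ++ sepMark ∷ ones k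
  frameCode andᶠ          = andMark ∷ []
  frameCode orᶠ           = orMark ∷ []
  frameCode negᶠ          = negMark ∷ []

  stackCode : List Frame → Cells
  stackCode []       = []
  stackCode (f ∷ fs) = frameCode f ++ stackCode fs

  index : ℕ → Cells
  index k = ones k ++ sepMark ∷ []

  -- The loop that moves scanned frames back to `E` stops at the first blank, so none may occur
  -- among them.
  Solid : Cells → Set
  Solid []          = ⊤
  Solid (blank ∷ _) = ⊥
  Solid (_ ∷ cs)    = Solid cs

  solid-++ : ∀ a {b} → Solid a → Solid b → Solid (a ++ b)
  solid-++ []           _ h = h
  solid-++ (bit _ ∷ a)  g h = solid-++ a g h
  solid-++ (mark _ ∷ a) g h = solid-++ a g h

  solid-ʳ++ : ∀ a {b} → Solid a → Solid b → Solid (a ʳ++ b)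
  solid-ʳ++ []           _ h = h
  solid-ʳ++ (bit _ ∷ a)  g h = solid-ʳ++ a g h
  solid-ʳ++ (mark _ ∷ a) g h = solid-ʳ++ a g h

  solid-bits : ∀ s → Solid (bits s)
  solid-bits []      = tt
  solid-bits (_ ∷ s) = solid-bits s

  Body : Cells → Set
  Body []       = ⊤
  Body (c ∷ cs) = T (isBody c) × Body cs

  body-bits : ∀ s {cs} → Body cs → Body (bits s ++ cs)
  body-bits []      h = h
  body-bits (b ∷ s) h = tt , body-bits s h

  T⇒≡ : ∀ {b} → T b → b ≡ true
  T⇒≡ {true} _ = refl

  frame-solid : ∀ f → Solid (frameCode f)
  frame-solid (bindᶠ number x k) = solid-++ (bits (⌜ x ⌝ᴺ ʳ++ [])) (solid-bits (⌜ x ⌝ᴺ ʳ++ [])) (solid-bits (nm k))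
  frame-solid (bindᶠ set    x k) = solid-++ (bits (⌜ x ⌝ᴺ ʳ++ [])) (solid-bits (⌜ x ⌝ᴺ ʳ++ [])) (solid-bits (nm k))
  frame-solid (bindᶠ class  x k) = solid-++ (bits (⌜ x ⌝ᴺ ʳ++ [])) (solid-bits (⌜ x ⌝ᴺ ʳ++ [])) (solid-bits (nm k))
  frame-solid andᶠ = tt
  frame-solid orᶠ  = tt
  frame-solid negᶠ = tt

  NonBody : Cells → Set
  NonBody cs = isBody (top cs) ≡ false

  stack-nonbody : ∀ fs → NonBody (stackCode fs)
  stack-nonbody []                      = refl
  stack-nonbody (bindᶠ number x k ∷ fs) = refl
  stack-nonbody (bindᶠ set    x k ∷ fs) = refl
  stack-nonbody (bindᶠ class  x k ∷ fs) = refl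
  stack-nonbody (andᶠ ∷ fs)             = refl
  stack-nonbody (orᶠ ∷ fs)              = refl
  stack-nonbody (negᶠ ∷ fs)             = refl

  nonbody⇒nonbit : ∀ cs → NonBody cs → NonBit cs
  nonbody⇒nonbit []           _ = refl
  nonbody⇒nonbit (blank ∷ _)  _ = refl
  nonbody⇒nonbit (mark _ ∷ _) _ = refl

  module _ {i q m c l p : Cells} where

    at-lookup : Cells → Cells → Cells → Cells → Cells → Stacks 11 12
    at-lookup e n r s s′ = stacks i q m e c l n r s s′ p

    skipBodyᵂ : ∀ cs {z n r} s {s′} → Body cs → NonBody z →
      Within skipBody (at-lookup (cs ++ z) n r s s′) (at-lookup z n r (cs ʳ++ s) s′) (4 * length cs + 1)
    skipBodyᵂ []       s h nz = stopᵂ nz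
    skipBodyᵂ (c ∷ cs) s (hc , h) nz = relax (ℕ.≤-reflexive (sum (length cs))) (againᵂ (T⇒≡ hc) (straight refl) (skipBodyᵂ cs (c ∷ s) h nz))
      where
        sum : ∀ n → 1 + (3 + (4 * n + 1)) ≡ 4 * suc n + 1
        sum = solve-∀

    -- `w` is the longest common prefix. The disjunction mirrors the test that follows in `inspect`:
    -- either both names are exhausted, or the test fails and the names differ.
    compareᵂ : ∀ u v {z r} s t → NonBit z → ∃[ w ] ∃[ u′ ] ∃[ v′ ] u ≡ w ++ u′ × v ≡ w ++ v′ ×
      (u′ ≡ [] × v′ ≡ [] ⊎ (same (top (bits v′ ++ z)) sepMark ∧ isBlank (top (bits u′))) ≡ false × u′ ≢ v′) ×
      Within (loop agree (move E S ⨾ move N S′)) (at-lookup (bits v ++ z) (bits u) r s (bits t))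
        (at-lookup (bits v′ ++ z) (bits u′) r (bits w ʳ++ s) (bits (w ʳ++ t))) (7 * length v + 1)
    compareᵂ [] [] {z} s t nz = [] , [] , [] , refl , refl , inj₁ (refl , refl) , stopᵂ (cong (λ b → b ∧ same (top z) blank) nz)
    compareᵂ [] (true ∷ v)  s t nz = [] , [] , true ∷ v , refl , refl , inj₂ (refl , λ ()) , relax (ℕ.m≤n+m 1 (7 * length (true ∷ v))) (stopᵂ refl)
    compareᵂ [] (false ∷ v) s t nz = [] , [] , false ∷ v , refl , refl , inj₂ (refl , λ ()) , relax (ℕ.m≤n+m 1 (7 * length (false ∷ v))) (stopᵂ refl)
    compareᵂ (a ∷ u) [] {z} s t nz = [] , a ∷ u , [] , refl , refl , inj₂ (blank-false (same (top z) sepMark) , λ ()) , stopᵂ (cong (λ b → b ∧ same (top z) (bit a)) nz)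
      where
        blank-false : ∀ b → b ∧ false ≡ false
        blank-false true  = refl
        blank-false false = refl
    compareᵂ (true ∷ u) (false ∷ v) s t nz = [] , true ∷ u , false ∷ v , refl , refl , inj₂ (refl , λ ()) , relax (ℕ.m≤n+m 1 (7 * suc (length v))) (stopᵂ refl)
    compareᵂ (false ∷ u) (true ∷ v) s t nz = [] , false ∷ u , true ∷ v , refl , refl , inj₂ (refl , λ ()) , relax (ℕ.m≤n+m 1 (7 * suc (length v))) (stopᵂ refl)
    compareᵂ (true ∷ u) (true ∷ v) s t nz with compareᵂ u v (bit true ∷ s) (true ∷ t) nz
    ... | w , u′ , v′ , eu , ev , d , r = true ∷ w , u′ , v′ , cong (true ∷_) eu , cong (true ∷_) ev , d ,
      relax (ℕ.≤-reflexive (sum (length v))) (againᵂ refl (straight refl) r)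
      where
        sum : ∀ n → 1 + (6 + (7 * n + 1)) ≡ 7 * suc n + 1
        sum = solve-∀
    compareᵂ (false ∷ u) (false ∷ v) s t nz with compareᵂ u v (bit false ∷ s) (false ∷ t) nz
    ... | w , u′ , v′ , eu , ev , d , r = false ∷ w , u′ , v′ , cong (false ∷_) eu , cong (false ∷_) ev , d ,
      relax (ℕ.≤-reflexive (sum (length v))) (againᵂ refl (straight refl) r)
      where
        sum : ∀ n → 1 + (6 + (7 * n + 1)) ≡ 7 * suc n + 1
        sum = solve-∀

    repairᵂ : ∀ w u {e r s} → Within (pour S′ N) (at-lookup e (bits u) r s (bits (w ʳ++ []))) (at-lookup e (bits (w ++ u)) r s []) (4 * length w + 1)
    repairᵂ w u {e} {r} {s} = relax (ℕ.≤-reflexive (cong (λ l → 4 * l + 1) (trans (List.length-ʳ++ w) (ℕ.+-identityʳ _))))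
      (depart (cong (at-lookup e (bits u) r s) (List.++-identityʳ (bits (w ʳ++ []))))
        (arrive (cong (λ n → at-lookup e n r s []) (trans (sym (bits-ʳ++ (w ʳ++ []) u)) (cong bits (List.ʳ++-ʳ++ w))))
          (pourᴬ {i = S′} {j = N} {f = λ s′ n → at-lookup e n r s s′} (λ ()) (λ _ → lens (λ _ → refl) (λ _ _ → refl)) (λ _ → lens (λ _ → refl) (λ _ _ → refl))
            (w ʳ++ []) {[]} refl (bits u))))

    retrieveᵂ : ∀ k {z n r s′} s → NonBit z → Within (loop (oneOn E) (copy E R ⨾ move E S)) (at-lookup (ones k ++ z) n r s s′)
      (at-lookup z n (ones k ++ r) (ones k ʳ++ s) s′) (6 * k + 1)
    retrieveᵂ zero    {z} s nz = stopᵂ (no-one z nz)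
      where
        no-one : ∀ (cs : Cells) → NonBit cs → isOne (top cs) ≡ false
        no-one []             _ = refl
        no-one (blank ∷ _)    _ = refl
        no-one (mark _ ∷ _)   _ = refl
    retrieveᵂ (suc k) {z} {n} {r} {s′} s nz = arrive (cong (λ r → at-lookup z n r (ones k ʳ++ bit I ∷ s) s′) (slide k))
      (relax (ℕ.≤-reflexive (sum k)) (againᵂ refl (straight refl) (retrieveᵂ k (bit I ∷ s) nz)))
      where
        sum : ∀ k → 1 + (5 + (6 * k + 1)) ≡ 6 * suc k + 1
        sum = solve-∀
        slide : ∀ k → ones k ++ bit I ∷ r ≡ ones (suc k) ++ r
        slide zero    = refl
        slide (suc k) = cong (bit I ∷_) (slide k)

    found : Sort → Name → Frame → Cells
    found τ x (bindᶠ τ′ y k) = if sort≡ᵇ τ τ′ ∧ does (x ≟ᴺ y) then index k else []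
    found τ x _              = []

    other-frame : ∀ τ {n s} f z → same (sortMark τ) (top (frameCode f ++ z)) ≡ false → NonBody z →
      Within (inspect τ) (at-lookup (frameCode f ++ z) n [] s []) (at-lookup z n [] (frameCode f ʳ++ s) []) (4 + (4 * length (frameCode f) + 1))
    other-frame τ {s = s} (bindᶠ τ′ y k) z e nz = elseᵂ e (relax (ℕ.+-monoʳ-≤ 3 (ℕ.+-monoˡ-≤ 1 (ℕ.*-monoʳ-≤ 4 (ℕ.n≤1+n (length body)))))
      (straight refl ⨟ skipBodyᵂ body (sortMark τ′ ∷ s) (body-bits (⌜ y ⌝ᴺ ʳ++ []) (tt , subst Body (List.++-identityʳ (ones k)) (body-bits (nm k) tt))) nz))
      where
        body = bits (⌜ y ⌝ᴺ ʳ++ []) ++ sepMark ∷ ones k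
    other-frame τ {s = s} andᶠ z e nz = elseᵂ e (relax (ℕ.≤ᵇ⇒≤ 4 8 tt) (straight refl ⨟ skipBodyᵂ [] (andMark ∷ s) tt nz))
    other-frame τ {s = s} orᶠ  z e nz = elseᵂ e (relax (ℕ.≤ᵇ⇒≤ 4 8 tt) (straight refl ⨟ skipBodyᵂ [] (orMark ∷ s) tt nz))
    other-frame τ {s = s} negᶠ z e nz = elseᵂ e (relax (ℕ.≤ᵇ⇒≤ 4 8 tt) (straight refl ⨟ skipBodyᵂ [] (negMark ∷ s) tt nz))

    mark-sort : ∀ τ τ′ → same (sortMark τ) (sortMark τ′) ≡ sort≡ᵇ τ τ′
    mark-sort number number = refl
    mark-sort number set    = refl
    mark-sort number class  = refl
    mark-sort set    number = refl
    mark-sort set    set    = refl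
    mark-sort set    class  = refl
    mark-sort class  number = refl
    mark-sort class  set    = refl
    mark-sort class  class  = refl

    nameOf : Name → List Bool
    nameOf x = ⌜ x ⌝ᴺ ʳ++ []

    same-frame : ∀ τ τ′ x y k {s} z → same (sortMark τ) (sortMark τ′) ≡ true → NonBody z →
      Within (inspect τ) (at-lookup (frameCode (bindᶠ τ′ y k) ++ z) (bits (nameOf x)) [] s [])
        (at-lookup z (bits (nameOf x)) (if does (x ≟ᴺ y) then index k else []) (frameCode (bindᶠ τ′ y k) ʳ++ s) []) (20 + 18 * length (frameCode (bindᶠ τ′ y k)))
    same-frame τ τ′ x y k {s} z e nz
      with compareᵂ (nameOf x) (nameOf y) {sepMark ∷ ones k ++ z} {[]} (sortMark τ′ ∷ s) [] refl
    ... | w , u′ , v′ , eu , ev , d , r =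
      depart (cong (λ e → at-lookup (sortMark τ′ ∷ e) (bits (nameOf x)) [] s []) (sym (List.++-assoc (bits (nameOf y)) (sepMark ∷ ones k) z)))
        (arrive (cong (λ n → at-lookup z n _ (frameCode (bindᶠ τ′ y k) ʳ++ s) []) (cong bits (sym eu)))
          (relax bound (thenᵂ e (straight refl ⨟ r ⨟ decide d ⨟ repairᵂ w u′))))
      where
        s₁ = bits w ʳ++ sortMark τ′ ∷ s
        all-scanned : ∀ v″ → v″ ≡ v′ → (bits v″ ++ sepMark ∷ ones k) ʳ++ s₁ ≡ frameCode (bindᶠ τ′ y k) ʳ++ s
        all-scanned v″ refl = begin
          (bits v′ ++ sepMark ∷ ones k) ʳ++ bits w ʳ++ sortMark τ′ ∷ s  ≡⟨ sym (List.++-ʳ++ (bits w)) ⟩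
          (bits w ++ bits v′ ++ sepMark ∷ ones k) ʳ++ sortMark τ′ ∷ s  ≡⟨ cong (_ʳ++ sortMark τ′ ∷ s) (sym (List.++-assoc (bits w) (bits v′) _)) ⟩
          ((bits w ++ bits v′) ++ sepMark ∷ ones k) ʳ++ sortMark τ′ ∷ s  ≡⟨ cong (λ b → (b ++ sepMark ∷ ones k) ʳ++ sortMark τ′ ∷ s)
                                                                              (trans (sym (List.map-++ bit w v′)) (cong bits (sym ev))) ⟩
          (bits (nameOf y) ++ sepMark ∷ ones k) ʳ++ sortMark τ′ ∷ s  ∎
          where open ≡-Reasoning
        Decide : Program
        Decide = cond (λ cs → same (lookup cs E) sepMark ∧ isBlank (lookup cs N))
                   (move E S ⨾ push R sepMark ⨾ loop (oneOn E) (copy E R ⨾ move E S)) skipBody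
        lenᵥ : length v′ ≤ length (nameOf y)
        lenᵥ = ℕ.≤-trans (ℕ.m≤n+m (length v′) (length w)) (ℕ.≤-reflexive (trans (sym (List.length-++ w)) (cong length (sym ev))))
        lenᵤ : length w ≤ length (nameOf y)
        lenᵤ = ℕ.≤-trans (ℕ.m≤m+n (length w) (length v′)) (ℕ.≤-reflexive (trans (sym (List.length-++ w)) (cong length (sym ev))))
        decide-time : ℕ
        decide-time = 8 + (6 * k + 4 * length (nameOf y) + 4)
        decide : (u′ ≡ [] × v′ ≡ [] ⊎ (same (top (bits v′ ++ sepMark ∷ ones k ++ z)) sepMark ∧ isBlank (top (bits u′))) ≡ false × u′ ≢ v′) →
          Within Decide (at-lookup (bits v′ ++ sepMark ∷ ones k ++ z) (bits u′) [] s₁ (bits (w ʳ++ [])))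
            (at-lookup z (bits u′) (if does (x ≟ᴺ y) then index k else []) (frameCode (bindᶠ τ′ y k) ʳ++ s) (bits (w ʳ++ []))) decide-time
        decide (inj₁ (refl , refl)) with x ≟ᴺ y
        ... | yes _  = relax (ℕ.≤-trans (ℕ.≤-reflexive (sum k)) (ℕ.+-mono-≤ (ℕ.n≤1+n 7) (ℕ.≤-trans (ℕ.m≤m+n (6 * k) (4 * length (nameOf y))) (ℕ.m≤m+n _ 4))))
          (thenᵂ refl (arrive (cong (λ s → at-lookup z [] (index k) s (bits (w ʳ++ []))) (all-scanned [] refl))
            (straight refl ⨟ straight refl ⨟ retrieveᵂ k (sepMark ∷ s₁) (nonbody⇒nonbit z nz))))
          where
            sum : ∀ k → suc (3 + (2 + (6 * k + 1))) ≡ 7 + 6 * k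
            sum = solve-∀
        ... | no x≢y = ⊥-elim (x≢y (reversed-injective {x} {y} (trans eu (sym ev))))
        decide (inj₂ (f , u≢v)) with x ≟ᴺ y
        ... | yes refl = ⊥-elim (u≢v (List.++-cancelˡ w u′ v′ (trans (sym eu) ev)))
        ... | no _     = relax time (elseᵂ f
          (depart (cong (λ e → at-lookup e (bits u′) [] s₁ (bits (w ʳ++ []))) (List.++-assoc (bits v′) (sepMark ∷ ones k) z))
            (arrive (cong (λ s → at-lookup z (bits u′) [] s (bits (w ʳ++ []))) (all-scanned v′ refl))
              (skipBodyᵂ (bits v′ ++ sepMark ∷ ones k) s₁ (body-bits v′ (tt , subst Body (List.++-identityʳ (ones k)) (body-bits (nm k) tt))) nz))))
          where
            open ℕ.≤-Reasoning
            sum : ∀ v k → suc (4 * (v + suc k) + 1) + (2 * k + 6) ≡ 8 + (6 * k + 4 * v + 4)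
            sum = solve-∀
            body-length : length (bits v′ ++ sepMark ∷ ones k) ≡ length v′ + suc k
            body-length = trans (List.length-++ (bits v′)) (cong₂ (λ a b → a + suc b) (List.length-map bit v′)
              (trans (List.length-map bit (nm k)) (List.length-replicate k)))
            time : suc (4 * length (bits v′ ++ sepMark ∷ ones k) + 1) ≤ decide-time
            time = begin
              suc (4 * length (bits v′ ++ sepMark ∷ ones k) + 1)  ≡⟨ cong (λ l → suc (4 * l + 1)) body-length ⟩
              suc (4 * (length v′ + suc k) + 1)  ≤⟨ ℕ.m≤m+n _ (2 * k + 6) ⟩
              suc (4 * (length v′ + suc k) + 1) + (2 * k + 6)  ≡⟨ sum (length v′) k ⟩
              8 + (6 * k + 4 * length v′ + 4)  ≤⟨ ℕ.+-monoʳ-≤ 8 (ℕ.+-monoˡ-≤ 4 (ℕ.+-monoʳ-≤ (6 * k) (ℕ.*-monoʳ-≤ 4 lenᵥ))) ⟩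
              decide-time  ∎
        bound : suc (3 + ((7 * length (nameOf y) + 1) + (decide-time + (4 * length w + 1)))) ≤ 20 + 18 * length (frameCode (bindᶠ τ′ y k))
        bound = begin
          suc (3 + ((7 * Y + 1) + (decide-time + (4 * length w + 1))))  ≤⟨ s≤s (ℕ.+-monoʳ-≤ 3 (ℕ.+-monoʳ-≤ (7 * Y + 1) (ℕ.+-monoʳ-≤ decide-time (ℕ.+-monoˡ-≤ 1 (ℕ.*-monoʳ-≤ 4 lenᵤ))))) ⟩
          suc (3 + ((7 * Y + 1) + (decide-time + (4 * Y + 1))))  ≤⟨ ℕ.m≤m+n _ (3 * Y + 12 * k + 38) ⟩
          suc (3 + ((7 * Y + 1) + (decide-time + (4 * Y + 1)))) + (3 * Y + 12 * k + 38)  ≡⟨ sum Y k ⟩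
          20 + 18 * suc (Y + suc k)  ≡⟨ cong (λ l → 20 + 18 * suc l) (sym frame-length) ⟩
          20 + 18 * length (frameCode (bindᶠ τ′ y k))  ∎
          where
            open ℕ.≤-Reasoning
            Y = length (nameOf y)
            sum : ∀ Y k → suc (3 + ((7 * Y + 1) + ((8 + (6 * k + 4 * Y + 4)) + (4 * Y + 1)))) + (3 * Y + 12 * k + 38) ≡ 20 + 18 * suc (Y + suc k)
            sum = solve-∀
            frame-length : length (bits {11} (nameOf y) ++ sepMark ∷ ones k) ≡ Y + suc k
            frame-length = trans (List.length-++ (bits (nameOf y))) (cong₂ (λ a b → a + suc b) (List.length-map bit (nameOf y))
              (trans (List.length-map bit (nm k)) (List.length-replicate k)))

    inspectᵂ : ∀ τ x f {s} z → NonBody z → Within (inspect τ) (at-lookup (frameCode f ++ z) (bits (nameOf x)) [] s [])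
      (at-lookup z (bits (nameOf x)) (found τ x f) (frameCode f ʳ++ s) []) (20 + 18 * length (frameCode f))
    inspectᵂ τ x (bindᶠ τ′ y k) z nz with sort≡ᵇ τ τ′ in e
    ... | true  = same-frame τ τ′ x y k z (trans (mark-sort τ τ′) e) nz
    ... | false = relax (ℕ.+-mono-≤ (ℕ.≤ᵇ⇒≤ 5 20 tt) (ℕ.*-monoˡ-≤ (length (frameCode (bindᶠ τ′ y k))) (ℕ.≤ᵇ⇒≤ 4 18 tt)))
      (relax (ℕ.≤-reflexive (sum (length (frameCode (bindᶠ τ′ y k))))) (other-frame τ (bindᶠ τ′ y k) z (trans (mark-sort τ τ′) e) nz))
      where
        sum : ∀ l → 4 + (4 * l + 1) ≡ 5 + 4 * l
        sum = solve-∀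
    inspectᵂ number x andᶠ z nz = relax (ℕ.≤ᵇ⇒≤ 9 38 tt) (other-frame number andᶠ z refl nz)
    inspectᵂ set    x andᶠ z nz = relax (ℕ.≤ᵇ⇒≤ 9 38 tt) (other-frame set andᶠ z refl nz)
    inspectᵂ class  x andᶠ z nz = relax (ℕ.≤ᵇ⇒≤ 9 38 tt) (other-frame class andᶠ z refl nz)
    inspectᵂ number x orᶠ  z nz = relax (ℕ.≤ᵇ⇒≤ 9 38 tt) (other-frame number orᶠ z refl nz)
    inspectᵂ set    x orᶠ  z nz = relax (ℕ.≤ᵇ⇒≤ 9 38 tt) (other-frame set orᶠ z refl nz)
    inspectᵂ class  x orᶠ  z nz = relax (ℕ.≤ᵇ⇒≤ 9 38 tt) (other-frame class orᶠ z refl nz)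
    inspectᵂ number x negᶠ z nz = relax (ℕ.≤ᵇ⇒≤ 9 38 tt) (other-frame number negᶠ z refl nz)
    inspectᵂ set    x negᶠ z nz = relax (ℕ.≤ᵇ⇒≤ 9 38 tt) (other-frame set negᶠ z refl nz)
    inspectᵂ class  x negᶠ z nz = relax (ℕ.≤ᵇ⇒≤ 9 38 tt) (other-frame class negᶠ z refl nz)

    searchLoop : Sort → Program
    searchLoop τ = loop (λ cs → not (isBlank (lookup cs E)) ∧ isBlank (lookup cs R)) (inspect τ)

    nonblank-frame : ∀ f z → isBlank (top (frameCode f ++ z)) ≡ false
    nonblank-frame (bindᶠ number x k) z = refl
    nonblank-frame (bindᶠ set    x k) z = refl
    nonblank-frame (bindᶠ class  x k) z = refl
    nonblank-frame andᶠ z = refl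
    nonblank-frame orᶠ  z = refl
    nonblank-frame negᶠ z = refl

    frame-length>0 : ∀ f → 1 ≤ length (frameCode f)
    frame-length>0 (bindᶠ _ _ _) = s≤s z≤n
    frame-length>0 andᶠ = s≤s z≤n
    frame-length>0 orᶠ  = s≤s z≤n
    frame-length>0 negᶠ = s≤s z≤n

    Result : List Frame → Sort → Name → Cells → Set
    Result fs τ x r = r ≡ [] × find (env fs) τ x ≡ 0 ⊎ r ≡ index (find (env fs) τ x)

    index-nonblank : ∀ k → isBlank (top (index k)) ≡ false
    index-nonblank zero    = refl
    index-nonblank (suc k) = refl

    Searched : List Frame → Sort → Name → Cells → Cells → ℕ → Set
    Searched fs τ x s r T = ∃[ u ] ∃[ v ] stackCode fs ≡ u ++ v × Solid u × Result fs τ x r ×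
      Within (searchLoop τ) (at-lookup (stackCode fs) (bits (nameOf x)) [] s []) (at-lookup v (bits (nameOf x)) r (u ʳ++ s) []) T

    -- A frame of length `l` costs at most `21 + 18 * l` including the loop test; as `l` is at least
    -- 1, this is at most `39 * l`.
    searchᵂ : ∀ τ x fs s → ∃[ r ] Searched fs τ x s r (39 * length (stackCode fs) + 1)
    continue : ∀ τ x f fs s r₁ → r₁ ≡ found τ x f → ∃[ r ] ∃[ u ] ∃[ v ] stackCode fs ≡ u ++ v × Solid u × Result (f ∷ fs) τ x r ×
      Within (searchLoop τ) (at-lookup (stackCode fs) (bits (nameOf x)) r₁ s []) (at-lookup v (bits (nameOf x)) r (u ʳ++ s) []) (39 * length (stackCode fs) + 1)

    searchᵂ τ x []       s = [] , [] , [] , refl , tt , inj₁ (refl , refl) , stopᵂ refl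
    searchᵂ τ x (f ∷ fs) s =
      let r , u , v , e , solid , result , w = continue τ x f fs (frameCode f ʳ++ s) (found τ x f) refl
      in r , frameCode f ++ u , v , trans (cong (frameCode f ++_) e) (sym (List.++-assoc (frameCode f) u v)) ,
         solid-++ (frameCode f) (frame-solid f) solid , result ,
         arrive (cong (λ s → at-lookup v (bits (nameOf x)) r s []) (sym (List.++-ʳ++ (frameCode f))))
           (relax bound
             (againᵂ (cong (λ c → not c ∧ true) (nonblank-frame f (stackCode fs))) (inspectᵂ τ x f (stackCode fs) (stack-nonbody fs)) w))
      where
        open ℕ.≤-Reasoning
        sum : ∀ l m → (21 + 18 * l) + (39 * m + 1) ≡ 18 * l + 21 + (39 * m + 1)
        sum = solve-∀
        sum′ : ∀ l m → 18 * l + 21 * l + (39 * m + 1) ≡ 39 * (l + m) + 1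
        sum′ = solve-∀
        bound : suc ((20 + 18 * length (frameCode f)) + (39 * length (stackCode fs) + 1)) ≤ 39 * length (frameCode f ++ stackCode fs) + 1
        bound = begin
          (21 + 18 * length (frameCode f)) + (39 * length (stackCode fs) + 1)  ≡⟨ sum (length (frameCode f)) (length (stackCode fs)) ⟩
          18 * length (frameCode f) + 21 * 1 + (39 * length (stackCode fs) + 1)
            ≤⟨ ℕ.+-monoˡ-≤ _ (ℕ.+-monoʳ-≤ (18 * length (frameCode f)) (ℕ.*-monoʳ-≤ 21 (frame-length>0 f))) ⟩
          18 * length (frameCode f) + 21 * length (frameCode f) + (39 * length (stackCode fs) + 1)  ≡⟨ sum′ (length (frameCode f)) (length (stackCode fs)) ⟩
          39 * (length (frameCode f) + length (stackCode fs)) + 1  ≡⟨ cong (λ l → 39 * l + 1) (sym (List.length-++ (frameCode f))) ⟩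
          39 * length (frameCode f ++ stackCode fs) + 1  ∎

    continue τ x f fs s [] e =
      let r , u , v , eq , solid , result , w = searchᵂ τ x fs s
      in r , u , v , eq , solid , skipped f e r result , w
      where
        no-index : ∀ k → [] ≢ index k
        no-index zero    ()
        no-index (suc k) ()
        skipped : ∀ f → [] ≡ found τ x f → ∀ r → Result fs τ x r → Result (f ∷ fs) τ x r
        skipped (bindᶠ τ′ y k) e r h with sort≡ᵇ τ τ′ ∧ does (x ≟ᴺ y)
        ... | true  = ⊥-elim (no-index k e)
        ... | false = h
        skipped andᶠ e r h = h
        skipped orᶠ  e r h = h
        skipped negᶠ e r h = h
    continue τ x f fs s r₁@(c ∷ _) e = r₁ , [] , stackCode fs , refl , tt , inj₂ (hit f e) ,
      relax (ℕ.m≤n+m 1 _) (stopᵂ (trans (cong (not (isBlank (top (stackCode fs))) ∧_) (blank-false f e)) (∧-false _)))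
      where
        ∧-false : ∀ b → b ∧ false ≡ false
        ∧-false true  = refl
        ∧-false false = refl
        hit : ∀ f → r₁ ≡ found τ x f → r₁ ≡ index (find (env (f ∷ fs)) τ x)
        hit (bindᶠ τ′ y k) e with sort≡ᵇ τ τ′ ∧ does (x ≟ᴺ y)
        hit (bindᶠ τ′ y k) e  | true  = e
        hit (bindᶠ τ′ y k) () | false
        blank-false : ∀ f → r₁ ≡ found τ x f → isBlank c ≡ false
        blank-false (bindᶠ τ′ y k) e with sort≡ᵇ τ τ′ ∧ does (x ≟ᴺ y)
        blank-false (bindᶠ τ′ y k) e  | true  = trans (cong (isBlank ∘ top) e) (index-nonblank k)
        blank-false (bindᶠ τ′ y k) () | false

    restoreᵂ : ∀ u {e n r s′} → Solid u → Within (loop (λ cs → not (isBlank (lookup cs S))) (move S E)) (at-lookup e n r u s′) (at-lookup (u ʳ++ e) n r [] s′)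
      (4 * length u + 1)
    restoreᵂ []           _ = stopᵂ refl
    restoreᵂ (bit b ∷ u)  h = relax (ℕ.≤-reflexive (sum (length u))) (againᵂ refl (straight refl) (restoreᵂ u h))
      where
        sum : ∀ n → 1 + (3 + (4 * n + 1)) ≡ 4 * suc n + 1
        sum = solve-∀
    restoreᵂ (mark a ∷ u) h = relax (ℕ.≤-reflexive (sum (length u))) (againᵂ refl (straight refl) (restoreᵂ u h))
      where
        sum : ∀ n → 1 + (3 + (4 * n + 1)) ≡ 4 * suc n + 1
        sum = solve-∀

    defaultᵂ : ∀ fs τ x r {e n s} → Result fs τ x r → Within (cond (on R isBlank) (push R sepMark) skip) (at-lookup e n r s []) (at-lookup e n (index (find (env fs) τ x)) s []) 3
    defaultᵂ fs τ x r {e} {n} {s} (inj₁ (refl , z)) = thenᵂ refl (arrive (cong (λ k → at-lookup e n (index k) s []) (sym z)) (straight refl))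
    defaultᵂ fs τ x r (inj₂ refl) = elseᵂ (index-nonblank (find (env fs) τ x)) (relax (ℕ.n≤1+n 1) (straight refl))

    lookupNameᵂ : ∀ τ x fs → Within (lookupName τ) (at-lookup (stackCode fs) (bits (nameOf x)) [] [] [])
      (at-lookup (stackCode fs) [] (index (find (env fs) τ x)) [] []) (43 * length (stackCode fs) + 2 * length ⌜ x ⌝ᴺ + 6)
    lookupNameᵂ τ x fs = finish′ (searchᵂ τ x fs [])
      where
        k = find (env fs) τ x
        finish′ : (∃[ r ] Searched fs τ x [] r (39 * length (stackCode fs) + 1)) → _
        finish′ (r , u , v , e , solid , result , w) = relax bound (w ⨟ defaultᵂ fs τ x r result ⨟
            arrive (cong (λ e → at-lookup e (bits (nameOf x)) (index k) [] []) (trans (List.ʳ++-ʳ++ u) (sym e)))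
              (restoreᵂ (u ʳ++ []) (solid-ʳ++ u solid tt)) ⨟
            depart (cong (λ n → at-lookup (stackCode fs) n (index k) [] []) (List.++-identityʳ (bits (nameOf x))))
              (discardᴬ {i = N} {f = λ n → at-lookup (stackCode fs) n (index k) [] []} (lens (λ _ → refl) (λ _ _ → refl)) (nameOf x) {[]} refl))
          where
            open ℕ.≤-Reasoning
            lₑ = length (stackCode fs)
            lₙ = length ⌜ x ⌝ᴺ
            scanned : length (u ʳ++ []) ≤ lₑ
            scanned = ℕ.≤-trans (ℕ.≤-reflexive (trans (List.length-ʳ++ u) (ℕ.+-identityʳ _)))
              (ℕ.≤-trans (ℕ.m≤m+n (length u) (length v)) (ℕ.≤-reflexive (trans (sym (List.length-++ u)) (cong length (sym e)))))
            sum : ∀ l n → 39 * l + 1 + (3 + (4 * l + 1 + (2 * n + 1))) ≡ 43 * l + 2 * n + 6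
            sum = solve-∀
            bound : 39 * lₑ + 1 + (3 + (4 * length (u ʳ++ []) + 1 + (2 * length (nameOf x) + 1))) ≤ 43 * lₑ + 2 * lₙ + 6
            bound = begin
              39 * lₑ + 1 + (3 + (4 * length (u ʳ++ []) + 1 + (2 * length (nameOf x) + 1)))
                ≡⟨ cong (λ a → 39 * lₑ + 1 + (3 + (4 * length (u ʳ++ []) + 1 + (2 * a + 1)))) (trans (List.length-ʳ++ ⌜ x ⌝ᴺ) (ℕ.+-identityʳ _)) ⟩
              39 * lₑ + 1 + (3 + (4 * length (u ʳ++ []) + 1 + (2 * lₙ + 1)))
                ≤⟨ ℕ.+-monoʳ-≤ (39 * lₑ + 1) (ℕ.+-monoʳ-≤ 3 (ℕ.+-monoˡ-≤ (2 * lₙ + 1) (ℕ.+-monoˡ-≤ 1 (ℕ.*-monoʳ-≤ 4 scanned)))) ⟩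
              39 * lₑ + 1 + (3 + (4 * lₑ + 1 + (2 * lₙ + 1)))  ≡⟨ sum lₑ lₙ ⟩
              43 * lₑ + 2 * lₙ + 6  ∎

  -- A frame stores its level in unary, so a level that is found cannot exceed the stack that
  -- contains it.
  find≤ : ∀ fs τ x → find (env fs) τ x ≤ length (stackCode fs)
  find≤ []                  τ x = z≤n
  find≤ (bindᶠ τ′ y k ∷ fs) τ x with sort≡ᵇ τ τ′ ∧ does (x ≟ᴺ y)
  ... | true  = begin
    k  ≡⟨ sym (trans (List.length-map bit (nm k)) (List.length-replicate k)) ⟩
    length (ones k)  ≤⟨ ℕ.m≤n+m _ (length (bits {11} (⌜ y ⌝ᴺ ʳ++ [])) + 1) ⟩
    length (bits {11} (⌜ y ⌝ᴺ ʳ++ [])) + 1 + length (ones k)  ≡⟨ ℕ.+-assoc (length (bits {11} (⌜ y ⌝ᴺ ʳ++ []))) 1 _ ⟩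
    length (bits {11} (⌜ y ⌝ᴺ ʳ++ [])) + suc (length (ones k))  ≡⟨ sym (List.length-++ (bits (⌜ y ⌝ᴺ ʳ++ []))) ⟩
    length (bits (⌜ y ⌝ᴺ ʳ++ []) ++ sepMark ∷ ones k)  ≤⟨ ℕ.m≤m+n _ _ ⟩
    length (bits (⌜ y ⌝ᴺ ʳ++ []) ++ sepMark ∷ ones k) + length (stackCode fs)
      ≡⟨ sym (List.length-++ (bits (⌜ y ⌝ᴺ ʳ++ []) ++ sepMark ∷ ones k)) ⟩
    length ((bits (⌜ y ⌝ᴺ ʳ++ []) ++ sepMark ∷ ones k) ++ stackCode fs)  ≤⟨ ℕ.n≤1+n _ ⟩
    length (stackCode (bindᶠ τ′ y k ∷ fs))  ∎
    where open ℕ.≤-Reasoning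
  ... | false = ℕ.≤-trans (find≤ fs τ x) (ℕ.≤-trans (ℕ.m≤n+m _ (length (frameCode (bindᶠ τ′ y k)))) (ℕ.≤-reflexive (sym (List.length-++ (frameCode (bindᶠ τ′ y k))))))
  find≤ (andᶠ ∷ fs)         τ x = ℕ.m≤n⇒m≤1+n (find≤ fs τ x)
  find≤ (orᶠ ∷ fs)          τ x = ℕ.m≤n⇒m≤1+n (find≤ fs τ x)
  find≤ (negᶠ ∷ fs)         τ x = ℕ.m≤n⇒m≤1+n (find≤ fs τ x)

-- From arithmetic to Hyper²LTL: the words that the machine writes

reversed₅ : ∀ {A : Set} (a b c d e w : List A) → e ʳ++ d ʳ++ c ʳ++ b ʳ++ a ʳ++ w ≡ (a ++ b ++ c ++ d ++ e) ʳ++ w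
reversed₅ a b c d e w = sym (trans (List.++-ʳ++ a {b ++ c ++ d ++ e} {w}) (trans (List.++-ʳ++ b {c ++ d ++ e} {a ʳ++ w})
  (trans (List.++-ʳ++ c {d ++ e} {b ʳ++ a ʳ++ w}) (List.++-ʳ++ d {e} {c ʳ++ b ʳ++ a ʳ++ w}))))

module HyperCodes (m : ℕ) where

  open ToHyper
  open Gadgets m

  head : ℕ → Bool → List Bool
  head k b = I ∷ O ∷ not b ∷ I ∷ ⌜ nm k ⌝ᴺ ++ I ∷ I ∷ not b ∷ ⌜ nm k ⌝ᴺ ++ I ∷ ⌜ nm k ⌝ᴺ ++ I ∷ I ∷ not b ∷ ⌜ nm k ⌝ᴺ

  prefixCode : ℕ → Prefix → List Bool
  prefixCode k []             = []
  prefixCode k ((b , s) ∷ Qs) = (head k b ++ ⌜ sourceVar s ⌝ˢ) ++ prefixCode (suc k) Qs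

  prefixCode-++ : ∀ k A B → prefixCode k (A ++ B) ≡ prefixCode k A ++ prefixCode (after-prefix k A) B
  prefixCode-++ k []            B = refl
  prefixCode-++ k ((b , s) ∷ A) B = trans (cong ((head k b ++ ⌜ sourceVar s ⌝ˢ) ++_) (prefixCode-++ (suc k) A B)) (sym (List.++-assoc (head k b ++ ⌜ sourceVar s ⌝ˢ) _ _))

  head-++ : ∀ k b X → head k b ++ X ≡
    I ∷ O ∷ not b ∷ I ∷ ⌜ nm k ⌝ᴺ ++ I ∷ I ∷ not b ∷ ⌜ nm k ⌝ᴺ ++ I ∷ ⌜ nm k ⌝ᴺ ++ I ∷ I ∷ not b ∷ ⌜ nm k ⌝ᴺ ++ X
  head-++ k b X = cong (λ s → I ∷ O ∷ not b ∷ I ∷ s) (trans (List.++-assoc ⌜ nm k ⌝ᴺ _ X) (cong (λ s → ⌜ nm k ⌝ᴺ ++ I ∷ I ∷ not b ∷ s)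
    (trans (List.++-assoc ⌜ nm k ⌝ᴺ _ X) (cong (λ s → ⌜ nm k ⌝ᴺ ++ I ∷ s) (List.++-assoc ⌜ nm k ⌝ᴺ _ X)))))

  prefixed-code : ∀ k Qs (φ : Hyper²LTL (suc m)) → ⌜ prefixed k Qs φ ⌝ᴴ ≡ prefixCode k Qs ++ ⌜ φ ⌝ᴴ
  prefixed-code k []                 φ = refl
  prefixed-code k ((b , s) ∷ Qs) φ = trans (same-head b) (trans (sym (head-++ k b _)) (trans
    (cong (λ t → head k b ++ ⌜ sourceVar s ⌝ˢ ++ t) (prefixed-code (suc k) Qs φ))
    (trans (sym (List.++-assoc (head k b) ⌜ sourceVar s ⌝ˢ _)) (sym (List.++-assoc (head k b ++ ⌜ sourceVar s ⌝ˢ) _ _)))))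
    where
      same-head : ∀ b → ⌜ quantify₂ b (var (nm k)) (quantify₁ b (nm k) (var (nm k)) (quantify₁ b (nm k) (sourceVar s) (prefixed (suc k) Qs φ))) ⌝ᴴ ≡
        I ∷ O ∷ not b ∷ I ∷ ⌜ nm k ⌝ᴺ ++ I ∷ I ∷ not b ∷ ⌜ nm k ⌝ᴺ ++ I ∷ ⌜ nm k ⌝ᴺ ++ I ∷ I ∷ not b ∷ ⌜ nm k ⌝ᴺ ++ ⌜ sourceVar s ⌝ˢ ++ ⌜ prefixed (suc k) Qs φ ⌝ᴴ
      same-head true  = refl
      same-head false = refl

  linkCodes : List (LTL (suc m)) → List Bool
  linkCodes []       = []
  linkCodes (ψ ∷ ψs) = (conjCode ++ ⌜ ψ ⌝ᴸ ++ thenCode) ++ linkCodes ψs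

  linkCodes-++ : ∀ A B → linkCodes (A ++ B) ≡ linkCodes A ++ linkCodes B
  linkCodes-++ []      B = refl
  linkCodes-++ (ψ ∷ A) B = trans (cong ((conjCode ++ ⌜ ψ ⌝ᴸ ++ thenCode) ++_) (linkCodes-++ A B)) (sym (List.++-assoc (conjCode ++ ⌜ ψ ⌝ᴸ ++ thenCode) _ _))

  conjs-code : ∀ ψs → ⌜ conjs ψs ⌝ᴸ ≡ linkCodes ψs ++ bitCode ++ O ∷ []
  conjs-code []       = refl
  conjs-code (ψ ∷ ψs) = trans (cong (λ s → conjCode ++ ⌜ ψ ⌝ᴸ ++ thenCode ++ s) (conjs-code ψs))
    (sym (trans (List.++-assoc (conjCode ++ ⌜ ψ ⌝ᴸ ++ thenCode) (linkCodes ψs) (bitCode ++ O ∷ []))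
      (cong (conjCode ++_) (List.++-assoc ⌜ ψ ⌝ᴸ thenCode (linkCodes ψs ++ bitCode ++ O ∷ [])))))

  sideCode : Side → List Bool
  sideCode side₀ = []
  sideCode side₁ = O ∷ I ∷ I ∷ []
  sideCode side₂ = O ∷ I ∷ I ∷ O ∷ I ∷ I ∷ []

  opaque
    unfolding Gadgets.eventually

    link-code : ∀ r j side → (conjCode ++ linkCode ++ O ∷ I ∷ I ∷ O ∷ I ∷ I ∷ bitCode) ++ ⌜ nm r ⌝ᴺ ++ thenCode ++ (sideCode side ++ bitCode ++ ⌜ nm j ⌝ᴺ) ++ thenCode
      ≡ conjCode ++ ⌜ link r (j , sideℕ side) ⌝ᴸ ++ thenCode
    link-code r j side₀ = cong (λ s → (conjCode ++ linkCode ++ O ∷ I ∷ I ∷ O ∷ I ∷ I ∷ bitCode) ++ s) (sym (List.++-assoc ⌜ nm r ⌝ᴺ _ thenCode))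
    link-code r j side₁ = cong (λ s → (conjCode ++ linkCode ++ O ∷ I ∷ I ∷ O ∷ I ∷ I ∷ bitCode) ++ s) (sym (List.++-assoc ⌜ nm r ⌝ᴺ _ thenCode))
    link-code r j side₂ = cong (λ s → (conjCode ++ linkCode ++ O ∷ I ∷ I ∷ O ∷ I ∷ I ∷ bitCode) ++ s) (sym (List.++-assoc ⌜ nm r ⌝ᴺ _ thenCode))

-- From arithmetic to Hyper²LTL: running times of the subroutines

module Macros (m Z : ℕ) (1≤Z : 1 ≤ Z) where

  open ToHyper
  open Timing Z 1≤Z
  open Lookup
  open Gadgets m
  open HyperCodes m

  againᵀ : ∀ {a v b p σ σ′ σ″} → b (tops σ) ≡ true → Takes a p σ σ′ → Takes v (loop b p) σ′ σ″ → Takes (suc (a + v)) (loop b p) σ σ″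
  againᵀ {a} {v} e (takes r) (takes s) = takes (relax
    (ℕ.+-mono-≤ 1≤Z (ℕ.≤-reflexive (sym (ℕ.*-distribʳ-+ Z a v)))) (againᵂ e r s))

  stopᵀ : ∀ {b p σ} → b (tops σ) ≡ false → Takes 1 (loop b p) σ σ
  stopᵀ e = const (stopᵂ e)

  readI : ∀ {a p q i Q M e c l n r s s′ x σ} → Takes a p (stacks i Q M e c l n r s s′ x) σ → Takes (2 + a) (read p q) (stacks (bit I ∷ i) Q M e c l n r s s′ x) σ
  readI h = thenᵀ refl (const (straight refl) ⊳ h)

  readO : ∀ {a p q i Q M e c l n r s s′ x σ} → Takes a q (stacks i Q M e c l n r s s′ x) σ → Takes (2 + a) (read p q) (stacks (bit O ∷ i) Q M e c l n r s s′ x) σ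
  readO h = elseᵀ refl (const (straight refl) ⊳ h)

  record Emits (c : ℕ) (p : Program) (f : Cells → Stacks 11 12) (s : List Bool) : Set where
    constructor emits
    field emitted : ∀ w → Takes c p (f (bits w)) (f (bits (s ʳ++ w)))

  open Emits

  infixr 5 _▹_

  _▹_ : ∀ {a b p q f s t} → Emits a p f s → Emits b q f t → Emits (a + b) (p ⨾ q) f (s ++ t)
  _▹_ {f = f} {s} (emits h) (emits g) = emits λ w → h w ⊳ arriveᵀ (cong (f ∘ bits) (sym (List.++-ʳ++ s))) (g _)

  slackenᴱ : ∀ {a b p f s} {_ : T (a ≤ᵇ b)} → Emits a p f s → Emits b p f s
  slackenᴱ {a} {b} {_} {_} {_} {h} (emits g) = emits λ w → slacken {a} {b} {_} {_} {_} {h} (g w)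

  word : ∀ {j f} → At j f → ∀ s → Emits (2 * length s + 1) (emit j s) f s
  word l s = emits λ w → const (emitᴬ l s w)

  onQ : ∀ {i w e c l r p} → At Q (λ q → stacks i q w e c l [] r [] [] p)
  onQ = lens (λ _ → refl) (λ _ _ → refl)

  onM : ∀ {i q e c l r p} → At M (λ w → stacks i q w e c l [] r [] [] p)
  onM = lens (λ _ → refl) (λ _ _ → refl)

  indexCQ : ∀ {i w e l r p} k → k ≤ Z → Emits 16 (emitIndex C Q) (λ x → stacks i x w e (index k) l [] r [] [] p) ⌜ nm k ⌝ᴺ
  indexCQ {i} {w} {e} {l} {r} {p} k k≤ = emits λ x → emitIndexᵂ (λ ()) (λ ()) (λ ()) {f = λ c q s → stacks i q w e c l [] r s [] p}
    (λ _ _ → lens (λ _ → refl) (λ _ _ → refl)) (λ _ _ → lens (λ _ → refl) (λ _ _ → refl)) (λ _ _ → lens (λ _ → refl) (λ _ _ → refl)) k x refl k≤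

  indexRQ : ∀ {i w e c l p} k → k ≤ Z → Emits 16 (emitIndex R Q) (λ x → stacks i x w e c l [] (index k) [] [] p) ⌜ nm k ⌝ᴺ
  indexRQ {i} {w} {e} {c} {l} {p} k k≤ = emits λ x → emitIndexᵂ (λ ()) (λ ()) (λ ()) {f = λ r q s → stacks i q w e c l [] r s [] p}
    (λ _ _ → lens (λ _ → refl) (λ _ _ → refl)) (λ _ _ → lens (λ _ → refl) (λ _ _ → refl)) (λ _ _ → lens (λ _ → refl) (λ _ _ → refl)) k x refl k≤

  indexCM : ∀ {i q e l r p} k → k ≤ Z → Emits 16 (emitIndex C M) (λ x → stacks i q x e (index k) l [] r [] [] p) ⌜ nm k ⌝ᴺ
  indexCM {i} {q} {e} {l} {r} {p} k k≤ = emits λ x → emitIndexᵂ (λ ()) (λ ()) (λ ()) {f = λ c w s → stacks i q w e c l [] r s [] p}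
    (λ _ _ → lens (λ _ → refl) (λ _ _ → refl)) (λ _ _ → lens (λ _ → refl) (λ _ _ → refl)) (λ _ _ → lens (λ _ → refl) (λ _ _ → refl)) k x refl k≤

  indexRM : ∀ {i q e c l p} k → k ≤ Z → Emits 16 (emitIndex R M) (λ x → stacks i q x e c l [] (index k) [] [] p) ⌜ nm k ⌝ᴺ
  indexRM {i} {q} {e} {c} {l} {p} k k≤ = emits λ x → emitIndexᵂ (λ ()) (λ ()) (λ ()) {f = λ r w s → stacks i q w e c l [] r s [] p}
    (λ _ _ → lens (λ _ → refl) (λ _ _ → refl)) (λ _ _ → lens (λ _ → refl) (λ _ _ → refl)) (λ _ _ → lens (λ _ → refl) (λ _ _ → refl)) k x refl k≤

  sign : Bool → Cells
  sign b = bit (not b) ∷ []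

  quantifiersᴱ : ∀ {i w e l r} k b → k ≤ Z → Emits 100 quantifiers (λ x → stacks i x w e (index k) l [] r [] [] (sign b)) (head k b)
  quantifiersᴱ k b k≤ = slackenᴱ (word onQ (I ∷ O ∷ []) ▹ copied ▹ word′ ▹ indexCQ k k≤ ▹ word onQ (I ∷ I ∷ []) ▹ copied ▹ indexCQ k k≤ ▹
      word′ ▹ indexCQ k k≤ ▹ word onQ (I ∷ I ∷ []) ▹ copied ▹ indexCQ k k≤)
    where
      copied : ∀ {i w e c l r} → Emits 2 (copy P Q) (λ x → stacks i x w e c l [] r [] [] (sign b)) (not b ∷ [])
      copied = emits λ w → const (straight refl)
      word′ : ∀ {i w e c l r p} → Emits 2 (push Q (bit I)) (λ x → stacks i x w e c l [] r [] [] p) (I ∷ [])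
      word′ = emits λ w → const (straight refl)

  slotOf : Side → ℕ → Cells → Cells
  slotOf side j l = sideMark side ∷ ones j ++ l

  slotᵂ : ∀ {i q e c r p} side j l w → NonBit l → j ≤ Z →
    Takes 40 slot (stacks i q (bits w) e c (slotOf side j l) [] r [] [] p) (stacks i q (bits ((sideCode side ++ bitCode ++ ⌜ nm j ⌝ᴺ) ʳ++ w)) e c l [] r [] [] p)
  slotᵂ {i} {q} {e} {c} {r} {p} side j l w nb j≤ = slacken {17 + (9 + (7 + 2))} (choose side ⊳ emitted (word onM bitCode) _ ⊳
      linear 6 1 j≤ (unary j (bitCode ʳ++ sideCode side ʳ++ w)) ⊳
      arriveᵀ (cong (λ w → stacks i q (bits w) e c l [] r [] [] p) (sym spelling)) (const (straight refl)))
    where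
      pairs : ℕ → List Bool
      pairs j = concatMap (λ b → I ∷ b ∷ []) (nm j)
      spelling : (sideCode side ++ bitCode ++ ⌜ nm j ⌝ᴺ) ʳ++ w ≡ O ∷ (pairs j ʳ++ bitCode ʳ++ sideCode side ʳ++ w)
      spelling = trans (List.++-ʳ++ (sideCode side)) (trans (List.++-ʳ++ bitCode {⌜ nm j ⌝ᴺ} {sideCode side ʳ++ w}) (List.++-ʳ++ (pairs j)))
      choose : ∀ side → Takes 17 (cond (on L (same (sideMark side₀))) (pop L)
        (cond (on L (same (sideMark side₁))) (pop L ⨾ emit M (O ∷ I ∷ I ∷ []))
          (pop L ⨾ emit M (O ∷ I ∷ I ∷ O ∷ I ∷ I ∷ []))))
        (stacks i q (bits w) e c (slotOf side j l) [] r [] [] p) (stacks i q (bits (sideCode side ʳ++ w)) e c (ones j ++ l) [] r [] [] p)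
      choose side₀ = slacken (const (straight refl))
      choose side₁ = slacken (const (straight refl))
      choose side₂ = slacken (const (straight refl))
      unary : ∀ j w → Within (loop (oneOn L) (push M (bit I) ⨾ push M (bit I) ⨾ pop L)) (stacks i q (bits w) e c (ones j ++ l) [] r [] [] p)
        (stacks i q (bits (pairs j ʳ++ w)) e c l [] r [] [] p) (6 * j + 1)
      unary zero    w = stopᵂ (not-one l nb)
      unary (suc j) w = relax (ℕ.≤-reflexive (sum j)) (againᵂ refl (straight refl) (unary j (I ∷ I ∷ w)))
        where
          sum : ∀ j → 1 + (5 + (6 * j + 1)) ≡ 6 * suc j + 1
          sum = solve-∀

  linkToᵂ : ∀ h {i q e c r p} side k j l w → NonBit l → j ≤ Z →
    (∀ {l} → Emits 16 (emitIndex h M) (λ x → stacks i q x e c l [] r [] [] p) ⌜ nm k ⌝ᴺ) →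
    Takes 250 (linkTo h) (stacks i q (bits w) e c (slotOf side j l) [] r [] [] p)
      (stacks i q (bits ((conjCode ++ ⌜ link k (j , sideℕ side) ⌝ᴸ ++ thenCode) ʳ++ w)) e c l [] r [] [] p)
  linkToᵂ h {i} {q} {e} {c} {r} {p} side k j l w nb j≤ index = arriveᵀ (cong (λ w → stacks i q (bits w) e c l [] r [] [] p) spelling)
      (slacken (emitted (word onM opening′) w ⊳ emitted index (opening′ ʳ++ w) ⊳ emitted (word onM thenCode) _ ⊳ slotᵂ side j l _ nb j≤ ⊳ emitted (word onM thenCode) _))
    where
      opening′ = conjCode ++ linkCode ++ O ∷ I ∷ I ∷ O ∷ I ∷ I ∷ bitCode
      slotted = sideCode side ++ bitCode ++ ⌜ nm j ⌝ᴺ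
      spelling : thenCode ʳ++ slotted ʳ++ thenCode ʳ++ ⌜ nm k ⌝ᴺ ʳ++ opening′ ʳ++ w ≡ (conjCode ++ ⌜ link k (j , sideℕ side) ⌝ᴸ ++ thenCode) ʳ++ w
      spelling = trans (reversed₅ opening′ ⌜ nm k ⌝ᴺ thenCode slotted thenCode w) (cong (_ʳ++ w) (link-code k j side))

  findNameᵂ : ∀ τ x fs i {q w c l p} → length (stackCode fs) ≤ Z → length ⌜ x ⌝ᴺ ≤ Z →
    Takes 58 (findName τ) (stacks (bits (⌜ x ⌝ᴺ ++ i)) q w (stackCode fs) c l [] [] [] [] p)
      (stacks (bits i) q w (stackCode fs) c l [] (index (find (env fs) τ x)) [] [] p)
  findNameᵂ τ x fs i {q} {w} {c} {l} {p} e≤ x≤ = linear 7 0 x≤ (relax (ℕ.≤-reflexive (sym (ℕ.+-identityʳ _)))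
      (arrive (cong (λ n → stacks (bits i) q w (stackCode fs) c l n [] [] [] p) (sym (bits-ʳ++ ⌜ x ⌝ᴺ [])))
        (copyNameᴬ {i = In} {j = N} {f = λ i n → stacks i q w (stackCode fs) c l n [] [] [] p} (λ ())
          (λ _ → lens (λ _ → refl) (λ _ _ → refl)) (λ _ → lens (λ _ → refl) (λ _ _ → refl)) x i []))) ⊳
    takes (relax bound (lookupNameᵂ τ x fs))
    where
      open ℕ.≤-Reasoning
      sum : ∀ z → 43 * z + 2 * z + 6 * z ≡ 51 * z
      sum = solve-∀
      bound : 43 * length (stackCode fs) + 2 * length ⌜ x ⌝ᴺ + 6 ≤ 51 * Z
      bound = begin
        43 * length (stackCode fs) + 2 * length ⌜ x ⌝ᴺ + 6 * 1  ≤⟨ ℕ.+-mono-≤ (ℕ.+-mono-≤ (ℕ.*-monoʳ-≤ 43 e≤) (ℕ.*-monoʳ-≤ 2 x≤)) (ℕ.*-monoʳ-≤ 6 1≤Z) ⟩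
        43 * Z + 2 * Z + 6 * Z  ≡⟨ sum Z ⟩
        51 * Z  ∎

  forgetᵂ : ∀ k {i q w e c l p} → k ≤ Z → Takes 4 forget (stacks i q w e c l [] (index k) [] [] p) (stacks i q w e c l [] [] [] [] p)
  forgetᵂ k {i} {q} {w} {e} {c} {l} {p} k≤ = linear 2 1 (subst (_≤ Z) (sym (List.length-replicate k)) k≤)
    (discardᴬ {i = R} {f = λ r → stacks i q w e c l [] r [] [] p} (lens (λ _ → refl) (λ _ _ → refl)) (nm k) {sepMark ∷ []} refl) ⊳ const (straight refl)

  pushSlotᵂ : ∀ k x {i q w e l r p} → k ≤ Z → Takes 14 (pushSlot x) (stacks i q w e (index k) l [] r [] [] p) (stacks i q w e (index k) (x ∷ ones k ++ l) [] r [] [] p)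
  pushSlotᵂ k x {i} {q} {w} {e} {l} {r} {p} k≤ = copyIndexᵂ (λ ()) (λ ()) (λ ()) {f = λ c l s → stacks i q w e c l [] r s [] p}
    (λ _ _ → lens (λ _ → refl) (λ _ _ → refl)) (λ _ _ → lens (λ _ → refl) (λ _ _ → refl)) (λ _ _ → lens (λ _ → refl) (λ _ _ → refl)) k l refl k≤ ⊳ const (straight refl)

  state : List Bool → List Bool → List Bool → List Frame → ℕ → Cells → Bool → Stacks 11 12
  state i q w fs k l b = stacks (bits i) (bits q) (bits w) (stackCode fs) (index k) l [] [] [] [] (sign b)

  nodeᵂ : ∀ s {_ : T (2 * length (I ∷ ⌜ nm s ⌝ᴺ) + 1 ≤ᵇ 13)} {i q w fs b} side k j l → NonBit l → j ≤ Z → k ≤ Z →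
    Takes 400 (node s) (state i q w fs k (slotOf side j l) b)
      (state i ((head k b ++ ⌜ sourceVar (ix s) ⌝ˢ) ʳ++ q) ((conjCode ++ ⌜ link k (j , sideℕ side) ⌝ᴸ ++ thenCode) ʳ++ w) fs (suc k)
        (slotOf side₀ k (slotOf side₁ k l)) b)
  nodeᵂ s {h} {i} {q} {w} {fs} {b} side k j l nb j≤ k≤ = slacken {100 + (13 + (250 + (14 + (14 + 2))))}
    (emitted (quantifiersᴱ k b k≤) q ⊳
     arriveᵀ (cong (λ q → state i q w fs k (slotOf side j l) b) (sym (List.++-ʳ++ (head k b)))) (slacken {2 * length (I ∷ ⌜ nm s ⌝ᴺ) + 1} {13} {_} {_} {_} {h} (emitted (word onQ (I ∷ ⌜ nm s ⌝ᴺ)) (head k b ʳ++ q))) ⊳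
     linkToᵂ C side k j l w nb j≤ (indexCM k k≤) ⊳ pushSlotᵂ k _ k≤ ⊳ pushSlotᵂ k _ k≤ ⊳ const (straight refl))

-- From arithmetic to Hyper²LTL: terms and backtracking

abstract
  -- Time per input bit in units of `Z`. The dearest token, membership of a set in a class, needs at
  -- most 2009 of them.
  tokenCost : ℕ
  tokenCost = 5000

  ≤tokenCost : ∀ {a} → T (a ≤ᵇ 5000) → a ≤ tokenCost
  ≤tokenCost {a} = ℕ.≤ᵇ⇒≤ a 5000

module Terms (m Z : ℕ) (1≤Z : 1 ≤ Z) where

  open ToHyper
  open Timing Z 1≤Z
  open Lookup
  open Gadgets m
  open HyperCodes m
  open Macros m Z 1≤Z
  open Bounds m using (after-prefixᵀ)

  spend : ∀ {a v p σ σ′} len {_ : T (a ≤ᵇ 5000)} → Takes (a + v) p σ σ′ → Takes (tokenCost * suc len + v) p σ σ′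
  spend {a} {v} len {h} (takes r) = takes (relax (ℕ.*-monoˡ-≤ Z (ℕ.+-monoˡ-≤ v (ℕ.≤-trans (≤tokenCost {a} h) (ℕ.m≤m*n tokenCost (suc len))))) r)

  spend₁ : ∀ {a v p σ σ′} x {len} {_ : T (a ≤ᵇ 5000)} → x ≤ len → Takes (a + (tokenCost * x + v)) p σ σ′ → Takes (tokenCost * suc len + v) p σ σ′
  spend₁ {a} {v} x {len} {h} x≤ (takes r) = takes (relax (ℕ.*-monoˡ-≤ Z bound) r)
    where
      open ℕ.≤-Reasoning
      bound : a + (tokenCost * x + v) ≤ tokenCost * suc len + v
      bound = begin
        a + (tokenCost * x + v)  ≤⟨ ℕ.+-mono-≤ (≤tokenCost {a} h) (ℕ.+-monoˡ-≤ v (ℕ.*-monoʳ-≤ tokenCost x≤)) ⟩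
        tokenCost + (tokenCost * len + v)  ≡⟨ sym (ℕ.+-assoc tokenCost _ v) ⟩
        tokenCost + tokenCost * len + v  ≡⟨ cong (_+ v) (sym (ℕ.*-suc tokenCost len)) ⟩
        tokenCost * suc len + v  ∎

  spend₂ : ∀ {a v p σ σ′} (s t : List Bool) {len} {_ : T (a ≤ᵇ 5000)} → length (s ++ t) ≤ len →
    Takes (a + (tokenCost * length s + (tokenCost * length t + v))) p σ σ′ → Takes (tokenCost * suc len + v) p σ σ′
  spend₂ {a} {v} s t {len} {h} st≤ (takes r) = spend₁ {a} {v} (length (s ++ t)) {len} {h} st≤ (takes (relax (ℕ.≤-reflexive (cong (_* Z) (cong (a +_) same-cost))) r))
    where
      same-cost : tokenCost * length s + (tokenCost * length t + v) ≡ tokenCost * length (s ++ t) + v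
      same-cost = trans (sym (ℕ.+-assoc (tokenCost * length s) _ v)) (cong (_+ v)
        (trans (sym (ℕ.*-distribˡ-+ tokenCost (length s) (length t))) (cong (tokenCost *_) (sym (List.length-++ s)))))

  pairQ : ∀ k b x A B q {k₂} → after-prefix (suc k) A ≡ k₂ →
    prefixCode k₂ B ʳ++ prefixCode (suc k) A ʳ++ (head k b ++ ⌜ sourceVar x ⌝ˢ) ʳ++ q ≡ prefixCode k ((b , x) ∷ A ++ B) ʳ++ q
  pairQ k b x A B q refl = sym (trans (cong (λ s → ((head k b ++ ⌜ sourceVar x ⌝ˢ) ++ s) ʳ++ q) (prefixCode-++ (suc k) A B))
    (trans (List.++-ʳ++ (head k b ++ ⌜ sourceVar x ⌝ˢ) {prefixCode (suc k) A ++ prefixCode (after-prefix (suc k) A) B} {q})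
      (List.++-ʳ++ (prefixCode (suc k) A) {prefixCode (after-prefix (suc k) A) B} {(head k b ++ ⌜ sourceVar x ⌝ˢ) ʳ++ q})))

  pairM : ∀ ψ A B w → linkCodes B ʳ++ linkCodes A ʳ++ (conjCode ++ ⌜ ψ ⌝ᴸ ++ thenCode) ʳ++ w ≡ linkCodes (ψ ∷ A ++ B) ʳ++ w
  pairM ψ A B w = sym (trans (cong (λ s → ((conjCode ++ ⌜ ψ ⌝ᴸ ++ thenCode) ++ s) ʳ++ w) (linkCodes-++ A B))
    (trans (List.++-ʳ++ (conjCode ++ ⌜ ψ ⌝ᴸ ++ thenCode) {linkCodes A ++ linkCodes B} {w})
      (List.++-ʳ++ (linkCodes A) {linkCodes B} {(conjCode ++ ⌜ ψ ⌝ᴸ ++ thenCode) ʳ++ w})))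

  nextᵀ≤ : ∀ k t → nextᵀ k t ≤ k + length ⌜ t ⌝ᵀ
  nextᵀ≤₂ : ∀ k s t → nextᵀ (nextᵀ k s) t ≤ k + length (⌜ s ⌝ᵀ ++ ⌜ t ⌝ᵀ)
  nextᵀ≤ k (var x) = ℕ.m≤m+n k _
  nextᵀ≤ k (s ⊕ t) = ℕ.≤-trans (nextᵀ≤₂ (suc k) s t) (ℕ.≤-trans (ℕ.≤-reflexive (sym (ℕ.+-suc k _))) (ℕ.+-monoʳ-≤ k (ℕ.n≤1+n _)))
  nextᵀ≤ k (s ⊗ t) = ℕ.≤-trans (nextᵀ≤₂ (suc k) s t) (ℕ.≤-trans (ℕ.≤-reflexive (sym (ℕ.+-suc k _))) (ℕ.+-monoʳ-≤ k (ℕ.n≤1+n _)))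
  nextᵀ≤₂ k s t = begin
    nextᵀ (nextᵀ k s) t  ≤⟨ nextᵀ≤ (nextᵀ k s) t ⟩
    nextᵀ k s + length ⌜ t ⌝ᵀ  ≤⟨ ℕ.+-monoˡ-≤ (length ⌜ t ⌝ᵀ) (nextᵀ≤ k s) ⟩
    k + length ⌜ s ⌝ᵀ + length ⌜ t ⌝ᵀ  ≡⟨ ℕ.+-assoc k _ _ ⟩
    k + (length ⌜ s ⌝ᵀ + length ⌜ t ⌝ᵀ)  ≡⟨ cong (k +_) (sym (List.length-++ ⌜ s ⌝ᵀ)) ⟩
    k + length (⌜ s ⌝ᵀ ++ ⌜ t ⌝ᵀ)  ∎
    where open ℕ.≤-Reasoning

  sums≤ : ∀ k (s t : List Bool) {y} → k + length (s ++ t) ≤ y → k + length s ≤ y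
  sums≤ k s t h = ℕ.≤-trans (ℕ.+-monoʳ-≤ k (ℕ.≤-trans (ℕ.m≤m+n (length s) (length t)) (ℕ.≤-reflexive (sym (List.length-++ s))))) h

  next≤ : ∀ k s t {y} → k + length (⌜ s ⌝ᵀ ++ ⌜ t ⌝ᵀ) ≤ y → nextᵀ k s + length ⌜ t ⌝ᵀ ≤ y
  next≤ k s t h = ℕ.≤-trans (ℕ.+-monoˡ-≤ (length ⌜ t ⌝ᵀ) (nextᵀ≤ k s))
    (ℕ.≤-trans (ℕ.≤-reflexive (trans (ℕ.+-assoc k _ _) (cong (k +_) (sym (List.length-++ ⌜ s ⌝ᵀ))))) h)

  drop≤ : ∀ k a n {y} → k + (a + n) ≤ y → k + n ≤ y
  drop≤ k a n h = ℕ.≤-trans (ℕ.+-monoʳ-≤ k (ℕ.m≤n+m n a)) h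

  shift≤ : ∀ k n {y} → k + suc n ≤ y → suc k + n ≤ y
  shift≤ k n h = ℕ.≤-trans (ℕ.≤-reflexive (sym (ℕ.+-suc k n))) h

  side-on : ∀ side l → isSide (top (sideMark side ∷ l)) ≡ true
  side-on side₀ l = refl
  side-on side₁ l = refl
  side-on side₂ l = refl

  -- In continuation form, over the stack of open slots: the code of `t` fills the slot on top,
  -- together with all slots that it opens itself, and leaves `l` to the continuation.
  termsᵂ : ∀ t {i q w} fs k j side l b {σ v} → NonBit l → j ≤ Z → length (stackCode fs) ≤ Z → k + length ⌜ t ⌝ᵀ ≤ Z →
    Takes v terms (state i (prefixCode k (prefixᵀ b t) ʳ++ q) (linkCodes (links (env fs) k (j , sideℕ side) t) ʳ++ w) fs (nextᵀ k t) l b) σ →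
    Takes (tokenCost * length ⌜ t ⌝ᵀ + v) terms (state (⌜ t ⌝ᵀ ++ i) q w fs k (slotOf side j l) b) σ

  compoundᵂ : ∀ z s t n₀ {_ : T (2 * length (I ∷ ⌜ nm n₀ ⌝ᴺ) + 1 ≤ᵇ 13)} {i q w} fs k j side l b {σ v} → NonBit l → j ≤ Z → length (stackCode fs) ≤ Z →
    k + suc (suc (length (⌜ s ⌝ᵀ ++ ⌜ t ⌝ᵀ))) ≤ Z →
    (∀ i {q w} fs {k l b σ} → Takes 400 (node n₀) (state i q w fs k l b) σ → Takes 404 termToken (state (I ∷ z ∷ i) q w fs k l b) σ) →
    Takes v terms (state i (prefixCode k ((b , ix n₀) ∷ prefixᵀ b s ++ prefixᵀ b t) ʳ++ q)
      (linkCodes (link k (j , sideℕ side) ∷ links (env fs) (suc k) (k , 0) s ++ links (env fs) (nextᵀ (suc k) s) (k , 1) t) ʳ++ w) fs (nextᵀ (nextᵀ (suc k) s) t) l b) σ →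
    Takes (tokenCost * suc (suc (length (⌜ s ⌝ᵀ ++ ⌜ t ⌝ᵀ))) + v) terms (state (I ∷ z ∷ (⌜ s ⌝ᵀ ++ ⌜ t ⌝ᵀ) ++ i) q w fs k (slotOf side j l) b) σ
  compoundᵂ z s t n₀ {h} {i} {q} {w} fs k j side l b {σ} {v} nb j≤ e≤ k≤ tok r = spend₂ {405} {v} ⌜ s ⌝ᵀ ⌜ t ⌝ᵀ (ℕ.n≤1+n _)
    (departᵀ (cong (λ i → state (I ∷ z ∷ i) q w fs k (slotOf side j l) b) (sym (List.++-assoc ⌜ s ⌝ᵀ ⌜ t ⌝ᵀ i)))
      (againᵀ (side-on side (ones j ++ l)) (tok (⌜ s ⌝ᵀ ++ ⌜ t ⌝ᵀ ++ i) {q} {w} fs {k} {slotOf side j l} {b} (nodeᵂ n₀ {h} {fs = fs} side k j l nb j≤ k≤Z))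
        (termsᵂ s fs (suc k) k side₀ (slotOf side₁ k l) b refl k≤Z e≤ (sums≤ (suc k) ⌜ s ⌝ᵀ ⌜ t ⌝ᵀ k≤′)
          (termsᵂ t fs (nextᵀ (suc k) s) k side₁ l b nb k≤Z e≤ (next≤ (suc k) s t k≤′)
            (departᵀ (cong₂ (λ q w → state i q w fs (nextᵀ (nextᵀ (suc k) s) t) l b)
              (sym (pairQ k b (ix n₀) (prefixᵀ b s) (prefixᵀ b t) q (after-prefixᵀ b (suc k) s)))
              (sym (pairM (link k (j , sideℕ side)) (links (env fs) (suc k) (k , 0) s) (links (env fs) (nextᵀ (suc k) s) (k , 1) t) w))) r)))))
    where
      k≤Z : k ≤ Z
      k≤Z = ℕ.≤-trans (ℕ.m≤m+n k _) k≤
      k≤′ : suc k + length (⌜ s ⌝ᵀ ++ ⌜ t ⌝ᵀ) ≤ Z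
      k≤′ = shift≤ k _ (drop≤ k 1 _ k≤)

  termsᵂ (var x) {i} {q} {w} fs k j side l b {σ} {v} nb j≤ e≤ k≤ r = spend {315} {v} (length ⌜ x ⌝ᴺ)
    (againᵀ (side-on side (ones j ++ l)) (readO (findNameᵂ number x fs i e≤ (drop≤ 0 1 _ (ℕ.≤-trans (ℕ.m≤n+m _ k) k≤)) ⊳
        linkToᵂ R side kᵣ j l w nb j≤ (indexRM kᵣ kᵣ≤) ⊳ forgetᵂ kᵣ kᵣ≤))
      (departᵀ (cong (λ w → state i q w fs k l b) (cong (_ʳ++ w) (List.++-identityʳ (conjCode ++ ⌜ link kᵣ (j , sideℕ side) ⌝ᴸ ++ thenCode)))) r))
    where
      kᵣ = find (env fs) number x
      kᵣ≤ : kᵣ ≤ Z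
      kᵣ≤ = ℕ.≤-trans (find≤ fs number x) e≤
  termsᵂ (s ⊕ t) fs k j side l b nb j≤ e≤ k≤ r = compoundᵂ O s t 1 fs k j side l b nb j≤ e≤ k≤ (λ _ _ h → readI (readO h)) r
  termsᵂ (s ⊗ t) fs k j side l b nb j≤ e≤ k≤ r = compoundᵂ I s t 2 fs k j side l b nb j≤ e≤ k≤ (λ _ _ h → readI (readI h)) r

  flipᵂ : ∀ b {i q w e c l n r s s′} → Within flip (stacks i q w e c l n r s s′ (sign b)) (stacks i q w e c l n r s s′ (sign (not b))) 4
  flipᵂ true  = straight refl
  flipᵂ false = straight refl

  -- The frames that remain when the scopes ending at an atom are closed; each negation that is left
  -- flips the polarity back.
  strip : List Frame → Bool → List Frame × Bool
  strip []               b = [] , b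
  strip (bindᶠ _ _ _ ∷ fs) b = strip fs b
  strip (negᶠ ∷ fs)      b = strip fs (not b)
  strip (andᶠ ∷ fs)      b = andᶠ ∷ fs , b
  strip (orᶠ ∷ fs)       b = orᶠ ∷ fs , b

  resumed : List Frame × Bool → List Bool → List Frame × Bool × List Bool
  resumed (andᶠ ∷ fs , b) w = fs , b , thenCode ʳ++ w
  resumed (orᶠ ∷ fs  , b) w = fs , b , w
  resumed (fs , b)        w = fs , b , w

  resume : List Bool → List Bool → ℕ → List Frame × Bool × List Bool → Stacks 11 12
  resume i q k (fs , b , w) = state i q w fs k [] b

  backtracked : List Frame → Bool → List Bool → List Frame × Bool × List Bool
  backtracked fs b w = resumed (strip fs b) w

  stripLoop : Program
  stripLoop = loop (on E (λ c → same c negMark ∨ (same c (sortMark number) ∨ (same c (sortMark set) ∨ same c (sortMark class)))))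
      (cond (on E (same negMark)) (pop E ⨾ flip) (pop E ⨾ loop (on E isBody) (pop E)))

  backtrackᵂ : ∀ fs {i q} k b w → length (stackCode fs) ≤ Z → Takes 22 backtrack (state i q w fs k [] b) (resume i q k (backtracked fs b w))
  backtrackᵂ fs {i} {q} k b w e≤ = linear 12 1 e≤ (stripᵂ fs b) ⊳ slacken {9} (resumeᵂ (strip fs b))
    where
      at-strip : Cells → Bool → Stacks 11 12
      at-strip e b = stacks (bits i) (bits q) (bits w) e (index k) [] [] [] [] [] (sign b)
      bodyOf : Name → ℕ → Cells
      bodyOf x k = bits (⌜ x ⌝ᴺ ʳ++ []) ++ sepMark ∷ ones k
      body : ∀ x k → Body (bodyOf x k)
      body x k = body-bits (⌜ x ⌝ᴺ ʳ++ []) (tt , subst Body (List.++-identityʳ (ones k)) (body-bits (nm k) tt))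
      dropᵂ : ∀ u {z b} → Body u → NonBody z → Within (loop (on E isBody) (pop E)) (at-strip (u ++ z) b) (at-strip z b) (2 * length u + 1)
      dropᵂ []      _ nz = stopᵂ nz
      dropᵂ (c ∷ u) (h , hs) nz = relax (ℕ.≤-reflexive (sum (length u))) (againᵂ (T⇒≡ h) (straight refl) (dropᵂ u hs nz))
        where
          sum : ∀ n → 1 + (1 + (2 * n + 1)) ≡ 2 * suc n + 1
          sum = solve-∀
      bind≤ : ∀ τ x k fs {t} → t ≤ 12 * length (stackCode fs) + 1 → suc (suc (1 + (2 * length (bodyOf x k) + 1)) + t) ≤ 12 * length (stackCode (bindᶠ τ x k ∷ fs)) + 1
      bind≤ τ x k fs {t} h = begin
        suc (suc (1 + (2 * lᵤ + 1)) + t)  ≤⟨ s≤s (ℕ.+-monoʳ-≤ _ h) ⟩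
        suc (suc (1 + (2 * lᵤ + 1)) + (12 * lᵥ + 1))  ≤⟨ ℕ.m≤m+n _ (10 * lᵤ + 8) ⟩
        suc (suc (1 + (2 * lᵤ + 1)) + (12 * lᵥ + 1)) + (10 * lᵤ + 8)  ≡⟨ sum lᵤ lᵥ ⟩
        12 * suc (lᵤ + lᵥ) + 1  ≡⟨ cong (λ l → 12 * suc l + 1) (sym (List.length-++ (bodyOf x k))) ⟩
        12 * length (stackCode (bindᶠ τ x k ∷ fs)) + 1  ∎
        where
          open ℕ.≤-Reasoning
          lᵤ = length (bodyOf x k)
          lᵥ = length (stackCode fs)
          sum : ∀ u v → suc (suc (1 + (2 * u + 1)) + (12 * v + 1)) + (10 * u + 8) ≡ 12 * suc (u + v) + 1
          sum = solve-∀
      stripᵂ : ∀ fs b → Within stripLoop (at-strip (stackCode fs) b) (at-strip (stackCode (proj₁ (strip fs b))) (proj₂ (strip fs b))) (12 * length (stackCode fs) + 1)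
      stripᵂ []          b = stopᵂ refl
      stripᵂ (andᶠ ∷ fs) b = relax (ℕ.m≤n+m 1 (12 * suc (length (stackCode fs)))) (stopᵂ refl)
      stripᵂ (orᶠ ∷ fs)  b = relax (ℕ.m≤n+m 1 (12 * suc (length (stackCode fs)))) (stopᵂ refl)
      stripᵂ (negᶠ ∷ fs) b = relax (ℕ.≤-trans (ℕ.m≤m+n _ 5) (ℕ.≤-reflexive (sum (length (stackCode fs)))))
          (againᵂ refl (thenᵂ refl (straight {t = 1} refl ⨟ flipᵂ b)) (stripᵂ fs (not b)))
        where
          sum : ∀ l → suc (suc (1 + 4) + (12 * l + 1)) + 5 ≡ 12 * suc l + 1
          sum = solve-∀
      stripᵂ (bindᶠ number x k ∷ fs) b = relax (bind≤ number x k fs ℕ.≤-refl)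
        (againᵂ refl (elseᵂ refl (straight {t = 1} refl ⨟ dropᵂ (bodyOf x k) (body x k) (stack-nonbody fs))) (stripᵂ fs b))
      stripᵂ (bindᶠ set x k ∷ fs)    b = relax (bind≤ set x k fs ℕ.≤-refl)
        (againᵂ refl (elseᵂ refl (straight {t = 1} refl ⨟ dropᵂ (bodyOf x k) (body x k) (stack-nonbody fs))) (stripᵂ fs b))
      stripᵂ (bindᶠ class x k ∷ fs)  b = relax (bind≤ class x k fs ℕ.≤-refl)
        (againᵂ refl (elseᵂ refl (straight {t = 1} refl ⨟ dropᵂ (bodyOf x k) (body x k) (stack-nonbody fs))) (stripᵂ fs b))
      resumeᵂ : ∀ p → Takes 9 (cond (on E (same andMark)) (pop E ⨾ emit M thenCode) (cond (on E (same orMark)) (pop E) skip))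
        (at-strip (stackCode (proj₁ p)) (proj₂ p)) (resume i q k (resumed p w))
      resumeᵂ ([] , b)                    = slacken (const (straight refl))
      resumeᵂ (andᶠ ∷ fs , b)             = slacken (const (straight refl))
      resumeᵂ (orᶠ ∷ fs , b)              = slacken (const (straight refl))
      resumeᵂ (negᶠ ∷ fs , b)             = slacken (const (straight refl))
      resumeᵂ (bindᶠ number x k ∷ fs , b) = slacken (const (straight refl))
      resumeᵂ (bindᶠ set x k ∷ fs , b)    = slacken (const (straight refl))
      resumeᵂ (bindᶠ class x k ∷ fs , b)  = slacken (const (straight refl))

-- From arithmetic to Hyper²LTL: atoms, binders and the space invariant

module Formulas (m W Z : ℕ) (1≤Z : 1 ≤ Z) (W≤Z : W ≤ Z) where

  open ToHyper
  open Timing Z 1≤Z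
  open Lookup
  open Gadgets m
  open HyperCodes m
  open Macros m Z 1≤Z
  open Terms m Z 1≤Z
  open Emits
  open Bounds m using (after-prefixᵀ)

  finishᵂ : ∀ fs {i q} k b w → length (stackCode fs) ≤ Z → Takes 60 finish (state i q w fs k [] b) (resume i q k (backtracked fs b ((bitCode ++ O ∷ []) ʳ++ w)))
  finishᵂ fs k b w e≤ = slacken (emitted (word onM (bitCode ++ O ∷ [])) w ⊳ backtrackᵂ fs k b _ e≤)

  comparisonᵂ : ∀ sgn {_ : T (2 * length (conjCode ++ sgn) + 1 ≤ᵇ 100)} s t (ψ : LTL (suc m)) fs {i q} k b w →
    (conjCode ++ sgn) ++ ⌜ nm k ⌝ᴺ ++ thenCode ++ ⌜ conjs (links (env fs) (suc k) (k , 0) s ++ links (env fs) (nextᵀ (suc k) s) (k , 2) t) ⌝ᴸ ≡ ⌜ ψ ⌝ᴸ →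
    length (stackCode fs) ≤ Z → k + suc (length (⌜ s ⌝ᵀ ++ ⌜ t ⌝ᵀ)) ≤ Z →
    Takes (400 + (tokenCost * length ⌜ s ⌝ᵀ + (tokenCost * length ⌜ t ⌝ᵀ + 1))) (comparison sgn) (state ((⌜ s ⌝ᵀ ++ ⌜ t ⌝ᵀ) ++ i) q w fs k [] b)
      (resume i (prefixCode k ((b , ix 1) ∷ prefixᵀ b s ++ prefixᵀ b t) ʳ++ q) (nextᵀ (nextᵀ (suc k) s) t) (backtracked fs b (⌜ ψ ⌝ᴸ ʳ++ w)))
  comparisonᵂ sgn {h} s t ψ fs {i} {q} k b w code e≤ k≤ = takes (relax (ℕ.*-monoˡ-≤ Z (bound (tokenCost * length ⌜ s ⌝ᵀ) (tokenCost * length ⌜ t ⌝ᵀ))) (within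
    (departᵀ (cong (λ i → state i q w fs k [] b) (sym (List.++-assoc ⌜ s ⌝ᵀ ⌜ t ⌝ᵀ i)))
      (emitted (quantifiersᴱ k b k≤Z) q ⊳
       arriveᵀ (cong (λ q → state i₀ q w fs k [] b) (sym (List.++-ʳ++ (head k b) {I ∷ ⌜ nm 1 ⌝ᴺ} {q}))) (emitted (word onQ (I ∷ ⌜ nm 1 ⌝ᴺ)) (head k b ʳ++ q)) ⊳
       slacken {2 * length (conjCode ++ sgn) + 1} {100} {_} {_} {_} {h} (emitted (word onM (conjCode ++ sgn)) w) ⊳
       emitted (indexCM k k≤Z) ((conjCode ++ sgn) ʳ++ w) ⊳
       emitted (word onM thenCode) _ ⊳
       pushSlotᵂ k _ k≤Z ⊳ pushSlotᵂ k _ k≤Z ⊳ const {t = 2} (straight refl) ⊳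
       termsᵂ s fs (suc k) k side₀ (slotOf side₂ k []) b refl k≤Z e≤ (sums≤ (suc k) ⌜ s ⌝ᵀ ⌜ t ⌝ᵀ k≤′)
         (termsᵂ t fs (nextᵀ (suc k) s) k side₂ [] b refl k≤Z e≤ (next≤ (suc k) s t k≤′) (stopᵀ refl)) ⊳
       arriveᵀ (cong₂ (λ q w → resume i q (nextᵀ (nextᵀ (suc k) s) t) (backtracked fs b w))
           (pairQ k b (ix 1) (prefixᵀ b s) (prefixᵀ b t) q (after-prefixᵀ b (suc k) s)) spelling)
         (finishᵂ fs (nextᵀ (nextᵀ (suc k) s) t) b _ e≤)))))
    where
      i₀ = ⌜ s ⌝ᵀ ++ ⌜ t ⌝ᵀ ++ i
      A = links (env fs) (suc k) (k , 0) s
      B = links (env fs) (nextᵀ (suc k) s) (k , 2) t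
      k≤Z : k ≤ Z
      k≤Z = ℕ.≤-trans (ℕ.m≤m+n k _) k≤
      k≤′ : suc k + length (⌜ s ⌝ᵀ ++ ⌜ t ⌝ᵀ) ≤ Z
      k≤′ = shift≤ k _ k≤
      fin = bitCode ++ O ∷ []
      opened = (conjCode ++ sgn) ++ ⌜ nm k ⌝ᴺ ++ thenCode
      spelling : fin ʳ++ linkCodes B ʳ++ linkCodes A ʳ++ thenCode ʳ++ ⌜ nm k ⌝ᴺ ʳ++ (conjCode ++ sgn) ʳ++ w ≡ ⌜ ψ ⌝ᴸ ʳ++ w
      spelling = begin
        fin ʳ++ linkCodes B ʳ++ linkCodes A ʳ++ thenCode ʳ++ ⌜ nm k ⌝ᴺ ʳ++ (conjCode ++ sgn) ʳ++ w
          ≡⟨ cong (λ z → fin ʳ++ linkCodes B ʳ++ z) (reversed₅ (conjCode ++ sgn) ⌜ nm k ⌝ᴺ thenCode (linkCodes A) [] w) ⟩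
        fin ʳ++ linkCodes B ʳ++ ((conjCode ++ sgn) ++ ⌜ nm k ⌝ᴺ ++ thenCode ++ linkCodes A ++ []) ʳ++ w
          ≡⟨ reversed₅ [] [] ((conjCode ++ sgn) ++ ⌜ nm k ⌝ᴺ ++ thenCode ++ linkCodes A ++ []) (linkCodes B) fin w ⟩
        (((conjCode ++ sgn) ++ ⌜ nm k ⌝ᴺ ++ thenCode ++ linkCodes A ++ []) ++ linkCodes B ++ fin) ʳ++ w
          ≡⟨ cong (_ʳ++ w) (regroup (conjCode ++ sgn) ⌜ nm k ⌝ᴺ thenCode (linkCodes A) (linkCodes B) fin) ⟩
        ((conjCode ++ sgn) ++ ⌜ nm k ⌝ᴺ ++ thenCode ++ (linkCodes A ++ linkCodes B) ++ fin) ʳ++ w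
          ≡⟨ cong (λ z → ((conjCode ++ sgn) ++ ⌜ nm k ⌝ᴺ ++ thenCode ++ z) ʳ++ w) (trans (cong (_++ fin) (sym (linkCodes-++ A B))) (sym (conjs-code (A ++ B)))) ⟩
        ((conjCode ++ sgn) ++ ⌜ nm k ⌝ᴺ ++ thenCode ++ ⌜ conjs (A ++ B) ⌝ᴸ) ʳ++ w  ≡⟨ cong (_ʳ++ w) code ⟩
        ⌜ ψ ⌝ᴸ ʳ++ w  ∎
        where
          open ≡-Reasoning
          regroup : ∀ (a n c x y z : List Bool) → (a ++ n ++ c ++ x ++ []) ++ y ++ z ≡ a ++ n ++ c ++ (x ++ y) ++ z
          regroup a n c x y z = trans (List.++-assoc a _ _) (cong (a ++_) (trans (List.++-assoc n _ _) (cong (n ++_) (trans (List.++-assoc c _ _)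
            (cong (c ++_) (trans (cong (_++ y ++ z) (List.++-identityʳ x)) (sym (List.++-assoc x y z))))))))
      bound : ∀ x y → 100 + (9 + (100 + (16 + (7 + (14 + (14 + (2 + (x + (y + 1) + 60)))))))) ≤ 400 + (x + (y + 1))
      bound x y = begin
        100 + (9 + (100 + (16 + (7 + (14 + (14 + (2 + (x + (y + 1) + 60))))))))  ≡⟨ sum x y ⟩
        322 + (x + (y + 1))  ≤⟨ ℕ.+-monoˡ-≤ (x + (y + 1)) (ℕ.≤ᵇ⇒≤ 322 400 tt) ⟩
        400 + (x + (y + 1))  ∎
        where
          open ℕ.≤-Reasoning
          sum : ∀ x y → 100 + (9 + (100 + (16 + (7 + (14 + (14 + (2 + (x + (y + 1) + 60)))))))) ≡ 322 + (x + (y + 1))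
          sum = solve-∀

  setMemberᵂ : ∀ t x fs {i q} k b w → length (stackCode fs) ≤ Z → length ⌜ x ⌝ᴺ ≤ Z → k + suc (length ⌜ t ⌝ᵀ) ≤ Z →
    Takes (600 + (tokenCost * length ⌜ t ⌝ᵀ + 1)) setMember (state ((⌜ t ⌝ᵀ ++ ⌜ x ⌝ᴺ) ++ i) q w fs k [] b)
      (resume i (prefixCode k ((b , ix 1) ∷ prefixᵀ b t) ʳ++ q) (nextᵀ (suc k) t) (backtracked fs b (⌜ matrixᶠ (env fs) k (t ∈₁ x) ⌝ᴸ ʳ++ w)))
  setMemberᵂ t x fs {i} {q} k b w e≤ x≤ k≤ = takes (relax (ℕ.*-monoˡ-≤ Z (bound (tokenCost * length ⌜ t ⌝ᵀ))) (within
    (departᵀ (cong (λ i → state i q w fs k [] b) (sym (List.++-assoc ⌜ t ⌝ᵀ ⌜ x ⌝ᴺ i)))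
      (emitted (quantifiersᴱ k b k≤Z) q ⊳
       arriveᵀ (cong (λ q → state (⌜ t ⌝ᵀ ++ ⌜ x ⌝ᴺ ++ i) q w fs k [] b) (sym (List.++-ʳ++ (head k b) {I ∷ ⌜ nm 1 ⌝ᴺ} {q}))) (emitted (word onQ (I ∷ ⌜ nm 1 ⌝ᴺ)) (head k b ʳ++ q)) ⊳
       pushSlotᵂ k _ k≤Z ⊳ pushSlotᵂ k _ k≤Z ⊳ const {t = 2} (straight refl) ⊳
       termsᵂ t fs (suc k) k side₂ (pendingMark ∷ ones k ++ []) b refl k≤Z e≤ (shift≤ k _ k≤) (stopᵀ refl) ⊳
       const {t = 1} (straight refl) ⊳ const {t = 2} (straight refl) ⊳
       findNameᵂ set x fs i e≤ x≤ ⊳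
       linkToᵂ R side₂ kᵣ k [] _ refl k≤Z (indexRM kᵣ kᵣ≤) ⊳ forgetᵂ kᵣ kᵣ≤ ⊳
       arriveᵀ (cong₂ (λ q w → resume i q (nextᵀ (suc k) t) (backtracked fs b w))
           (sym (List.++-ʳ++ (head k b ++ ⌜ sourceVar (ix 1) ⌝ˢ) {prefixCode (suc k) (prefixᵀ b t)} {q})) spelling)
         (finishᵂ fs (nextᵀ (suc k) t) b _ e≤)))))
    where
      kᵣ = find (env fs) set x
      kᵣ≤ : kᵣ ≤ Z
      kᵣ≤ = ℕ.≤-trans (find≤ fs set x) e≤
      k≤Z : k ≤ Z
      k≤Z = ℕ.≤-trans (ℕ.m≤m+n k _) k≤
      A = links (env fs) (suc k) (k , 2) t
      ψ = link kᵣ (k , 2)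
      one = conjCode ++ ⌜ ψ ⌝ᴸ ++ thenCode
      fin = bitCode ++ O ∷ []
      spelling : fin ʳ++ one ʳ++ linkCodes A ʳ++ w ≡ ⌜ matrixᶠ (env fs) k (t ∈₁ x) ⌝ᴸ ʳ++ w
      spelling = begin
        fin ʳ++ one ʳ++ linkCodes A ʳ++ w  ≡⟨ reversed₅ [] [] (linkCodes A) one fin w ⟩
        (linkCodes A ++ one ++ fin) ʳ++ w  ≡⟨ cong (_ʳ++ w) (trans (cong (λ z → linkCodes A ++ z ++ fin) (sym (List.++-identityʳ one)))
                                                            (sym (List.++-assoc (linkCodes A) (one ++ []) fin))) ⟩
        ((linkCodes A ++ one ++ []) ++ fin) ʳ++ w  ≡⟨ cong (λ z → (z ++ fin) ʳ++ w) (sym (linkCodes-++ A (ψ ∷ []))) ⟩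
        (linkCodes (A ++ ψ ∷ []) ++ fin) ʳ++ w  ≡⟨ cong (_ʳ++ w) (sym (conjs-code (A ++ ψ ∷ []))) ⟩
        ⌜ conjs (A ++ ψ ∷ []) ⌝ᴸ ʳ++ w  ∎
        where open ≡-Reasoning
      bound : ∀ x → 100 + (9 + (14 + (14 + (2 + (x + 1 + (1 + (2 + (58 + (250 + (4 + 60)))))))))) ≤ 600 + (x + 1)
      bound x = begin
        100 + (9 + (14 + (14 + (2 + (x + 1 + (1 + (2 + (58 + (250 + (4 + 60))))))))))  ≡⟨ sum x ⟩
        514 + (x + 1)  ≤⟨ ℕ.+-monoˡ-≤ (x + 1) (ℕ.≤ᵇ⇒≤ 514 600 tt) ⟩
        600 + (x + 1)  ∎
        where
          open ℕ.≤-Reasoning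
          sum : ∀ x → 100 + (9 + (14 + (14 + (2 + (x + 1 + (1 + (2 + (58 + (250 + (4 + 60)))))))))) ≡ 514 + (x + 1)
          sum = solve-∀

  opaque
    unfolding Gadgets.eventually

    class-code : ∀ a k → (sameCode₁ ++ ⌜ nm a ⌝ᴺ ++ sameCode₂ ++ ⌜ nm k ⌝ᴺ ++ sameCode₃ ++ ⌜ nm a ⌝ᴺ ++ sameCode₄ ++ ⌜ nm k ⌝ᴺ ++ sameCode₅ ++ ⌜ nm k ⌝ᴺ)
      ≡ ⌜ conj (sameSet a k) (bitAt k) ⌝ᴸ
    class-code a k = cong (sameCode₁ ++_) (sym (regroup ⌜ nm a ⌝ᴺ sameCode₂ ⌜ nm k ⌝ᴺ sameCode₃ sameCode₄ (sameCode₅ ++ ⌜ nm k ⌝ᴺ)))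
      where
        regroup : ∀ (n y p z u v : List Bool) → ((n ++ y ++ p) ++ z ++ n ++ u ++ p) ++ v ≡ n ++ y ++ p ++ z ++ n ++ u ++ p ++ v
        regroup n y p z u v = trans (List.++-assoc (n ++ y ++ p) _ v) (trans (List.++-assoc n (y ++ p) _) (cong (n ++_)
          (trans (List.++-assoc y p _) (cong (λ s → y ++ p ++ s) (trans (List.++-assoc z _ v) (cong (z ++_)
            (trans (List.++-assoc n _ v) (cong (n ++_) (List.++-assoc u p v)))))))))

  classMemberᵂ : ∀ A x fs {i q} k b w → length (stackCode fs) ≤ Z → length ⌜ A ⌝ᴺ ≤ Z → length ⌜ x ⌝ᴺ ≤ Z → k ≤ Z →
    Takes 2000 classMember (state ((⌜ A ⌝ᴺ ++ ⌜ x ⌝ᴺ) ++ i) q w fs k [] b)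
      (resume i (prefixCode k ((b , ix (find (env fs) class x)) ∷ []) ʳ++ q) (suc k) (backtracked fs b (⌜ matrixᶠ (env fs) k (A ∈₂ x) ⌝ᴸ ʳ++ w)))
  classMemberᵂ A x fs {i} {q} k b w e≤ A≤ x≤ k≤ = slacken
    (departᵀ (cong (λ i → state i q w fs k [] b) (sym (List.++-assoc ⌜ A ⌝ᴺ ⌜ x ⌝ᴺ i)))
      (findNameᵂ set A fs (⌜ x ⌝ᴺ ++ i) e≤ A≤ ⊳
       emitted (word onM sameCode₁) w ⊳ emitted (indexRM a a≤) (sameCode₁ ʳ++ w) ⊳ emitted (word onM sameCode₂) (⌜ nm a ⌝ᴺ ʳ++ sameCode₁ ʳ++ w) ⊳ emitted (indexCM k k≤) (sameCode₂ ʳ++ ⌜ nm a ⌝ᴺ ʳ++ sameCode₁ ʳ++ w) ⊳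
       emitted (word onM sameCode₃) w₁ ⊳ emitted (indexRM a a≤) (sameCode₃ ʳ++ w₁) ⊳ emitted (word onM sameCode₄) (⌜ nm a ⌝ᴺ ʳ++ sameCode₃ ʳ++ w₁) ⊳ emitted (indexCM k k≤) (sameCode₄ ʳ++ ⌜ nm a ⌝ᴺ ʳ++ sameCode₃ ʳ++ w₁) ⊳
       emitted (word onM sameCode₅) w₂ ⊳ emitted (indexCM k k≤) (sameCode₅ ʳ++ w₂) ⊳
       forgetᵂ a a≤ ⊳ findNameᵂ class x fs i e≤ x≤ ⊳
       emitted (quantifiersᴱ k b k≤) q ⊳ const {t = 2} (straight refl) ⊳ emitted (indexRQ c c≤) (I ∷ (head k b ʳ++ q)) ⊳ forgetᵂ c c≤ ⊳ const {t = 2} (straight refl) ⊳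
       arriveᵀ (cong₂ (λ q w → resume i q (suc k) (backtracked fs b w)) spellingQ spellingM) (backtrackᵂ fs (suc k) b _ e≤)))
    where
      a = find (env fs) set A
      c = find (env fs) class x
      a≤ : a ≤ Z
      a≤ = ℕ.≤-trans (find≤ fs set A) e≤
      c≤ : c ≤ Z
      c≤ = ℕ.≤-trans (find≤ fs class x) e≤
      w₁ = ⌜ nm k ⌝ᴺ ʳ++ sameCode₂ ʳ++ ⌜ nm a ⌝ᴺ ʳ++ sameCode₁ ʳ++ w
      w₂ = ⌜ nm k ⌝ᴺ ʳ++ sameCode₄ ʳ++ ⌜ nm a ⌝ᴺ ʳ++ sameCode₃ ʳ++ w₁
      spellingQ : ⌜ nm c ⌝ᴺ ʳ++ I ∷ (head k b ʳ++ q) ≡ prefixCode k ((b , ix c) ∷ []) ʳ++ q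
      spellingQ = trans (sym (List.++-ʳ++ (head k b) {I ∷ ⌜ nm c ⌝ᴺ} {q})) (cong (_ʳ++ q) (sym (List.++-identityʳ (head k b ++ I ∷ ⌜ nm c ⌝ᴺ))))
      assoc₃ : ∀ (a b c d e f g h i j : List Bool) → (a ++ b ++ c ++ d ++ e) ++ f ++ g ++ h ++ i ++ j ≡ a ++ b ++ c ++ d ++ e ++ f ++ g ++ h ++ i ++ j
      assoc₃ a b c d e f g h i j = trans (List.++-assoc a _ _) (cong (a ++_) (trans (List.++-assoc b _ _) (cong (b ++_) (trans (List.++-assoc c _ _) (cong (c ++_) (List.++-assoc d e _))))))
      spellingM : ⌜ nm k ⌝ᴺ ʳ++ sameCode₅ ʳ++ w₂ ≡ ⌜ conj (sameSet a k) (bitAt k) ⌝ᴸ ʳ++ w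
      spellingM = trans (reversed₅ ⌜ nm a ⌝ᴺ sameCode₄ ⌜ nm k ⌝ᴺ sameCode₅ ⌜ nm k ⌝ᴺ (sameCode₃ ʳ++ w₁))
        (trans (cong (tail ʳ++_) (reversed₅ sameCode₁ ⌜ nm a ⌝ᴺ sameCode₂ ⌜ nm k ⌝ᴺ sameCode₃ w))
          (trans (sym (List.++-ʳ++ start′ {tail} {w})) (cong (_ʳ++ w)
            (trans (assoc₃ sameCode₁ ⌜ nm a ⌝ᴺ sameCode₂ ⌜ nm k ⌝ᴺ sameCode₃ ⌜ nm a ⌝ᴺ sameCode₄ ⌜ nm k ⌝ᴺ sameCode₅ ⌜ nm k ⌝ᴺ) (class-code a k)))))
        where
          start′ = sameCode₁ ++ ⌜ nm a ⌝ᴺ ++ sameCode₂ ++ ⌜ nm k ⌝ᴺ ++ sameCode₃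
          tail = ⌜ nm a ⌝ᴺ ++ sameCode₄ ++ ⌜ nm k ⌝ᴺ ++ sameCode₅ ++ ⌜ nm k ⌝ᴺ

  sourceOf : Sort → ℕ → Source
  sourceOf number k = ix 1
  sourceOf set    k = every
  sourceOf class  k = ix k

  introduceᵂ : ∀ τ x fs {i q w} k b → k ≤ Z → length ⌜ x ⌝ᴺ ≤ Z →
    Takes 60 (introduce τ) (state (⌜ x ⌝ᴺ ++ i) q w fs k [] b) (state i (⌜ sourceVar (sourceOf τ k) ⌝ˢ ʳ++ q) w (bindᶠ τ x k ∷ fs) (suc k) [] b)
  introduceᵂ τ x fs {i} {q} {w} k b k≤ x≤ = slacken
    (sourceᵂ τ ⊳
     copyIndexᵂ (λ ()) (λ ()) (λ ()) {f = λ c e s → stacks (bits (⌜ x ⌝ᴺ ++ i)) (bits q₁) (bits w) e c [] [] [] s [] (sign b)}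
       (λ _ _ → lens (λ _ → refl) (λ _ _ → refl)) (λ _ _ → lens (λ _ → refl) (λ _ _ → refl)) (λ _ _ → lens (λ _ → refl) (λ _ _ → refl)) k (stackCode fs) refl k≤ ⊳
     const {t = 2} (straight refl) ⊳
     linear 7 0 x≤ (relax (ℕ.≤-reflexive (sym (ℕ.+-identityʳ _)))
       (copyNameᴬ {i = In} {j = E} {f = λ i e → stacks i (bits q₁) (bits w) e (index k) [] [] [] [] [] (sign b)} (λ ())
          (λ _ → lens (λ _ → refl) (λ _ _ → refl)) (λ _ → lens (λ _ → refl) (λ _ _ → refl)) x i (sepMark ∷ ones k ++ stackCode fs))) ⊳
     const {t = 2} (straight refl) ⊳
     arriveᵀ (cong (λ e → stacks (bits i) (bits q₁) (bits w) (sortMark τ ∷ e) (index (suc k)) [] [] [] [] [] (sign b)) frame) (const {t = 2} (straight refl)))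
    where
      q₁ = ⌜ sourceVar (sourceOf τ k) ⌝ˢ ʳ++ q
      frame : bits ⌜ x ⌝ᴺ ʳ++ sepMark ∷ ones k ++ stackCode fs ≡ (bits (⌜ x ⌝ᴺ ʳ++ []) ++ sepMark ∷ ones k) ++ stackCode fs
      frame = trans (List.ʳ++-defn (bits ⌜ x ⌝ᴺ)) (trans (cong (_++ sepMark ∷ ones k ++ stackCode fs)
          (sym (trans (bits-ʳ++ ⌜ x ⌝ᴺ []) (trans (List.ʳ++-defn (bits ⌜ x ⌝ᴺ)) (List.++-identityʳ _)))))
        (sym (List.++-assoc (bits (⌜ x ⌝ᴺ ʳ++ [])) (sepMark ∷ ones k) (stackCode fs))))
      sourceᵂ : ∀ τ → Takes 18 (source τ) (state (⌜ x ⌝ᴺ ++ i) q w fs k [] b) (state (⌜ x ⌝ᴺ ++ i) (⌜ sourceVar (sourceOf τ k) ⌝ˢ ʳ++ q) w fs k [] b)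
      sourceᵂ number = slacken (emitted (word onQ (I ∷ ⌜ nm 1 ⌝ᴺ)) q)
      sourceᵂ set    = slacken (emitted (word onQ (O ∷ I ∷ [])) q)
      sourceᵂ class  = slacken (const {t = 2} (straight refl) ⊳ emitted (indexCQ k k≤) (I ∷ q))

  -- `n` is the length of the unread input. A token raises the level by no more than its own length
  -- allows and pushes at most one frame of length at most `W`, so these reserves keep levels below
  -- `W` and the frame stack below `Z` to the end.
  record Fits (k : ℕ) (fs : List Frame) (n : ℕ) : Set where
    constructor fits
    field
      level≤ : k + n ≤ W
      stack≤ : length (stackCode fs) + W * n ≤ Z

  open Fits

  fits-Z : ∀ {k fs n} → Fits k fs n → k + n ≤ Z
  fits-Z f = ℕ.≤-trans (level≤ f) W≤Z

  fits-stack : ∀ {k fs n} → Fits k fs n → length (stackCode fs) ≤ Z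
  fits-stack f = ℕ.≤-trans (ℕ.m≤m+n _ _) (stack≤ f)

  fits-push : ∀ {k k′ fs n n′} f → length (frameCode f) ≤ k + n → k′ + n′ ≤ k + n → suc n′ ≤ n → Fits k fs n → Fits k′ (f ∷ fs) n′
  fits-push {k} {k′} {fs} {n} {n′} f f≤ k≤ n≤ h = fits (ℕ.≤-trans k≤ (level≤ h)) (begin
      length (frameCode f ++ stackCode fs) + W * n′  ≡⟨ cong (_+ W * n′) (List.length-++ (frameCode f)) ⟩
      length (frameCode f) + length (stackCode fs) + W * n′  ≤⟨ ℕ.+-monoˡ-≤ (W * n′) (ℕ.+-monoˡ-≤ (length (stackCode fs)) (ℕ.≤-trans f≤ (level≤ h))) ⟩
      W + length (stackCode fs) + W * n′  ≡⟨ sum W (length (stackCode fs)) n′ ⟩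
      length (stackCode fs) + W * suc n′  ≤⟨ ℕ.+-monoʳ-≤ (length (stackCode fs)) (ℕ.*-monoʳ-≤ W n≤) ⟩
      length (stackCode fs) + W * n  ≤⟨ stack≤ h ⟩
      Z  ∎)
    where
      open ℕ.≤-Reasoning
      sum : ∀ w e n → w + e + w * n ≡ e + w * suc n
      sum = solve-∀

  fits-skip : ∀ {k k′ fs n n′} → k′ + n′ ≤ k + n → n′ ≤ n → Fits k fs n → Fits k′ fs n′
  fits-skip {fs = fs} k≤ n≤ h = fits (ℕ.≤-trans k≤ (level≤ h)) (ℕ.≤-trans (ℕ.+-monoʳ-≤ (length (stackCode fs)) (ℕ.*-monoʳ-≤ W n≤)) (stack≤ h))

  nextᶠ≤ : ∀ k φ → nextᶠ k φ ≤ k + length ⌜ φ ⌝ᴬ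
  nextᶠ≤₂ : ∀ k φ χ → nextᶠ (nextᶠ k φ) χ ≤ k + length (⌜ φ ⌝ᴬ ++ ⌜ χ ⌝ᴬ)
  nextᶠ≤₁ : ∀ k x φ → nextᶠ (suc k) φ ≤ k + (4 + length (⌜ x ⌝ᴺ ++ ⌜ φ ⌝ᴬ))
  nextᶠ≤₁ k x φ = ℕ.≤-trans (nextᶠ≤ (suc k) φ) (ℕ.≤-trans (ℕ.≤-reflexive (sym (ℕ.+-suc k _)))
    (ℕ.+-monoʳ-≤ k (s≤s (ℕ.≤-trans (ℕ.≤-trans (ℕ.m≤n+m _ (length ⌜ x ⌝ᴺ)) (ℕ.≤-reflexive (sym (List.length-++ ⌜ x ⌝ᴺ)))) (ℕ.m≤n+m _ 3)))))
  nextᶠ≤₂ k φ χ = ℕ.≤-trans (nextᶠ≤ (nextᶠ k φ) χ) (ℕ.≤-trans (ℕ.+-monoˡ-≤ _ (nextᶠ≤ k φ))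
    (ℕ.≤-reflexive (trans (ℕ.+-assoc k _ _) (cong (k +_) (sym (List.length-++ ⌜ φ ⌝ᴬ))))))
  nextᶠ≤ k (s ≈ t)    = ℕ.≤-trans (nextᵀ≤₂ (suc k) s t) (ℕ.≤-trans (ℕ.≤-reflexive (sym (ℕ.+-suc k _))) (ℕ.+-monoʳ-≤ k (s≤s (ℕ.m≤n+m _ 3))))
  nextᶠ≤ k (s ≺ t)    = ℕ.≤-trans (nextᵀ≤₂ (suc k) s t) (ℕ.≤-trans (ℕ.≤-reflexive (sym (ℕ.+-suc k _))) (ℕ.+-monoʳ-≤ k (s≤s (ℕ.m≤n+m _ 3))))
  nextᶠ≤ k (t ∈₁ A)   = ℕ.≤-trans (nextᵀ≤ (suc k) t) (ℕ.≤-trans (ℕ.≤-reflexive (sym (ℕ.+-suc k _)))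
    (ℕ.+-monoʳ-≤ k (s≤s (ℕ.≤-trans (ℕ.≤-trans (ℕ.m≤m+n _ (length ⌜ A ⌝ᴺ)) (ℕ.≤-reflexive (sym (List.length-++ ⌜ t ⌝ᵀ)))) (ℕ.m≤n+m _ 3)))))
  nextᶠ≤ k (A ∈₂ 𝒜)   = ℕ.≤-trans (ℕ.≤-reflexive (ℕ.+-comm 1 k)) (ℕ.+-monoʳ-≤ k (s≤s z≤n))
  nextᶠ≤ k (neg φ)    = ℕ.≤-trans (nextᶠ≤ k φ) (ℕ.+-monoʳ-≤ k (ℕ.m≤n+m _ 4))
  nextᶠ≤ k (φ and χ)  = ℕ.≤-trans (nextᶠ≤₂ k φ χ) (ℕ.+-monoʳ-≤ k (ℕ.m≤n+m _ 4))
  nextᶠ≤ k (φ or χ)   = ℕ.≤-trans (nextᶠ≤₂ k φ χ) (ℕ.+-monoʳ-≤ k (ℕ.m≤n+m _ 4))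
  nextᶠ≤ k (∃⁰ x ∙ φ) = nextᶠ≤₁ k x φ
  nextᶠ≤ k (∀⁰ x ∙ φ) = nextᶠ≤₁ k x φ
  nextᶠ≤ k (∃¹ x ∙ φ) = nextᶠ≤₁ k x φ
  nextᶠ≤ k (∀¹ x ∙ φ) = nextᶠ≤₁ k x φ
  nextᶠ≤ k (∃² x ∙ φ) = nextᶠ≤₁ k x φ
  nextᶠ≤ k (∀² x ∙ φ) = nextᶠ≤₁ k x φ

-- From arithmetic to Hyper²LTL: the main loop

module FormulaLoop (m W Z : ℕ) (1≤Z : 1 ≤ Z) (W≤Z : W ≤ Z) where

  open ToHyper
  open Timing Z 1≤Z
  open Lookup
  open Gadgets m
  open HyperCodes m
  open Macros m Z 1≤Z
  open Terms m Z 1≤Z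
  open Formulas m W Z 1≤Z W≤Z
  open Emits
  open Bounds m using (after-prefixᶠ)

  recost : ∀ {a b p σ σ′} → a ≡ b → Takes a p σ σ′ → Takes b p σ σ′
  recost refl r = r

  existsᵂ : ∀ τ x fs {i q w} k b → k ≤ Z → length ⌜ x ⌝ᴺ ≤ Z → Takes 160 (quantifiers ⨾ introduce τ) (state (⌜ x ⌝ᴺ ++ i) q w fs k [] b)
    (state i ((head k b ++ ⌜ sourceVar (sourceOf τ k) ⌝ˢ) ʳ++ q) w (bindᶠ τ x k ∷ fs) (suc k) [] b)
  existsᵂ τ x fs {i} {q} {w} k b k≤ x≤ = emitted (quantifiersᴱ k b k≤) q ⊳
    arriveᵀ (cong (λ q → state i q w (bindᶠ τ x k ∷ fs) (suc k) [] b) (sym (List.++-ʳ++ (head k b) {⌜ sourceVar (sourceOf τ k) ⌝ˢ} {q})))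
      (introduceᵂ τ x fs k b k≤ x≤)

  unflipᵂ : ∀ b {i q w e c l n r s s′} → Within flip (stacks i q w e c l n r s s′ (sign (not b))) (stacks i q w e c l n r s s′ (sign b)) 4
  unflipᵂ true  = straight refl
  unflipᵂ false = straight refl

  forallᵂ : ∀ τ x fs {i q w} k b → k ≤ Z → length ⌜ x ⌝ᴺ ≤ Z → Takes 168 (flip ⨾ quantifiers ⨾ flip ⨾ introduce τ) (state (⌜ x ⌝ᴺ ++ i) q w fs k [] b)
    (state i ((head k (not b) ++ ⌜ sourceVar (sourceOf τ k) ⌝ˢ) ʳ++ q) w (bindᶠ τ x k ∷ fs) (suc k) [] b)
  forallᵂ τ x fs {i} {q} {w} k b k≤ x≤ = const (flipᵂ b) ⊳ emitted (quantifiersᴱ k (not b) k≤) q ⊳ const (unflipᵂ b) ⊳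
    arriveᵀ (cong (λ q → state i q w (bindᶠ τ x k ∷ fs) (suc k) [] b) (sym (List.++-ʳ++ (head k (not b)) {⌜ sourceVar (sourceOf τ k) ⌝ˢ} {q})))
      (introduceᵂ τ x fs k b k≤ x≤)

  split-length : ∀ (s t : List Bool) n → length (s ++ t) + n ≡ length s + (length t + n)
  split-length s t n = trans (cong (_+ n) (List.length-++ s)) (ℕ.+-assoc (length s) _ n)

  Resumed : ∀ φ fs k b i q w → Stacks 11 12
  Resumed φ fs k b i q w = resume i (prefixCode k (prefixᶠ (env fs) k b φ) ʳ++ q) (nextᶠ k φ) (backtracked fs b (⌜ matrixᶠ (env fs) k φ ⌝ᴸ ʳ++ w))

  -- Backtracking after the last atom of `φ` does not stop at the end of `φ` but also closes
  -- enclosing scopes. The state afterwards is therefore described as backtracking from the outer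
  -- frames `fs`: the frames pushed by `φ` itself vanish from the description, and scopes compose.
  formulaᵂ : ∀ φ fs k b {i q w n σ v} → Fits k fs (length ⌜ φ ⌝ᴬ + n) → Takes v mainLoop (Resumed φ fs k b i q w) σ →
    Takes (tokenCost * length ⌜ φ ⌝ᴬ + v) mainLoop (state (⌜ φ ⌝ᴬ ++ i) q w fs k [] b) σ

  bindᵂ : ∀ c₁ c₂ c₃ τ x φ fs k b b₀ {i q w n σ v} → Fits k fs (4 + length (⌜ x ⌝ᴺ ++ ⌜ φ ⌝ᴬ) + n) →
    (k ≤ Z → length ⌜ x ⌝ᴺ ≤ Z → ∀ i → Takes 200 token (state (I ∷ c₁ ∷ c₂ ∷ c₃ ∷ ⌜ x ⌝ᴺ ++ i) q w fs k [] b)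
      (state i ((head k b₀ ++ ⌜ sourceVar (sourceOf τ k) ⌝ˢ) ʳ++ q) w (bindᶠ τ x k ∷ fs) (suc k) [] b)) →
    Takes v mainLoop (resume i (prefixCode k ((b₀ , sourceOf τ k) ∷ prefixᶠ ((τ , x , k) ∷ env fs) (suc k) b φ) ʳ++ q) (nextᶠ (suc k) φ)
      (backtracked fs b (⌜ matrixᶠ ((τ , x , k) ∷ env fs) (suc k) φ ⌝ᴸ ʳ++ w))) σ →
    Takes (tokenCost * (4 + length (⌜ x ⌝ᴺ ++ ⌜ φ ⌝ᴬ)) + v) mainLoop (state (I ∷ c₁ ∷ c₂ ∷ c₃ ∷ (⌜ x ⌝ᴺ ++ ⌜ φ ⌝ᴬ) ++ i) q w fs k [] b) σ
  bindᵂ c₁ c₂ c₃ τ x φ fs k b b₀ {i} {q} {w} {n} {σ} {v} f tok r = spend₁ {201} {v} (length ⌜ φ ⌝ᴬ)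
      (ℕ.≤-trans (ℕ.≤-trans (ℕ.m≤n+m _ (length ⌜ x ⌝ᴺ)) (ℕ.≤-reflexive (sym (List.length-++ ⌜ x ⌝ᴺ)))) (ℕ.m≤n+m _ 3))
      (departᵀ (cong (λ i → state (I ∷ c₁ ∷ c₂ ∷ c₃ ∷ i) q w fs k [] b) (sym (List.++-assoc ⌜ x ⌝ᴺ ⌜ φ ⌝ᴬ i)))
        (againᵀ refl (tok (ℕ.≤-trans (ℕ.m≤m+n k _) (fits-Z f′)) (ℕ.≤-trans (ℕ.≤-trans (ℕ.≤-trans (ℕ.m≤m+n _ z) (ℕ.m≤n+m _ 4)) (ℕ.m≤n+m _ k)) (fits-Z f′)) (⌜ φ ⌝ᴬ ++ i))
          (formulaᵂ φ (bindᶠ τ x k ∷ fs) (suc k) b (fits-push (bindᶠ τ x k) frame≤ level′≤ shorter f′)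
            (departᵀ (cong (λ q → resume i q (nextᶠ (suc k) φ) (backtracked fs b (⌜ matrixᶠ ((τ , x , k) ∷ env fs) (suc k) φ ⌝ᴸ ʳ++ w)))
              (List.++-ʳ++ (head k b₀ ++ ⌜ sourceVar (sourceOf τ k) ⌝ˢ) {prefixCode (suc k) (prefixᶠ ((τ , x , k) ∷ env fs) (suc k) b φ)} {q})) r))))
    where
      open ℕ.≤-Reasoning
      z = length ⌜ φ ⌝ᴬ + n
      lₓ = length ⌜ x ⌝ᴺ
      f′ : Fits k fs (4 + (lₓ + z))
      f′ = subst (λ z → Fits k fs (4 + z)) (split-length ⌜ x ⌝ᴺ ⌜ φ ⌝ᴬ n) f
      shorter : suc z ≤ 4 + (lₓ + z)
      shorter = s≤s (ℕ.≤-trans (ℕ.m≤n+m z lₓ) (ℕ.m≤n+m _ 3))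
      level′≤ : suc k + z ≤ k + (4 + (lₓ + z))
      level′≤ = ℕ.≤-trans (ℕ.≤-reflexive (sym (ℕ.+-suc k z))) (ℕ.+-monoʳ-≤ k shorter)
      frame≤ : length (frameCode (bindᶠ τ x k)) ≤ k + (4 + (lₓ + z))
      frame≤ = begin
        suc (length (bits {11} (⌜ x ⌝ᴺ ʳ++ []) ++ sepMark ∷ ones k))  ≡⟨ cong suc (List.length-++ (bits (⌜ x ⌝ᴺ ʳ++ []))) ⟩
        suc (length (bits {11} (⌜ x ⌝ᴺ ʳ++ [])) + suc (length (ones k)))
          ≡⟨ cong₂ (λ a c → suc (a + suc c)) (trans (List.length-map bit (⌜ x ⌝ᴺ ʳ++ [])) (trans (List.length-ʳ++ ⌜ x ⌝ᴺ) (ℕ.+-identityʳ _)))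
               (trans (List.length-map bit (nm k)) (List.length-replicate k)) ⟩
        suc (lₓ + suc k)  ≤⟨ ℕ.m≤m+n _ (2 + z) ⟩
        suc (lₓ + suc k) + (2 + z)  ≡⟨ sum lₓ k z ⟩
        k + (4 + (lₓ + z))  ∎
        where
          sum : ∀ l k z → suc (l + suc k) + (2 + z) ≡ k + (4 + (l + z))
          sum = solve-∀

  atom≤ : ∀ {k fs} a {n} → Fits k fs (4 + a + n) → k + suc a ≤ Z
  atom≤ {k} a {n} f = ℕ.≤-trans (ℕ.+-monoʳ-≤ k (s≤s (ℕ.≤-trans (ℕ.m≤m+n a n) (ℕ.m≤n+m _ 3)))) (fits-Z f)

  firstPart : ∀ {k fs} (s t : List Bool) {n} → Fits k fs (4 + length (s ++ t) + n) → length s ≤ Z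
  firstPart {k} s t f = ℕ.≤-trans (ℕ.≤-trans (ℕ.m≤m+n (length s) (length t)) (ℕ.≤-reflexive (sym (List.length-++ s))))
    (ℕ.≤-trans (ℕ.≤-trans (ℕ.n≤1+n _) (ℕ.m≤n+m _ k)) (atom≤ {k} (length (s ++ t)) f))

  secondPart : ∀ {k fs} (s t : List Bool) {n} → Fits k fs (4 + length (s ++ t) + n) → length t ≤ Z
  secondPart {k} s t f = ℕ.≤-trans (ℕ.≤-trans (ℕ.m≤n+m (length t) (length s)) (ℕ.≤-reflexive (sym (List.length-++ s))))
    (ℕ.≤-trans (ℕ.≤-trans (ℕ.n≤1+n _) (ℕ.m≤n+m _ k)) (atom≤ {k} (length (s ++ t)) f))

  fits-mark : ∀ {k fs} f z → length (frameCode f) ≡ 1 → Fits k fs (4 + z) → Fits k (f ∷ fs) z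
  fits-mark {k} f z e = fits-push f (ℕ.≤-trans (ℕ.≤-reflexive e) (ℕ.≤-trans (s≤s z≤n) (ℕ.m≤n+m (4 + z) k))) (ℕ.+-monoʳ-≤ k (ℕ.m≤n+m z 4)) (ℕ.m≤n+m (suc z) 3)

  fits-second : ∀ {k fs} φ z → Fits k fs (4 + (length ⌜ φ ⌝ᴬ + z)) → Fits (nextᶠ k φ) fs z
  fits-second {k} φ z = fits-skip (ℕ.≤-trans (ℕ.+-monoˡ-≤ z (nextᶠ≤ k φ)) (ℕ.≤-trans (ℕ.≤-reflexive (ℕ.+-assoc k _ z)) (ℕ.+-monoʳ-≤ k (ℕ.m≤n+m _ 4))))
    (ℕ.≤-trans (ℕ.m≤n+m z (length ⌜ φ ⌝ᴬ)) (ℕ.m≤n+m _ 4))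

  joinQ : ∀ φ χ fs k b q → prefixCode (nextᶠ k φ) (prefixᶠ (env fs) (nextᶠ k φ) b χ) ʳ++ prefixCode k (prefixᶠ (env fs) k b φ) ʳ++ q ≡
    prefixCode k (prefixᶠ (env fs) k b φ ++ prefixᶠ (env fs) (nextᶠ k φ) b χ) ʳ++ q
  joinQ φ χ fs k b q = trans (sym (List.++-ʳ++ (prefixCode k A) {prefixCode (nextᶠ k φ) B} {q}))
    (cong (_ʳ++ q) (trans (cong (λ k′ → prefixCode k A ++ prefixCode k′ B) (sym (after-prefixᶠ (env fs) k b φ))) (sym (prefixCode-++ k A B))))
    where
      A = prefixᶠ (env fs) k b φ
      B = prefixᶠ (env fs) (nextᶠ k φ) b χ

  cost₂ : ∀ x y v → suc (408 + (x + (y + 1)) + v) ≡ 410 + (x + (y + v))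
  cost₂ = solve-∀

  cost₁ : ∀ x v → suc (608 + (x + 1) + v) ≡ 610 + (x + v)
  cost₁ = solve-∀

  formulaᵂ (s ≈ t) fs k b {i} {q} {w} {n} {σ} {v} f r = spend₂ {410} {v} ⌜ s ⌝ᵀ ⌜ t ⌝ᵀ (ℕ.m≤n+m _ 3) (recost (cost₂ (tokenCost * length ⌜ s ⌝ᵀ) (tokenCost * length ⌜ t ⌝ᵀ) v) (againᵀ refl
    (readO (readO (readO (readO (comparisonᵂ (O ∷ I ∷ I ∷ bitCode) s t (matrixᶠ (env fs) k (s ≈ t)) fs k b w refl (fits-stack f) (atom≤ _ f)))))) r))
  formulaᵂ (s ≺ t) fs k b {i} {q} {w} {n} {σ} {v} f r = spend₂ {410} {v} ⌜ s ⌝ᵀ ⌜ t ⌝ᵀ (ℕ.m≤n+m _ 3) (recost (cost₂ (tokenCost * length ⌜ s ⌝ᵀ) (tokenCost * length ⌜ t ⌝ᵀ) v) (againᵀ refl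
    (readO (readO (readO (readI (comparisonᵂ (thenCode ++ O ∷ I ∷ I ∷ bitCode) s t (matrixᶠ (env fs) k (s ≺ t)) fs k b w refl (fits-stack f) (atom≤ _ f)))))) r))
  formulaᵂ (t ∈₁ x) fs k b {i} {q} {w} {n} {σ} {v} f r = spend₁ {610} {v} (length ⌜ t ⌝ᵀ)
    (ℕ.≤-trans (ℕ.≤-trans (ℕ.m≤m+n _ (length ⌜ x ⌝ᴺ)) (ℕ.≤-reflexive (sym (List.length-++ ⌜ t ⌝ᵀ)))) (ℕ.m≤n+m _ 3)) (recost (cost₁ (tokenCost * length ⌜ t ⌝ᵀ) v) (againᵀ refl
      (readO (readO (readI (readO (setMemberᵂ t x fs k b w (fits-stack f) (secondPart ⌜ t ⌝ᵀ ⌜ x ⌝ᴺ f)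
        (ℕ.≤-trans (ℕ.+-monoʳ-≤ k (s≤s (ℕ.≤-trans (ℕ.m≤m+n _ (length ⌜ x ⌝ᴺ)) (ℕ.≤-reflexive (sym (List.length-++ ⌜ t ⌝ᵀ)))))) (atom≤ _ f))))))) r))
  formulaᵂ (A ∈₂ x) fs k b {i} {q} {w} {n} {σ} {v} f r = spend {2009} {v} (3 + length (⌜ A ⌝ᴺ ++ ⌜ x ⌝ᴺ)) (againᵀ refl
      (readO (readO (readI (readI (classMemberᵂ A x fs k b w (fits-stack f) (firstPart ⌜ A ⌝ᴺ ⌜ x ⌝ᴺ f) (secondPart ⌜ A ⌝ᴺ ⌜ x ⌝ᴺ f)
        (ℕ.≤-trans (ℕ.m≤m+n k _) (fits-Z f))))))) r)
  formulaᵂ (neg φ) fs k b {i} {q} {w} {n} {σ} {v} f r = spend₁ {22} {v} (length ⌜ φ ⌝ᴬ) (ℕ.m≤n+m _ 3) (againᵀ refl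
      (readO (readI (readO (readO (emitted (word onM thenCode) w ⊳ const {t = 2} (straight refl) ⊳ const (flipᵂ b))))))
      (formulaᵂ φ (negᶠ ∷ fs) k (not b) (fits-mark negᶠ _ refl f)
        (departᵀ (cong (λ b′ → resume i (prefixCode k (prefixᶠ (env fs) k (not b) φ) ʳ++ q) (nextᶠ k φ) (backtracked fs b′ (⌜ neg (matrixᶠ (env fs) k φ) ⌝ᴸ ʳ++ w)))
          (involutive b)) r)))
    where
      involutive : ∀ b → b ≡ not (not b)
      involutive true  = refl
      involutive false = refl
  formulaᵂ (φ and χ) fs k b {i} {q} {w} {n} {σ} {v} f r = spend₂ {30} {v} ⌜ φ ⌝ᴬ ⌜ χ ⌝ᴬ (ℕ.m≤n+m _ 3)
      (departᵀ (cong (λ i → state (O ∷ I ∷ O ∷ I ∷ i) q w fs k [] b) (sym (List.++-assoc ⌜ φ ⌝ᴬ ⌜ χ ⌝ᴬ i)))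
        (againᵀ refl (readO (readI (readO (readI (emitted (word onM conjCode) w ⊳ const {t = 2} (straight refl))))))
          (formulaᵂ φ (andᶠ ∷ fs) k b (fits-mark andᶠ _ refl f′)
            (formulaᵂ χ fs (nextᶠ k φ) b (fits-second φ _ f′)
              (departᵀ (cong₂ (λ q w → resume i q (nextᶠ (nextᶠ k φ) χ) (backtracked fs b w)) (sym (joinQ φ χ fs k b q))
                (List.++-ʳ++ ⌜ matrixᶠ (env fs) k φ ⌝ᴸ {thenCode ++ ⌜ matrixᶠ (env fs) (nextᶠ k φ) χ ⌝ᴸ} {conjCode ʳ++ w})) r)))))
    where
      f′ : Fits k fs (4 + (length ⌜ φ ⌝ᴬ + (length ⌜ χ ⌝ᴬ + n)))
      f′ = subst (λ z → Fits k fs (4 + z)) (split-length ⌜ φ ⌝ᴬ ⌜ χ ⌝ᴬ n) f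
  formulaᵂ (φ or χ) fs k b {i} {q} {w} {n} {σ} {v} f r = spend₂ {18} {v} ⌜ φ ⌝ᴬ ⌜ χ ⌝ᴬ (ℕ.m≤n+m _ 3)
      (departᵀ (cong (λ i → state (O ∷ I ∷ I ∷ O ∷ i) q w fs k [] b) (sym (List.++-assoc ⌜ φ ⌝ᴬ ⌜ χ ⌝ᴬ i)))
        (againᵀ refl (readO (readI (readI (readO (emitted (word onM (O ∷ I ∷ O ∷ [])) w ⊳ const {t = 2} (straight refl))))))
          (formulaᵂ φ (orᶠ ∷ fs) k b (fits-mark orᶠ _ refl f′)
            (formulaᵂ χ fs (nextᶠ k φ) b (fits-second φ _ f′)
              (departᵀ (cong₂ (λ q w → resume i q (nextᶠ (nextᶠ k φ) χ) (backtracked fs b w)) (sym (joinQ φ χ fs k b q))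
                (List.++-ʳ++ ⌜ matrixᶠ (env fs) k φ ⌝ᴸ {⌜ matrixᶠ (env fs) (nextᶠ k φ) χ ⌝ᴸ} {O ∷ I ∷ O ∷ w})) r)))))
    where
      f′ : Fits k fs (4 + (length ⌜ φ ⌝ᴬ + (length ⌜ χ ⌝ᴬ + n)))
      f′ = subst (λ z → Fits k fs (4 + z)) (split-length ⌜ φ ⌝ᴬ ⌜ χ ⌝ᴬ n) f
  formulaᵂ (∃⁰ x ∙ φ) fs k b f r = bindᵂ O O O number x φ fs k b b f (λ k≤ x≤ i → slacken (readI (readO (readO (readO (existsᵂ number x fs k b k≤ x≤)))))) r
  formulaᵂ (∀⁰ x ∙ φ) fs k b f r = bindᵂ O O I number x φ fs k b (not b) f (λ k≤ x≤ i → slacken (readI (readO (readO (readI (forallᵂ number x fs k b k≤ x≤)))))) r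
  formulaᵂ (∃¹ x ∙ φ) fs k b f r = bindᵂ O I O set x φ fs k b b f (λ k≤ x≤ i → slacken (readI (readO (readI (readO (existsᵂ set x fs k b k≤ x≤)))))) r
  formulaᵂ (∀¹ x ∙ φ) fs k b f r = bindᵂ O I I set x φ fs k b (not b) f (λ k≤ x≤ i → slacken (readI (readO (readI (readI (forallᵂ set x fs k b k≤ x≤)))))) r
  formulaᵂ (∃² x ∙ φ) fs k b f r = bindᵂ I O O class x φ fs k b b f (λ k≤ x≤ i → slacken (readI (readI (readO (readO (existsᵂ class x fs k b k≤ x≤)))))) r
  formulaᵂ (∀² x ∙ φ) fs k b f r = bindᵂ I O I class x φ fs k b (not b) f (λ k≤ x≤ i → slacken (readI (readI (readO (readI (forallᵂ class x fs k b k≤ x≤)))))) r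

-- From arithmetic to Hyper²LTL: the whole machine

module HyperProgram (m : ℕ) where

  open ToHyper
  open Gadgets m
  open HyperCodes m
  open Bounds m using (hyperSentence)

  abstract
    constCode matrixStart : List Bool
    constCode   = prefixCode 0 (constants ++ axiomPrefix)
    matrixStart = O ∷ conjCode ++ ⌜ axioms ⌝ᴸ ++ thenCode

    hyper-code : ∀ φ → (constCode ++ prefixCode firstFree (prefixᶠ [] firstFree true φ)) ++ matrixStart ++ ⌜ matrixᶠ [] firstFree φ ⌝ᴸ ≡ ⌜ hyper φ ⌝ᴴ
    hyper-code φ = trans (cong₂ _++_ (sym (prefixCode-++ 0 (constants ++ axiomPrefix) (prefixᶠ [] firstFree true φ)))
        (cong (λ s → O ∷ conjCode ++ s) (List.++-assoc ⌜ axioms ⌝ᴸ thenCode ⌜ matrixᶠ [] firstFree φ ⌝ᴸ)))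
      (sym (prefixed-code 0 (wholePrefix φ) (ltl (wholeMatrix φ))))

  setup translate output program : Program
  setup     = push C sepMark ⨾ emit C (nm firstFree) ⨾ push P (bit O)
  translate = emit Q constCode ⨾ emit M matrixStart ⨾ setup ⨾ mainLoop
  output    = pour M Out ⨾ pour Q Out
  program   = translate ⨾ output

  -- Levels start at 15 and rise by at most one per input bit, so `n + 16` bounds them and also the
  -- length of a frame. The frame stack then needs at most `width n` cells per input bit, which
  -- gives quadratic space and cubic time.
  width space setupTime translateTime time : ℕ → ℕ
  width n         = n + 16
  space n         = width n * n + width n
  setupTime _     = 2 * length constCode + 1 + (2 * length matrixStart + 1 + 35)
  translateTime n = setupTime n + (tokenCost * n + 1) * space n
  time n          = translateTime n + (4 * (translateTime n + n) + 1 + (4 * (translateTime n + n) + 1))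

  time-polynomial : Polynomial time
  time-polynomial = polynomial (translating +ᴾ (pouring +ᴾ pouring))
    where
      widthᴾ : Polynomial′ width
      widthᴾ = idᴾ +ᴾ constᴾ 16
      translating : Polynomial′ translateTime
      translating = constᴾ (setupTime 0) +ᴾ (constᴾ tokenCost *ᴾ idᴾ +ᴾ constᴾ 1) *ᴾ (widthᴾ *ᴾ idᴾ +ᴾ widthᴾ)
      pouring : Polynomial′ (λ n → 4 * (translateTime n + n) + 1)
      pouring = constᴾ 4 *ᴾ (translating +ᴾ idᴾ) +ᴾ constᴾ 1

  module _ (φ : Arith) where

    private
      size = length ⌜ φ ⌝ᴬ

    1≤width : 1 ≤ width size
    1≤width = ℕ.≤-trans (s≤s z≤n) (ℕ.m≤n+m 16 size)

    width≤space : width size ≤ space size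
    width≤space = ℕ.m≤n+m (width size) (width size * size)

    1≤space : 1 ≤ space size
    1≤space = ℕ.≤-trans 1≤width width≤space

    open Timing (space size) 1≤space using (within)
    open Macros m (space size) 1≤space using (state; onQ; onM; stopᵀ)
    open FormulaLoop m (width size) (space size) 1≤space width≤space using (formulaᵂ)
    open Formulas m (width size) (space size) 1≤space width≤space using (fits)

    prefixStack matrixStack : List Bool
    prefixStack = prefixCode firstFree (prefixᶠ [] firstFree true φ) ʳ++ constCode ʳ++ []
    matrixStack = ⌜ matrixᶠ [] firstFree φ ⌝ᴸ ʳ++ matrixStart ʳ++ []

    translated : Stacks 11 12
    translated = state [] prefixStack matrixStack [] (nextᶠ firstFree φ) [] true

    translateᵂ : Within translate (inputStacks ⌜ φ ⌝ᴬ) translated (translateTime size)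
    translateᵂ = relax (ℕ.≤-reflexive (sum (2 * length constCode + 1) (2 * length matrixStart + 1) ((tokenCost * size + 1) * space size)))
      -- The 35 steps of `setup` are 2 for the separator, 31 for fifteen ones and 2 for the
      -- polarity.
      (emitᴬ onQ constCode [] ⨟ emitᴬ onM matrixStart [] ⨟ straight {t = 35} refl ⨟
       depart (cong (λ i → state i (constCode ʳ++ []) (matrixStart ʳ++ []) [] firstFree [] true) (List.++-identityʳ ⌜ φ ⌝ᴬ))
         (within (formulaᵂ φ [] firstFree true {[]} {constCode ʳ++ []} {matrixStart ʳ++ []} {0}
           (fits (ℕ.≤-trans (ℕ.≤-reflexive (level size)) (ℕ.+-monoʳ-≤ size (ℕ.n≤1+n 15)))
                 (ℕ.≤-trans (ℕ.≤-reflexive (cong (width size *_) (ℕ.+-identityʳ size))) (ℕ.m≤m+n _ (width size))))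
           (stopᵀ refl))))
      where
        level : ∀ n → 15 + (n + 0) ≡ n + 15
        level = solve-∀
        sum : ∀ a b c → a + (b + (35 + c)) ≡ a + (b + 35) + c
        sum = solve-∀

    stack≤ : ∀ i s → lookup translated i ≡ bits s → length s ≤ translateTime size + size
    stack≤ i s e = begin
      length s  ≡⟨ sym (List.length-map bit s) ⟩
      length (bits {11} s)  ≡⟨ cong length (sym e) ⟩
      length (lookup translated i)  ≤⟨ height-lookup translated i ⟩
      height translated  ≤⟨ run-height (proj₂ (proj₂ translateᵂ)) ⟩
      proj₁ translateᵂ + height (inputStacks {11} {10} ⌜ φ ⌝ᴬ)  ≤⟨ ℕ.+-mono-≤ (proj₁ (proj₂ translateᵂ))
        (ℕ.≤-reflexive (trans (ℕ.+-identityʳ _) (List.length-map bit ⌜ φ ⌝ᴬ))) ⟩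
      translateTime size + size  ∎
      where open ℕ.≤-Reasoning

    finished : Stacks 11 12
    finished = [] ∷ (bits prefixStack ʳ++ bits matrixStack ʳ++ []) ∷ [] ∷ [] ∷ [] ∷ Lookup.index (nextᶠ firstFree φ) ∷ [] ∷ [] ∷ [] ∷ [] ∷ [] ∷ (bit O ∷ []) ∷ []

    outputᵂ : Within output translated finished (4 * (translateTime size + size) + 1 + (4 * (translateTime size + size) + 1))
    outputᵂ =
      relax (ℕ.+-monoˡ-≤ 1 (ℕ.*-monoʳ-≤ 4 (stack≤ M matrixStack refl)))
        (depart (cong (λ w → stacks′ (bits prefixStack) w []) (List.++-identityʳ (bits matrixStack)))
          (pourᴬ {i = M} {j = Out} {f = λ w o → stacks′ (bits prefixStack) w o} (λ ()) (λ _ → lens (λ _ → refl) (λ _ _ → refl))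
            (λ _ → lens (λ _ → refl) (λ _ _ → refl)) matrixStack {[]} refl [])) ⨟
      relax (ℕ.+-monoˡ-≤ 1 (ℕ.*-monoʳ-≤ 4 (stack≤ Q prefixStack refl)))
        (depart (cong (λ q → stacks′ q [] (bits matrixStack ʳ++ [])) (List.++-identityʳ (bits prefixStack)))
          (pourᴬ {i = Q} {j = Out} {f = λ q o → stacks′ q [] o} (λ ()) (λ _ → lens (λ _ → refl) (λ _ _ → refl))
            (λ _ → lens (λ _ → refl) (λ _ _ → refl)) prefixStack {[]} refl (bits matrixStack ʳ++ [])))
      where
        stacks′ : Cells → Cells → Cells → Stacks 11 12
        stacks′ q w o = [] ∷ o ∷ q ∷ w ∷ [] ∷ Lookup.index (nextᶠ firstFree φ) ∷ [] ∷ [] ∷ [] ∷ [] ∷ [] ∷ (bit O ∷ []) ∷ []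

    written : bits {11} prefixStack ʳ++ bits matrixStack ʳ++ [] ≡ bits ⌜ hyper φ ⌝ᴴ
    written = begin
      bits {11} prefixStack ʳ++ bits matrixStack ʳ++ []  ≡⟨ cong (bits prefixStack ʳ++_) (sym (bits-ʳ++ matrixStack [])) ⟩
      bits {11} prefixStack ʳ++ bits (matrixStack ʳ++ [])  ≡⟨ sym (bits-ʳ++ prefixStack (matrixStack ʳ++ [])) ⟩
      bits {11} (prefixStack ʳ++ matrixStack ʳ++ [])  ≡⟨ cong (bits {11}) (cong₂ _ʳ++_ (sym (List.++-ʳ++ constCode {Pᶠ} {[]})) (cong (_ʳ++ []) (sym (List.++-ʳ++ matrixStart {Mᶠ} {[]})))) ⟩
      bits {11} (((constCode ++ Pᶠ) ʳ++ []) ʳ++ ((matrixStart ++ Mᶠ) ʳ++ []) ʳ++ [])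
        ≡⟨ cong (bits {11}) (cong (((constCode ++ Pᶠ) ʳ++ []) ʳ++_) (trans (List.ʳ++-ʳ++ (matrixStart ++ Mᶠ) {[]} {[]}) (List.++-identityʳ _))) ⟩
      bits {11} (((constCode ++ Pᶠ) ʳ++ []) ʳ++ matrixStart ++ Mᶠ)  ≡⟨ cong (bits {11}) (List.ʳ++-ʳ++ (constCode ++ Pᶠ) {[]} {matrixStart ++ Mᶠ}) ⟩
      bits {11} ((constCode ++ Pᶠ) ++ matrixStart ++ Mᶠ)  ≡⟨ cong (bits {11}) {y = ⌜ hyper φ ⌝ᴴ} (hyper-code φ) ⟩
      bits {11} ⌜ hyper φ ⌝ᴴ  ∎
      where
        open ≡-Reasoning
        Pᶠ = prefixCode firstFree (prefixᶠ [] firstFree true φ)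
        Mᶠ = ⌜ matrixᶠ [] firstFree φ ⌝ᴸ

    programᵂ : ∃[ t ] ∃[ σ ] Run program (inputStacks ⌜ φ ⌝ᴬ) t σ × lookup σ Out ≡ bits ⌜ hyper φ ⌝ᴴ × t ≤ time size
    programᵂ = let t , t≤ , r = translateᵂ ⨟ outputᵂ in t , finished , r , written , t≤

-- From arithmetic to Hyper²LTL: the reduction

backward : ExcludedMiddle 1ℓ → ∀ m → TruthInThirdOrderArithmetic ≤ᵖ ClosedWorldFiniteStateSatisfiability (suc m)
backward em m = hyperSentence
  , polynomialTime {TruthInThirdOrderArithmetic} {ClosedWorldFiniteStateSatisfiability (suc m)} hyperSentence program time-polynomial (λ (φ , _) → programᵂ φ)
  , λ (φ , closed) → mk⇔ (λ h → true⇒satisfiableᴴ φ closed anyValuation (h anyValuation)) (satisfiableᴴ⇒true φ closed)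
  where
    open HyperProgram m
    open Bounds m using (hyperSentence)
    open Backward em m
    anyValuation : Valuation
    anyValuation = ⟨ (λ _ → 0) ∣ (λ _ _ → ⊥) ∣ (λ _ → record { member = λ _ → ⊥ ; respect = λ _ () }) ⟩

corollary4p5 : ExcludedMiddle 1ℓ →
    (n : ℕ) .{{_ : NonZero n}} →
    ClosedWorldFiniteStateSatisfiability n ≡ᵖ TruthInThirdOrderArithmetic
corollary4p5 em (suc m) = forward em (suc m) _ , backward em m
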